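{- Let $\overline{N}(s,m,n)$ denote the number of overpartitions of $n$ whose rank is congruent to $s$ modulo $m$ (with the convention that $\overline{N}(s,m,0)=0$ for all $s,m$), and for $\ell=3$ set $$R_{st}(d)=\sum_{n\ge 0}\left(\overline{N}(s,3,3n+d)-\overline{N}(t,3,3n+d)\right)q^n.$$ Then, as formal power series in $q$ (equivalently, as analytic functions for $|q|<1$), $$R_{01}(0)=-1+\frac{(q^3;q^3)_\infty^2(-q;q)_\infty}{(q;q)_\infty(-q^3;q^3)_\infty^2},$$ $$R_{01}(1)=\frac{2(q^3;q^3)_\infty(q^6;q^6)_\infty}{(q;q)_\infty},$$ $$R_{01}(2)=\frac{4(-q^3;q^3)_\infty^2(q^6;q^6)_\infty^2}{(q^2;q^2)_\infty}-\frac{6(-q^3;q^3)_\infty}{(q^3;q^3)_\infty}\sum_{n\in\mathbb{Z}}\frac{(-1)^nq^{3n^2+3n}}{1-q^{3n+1}}.$$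
   Context: An overpartition of $n$ is a partition of $n$ in which the first occurrence of each distinct part may be overlined. The rank of an overpartition is its largest part minus its number of parts. $\overline{N}(s,m,n)$ is the number of overpartitions of $n$ with rank congruent to $s$ modulo $m$; the empty overpartition of $0$ is not counted, i.e. $\overline{N}(s,m,0)=0$. Notation: $(a_1,\dots,a_j;q)_\infty=\prod_{k\ge0}(1-a_1q^k)\cdots(1-a_jq^k)$. -}

module Defs where

open import Data.Nat as ℕ using (ℕ; zero; suc; _≡ᵇ_; _≤ᵇ_; _⊔_)
open import Data.Nat.Divisibility using (_∣?_)
open import Data.Integer as ℤ using (ℤ; +_; -[1+_]; ∣_∣)
open import Data.Bool using (Bool; true; false; _∧_; _∨_; not; if_then_else_)
open import Data.Product using (_×_; _,_; proj₁)
open import Data.List using (List; []; _∷_; length; map; concatMap; upTo; filterᵇ; foldr)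
open import Data.Nat.ListAction using (sum)
open import Relation.Nullary using (does)

-- An overpartition is represented canonically as a list of
-- (part , overlined?) pairs, listed in non-increasing order of parts,
-- where among equal parts only the first one may be overlined.

OverPart : Set
OverPart = List (ℕ × Bool)

partsSum : OverPart → ℕ
partsSum λ' = sum (map proj₁ λ')

allPositive : OverPart → Bool
allPositive [] = true
allPositive ((p , _) ∷ xs) = (1 ≤ᵇ p) ∧ allPositive xs

canonical : OverPart → Bool
canonical [] = true
canonical (x ∷ []) = true
canonical ((p , b) ∷ (p' , b') ∷ xs) =
  (p' ≤ᵇ p) ∧ (not (p' ≡ᵇ p) ∨ not b') ∧ canonical ((p' , b') ∷ xs)

isOverpartitionOf : ℕ → OverPart → Bool
isOverpartitionOf n λ' = (partsSum λ' ≡ᵇ n) ∧ allPositive λ' ∧ canonical λ'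

allLists : {A : Set} → List A → ℕ → List (List A)
allLists A zero = [] ∷ []
allLists A (suc k) = [] ∷ concatMap (λ x → map (x ∷_) (allLists A k)) A

alphabet : ℕ → List (ℕ × Bool)
alphabet n = concatMap (λ p → (suc p , true) ∷ (suc p , false) ∷ []) (upTo n)

-- every overpartition of n has ≤ n parts, each in 1..n
candidates : ℕ → List OverPart
candidates n = allLists (alphabet n) n

largestPart : OverPart → ℕ
largestPart λ' = foldr _⊔_ 0 (map proj₁ λ')

numParts : OverPart → ℕ
numParts = length

rank : OverPart → ℤ
rank λ' = + largestPart λ' ℤ.- + numParts λ'

congMod : ℤ → ℤ → ℕ → Bool
congMod x s m = does (m ∣? ∣ x ℤ.- s ∣)

Nbar : ℤ → ℕ → ℕ → ℕ
Nbar s m zero = 0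
Nbar s m (suc n) =
  length (filterᵇ (λ λ' → isOverpartitionOf (suc n) λ' ∧ congMod (rank λ') s m)
                  (candidates (suc n)))

PS : Set
PS = ℕ → ℤ

Σ< : ℕ → (ℕ → ℤ) → ℤ
Σ< zero f = + 0
Σ< (suc n) f = Σ< n f ℤ.+ f n

constPS : ℤ → PS
constPS c zero = c
constPS c (suc n) = + 0

onePS : PS
onePS = constPS (+ 1)

mono : ℤ → ℕ → PS
mono c e n = if n ≡ᵇ e then c else + 0

_⊕_ : PS → PS → PS
(f ⊕ g) n = f n ℤ.+ g n

_⊖_ : PS → PS → PS
(f ⊖ g) n = f n ℤ.- g n

_·_ : ℤ → PS → PS
(c · f) n = c ℤ.* f n

infixl 6 _⊕_ _⊖_
infixl 7 _⊗_ _÷_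
infixr 8 _·_

_⊗_ : PS → PS → PS
(f ⊗ g) n = Σ< (suc n) (λ i → f i ℤ.* g (n ℕ.∸ i))

-- multiplicative inverse of a series with constant term 1:
-- c₀ = 1, c_{n+1} = - Σ_{i=1}^{n+1} f i · c_{n+1-i}.
-- revCoeffs f n = [c_n , c_{n-1} , … , c_0]
private
  dotFrom : PS → ℕ → List ℤ → ℤ
  dotFrom f i [] = + 0
  dotFrom f i (x ∷ xs) = f i ℤ.* x ℤ.+ dotFrom f (suc i) xs

  revCoeffs : PS → ℕ → List ℤ
  revCoeffs f zero = + 1 ∷ []
  revCoeffs f (suc n) = ℤ.- dotFrom f 1 (revCoeffs f n) ∷ revCoeffs f n

  headOr0 : List ℤ → ℤ
  headOr0 [] = + 0
  headOr0 (x ∷ _) = x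

invPS : PS → PS
invPS f n = headOr0 (revCoeffs f n)

-- f / g  (used only for g with constant term 1)
_÷_ : PS → PS → PS
f ÷ g = f ⊗ invPS g

prodUpTo : ℕ → (ℕ → PS) → PS
prodUpTo zero F = onePS
prodUpTo (suc k) F = prodUpTo k F ⊗ F k

-- infinite product Π_{k≥0} F k, valid when F k ≡ 1 mod q^{k+1}:
-- coefficient of q^n is that of the finite product of F 0 … F n.
infProd : (ℕ → PS) → PS
infProd F n = prodUpTo (suc n) F n

-- (c q^a ; q^b)_∞ = Π_{k≥0} (1 - c q^{a+bk}),   used with a , b ≥ 1
poch : ℤ → ℕ → ℕ → PS
poch c a b = infProd (λ k → onePS ⊖ mono c (a ℕ.+ b ℕ.* k))

-- The bilateral sum  Σ_{n∈ℤ} (-1)^n q^{3n²+3n} / (1 - q^{3n+1})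
-- Expansion for |q|<1 : for e = 3n+1 > 0, 1/(1-q^e) = Σ_{k≥0} q^{ek};
-- for e < 0, 1/(1-q^e) = -q^{-e}/(1-q^{-e}) = - Σ_{k≥1} q^{-ek}.
-- Coefficient of q^N in the n-th term:

signZ : ℤ → ℤ
signZ n = if does (2 ∣? ∣ n ∣) then + 1 else ℤ.- + 1

bilatTermCoeff : ℤ → ℕ → ℤ
bilatTermCoeff n N with (ℤ.+ 3 ℤ.* n ℤ.* n ℤ.+ ℤ.+ 3 ℤ.* n) | (ℤ.+ 3 ℤ.* n ℤ.+ ℤ.+ 1)
... | A | e with (+ N) ℤ.- A
...   | d with e
...     | + (suc e') with d
...       | + d' = if does (suc e' ∣? d') then signZ n else + 0
...       | -[1+ _ ] = + 0
bilatTermCoeff n N | A | e | d | -[1+ e' ] with d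
...       | + (suc d') = if does (suc e' ∣? suc d') then ℤ.- signZ n else + 0
...       | + zero = + 0
...       | -[1+ _ ] = + 0
bilatTermCoeff n N | A | e | d | + zero = + 0   -- never occurs (3n+1 ≠ 0)

-- Only n ∈ [-(N+1), N] contribute to the coefficient of q^N
-- (the n-th term has order 3n²+3n for n ≥ 0 and 3n²-1 for n < 0).
bilatSum : PS
bilatSum N = Σ< (suc N) (λ i → bilatTermCoeff (+ i) N)
           ℤ.+ Σ< (suc N) (λ j → bilatTermCoeff (-[1+ j ]) N)

R : ℤ → ℤ → ℕ → PS
R s t d n = + Nbar s 3 (3 ℕ.* n ℕ.+ d) ℤ.- + Nbar t 3 (3 ℕ.* n ℕ.+ d)

-- Let F(q) = 1 + Σ (N̄(0,3,n) − N̄(1,3,n)) qⁿ, the rank generating function of overpartitions at a primitive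
-- cube root of unity, and θ(q) = Σ (−1)^k q^{k²}.  A Rogers–Fine iteration, partial fractions and a Durfee
-- dissection give θ F = T with T = 1 + 6 Σ_{n≥1} (−1)ⁿ q^{n²+n} / (1 + qⁿ + q²ⁿ).
-- Put y = q³.  Then θ(q) = A(y) − 2q B(y) with A(y) = θ(y³) and B(y) = Σ (−1)^m y^{3m²+2m}, and comparing
-- exponents modulo 3 in θ F = T yields a linear system for the sections F₀, F₁, F₂ of F:
--   A F₀ − 2y B F₂ = T₀,   A F₁ − 2 B F₀ = 0,   A F₂ − 2 B F₁ = T₂.
-- It is solved by two identities: A (A³ − 8y B³) = θ(y)⁴, the product of θ over the cube roots of unity times q,
-- and A T₀ + 2y B T₂ = θ(y)³, so that θ F₀ = A², θ F₁ = 2AB and A F₂ = 2B F₁ + T₂.  Gauss' and Jacobi's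
-- product formulas for θ and B then give the theorem, T₂ being −6 times the bilateral sum.
-- The second identity counts representations 3M = k² + 2ab with characters modulo 3 in two ways (splitting the
-- sum over k at b − a, in the style of Liouville), and representations of M by three squares, arranged by
-- x + y + z, through the number of representations by the hexagonal form; that number and the divisor sum
-- which it equals satisfy the same recursion, because Σ (xy + yz + zx) = 0 over x² + y² + z² = M.
module Submission where

open import Defs hiding (R)
open import Level using (0ℓ)
open import Algebra using (CommutativeMonoid; CommutativeRing)
open import Algebra.Morphism.Structures using (IsMonoidHomomorphism; IsRingHomomorphism)
import Algebra.Properties.AbelianGroup
import Algebra.Properties.CommutativeSemigroup
import Algebra.Properties.CommutativeSemiring.Exp
import Algebra.Properties.Ring
import Algebra.Properties.Semiring.Exp
import Algebra.Properties.Semiring.Mult.TCOptimised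
import Algebra.Solver.Ring
open import Algebra.Solver.Ring.AlmostCommutativeRing using (fromCommutativeRing; _-Raw-AlmostCommutative⟶_)
import Relation.Binary.Reasoning.Setoid
open import Data.Bool as Bool using (Bool; true; false; _∧_; _∨_; not; if_then_else_)
import Data.Bool.Properties as Boolₚ
open import Data.Empty using (⊥-elim)
open import Data.Fin using (Fin)
open import Data.Fin.Patterns
import Data.Fin.Properties as Finₚ
open import Data.List using (List; []; _∷_; _++_; map; concatMap; upTo; applyUpTo; length; filterᵇ)
open import Data.Nat as ℕ using (ℕ; zero; suc; _∸_; z≤n; s≤s; _≡ᵇ_; _≤ᵇ_; _⊔_)
import Data.Nat.Properties as ℕₚ
open import Data.Nat.Divisibility using (_∣?_; _∣_; divides; ∣m+n∣m⇒∣n; ∣m∣n⇒∣m+n; ∣-refl)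
open import Data.Nat.Induction using (<-rec)
open import Data.Nat.Tactic.RingSolver using () renaming (solve-∀ to ℕ-solve-∀)
open import Data.Integer as ℤ using (ℤ; +_; -[1+_]; ∣_∣)
import Data.Integer.Properties as ℤₚ
import Data.Integer.Divisibility.Signed as ℤ∣
open import Data.Integer.Tactic.RingSolver using () renaming (solve-∀ to ℤ-solve-∀)
open import Data.Maybe using (Maybe; just; nothing)
open import Data.Parity as ℙ using (Parity; 0ℙ; 1ℙ)
import Data.Parity.Properties as ℙₚ
open import Data.Product using (_×_; _,_; proj₁; proj₂; ∃)
open import Data.Sum using (_⊎_; inj₁; inj₂)
open import Data.Unit using (⊤; tt)
open import Function using (_∘_; Injective)
open import Function.Bundles using (mk⇔)
open import Relation.Nullary using (Dec; yes; no; does; ¬?)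
open import Relation.Nullary.Decidable using (from-yes; _→-dec_; does-⇔; dec-true; dec-false)
open import Relation.Binary.Definitions using (tri<; tri≈; tri>)
open import Relation.Binary.PropositionalEquality as ≡ using (_≡_; _≢_; _≗_)

-- Iterated operations over initial segments of ℕ

module Range (M : CommutativeMonoid 0ℓ 0ℓ) where
  open CommutativeMonoid M
  open Algebra.Properties.CommutativeSemigroup commutativeSemigroup using (interchange)
  open Relation.Binary.Reasoning.Setoid setoid

  fold : ℕ → (ℕ → Carrier) → Carrier
  fold zero f = ε
  fold (suc n) f = fold n f ∙ f n

  fold-cong< : ∀ n {f g} → (∀ i → i ℕ.< n → f i ≈ g i) → fold n f ≈ fold n g
  fold-cong< zero f≈g = refl
  fold-cong< (suc n) f≈g = ∙-cong (fold-cong< n (λ i i<n → f≈g i (ℕₚ.m<n⇒m<1+n i<n))) (f≈g n ℕₚ.≤-refl)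

  fold-cong : ∀ n {f g} → (∀ i → f i ≈ g i) → fold n f ≈ fold n g
  fold-cong n f≈g = fold-cong< n (λ i _ → f≈g i)

  fold-ε< : ∀ n {f} → (∀ i → i ℕ.< n → f i ≈ ε) → fold n f ≈ ε
  fold-ε< zero f≈ε = refl
  fold-ε< (suc n) f≈ε =
    trans (∙-cong (fold-ε< n (λ i i<n → f≈ε i (ℕₚ.m<n⇒m<1+n i<n))) (f≈ε n ℕₚ.≤-refl)) (identityʳ ε)

  fold-∙ : ∀ n f g → fold n (λ i → f i ∙ g i) ≈ fold n f ∙ fold n g
  fold-∙ zero f g = sym (identityʳ ε)
  fold-∙ (suc n) f g = trans (∙-congʳ (fold-∙ n f g)) (interchange _ _ _ _)

  fold-head : ∀ n f → fold (suc n) f ≈ f 0 ∙ fold n (f ∘ suc)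
  fold-head zero f = comm _ _
  fold-head (suc n) f = trans (∙-congʳ (fold-head n f)) (assoc _ _ _)

  fold-split : ∀ m n f → fold (m ℕ.+ n) f ≈ fold m f ∙ fold n (λ i → f (m ℕ.+ i))
  fold-split zero n f = sym (identityˡ _)
  fold-split (suc m) n f = begin
    fold (suc (m ℕ.+ n)) f                                       ≈⟨ fold-head (m ℕ.+ n) f ⟩
    f 0 ∙ fold (m ℕ.+ n) (f ∘ suc)                               ≈⟨ ∙-congˡ (fold-split m n (f ∘ suc)) ⟩
    f 0 ∙ (fold m (f ∘ suc) ∙ fold n (λ i → f (suc (m ℕ.+ i))))  ≈⟨ assoc _ _ _ ⟨
    (f 0 ∙ fold m (f ∘ suc)) ∙ fold n (λ i → f (suc (m ℕ.+ i)))  ≈⟨ ∙-congʳ (fold-head m f) ⟨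
    fold (suc m) f ∙ fold n (λ i → f (suc (m ℕ.+ i)))            ∎

  fold-extend : ∀ {m n} f → (∀ i → m ℕ.≤ i → f i ≈ ε) → m ℕ.≤ n → fold n f ≈ fold m f
  fold-extend {m} {n} f tail≈ε m≤n = begin
    fold n f                                    ≡⟨ ≡.cong (λ l → fold l f) (ℕₚ.m+[n∸m]≡n m≤n) ⟨
    fold (m ℕ.+ (n ∸ m)) f                      ≈⟨ fold-split m (n ∸ m) f ⟩
    fold m f ∙ fold (n ∸ m) (λ i → f (m ℕ.+ i)) ≈⟨ ∙-congˡ (fold-ε< (n ∸ m) (λ i _ → tail≈ε (m ℕ.+ i) (ℕₚ.m≤m+n m i))) ⟩
    fold m f ∙ ε                                ≈⟨ identityʳ _ ⟩
    fold m f                                    ∎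

  fold-blocks : ∀ b n f → fold (n ℕ.* b) f ≈ fold n (λ i → fold b (λ r → f (i ℕ.* b ℕ.+ r)))
  fold-blocks b zero f = refl
  fold-blocks b (suc n) f = begin
    fold (b ℕ.+ n ℕ.* b) f                                ≡⟨ ≡.cong (λ m → fold m f) (ℕₚ.+-comm b (n ℕ.* b)) ⟩
    fold (n ℕ.* b ℕ.+ b) f                                ≈⟨ fold-split (n ℕ.* b) b f ⟩
    fold (n ℕ.* b) f ∙ fold b (λ r → f (n ℕ.* b ℕ.+ r))   ≈⟨ ∙-congʳ (fold-blocks b n f) ⟩
    fold (suc n) (λ i → fold b (λ r → f (i ℕ.* b ℕ.+ r))) ∎

  fold-swap : ∀ m n (f : ℕ → ℕ → Carrier) → fold m (λ i → fold n (f i)) ≈ fold n (λ j → fold m (λ i → f i j))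
  fold-swap zero n f = sym (fold-ε< n (λ _ _ → refl))
  fold-swap (suc m) n f = trans (∙-congʳ (fold-swap m n f)) (sym (fold-∙ n _ _))

  fold-reverse : ∀ n f → fold (suc n) f ≈ fold (suc n) (λ i → f (n ∸ i))
  fold-reverse zero f = refl
  fold-reverse (suc n) f = begin
    fold (suc n) f ∙ f (suc n)                   ≈⟨ comm _ _ ⟩
    f (suc n) ∙ fold (suc n) f                   ≈⟨ ∙-congˡ (fold-reverse n f) ⟩
    f (suc n) ∙ fold (suc n) (λ i → f (n ∸ i))   ≈⟨ fold-head (suc n) (λ i → f (suc n ∸ i)) ⟨
    fold (suc (suc n)) (λ i → f (suc n ∸ i))     ∎

  fold-triangle : ∀ K (f : ℕ → ℕ → Carrier) →
    fold K (λ n → fold (suc n) (f n)) ≈ fold K (λ r → fold (K ∸ r) (λ b → f (r ℕ.+ b) r))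
  fold-triangle zero f = refl
  fold-triangle (suc K) f = begin
    fold K (λ n → fold (suc n) (f n)) ∙ fold (suc K) (f K)
      ≈⟨ ∙-congʳ (fold-triangle K f) ⟩
    fold K (λ r → fold (K ∸ r) (column r)) ∙ (fold K (f K) ∙ f K K)
      ≈⟨ assoc _ _ _ ⟨
    (fold K (λ r → fold (K ∸ r) (column r)) ∙ fold K (f K)) ∙ f K K
      ≈⟨ ∙-cong (sym (fold-∙ K _ _)) corner ⟩
    fold K (λ r → fold (K ∸ r) (column r) ∙ f K r) ∙ fold (suc K ∸ K) (column K)
      ≈⟨ ∙-congʳ (fold-cong< K lengthen) ⟩
    fold (suc K) (λ r → fold (suc K ∸ r) (column r)) ∎
    where
    column : ℕ → ℕ → Carrier
    column r b = f (r ℕ.+ b) r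
    corner : f K K ≈ fold (suc K ∸ K) (column K)
    corner rewrite ℕₚ.m+n∸n≡m 1 K = sym (trans (identityˡ _) (reflexive (≡.cong (λ n → f n K) (ℕₚ.+-identityʳ K))))
    lengthen : ∀ r → r ℕ.< K → fold (K ∸ r) (column r) ∙ f K r ≈ fold (suc K ∸ r) (column r)
    lengthen r r<K rewrite ℕₚ.+-∸-assoc 1 (ℕₚ.<⇒≤ r<K) =
      ∙-congˡ (reflexive (≡.cong (λ n → f n r) (≡.sym (ℕₚ.m+[n∸m]≡n (ℕₚ.<⇒≤ r<K)))))

RingHomomorphism : (R S : CommutativeRing 0ℓ 0ℓ) → (CommutativeRing.Carrier R → CommutativeRing.Carrier S) → Set
RingHomomorphism R S = IsRingHomomorphism (CommutativeRing.rawRing R) (CommutativeRing.rawRing S)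

module RingCalculus (R : CommutativeRing 0ℓ 0ℓ) where
  open CommutativeRing R public
  open Algebra.Properties.Ring ring public
    using (-‿distribˡ-*; -‿distribʳ-*; -1*x≈-x; -0#≈0#)
  open Algebra.Properties.AbelianGroup +-abelianGroup public
    using () renaming (⁻¹-involutive to -‿involutive; ⁻¹-∙-comm to -‿+-comm)
  open Algebra.Properties.Semiring.Exp semiring public
    using (_^_; ^-congˡ; ^-homo-*; ^-assocʳ)
  open Algebra.Properties.CommutativeSemiring.Exp commutativeSemiring public
    using (^-distrib-*)
  open Relation.Binary.Reasoning.Setoid setoid public
  open Range +-commutativeMonoid public renaming
    ( fold to ∑; fold-cong< to ∑-cong<; fold-cong to ∑-cong; fold-ε< to ∑-zero<; fold-∙ to ∑-+; fold-head to ∑-head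
    ; fold-split to ∑-split; fold-extend to ∑-extend; fold-blocks to ∑-blocks; fold-swap to ∑-swap
    ; fold-reverse to ∑-reverse; fold-triangle to ∑-triangle )
  open Range *-commutativeMonoid public using () renaming
    ( fold to ∏; fold-cong< to ∏-cong<; fold-cong to ∏-cong; fold-ε< to ∏-one<; fold-∙ to ∏-*; fold-head to ∏-head
    ; fold-extend to ∏-extend; fold-blocks to ∏-blocks )
  private
    open module Mult = Algebra.Properties.Semiring.Mult.TCOptimised semiring
      using () renaming (_×_ to _ℕ×_)

  fromℤ : ℤ → Carrier
  fromℤ (+ n) = n ℕ× 1#
  fromℤ -[1+ n ] = - (suc n ℕ× 1#)

  private
    +-cancelˡ-difference : ∀ x y z → (x + y) - (x + z) ≈ y - z
    +-cancelˡ-difference x y z = begin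
      (x + y) - (x + z)       ≈⟨ +-congˡ (-‿+-comm x z) ⟨
      (x + y) + (- x + - z)   ≈⟨ interchange x y (- x) (- z) ⟩
      (x - x) + (y - z)       ≈⟨ +-congʳ (-‿inverseʳ x) ⟩
      0# + (y - z)            ≈⟨ +-identityˡ _ ⟩
      y - z                   ∎
      where open Algebra.Properties.CommutativeSemigroup +-commutativeSemigroup using (interchange)

    fromℤ-⊖ : ∀ m n → fromℤ (m ℤ.⊖ n) ≈ (m ℕ× 1#) - (n ℕ× 1#)
    fromℤ-⊖ m zero = sym (trans (+-congˡ -0#≈0#) (+-identityʳ _))
    fromℤ-⊖ zero (suc n) = sym (+-identityˡ _)
    fromℤ-⊖ (suc m) (suc n) = begin
      fromℤ (suc m ℤ.⊖ suc n)               ≡⟨ ≡.cong fromℤ (ℤₚ.[1+m]⊖[1+n]≡m⊖n m n) ⟩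
      fromℤ (m ℤ.⊖ n)                       ≈⟨ fromℤ-⊖ m n ⟩
      (m ℕ× 1#) - (n ℕ× 1#)                 ≈⟨ +-cancelˡ-difference 1# _ _ ⟨
      (1# + m ℕ× 1#) - (1# + n ℕ× 1#)       ≈⟨ +-cong (Mult.1+× m 1#) (-‿cong (Mult.1+× n 1#)) ⟨
      (suc m ℕ× 1#) - (suc n ℕ× 1#)         ∎

    fromℤ-+ : ∀ x y → fromℤ (x ℤ.+ y) ≈ fromℤ x + fromℤ y
    fromℤ-+ (+ m) (+ n) = Mult.×-homo-+ 1# m n
    fromℤ-+ (+ m) -[1+ n ] = fromℤ-⊖ m (suc n)
    fromℤ-+ -[1+ m ] (+ n) = trans (fromℤ-⊖ n (suc m)) (+-comm _ _)
    fromℤ-+ -[1+ m ] -[1+ n ] = begin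
      - (suc (suc (m ℕ.+ n)) ℕ× 1#)           ≡⟨ ≡.cong (λ k → - (k ℕ× 1#)) (≡.sym (ℕₚ.+-suc (suc m) n)) ⟩
      - ((suc m ℕ.+ suc n) ℕ× 1#)             ≈⟨ -‿cong (Mult.×-homo-+ 1# (suc m) (suc n)) ⟩
      - (suc m ℕ× 1# + suc n ℕ× 1#)           ≈⟨ -‿+-comm _ _ ⟨
      - (suc m ℕ× 1#) + - (suc n ℕ× 1#)       ∎

    fromℤ-neg : ∀ x → fromℤ (ℤ.- x) ≈ - fromℤ x
    fromℤ-neg (+ zero) = sym -0#≈0#
    fromℤ-neg (+ suc n) = refl
    fromℤ-neg -[1+ n ] = sym (-‿involutive _)

    fromℤ-*⁺ : ∀ m n → fromℤ (+ m ℤ.* + n) ≈ fromℤ (+ m) * fromℤ (+ n)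
    fromℤ-*⁺ m n = trans (reflexive (≡.cong fromℤ (≡.sym (ℤₚ.pos-* m n)))) (Mult.×1-homo-* m n)

    fromℤ-* : ∀ x y → fromℤ (x ℤ.* y) ≈ fromℤ x * fromℤ y
    fromℤ-* (+ m) (+ n) = fromℤ-*⁺ m n
    fromℤ-* (+ m) -[1+ n ] = begin
      fromℤ (+ m ℤ.* -[1+ n ])            ≡⟨ ≡.cong fromℤ (≡.sym (ℤₚ.neg-distribʳ-* (+ m) (+ suc n))) ⟩
      fromℤ (ℤ.- (+ m ℤ.* + suc n))       ≈⟨ fromℤ-neg (+ m ℤ.* + suc n) ⟩
      - fromℤ (+ m ℤ.* + suc n)           ≈⟨ -‿cong (fromℤ-*⁺ m (suc n)) ⟩
      - (fromℤ (+ m) * fromℤ (+ suc n))   ≈⟨ -‿distribʳ-* _ _ ⟩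
      fromℤ (+ m) * fromℤ -[1+ n ]        ∎
    fromℤ-* -[1+ m ] (+ n) = begin
      fromℤ (-[1+ m ] ℤ.* + n)            ≡⟨ ≡.cong fromℤ (≡.sym (ℤₚ.neg-distribˡ-* (+ suc m) (+ n))) ⟩
      fromℤ (ℤ.- (+ suc m ℤ.* + n))       ≈⟨ fromℤ-neg (+ suc m ℤ.* + n) ⟩
      - fromℤ (+ suc m ℤ.* + n)           ≈⟨ -‿cong (fromℤ-*⁺ (suc m) n) ⟩
      - (fromℤ (+ suc m) * fromℤ (+ n))   ≈⟨ -‿distribˡ-* _ _ ⟩
      fromℤ -[1+ m ] * fromℤ (+ n)        ∎
    fromℤ-* -[1+ m ] -[1+ n ] = begin
      fromℤ (+ suc m ℤ.* + suc n)                ≈⟨ fromℤ-*⁺ (suc m) (suc n) ⟩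
      fromℤ (+ suc m) * fromℤ (+ suc n)          ≈⟨ -‿involutive _ ⟨
      - - (fromℤ (+ suc m) * fromℤ (+ suc n))    ≈⟨ -‿cong (-‿distribˡ-* _ _) ⟩
      - (- fromℤ (+ suc m) * fromℤ (+ suc n))    ≈⟨ -‿distribʳ-* _ _ ⟩
      fromℤ -[1+ m ] * fromℤ -[1+ n ]            ∎

    fromℤ-morphism : CommutativeRing.rawRing ℤₚ.+-*-commutativeRing -Raw-AlmostCommutative⟶ fromCommutativeRing R
    fromℤ-morphism = record
      { ⟦_⟧ = fromℤ ; +-homo = fromℤ-+ ; *-homo = fromℤ-* ; -‿homo = fromℤ-neg
      ; 0-homo = refl ; 1-homo = refl }

    fromℤ-≟ : ∀ x y → Maybe (fromℤ x ≈ fromℤ y)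
    fromℤ-≟ x y with x ℤₚ.≟ y
    ... | yes ≡.refl = just refl
    ... | no _ = nothing

  -- Integer coefficients, unlike those of the ring itself, let the solver cancel x − x.
  open Algebra.Solver.Ring (CommutativeRing.rawRing ℤₚ.+-*-commutativeRing) (fromCommutativeRing R) fromℤ-morphism fromℤ-≟ public
    using (solve; _:=_; _:+_; _:*_; _:-_; :-_; con; Polynomial)

  :0 :1 :2 : ∀ {n} → Polynomial n
  :0 = con (+ 0)
  :1 = con (+ 1)
  :2 = con (+ 2)

  2# : Carrier
  2# = 1# + 1#

  ∑-*ˡ : ∀ n c f → ∑ n (λ i → c * f i) ≈ c * ∑ n f
  ∑-*ˡ zero c f = sym (zeroʳ c)
  ∑-*ˡ (suc n) c f = trans (+-congʳ (∑-*ˡ n c f)) (sym (distribˡ c _ _))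

  ∑-*ʳ : ∀ n c f → ∑ n (λ i → f i * c) ≈ ∑ n f * c
  ∑-*ʳ n c f = trans (∑-cong n (λ i → *-comm _ _)) (trans (∑-*ˡ n c f) (*-comm _ _))

  ∑-neg : ∀ n f → ∑ n (λ i → - f i) ≈ - ∑ n f
  ∑-neg zero f = sym -0#≈0#
  ∑-neg (suc n) f = trans (+-congʳ (∑-neg n f)) (-‿+-comm _ _)

  +-absorbs-≈0 : ∀ {x} → x ≈ 0# → ∀ y z → y + x * z ≈ y
  +-absorbs-≈0 {x} x≈0 y z = begin
    y + x * z      ≈⟨ +-congˡ (*-congʳ x≈0) ⟩
    y + 0# * z     ≈⟨ +-congˡ (zeroˡ z) ⟩
    y + 0#         ≈⟨ +-identityʳ y ⟩
    y              ∎

  +-absorbs-≈1 : ∀ {x} → x ≈ 1# → ∀ y z → y + (x - 1#) * z ≈ y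
  +-absorbs-≈1 x≈1 = +-absorbs-≈0 (trans (+-congʳ x≈1) (-‿inverseʳ 1#))

  *-vanishˡ : ∀ {x} y → x ≈ 0# → x * y ≈ 0#
  *-vanishˡ y x≈0 = trans (*-congʳ x≈0) (zeroˡ y)

  *-vanishʳ : ∀ x {y} → y ≈ 0# → x * y ≈ 0#
  *-vanishʳ x y≈0 = trans (*-congˡ y≈0) (zeroʳ x)

  1^n≈1 : ∀ n → 1# ^ n ≈ 1#
  1^n≈1 zero = refl
  1^n≈1 (suc n) = trans (*-identityˡ _) (1^n≈1 n)

  sign : ℕ → Carrier
  sign n = (- 1#) ^ n

  sign-+ : ∀ m n → sign (m ℕ.+ n) ≈ sign m * sign n
  sign-+ = ^-homo-* (- 1#)

  sign²≈1 : ∀ n → sign n * sign n ≈ 1#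
  sign²≈1 zero = *-identityʳ 1#
  sign²≈1 (suc n) = begin
    sign (suc n) * sign (suc n)    ≈⟨ solve 1 (λ s → (:- :1 :* s) :* (:- :1 :* s) := s :* s) refl (sign n) ⟩
    sign n * sign n                ≈⟨ sign²≈1 n ⟩
    1#                             ∎

  sign-*3 : ∀ n → sign (n ℕ.* 3) ≈ sign n
  sign-*3 zero = refl
  sign-*3 (suc n) = begin
    sign (3 ℕ.+ n ℕ.* 3)   ≈⟨ solve 1 (λ s → :- :1 :* (:- :1 :* (:- :1 :* s)) := :- :1 :* s) refl (sign (n ℕ.* 3)) ⟩
    - 1# * sign (n ℕ.* 3)  ≈⟨ *-congˡ (sign-*3 n) ⟩
    sign (suc n)           ∎

  sign-∸ : ∀ {n r} → r ℕ.≤ n → sign (n ∸ r) ≈ sign n * sign r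
  sign-∸ {n} {r} r≤n = begin
    sign (n ∸ r)                         ≈⟨ *-identityʳ _ ⟨
    sign (n ∸ r) * 1#                    ≈⟨ *-congˡ (sign²≈1 r) ⟨
    sign (n ∸ r) * (sign r * sign r)     ≈⟨ *-assoc _ _ _ ⟨
    sign (n ∸ r) * sign r * sign r       ≈⟨ *-congʳ (sign-+ (n ∸ r) r) ⟨
    sign (n ∸ r ℕ.+ r) * sign r          ≡⟨ ≡.cong (λ m → sign m * sign r) (ℕₚ.m∸n+n≡m r≤n) ⟩
    sign n * sign r                      ∎

  Invertible : Carrier → Set
  Invertible x = ∃ λ y → x * y ≈ 1#

  Invertible-* : ∀ {x y} → Invertible x → Invertible y → Invertible (x * y)
  Invertible-* {x} {y} (x⁻¹ , xx⁻¹≈1) (y⁻¹ , yy⁻¹≈1) = x⁻¹ * y⁻¹ , (begin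
    (x * y) * (x⁻¹ * y⁻¹)   ≈⟨ solve 4 (λ x y a b → (x :* y) :* (a :* b) := (x :* a) :* (y :* b)) refl x y x⁻¹ y⁻¹ ⟩
    (x * x⁻¹) * (y * y⁻¹)   ≈⟨ *-cong xx⁻¹≈1 yy⁻¹≈1 ⟩
    1# * 1#                 ≈⟨ *-identityʳ 1# ⟩
    1#                      ∎)

  Invertible-∏ : ∀ n {f} → (∀ i → Invertible (f i)) → Invertible (∏ n f)
  Invertible-∏ zero inv = 1# , *-identityʳ 1#
  Invertible-∏ (suc n) inv = Invertible-* (Invertible-∏ n inv) (inv n)

  Invertible-cancelˡ : ∀ {x y z} → Invertible x → x * y ≈ x * z → y ≈ z
  Invertible-cancelˡ {x} {y} {z} (x⁻¹ , xx⁻¹≈1) xy≈xz = begin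
    y               ≈⟨ divide y ⟨
    x⁻¹ * (x * y)   ≈⟨ *-congˡ xy≈xz ⟩
    x⁻¹ * (x * z)   ≈⟨ divide z ⟩
    z               ∎
    where
    divide : ∀ w → x⁻¹ * (x * w) ≈ w
    divide w = begin
      x⁻¹ * (x * w)   ≈⟨ solve 3 (λ x a w → a :* (x :* w) := (x :* a) :* w) refl x x⁻¹ w ⟩
      (x * x⁻¹) * w   ≈⟨ *-congʳ xx⁻¹≈1 ⟩
      1# * w          ≈⟨ *-identityˡ w ⟩
      w               ∎

  IsNilpotent : ℕ → Carrier → Set
  IsNilpotent K q = q ^ K ≈ 0#

  IsNilpotent-^ : ∀ {K q} → IsNilpotent K q → ∀ {i} → K ℕ.≤ i → q ^ i ≈ 0#
  IsNilpotent-^ {K} {q} q^K≈0 {i} K≤i = begin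
    q ^ i                    ≡⟨ ≡.cong (q ^_) (ℕₚ.m+[n∸m]≡n K≤i) ⟨
    q ^ (K ℕ.+ (i ∸ K))      ≈⟨ ^-homo-* q K (i ∸ K) ⟩
    q ^ K * q ^ (i ∸ K)      ≈⟨ *-vanishˡ _ q^K≈0 ⟩
    0#                       ∎

  IsNilpotent-scale : ∀ {K q} → IsNilpotent K q → ∀ c → IsNilpotent K (c * q)
  IsNilpotent-scale {K} {q} q^K≈0 c = trans (^-distrib-* c q K) (*-vanishʳ _ q^K≈0)

  IsNilpotent-power : ∀ {K q} → IsNilpotent K q → ∀ b → IsNilpotent K (q ^ suc b)
  IsNilpotent-power {K} {q} q^K≈0 b = trans (^-assocʳ q (suc b) K) (IsNilpotent-^ q^K≈0 (ℕₚ.m≤m+n K (b ℕ.* K)))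

  IsPrimitiveCubeRoot : Carrier → Set
  IsPrimitiveCubeRoot ω = ω * ω + ω + 1# ≈ 0#

  cubeRoot³≈1 : ∀ {ω} → IsPrimitiveCubeRoot ω → ω ^ 3 ≈ 1#
  cubeRoot³≈1 {ω} ω²+ω+1≈0 = begin
    ω ^ 3                               ≈⟨ solve 1 (λ w → w :* (w :* (w :* :1)) := :1 :+ (w :* w :+ w :+ :1) :* (w :- :1)) refl ω ⟩
    1# + (ω * ω + ω + 1#) * (ω - 1#)    ≈⟨ +-absorbs-≈0 ω²+ω+1≈0 1# _ ⟩
    1#                                  ∎

-- Power series truncated at q^K

module Truncated (R : CommutativeRing 0ℓ 0ℓ) (q : CommutativeRing.Carrier R) (k : ℕ)
  (q^K≈0 : RingCalculus.IsNilpotent R (suc k) q) where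
  open RingCalculus R public

  K : ℕ
  K = suc k

  q^≥K : ∀ {i} → K ℕ.≤ i → q ^ i ≈ 0#
  q^≥K = IsNilpotent-^ q^K≈0

  q^-split : ∀ i j {n} → i ℕ.+ j ≡ n → q ^ n ≈ q ^ i * q ^ j
  q^-split i j i+j≡n = trans (reflexive (≡.cong (q ^_) (≡.sym i+j≡n))) (^-homo-* q i j)

  monomial^K≈0 : ∀ c i → IsNilpotent K (c * q ^ suc i)
  monomial^K≈0 c i = IsNilpotent-scale {K} (IsNilpotent-power {K} q^K≈0 i) c

  geometric : ∀ y n → (1# - y) * ∑ n (y ^_) ≈ 1# - y ^ n
  geometric y zero = solve 1 (λ y → (:1 :- y) :* :0 := :1 :- :1) refl y
  geometric y (suc n) = begin
    (1# - y) * (∑ n (y ^_) + y ^ n)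
      ≈⟨ distribˡ _ _ _ ⟩
    (1# - y) * ∑ n (y ^_) + (1# - y) * y ^ n
      ≈⟨ +-congʳ (geometric y n) ⟩
    (1# - y ^ n) + (1# - y) * y ^ n
      ≈⟨ solve 2 (λ y p → (:1 :- p) :+ (:1 :- y) :* p := :1 :- y :* p) refl y (y ^ n) ⟩
    1# - y * y ^ n ∎

  minusFactor plusFactor minusFactor⁻¹ : Carrier → ℕ → Carrier
  minusFactor c i = 1# - c * q ^ suc i
  plusFactor c i = 1# + c * q ^ suc i
  minusFactor⁻¹ c i = ∑ K ((c * q ^ suc i) ^_)

  minusFactor-inverse : ∀ c i → minusFactor c i * minusFactor⁻¹ c i ≈ 1#
  minusFactor-inverse c i = begin
    minusFactor c i * minusFactor⁻¹ c i   ≈⟨ geometric (c * q ^ suc i) K ⟩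
    1# - (c * q ^ suc i) ^ K              ≈⟨ +-congˡ (-‿cong (monomial^K≈0 c i)) ⟩
    1# - 0#                               ≈⟨ solve 0 (:1 :- :0 := :1) refl ⟩
    1#                                    ∎

  minusFactor-invertible : ∀ c i → Invertible (minusFactor c i)
  minusFactor-invertible c i = minusFactor⁻¹ c i , minusFactor-inverse c i

  plusFactor≈minusFactor : ∀ i → plusFactor 1# i ≈ minusFactor (- 1#) i
  plusFactor≈minusFactor i = solve 1 (λ x → :1 :+ :1 :* x := :1 :- (:- :1) :* x) refl (q ^ suc i)

  minusFactor-stable : ∀ c i → k ℕ.≤ i → minusFactor c i ≈ 1#
  minusFactor-stable c i k≤i = begin
    1# - c * q ^ suc i   ≈⟨ +-congˡ (-‿cong (*-vanishʳ c (q^≥K (s≤s k≤i)))) ⟩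
    1# - 0#              ≈⟨ solve 0 (:1 :- :0 := :1) refl ⟩
    1#                   ∎

  -- (−1; q)_m / (q; q)_m
  ratio : ℕ → Carrier
  ratio m = ∏ m (λ i → (1# + q ^ i) * minusFactor⁻¹ 1# i)

  ratio-suc : ∀ m → (1# - q ^ suc m) * ratio (suc m) ≈ (1# + q ^ m) * ratio m
  ratio-suc m = begin
    (1# - q ^ suc m) * (ratio m * ((1# + q ^ m) * minusFactor⁻¹ 1# m))
      ≈⟨ solve 4 (λ x g y i → (:1 :- x) :* (g :* (y :* i)) := y :* g :* ((:1 :- :1 :* x) :* i)) refl _ _ _ _ ⟩
    (1# + q ^ m) * ratio m * (minusFactor 1# m * minusFactor⁻¹ 1# m)
      ≈⟨ *-congˡ (minusFactor-inverse 1# m) ⟩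
    (1# + q ^ m) * ratio m * 1#
      ≈⟨ *-identityʳ _ ⟩
    (1# + q ^ m) * ratio m ∎

  ratio-stable : ∀ j → ratio (K ℕ.+ j) ≈ ratio K
  ratio-stable zero = reflexive (≡.cong ratio (ℕₚ.+-identityʳ K))
  ratio-stable (suc j) = begin
    ratio (K ℕ.+ suc j)
      ≡⟨ ≡.cong ratio (ℕₚ.+-suc K j) ⟩
    ratio (suc (K ℕ.+ j))
      ≈⟨ *-identityˡ _ ⟨
    1# * ratio (suc (K ℕ.+ j))
      ≈⟨ *-congʳ (trans (+-congˡ (-‿cong (q^≥K (ℕₚ.m≤n⇒m≤1+n K≤K+j)))) (solve 0 (:1 :- :0 := :1) refl)) ⟨
    (1# - q ^ suc (K ℕ.+ j)) * ratio (suc (K ℕ.+ j))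
      ≈⟨ ratio-suc (K ℕ.+ j) ⟩
    (1# + q ^ (K ℕ.+ j)) * ratio (K ℕ.+ j)
      ≈⟨ *-cong (trans (+-congˡ (q^≥K K≤K+j)) (+-identityʳ 1#)) (ratio-stable j) ⟩
    1# * ratio K
      ≈⟨ *-identityˡ _ ⟩
    ratio K ∎
    where
    K≤K+j : K ℕ.≤ K ℕ.+ j
    K≤K+j = ℕₚ.m≤m+n K j

  antidiagonal : ℕ → (ℕ → ℕ → Carrier) → Carrier
  antidiagonal N f = ∑ (suc N) (λ i → f i (N ∸ i))

  antidiagonal-first : ∀ N f → antidiagonal (suc N) f ≈ f 0 (suc N) + antidiagonal N (λ i j → f (suc i) j)
  antidiagonal-first N f = ∑-head (suc N) (λ i → f i (suc N ∸ i))

  antidiagonal-last : ∀ N f → antidiagonal (suc N) f ≈ antidiagonal N (λ i j → f i (suc j)) + f (suc N) 0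
  antidiagonal-last N f = +-cong
    (∑-cong< (suc N) (λ i i≤N → reflexive (≡.cong (f i) (ℕₚ.+-∸-assoc 1 (ℕₚ.≤-pred i≤N)))))
    (reflexive (≡.cong (f (suc N)) (ℕₚ.n∸n≡0 N)))

  antidiagonal-cong : ∀ N {f g : ℕ → ℕ → Carrier} → (∀ i j → i ℕ.+ j ≡ N → f i j ≈ g i j) →
    antidiagonal N f ≈ antidiagonal N g
  antidiagonal-cong N f≈g = ∑-cong< (suc N) (λ i i≤N → f≈g i (N ∸ i) (ℕₚ.m+[n∸m]≡n (ℕₚ.≤-pred i≤N)))

  antidiagonal-fold : ∀ n f → antidiagonal (suc n ℕ.+ suc n) f ≈ f (suc n) (suc n) +
    ∑ (suc n) (λ r → f (n ∸ r) (n ℕ.+ suc (suc r)) + f (n ℕ.+ suc (suc r)) (n ∸ r))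
  antidiagonal-fold n f = begin
    ∑ (suc N) h
      ≡⟨ ≡.cong (λ m → ∑ m h) (≡.sym (ℕₚ.+-suc (suc n) (suc n))) ⟩
    ∑ (suc n ℕ.+ suc (suc n)) h
      ≈⟨ ∑-split (suc n) (suc (suc n)) h ⟩
    ∑ (suc n) h + ∑ (suc (suc n)) (λ i → h (suc n ℕ.+ i))
      ≈⟨ +-cong (∑-reverse n h) (∑-head (suc n) _) ⟩
    ∑ (suc n) (λ r → h (n ∸ r)) + (h (suc n ℕ.+ 0) + ∑ (suc n) (λ r → h (suc n ℕ.+ suc r)))
      ≈⟨ solve 3 (λ x y z → x :+ (y :+ z) := y :+ (x :+ z)) refl _ _ _ ⟩
    h (suc n ℕ.+ 0) + (∑ (suc n) (λ r → h (n ∸ r)) + ∑ (suc n) (λ r → h (suc n ℕ.+ suc r)))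
      ≈⟨ +-cong (reflexive centre) (trans (sym (∑-+ (suc n) _ _)) (∑-cong< (suc n) (λ r r≤n →
           reflexive (≡.cong₂ _+_ (lower r (ℕₚ.≤-pred r≤n)) (upper r (ℕₚ.≤-pred r≤n)))))) ⟩
    f (suc n) (suc n) + ∑ (suc n) (λ r → f (n ∸ r) (n ℕ.+ suc (suc r)) + f (n ℕ.+ suc (suc r)) (n ∸ r)) ∎
    where
    N = suc n ℕ.+ suc n
    h : ℕ → Carrier
    h i = f i (N ∸ i)
    centre : h (suc n ℕ.+ 0) ≡ f (suc n) (suc n)
    centre rewrite ℕₚ.+-identityʳ n = ≡.cong (f (suc n)) (ℕₚ.m+n∸m≡n (suc n) (suc n))
    shuffle : ∀ b n r → b ℕ.+ (n ℕ.+ (2 ℕ.+ r)) ≡ suc (b ℕ.+ r) ℕ.+ suc n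
    shuffle = ℕ-solve-∀
    total : ∀ r → r ℕ.≤ n → (n ∸ r) ℕ.+ (n ℕ.+ suc (suc r)) ≡ N
    total r r≤n = ≡.trans (shuffle (n ∸ r) n r) (≡.cong (λ m → suc m ℕ.+ suc n) (ℕₚ.m∸n+n≡m r≤n))
    lower : ∀ r → r ℕ.≤ n → h (n ∸ r) ≡ f (n ∸ r) (n ℕ.+ suc (suc r))
    lower r r≤n = ≡.cong (f (n ∸ r))
      (≡.trans (≡.cong (_∸ (n ∸ r)) (≡.sym (total r r≤n))) (ℕₚ.m+n∸m≡n (n ∸ r) _))
    upper : ∀ r → r ℕ.≤ n → h (suc n ℕ.+ suc r) ≡ f (n ℕ.+ suc (suc r)) (n ∸ r)
    upper r r≤n = ≡.trans (≡.cong h (≡.sym (ℕₚ.+-suc n (suc r)))) (≡.cong (f (n ℕ.+ suc (suc r)))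
      (≡.trans (≡.cong (_∸ (n ℕ.+ suc (suc r))) (≡.sym (total r r≤n))) (ℕₚ.m+n∸n≡m (n ∸ r) (n ℕ.+ suc (suc r)))))

  altTerm shiftTerm : ℕ → ℕ → Carrier
  altTerm i j = sign j * (ratio i * ratio j)
  shiftTerm i j = sign j * (q ^ i * ratio i * ratio j)

  altSum shiftSum : ℕ → Carrier
  altSum N = antidiagonal N altTerm
  shiftSum N = antidiagonal N shiftTerm

  -- 1 − q^{i+j} = (1 − q^i) + q^i (1 − q^j) lets the recurrence of ratio act on either factor
  altSum-suc : ∀ N → (1# - q ^ suc N) * altSum (suc N) ≈ (1# - q ^ N) * altSum N
  altSum-suc N = begin
    (1# - q ^ suc N) * altSum (suc N)
      ≈⟨ ∑-*ˡ (suc (suc N)) _ _ ⟨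
    antidiagonal (suc N) (λ i j → (1# - q ^ suc N) * altTerm i j)
      ≈⟨ antidiagonal-cong (suc N) (λ i j i+j≡ → trans (*-congʳ (+-congˡ (-‿cong (q^-split i j i+j≡)))) (separate i j)) ⟩
    antidiagonal (suc N) (λ i j → first i j + second i j)
      ≈⟨ ∑-+ (suc (suc N)) _ _ ⟩
    antidiagonal (suc N) first + antidiagonal (suc N) second
      ≈⟨ +-cong (antidiagonal-first N first) (antidiagonal-last N second) ⟩
    (first 0 (suc N) + antidiagonal N (λ i j → first (suc i) j)) + (antidiagonal N (λ i j → second i (suc j)) + second (suc N) 0)
      ≈⟨ +-cong (trans (+-congʳ first-0) (+-identityˡ _)) (trans (+-congˡ second-0) (+-identityʳ _)) ⟩
    antidiagonal N (λ i j → first (suc i) j) + antidiagonal N (λ i j → second i (suc j))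
      ≈⟨ ∑-+ (suc N) _ _ ⟨
    antidiagonal N (λ i j → first (suc i) j + second i (suc j))
      ≈⟨ antidiagonal-cong N (λ i j i+j≡ → trans (recombine i j) (*-congʳ (+-congˡ (-‿cong (sym (q^-split i j i+j≡)))))) ⟩
    antidiagonal N (λ i j → (1# - q ^ N) * altTerm i j)
      ≈⟨ ∑-*ˡ (suc N) _ _ ⟩
    (1# - q ^ N) * altSum N ∎
    where
    first second : ℕ → ℕ → Carrier
    first i j = sign j * (((1# - q ^ i) * ratio i) * ratio j)
    second i j = sign j * (q ^ i * ratio i * ((1# - q ^ j) * ratio j))
    separate : ∀ i j → (1# - q ^ i * q ^ j) * altTerm i j ≈ first i j + second i j
    separate i j = solve 5 (λ x y s a b → (:1 :- x :* y) :* (s :* (a :* b)) :=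
      s :* (((:1 :- x) :* a) :* b) :+ s :* (x :* a :* ((:1 :- y) :* b))) refl (q ^ i) (q ^ j) (sign j) (ratio i) (ratio j)
    first-0 : first 0 (suc N) ≈ 0#
    first-0 = solve 3 (λ s a b → s :* (((:1 :- :1) :* a) :* b) := :0) refl (sign (suc N)) (ratio 0) (ratio (suc N))
    second-0 : second (suc N) 0 ≈ 0#
    second-0 = solve 4 (λ s x a b → s :* (x :* a :* ((:1 :- :1) :* b)) := :0) refl (sign 0) (q ^ suc N) (ratio (suc N)) (ratio 0)
    recombine : ∀ i j → first (suc i) j + second i (suc j) ≈ (1# - q ^ i * q ^ j) * altTerm i j
    recombine i j = begin
      first (suc i) j + second i (suc j)
        ≈⟨ +-cong (*-congˡ (*-congʳ (ratio-suc i))) (*-congˡ (*-congˡ (ratio-suc j))) ⟩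
      sign j * (((1# + q ^ i) * ratio i) * ratio j) + sign (suc j) * (q ^ i * ratio i * ((1# + q ^ j) * ratio j))
        ≈⟨ solve 5 (λ x y s a b → s :* (((:1 :+ x) :* a) :* b) :+ (:- :1 :* s) :* (x :* a :* ((:1 :+ y) :* b))
             := (:1 :- x :* y) :* (s :* (a :* b))) refl (q ^ i) (q ^ j) (sign j) (ratio i) (ratio j) ⟩
      (1# - q ^ i * q ^ j) * altTerm i j ∎

  altSum≈0 : ∀ N → altSum (suc N) ≈ 0#
  altSum≈0 N = Invertible-cancelˡ (minusFactor-invertible 1# N) (begin
    minusFactor 1# N * altSum (suc N)      ≈⟨ *-congʳ (+-congˡ (-‿cong (*-identityˡ _))) ⟩
    (1# - q ^ suc N) * altSum (suc N)      ≈⟨ altSum-suc N ⟩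
    (1# - q ^ N) * altSum N                ≈⟨ descend N ⟩
    0#                                     ≈⟨ zeroʳ _ ⟨
    minusFactor 1# N * 0#                  ∎)
    where
    descend : ∀ N → (1# - q ^ N) * altSum N ≈ 0#
    descend zero = *-vanishˡ _ (-‿inverseʳ 1#)
    descend (suc N) = trans (altSum-suc N) (descend N)

  shiftSum-suc : ∀ N → shiftSum (suc N) + shiftSum N ≈ altSum (suc N) - altSum N
  shiftSum-suc N = begin
    shiftSum (suc N) + shiftSum N
      ≈⟨ +-congʳ (antidiagonal-first N shiftTerm) ⟩
    (sign (suc N) * (1# * ratio 0 * ratio (suc N)) + antidiagonal N (λ i j → shiftTerm (suc i) j)) + shiftSum N
      ≈⟨ +-assoc _ _ _ ⟩
    sign (suc N) * (1# * ratio 0 * ratio (suc N)) + (antidiagonal N (λ i j → shiftTerm (suc i) j) + shiftSum N)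
      ≈⟨ +-cong (*-congˡ (*-congʳ (*-identityˡ _))) (sym (∑-+ (suc N) _ _)) ⟩
    altTerm 0 (suc N) + antidiagonal N (λ i j → shiftTerm (suc i) j + shiftTerm i j)
      ≈⟨ +-congˡ (antidiagonal-cong N (λ i j _ → telescope i j)) ⟩
    altTerm 0 (suc N) + antidiagonal N (λ i j → altTerm (suc i) j - altTerm i j)
      ≈⟨ +-congˡ (trans (∑-+ (suc N) _ _) (+-congˡ (∑-neg (suc N) _))) ⟩
    altTerm 0 (suc N) + (antidiagonal N (λ i j → altTerm (suc i) j) - altSum N)
      ≈⟨ +-assoc _ _ _ ⟨
    (altTerm 0 (suc N) + antidiagonal N (λ i j → altTerm (suc i) j)) - altSum N
      ≈⟨ +-congʳ (antidiagonal-first N altTerm) ⟨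
    altSum (suc N) - altSum N ∎
    where
    telescope : ∀ i j → shiftTerm (suc i) j + shiftTerm i j ≈ altTerm (suc i) j - altTerm i j
    telescope i j = begin
      shiftTerm (suc i) j + shiftTerm i j
        ≈⟨ solve 6 (λ s x x′ a a′ b → s :* (x′ :* a′ :* b) :+ s :* (x :* a :* b) :=
             s :* ((a′ :+ ((:1 :+ x) :* a) :- ((:1 :- x′) :* a′) :- a) :* b)) refl
             (sign j) (q ^ i) (q ^ suc i) (ratio i) (ratio (suc i)) (ratio j) ⟩
      sign j * ((ratio (suc i) + (1# + q ^ i) * ratio i - (1# - q ^ suc i) * ratio (suc i) - ratio i) * ratio j)
        ≈⟨ *-congˡ (*-congʳ (+-congʳ (+-congˡ (-‿cong (ratio-suc i))))) ⟩
      sign j * ((ratio (suc i) + (1# + q ^ i) * ratio i - (1# + q ^ i) * ratio i - ratio i) * ratio j)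
        ≈⟨ solve 5 (λ s x a a′ b → s :* ((a′ :+ x :- x :- a) :* b) := s :* (a′ :* b) :+ :- (s :* (a :* b))) refl
             (sign j) ((1# + q ^ i) * ratio i) (ratio i) (ratio (suc i)) (ratio j) ⟩
      altTerm (suc i) j - altTerm i j ∎

  shiftSum-value : ∀ N → shiftSum (suc N) ≈ 2# * sign (suc N)
  shiftSum-value zero = begin
    shiftSum 1
      ≈⟨ solve 2 (λ x y → x := (x :+ y) :- y) refl (shiftSum 1) (shiftSum 0) ⟩
    (shiftSum 1 + shiftSum 0) - shiftSum 0
      ≈⟨ +-congʳ (trans (shiftSum-suc 0) (+-congʳ (altSum≈0 0))) ⟩
    (0# - altSum 0) - shiftSum 0
      ≈⟨ solve 0 ((:0 :- (:0 :+ :1 :* (:1 :* :1))) :- (:0 :+ :1 :* (:1 :* :1 :* :1)) := :2 :* (:- :1 :* :1)) refl ⟩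
    2# * sign 1 ∎
  shiftSum-value (suc N) = begin
    shiftSum (2 ℕ.+ N)
      ≈⟨ solve 2 (λ x y → x := (x :+ y) :- y) refl _ (shiftSum (suc N)) ⟩
    (shiftSum (2 ℕ.+ N) + shiftSum (suc N)) - shiftSum (suc N)
      ≈⟨ +-cong (trans (shiftSum-suc (suc N)) (+-cong (altSum≈0 (suc N)) (-‿cong (altSum≈0 N)))) (-‿cong (shiftSum-value N)) ⟩
    (0# - 0#) - 2# * sign (suc N)
      ≈⟨ solve 1 (λ s → (:0 :- :0) :- :2 :* s := :2 :* (:- :1 :* s)) refl (sign (suc N)) ⟩
    2# * sign (2 ℕ.+ N) ∎

  -- Coefficient of the pole pair (1 − u q^{r+1})⁻¹ (1 − ū q^{r+1})⁻¹ in the partial fraction expansion of fineTerm n.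
  partialCoeff : ℕ → ℕ → Carrier
  partialCoeff n r = sign r * ((1# - q ^ suc r) * (1# - q ^ suc r)) * (ratio (n ℕ.+ suc (suc r)) * ratio (n ∸ r))

  q^n+1-split : ∀ {n r} → r ℕ.≤ n → q ^ suc n ≈ q ^ (n ∸ r) * q ^ suc r
  q^n+1-split {n} {r} r≤n = q^-split (n ∸ r) (suc r) (≡.trans (ℕₚ.+-suc (n ∸ r) r) (≡.cong suc (ℕₚ.m∸n+n≡m r≤n)))

  q^n+r+2-split : ∀ {n r} → r ℕ.≤ n → q ^ (n ℕ.+ suc (suc r)) ≈ q ^ (n ∸ r) * q ^ suc r * q ^ suc r
  q^n+r+2-split {n} {r} r≤n = trans (q^-split (suc n) (suc r) (≡.sym (ℕₚ.+-suc n (suc r)))) (*-congʳ (q^n+1-split r≤n))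

  balancedTerm : ℕ → ℕ → ℕ → Carrier
  balancedTerm n i j = shiftTerm i j - q ^ suc n * altTerm i j

  balancedTerm-pair : ∀ n r → r ℕ.≤ n →
    balancedTerm n (n ∸ r) (n ℕ.+ suc (suc r)) + balancedTerm n (n ℕ.+ suc (suc r)) (n ∸ r)
      ≈ sign n * (q ^ (n ∸ r) * partialCoeff n r)
  balancedTerm-pair n r r≤n = begin
    balancedTerm n l h + balancedTerm n h l
      ≈⟨ +-cong (+-cong (*-congʳ sign-h) (-‿cong (*-cong (q^n+1-split r≤n) (*-congʳ sign-h))))
                (+-cong (*-cong (sign-∸ r≤n) (*-congʳ (*-congʳ (q^n+r+2-split r≤n))))
                        (-‿cong (*-cong (q^n+1-split r≤n) (*-congʳ (sign-∸ r≤n))))) ⟩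
    (s * (x * ratio l * ratio h) - (x * y) * (s * (ratio l * ratio h)))
      + (s * (x * y * y * ratio h * ratio l) - (x * y) * (s * (ratio h * ratio l)))
      ≈⟨ solve 6 (λ sn sr x y l h → (sn :* sr :* (x :* l :* h) :- (x :* y) :* (sn :* sr :* (l :* h)))
             :+ (sn :* sr :* (x :* y :* y :* h :* l) :- (x :* y) :* (sn :* sr :* (h :* l)))
           := sn :* (x :* (sr :* ((:1 :- y) :* (:1 :- y)) :* (h :* l)))) refl (sign n) (sign r) x y (ratio l) (ratio h) ⟩
    sign n * (q ^ l * partialCoeff n r) ∎
    where
    l = n ∸ r
    h = n ℕ.+ suc (suc r)
    s = sign n * sign r
    x = q ^ l
    y = q ^ suc r
    sign-h : sign h ≈ s
    sign-h = trans (sign-+ n (suc (suc r))) (*-congˡ (solve 1 (λ s → :- :1 :* (:- :1 :* s) := s) refl (sign r)))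

  balancedTerm-sum : ∀ n → antidiagonal (suc n ℕ.+ suc n) (balancedTerm n) ≈ 2#
  balancedTerm-sum n = begin
    antidiagonal N (balancedTerm n)
      ≈⟨ ∑-+ (suc N) _ _ ⟩
    shiftSum N + ∑ (suc N) (λ i → - (q ^ suc n * altTerm i (N ∸ i)))
      ≈⟨ +-cong (shiftSum-value (n ℕ.+ suc n)) (trans (∑-neg (suc N) _) (-‿cong (∑-*ˡ (suc N) _ _))) ⟩
    2# * sign N - q ^ suc n * altSum N
      ≈⟨ +-cong (*-congˡ (trans (sign-+ (suc n) (suc n)) (sign²≈1 (suc n)))) (-‿cong (*-congˡ (altSum≈0 (n ℕ.+ suc n)))) ⟩
    2# * 1# - q ^ suc n * 0#
      ≈⟨ solve 1 (λ x → :2 :* :1 :- x :* :0 := :2) refl (q ^ suc n) ⟩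
    2# ∎
    where N = suc n ℕ.+ suc n

  partialCoeff-sum : ∀ n → ∑ (suc n) (λ r → q ^ (n ∸ r) * partialCoeff n r) ≈ 2# * sign n
  partialCoeff-sum n = begin
    S                                       ≈⟨ *-identityˡ S ⟨
    1# * S                                  ≈⟨ *-congʳ (sign²≈1 n) ⟨
    (sign n * sign n) * S                   ≈⟨ *-assoc _ _ _ ⟩
    sign n * (sign n * S)                   ≈⟨ *-congˡ folded ⟨
    sign n * antidiagonal N (balancedTerm n) ≈⟨ *-congˡ (balancedTerm-sum n) ⟩
    sign n * 2#                             ≈⟨ *-comm _ _ ⟩
    2# * sign n                             ∎
    where
    N = suc n ℕ.+ suc n
    S = ∑ (suc n) (λ r → q ^ (n ∸ r) * partialCoeff n r)
    centre : balancedTerm n (suc n) (suc n) ≈ 0#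
    centre = solve 3 (λ s x g → s :* (x :* g :* g) :- x :* (s :* (g :* g)) := :0) refl (sign (suc n)) (q ^ suc n) (ratio (suc n))
    folded : antidiagonal N (balancedTerm n) ≈ sign n * S
    folded = begin
      antidiagonal N (balancedTerm n)
        ≈⟨ antidiagonal-fold n (balancedTerm n) ⟩
      balancedTerm n (suc n) (suc n) + ∑ (suc n) (λ r →
        balancedTerm n (n ∸ r) (n ℕ.+ suc (suc r)) + balancedTerm n (n ℕ.+ suc (suc r)) (n ∸ r))
        ≈⟨ +-cong centre (∑-cong< (suc n) (λ r r≤n → balancedTerm-pair n r (ℕₚ.≤-pred r≤n))) ⟩
      0# + ∑ (suc n) (λ r → sign n * (q ^ (n ∸ r) * partialCoeff n r))
        ≈⟨ trans (+-identityˡ _) (∑-*ˡ (suc n) _ _) ⟩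
      sign n * S ∎

  durfeeTerm : ℕ → ℕ → Carrier
  durfeeTerm s b = q ^ (b ℕ.* (b ℕ.+ s)) * (1# + q ^ (b ℕ.+ (b ℕ.+ s))) * (ratio b * ratio (b ℕ.+ s))

  durfee-telescope : ∀ s m →
    ∑ m (durfeeTerm s) + q ^ (m ℕ.* (m ℕ.+ s)) * (ratio m * ratio (m ℕ.+ s)) * (1# - q ^ m) ≈ ∑ m (durfeeTerm (suc s))
  durfee-telescope s zero = solve 1 (λ x → :0 :+ x :* (:1 :- :1) := :0) refl _
  durfee-telescope s (suc m) = begin
    (A + durfeeTerm s m) + q ^ (suc m ℕ.* suc (m ℕ.+ s)) * (g′ * h′) * (1# - q * y)
      ≈⟨ +-cong (+-congˡ (*-congʳ (*-congˡ (+-congˡ (^-homo-* q m (m ℕ.+ s)))))) (*-congʳ (*-congʳ exponent-suc-suc)) ⟩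
    (A + E * (1# + y * x) * (g * h)) + (E * (q * x * y)) * (g′ * h′) * (1# - q * y)
      ≈⟨ solve 9 (λ A E q x y g h g′ h′ →
           (A :+ E :* (:1 :+ y :* x) :* (g :* h)) :+ (E :* (q :* x :* y)) :* (g′ :* h′) :* (:1 :- q :* y) :=
           (A :+ E :* (g :* h) :* (:1 :- y))
             :+ (E :* y :* g :* ((:1 :+ x) :* h) :+ (E :* (q :* x :* y)) :* h′ :* ((:1 :- q :* y) :* g′)))
           refl A E q x y g h g′ h′ ⟩
    (A + E * (g * h) * (1# - y)) + (E * y * g * ((1# + x) * h) + (E * (q * x * y)) * h′ * ((1# - q * y) * g′))
      ≈⟨ +-cong (durfee-telescope s m) (+-cong (*-congˡ (sym (ratio-suc (m ℕ.+ s)))) (*-congˡ (ratio-suc m))) ⟩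
    B + (E * y * g * ((1# - q * x) * h′) + (E * (q * x * y)) * h′ * ((1# + y) * g))
      ≈⟨ solve 7 (λ B E q x y g h′ → B :+ (E :* y :* g :* ((:1 :- q :* x) :* h′) :+ (E :* (q :* x :* y)) :* h′ :* ((:1 :+ y) :* g))
           := B :+ E :* y :* (:1 :+ y :* (q :* x)) :* (g :* h′)) refl B E q x y g h′ ⟩
    B + E * y * (1# + y * (q * x)) * (g * h′)
      ≈⟨ +-congˡ (*-congʳ (*-cong exponent-suc (+-congˡ (^-homo-* q m (suc (m ℕ.+ s)))))) ⟨
    B + q ^ (m ℕ.* suc (m ℕ.+ s)) * (1# + q ^ (m ℕ.+ suc (m ℕ.+ s))) * (g * h′)
      ≡⟨ ≡.cong (λ z → B + q ^ (m ℕ.* z) * (1# + q ^ (m ℕ.+ z)) * (g * ratio z)) (≡.sym (ℕₚ.+-suc m s)) ⟩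
    B + durfeeTerm (suc s) m ∎
    where
    A = ∑ m (durfeeTerm s)
    B = ∑ m (durfeeTerm (suc s))
    E = q ^ (m ℕ.* (m ℕ.+ s))
    y = q ^ m
    x = q ^ (m ℕ.+ s)
    g = ratio m
    h = ratio (m ℕ.+ s)
    g′ = ratio (suc m)
    h′ = ratio (suc (m ℕ.+ s))
    exponent-suc : q ^ (m ℕ.* suc (m ℕ.+ s)) ≈ E * y
    exponent-suc = q^-split (m ℕ.* (m ℕ.+ s)) m (≡.sym (≡.trans (ℕₚ.*-suc m (m ℕ.+ s)) (ℕₚ.+-comm m _)))
    exponent-suc-suc : q ^ (suc m ℕ.* suc (m ℕ.+ s)) ≈ E * (q * x * y)
    exponent-suc-suc = begin
      q ^ (suc (m ℕ.+ s) ℕ.+ m ℕ.* suc (m ℕ.+ s))    ≈⟨ ^-homo-* q (suc (m ℕ.+ s)) _ ⟩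
      q * x * q ^ (m ℕ.* suc (m ℕ.+ s))              ≈⟨ *-congˡ exponent-suc ⟩
      q * x * (E * y)                                ≈⟨ solve 4 (λ q x E y → q :* x :* (E :* y) := E :* (q :* x :* y)) refl q x E y ⟩
      E * (q * x * y)                                ∎

  durfeeSum : ℕ → Carrier
  durfeeSum s = ∑ K (durfeeTerm s)

  durfeeSum-suc : ∀ s → durfeeSum s ≈ durfeeSum (suc s)
  durfeeSum-suc s = begin
    durfeeSum s
      ≈⟨ +-absorbs-≈0 remainder≈0 (durfeeSum s) (1# - q ^ K) ⟨
    durfeeSum s + q ^ (K ℕ.* (K ℕ.+ s)) * (ratio K * ratio (K ℕ.+ s)) * (1# - q ^ K)
      ≈⟨ durfee-telescope s K ⟩
    durfeeSum (suc s) ∎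
    where
    remainder≈0 : q ^ (K ℕ.* (K ℕ.+ s)) * (ratio K * ratio (K ℕ.+ s)) ≈ 0#
    remainder≈0 = *-vanishˡ _ (q^≥K (ℕₚ.m≤m*n K (K ℕ.+ s)))

  -- The sum does not depend on s, and for s ≥ K only its first term survives.
  durfeeSum-value : ∀ s → durfeeSum s ≈ ratio K
  durfeeSum-value s = begin
    durfeeSum s
      ≈⟨ climb K ⟩
    durfeeSum (K ℕ.+ s)
      ≈⟨ ∑-head k _ ⟩
    1# * (1# + q ^ (K ℕ.+ s)) * (1# * ratio (K ℕ.+ s)) + ∑ k (durfeeTerm (K ℕ.+ s) ∘ suc)
      ≈⟨ +-cong (*-cong (*-congˡ (+-congˡ (q^≥K (ℕₚ.m≤m+n K s)))) (*-congˡ (ratio-stable s)))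
                (∑-zero< k (λ b _ → *-vanishˡ _ (*-vanishˡ _ (q^≥K (K≤exponent b))))) ⟩
    1# * (1# + 0#) * (1# * ratio K) + 0#
      ≈⟨ solve 1 (λ g → :1 :* (:1 :+ :0) :* (:1 :* g) :+ :0 := g) refl (ratio K) ⟩
    ratio K ∎
    where
    climb : ∀ j → durfeeSum s ≈ durfeeSum (j ℕ.+ s)
    climb zero = refl
    climb (suc j) = trans (climb j) (durfeeSum-suc (j ℕ.+ s))
    K≤exponent : ∀ b → K ℕ.≤ suc b ℕ.* (suc b ℕ.+ (K ℕ.+ s))
    K≤exponent b = ℕₚ.≤-trans (ℕₚ.≤-trans (ℕₚ.m≤m+n K s) (ℕₚ.m≤n+m (K ℕ.+ s) (suc b)))
      (ℕₚ.m≤n*m (suc b ℕ.+ (K ℕ.+ s)) (suc b))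

  theta : Carrier
  theta = 1# + 2# * ∑ K (λ r → sign (suc r) * q ^ (suc r ℕ.* suc r))

  module RankSeries (u ū : Carrier) (u*ū≈1 : u * ū ≈ 1#) where

    -- boundedGF l generates the overpartitions with parts at most l, weighted by u^{number of parts} q^{sum},
    -- and tailGF l what may follow a part l + 1.
    boundedGF tailGF : ℕ → Carrier
    boundedGF l = ∏ l (λ i → plusFactor u i * minusFactor⁻¹ u i)
    tailGF l = boundedGF l * minusFactor⁻¹ u l

    rankSeries : Carrier
    rankSeries = 1# + ∑ K (λ l → 2# * (ū ^ suc l * (u * q ^ suc l * tailGF l)))

    boundedGF-suc : ∀ l → boundedGF (suc l) ≈ boundedGF l + 2# * (u * q ^ suc l * tailGF l)
    boundedGF-suc l = begin
      boundedGF l * (plusFactor u l * minusFactor⁻¹ u l)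
        ≈⟨ solve 3 (λ w x i → w :* ((:1 :+ x) :* i) := w :* ((:1 :- x) :* i) :+ :2 :* (x :* (w :* i))) refl
             (boundedGF l) (u * q ^ suc l) (minusFactor⁻¹ u l) ⟩
      boundedGF l * (minusFactor u l * minusFactor⁻¹ u l) + 2# * (u * q ^ suc l * tailGF l)
        ≈⟨ +-congʳ (trans (*-congˡ (minusFactor-inverse u l)) (*-identityʳ _)) ⟩
      boundedGF l + 2# * (u * q ^ suc l * tailGF l) ∎

    boundedGF-sum : ∀ n → boundedGF n ≈ 1# + ∑ n (λ l → 2# * (u * q ^ suc l * tailGF l))
    boundedGF-sum zero = sym (+-identityʳ 1#)
    boundedGF-sum (suc n) = trans (boundedGF-suc n) (trans (+-congʳ (boundedGF-sum n)) (+-assoc _ _ _))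

    -- The Rogers–Fine recurrence for Σ_m (−u q^{n+1})_m / (u q^{n+2})_m (ū q^{n+1})^m
    fineCoeff : ℕ → ℕ → Carrier
    fineCoeff n m = ∏ m (λ i → plusFactor u (n ℕ.+ i) * minusFactor⁻¹ u (suc (n ℕ.+ i)))

    fineSeries : ℕ → Carrier
    fineSeries n = ∑ K (λ m → fineCoeff n m * (ū * q ^ suc n) ^ m)

    fineCoeff-suc : ∀ n m →
      fineCoeff n (suc m) * minusFactor u (suc (n ℕ.+ m)) ≈ fineCoeff n m * plusFactor u (n ℕ.+ m)
    fineCoeff-suc n m = begin
      fineCoeff n m * (plusFactor u i * minusFactor⁻¹ u (suc i)) * minusFactor u (suc i)
        ≈⟨ solve 4 (λ c p i m → c :* (p :* i) :* m := c :* p :* (m :* i)) refl _ _ _ _ ⟩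
      fineCoeff n m * plusFactor u i * (minusFactor u (suc i) * minusFactor⁻¹ u (suc i))
        ≈⟨ trans (*-congˡ (minusFactor-inverse u (suc i))) (*-identityʳ _) ⟩
      fineCoeff n m * plusFactor u i ∎
      where i = n ℕ.+ m

    fineCoeff-shift : ∀ n m → fineCoeff n (suc m) ≈ plusFactor u n * minusFactor⁻¹ u (suc n) * fineCoeff (suc n) m
    fineCoeff-shift n m = begin
      fineCoeff n (suc m)                        ≈⟨ ∏-head m _ ⟩
      f (n ℕ.+ 0) * ∏ m (λ i → f (n ℕ.+ suc i))  ≈⟨ *-cong (reflexive (≡.cong f (ℕₚ.+-identityʳ n)))
                                                            (∏-cong m (λ i → reflexive (≡.cong f (ℕₚ.+-suc n i)))) ⟩
      f n * fineCoeff (suc n) m                  ∎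
      where
      f : ℕ → Carrier
      f i = plusFactor u i * minusFactor⁻¹ u (suc i)

    private
      finePartial : ℕ → ℕ → Carrier
      finePartial n m = let Q = q ^ suc n in let τ = ū * Q in
        (1# + Q * Q) + q * (Q * Q) * plusFactor ū n * ∑ m (λ j → fineCoeff n (suc j) * (τ * q) ^ j)
          - fineCoeff n m * plusFactor u (n ℕ.+ m) * (τ * τ ^ m)

      finePartial-zero : ∀ n → (1# - ū * q ^ suc n) * (0# + 1# * 1#) ≈ finePartial n 0
      finePartial-zero n = sym (begin
        (1# + Q * Q) + q * (Q * Q) * plusFactor ū n * 0# - 1# * plusFactor u (n ℕ.+ 0) * (ū * Q * 1#)
          ≡⟨ ≡.cong (λ z → (1# + Q * Q) + q * (Q * Q) * plusFactor ū n * 0# - 1# * plusFactor u z * (ū * Q * 1#)) (ℕₚ.+-identityʳ n) ⟩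
        (1# + Q * Q) + q * (Q * Q) * plusFactor ū n * 0# - 1# * plusFactor u n * (ū * Q * 1#)
          ≈⟨ solve 4 (λ q Q u v →
               (:1 :+ Q :* Q) :+ q :* (Q :* Q) :* (:1 :+ v :* Q) :* :0 :- :1 :* (:1 :+ u :* Q) :* (v :* Q :* :1) :=
               ((:1 :- v :* Q) :* (:0 :+ :1 :* :1)) :+ (u :* v :- :1) :* (:- (Q :* Q))) refl q Q u ū ⟩
        (1# - ū * Q) * (0# + 1# * 1#) + (u * ū - 1#) * (- (Q * Q))
          ≈⟨ +-absorbs-≈1 u*ū≈1 _ _ ⟩
        (1# - ū * Q) * (0# + 1# * 1#) ∎)
        where Q = q ^ suc n

      finePartial-suc : ∀ n m → let τ = ū * q ^ suc n in
        finePartial n m + (1# - τ) * (fineCoeff n (suc m) * (τ * τ ^ m)) ≈ finePartial n (suc m)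
      finePartial-suc n m = begin
        (h + G * S - fineCoeff n m * plusFactor u (n ℕ.+ m) * (τ * T)) + (1# - τ) * (C * (τ * T))
          ≈⟨ +-congʳ (+-congˡ (-‿cong (*-congʳ (sym (fineCoeff-suc n m))))) ⟩
        (h + G * S - C * minusFactor u (suc (n ℕ.+ m)) * (τ * T)) + (1# - τ) * (C * (τ * T))
          ≈⟨ +-congʳ (+-congˡ (-‿cong (*-congʳ (*-congˡ (+-congˡ (-‿cong (*-congˡ (*-congˡ (^-homo-* q (suc n) m))))))))) ⟩
        (h + G * S - C * (1# - u * (q * (Q * Y))) * (τ * T)) + (1# - τ) * (C * (τ * T))
          ≈⟨ solve 9 (λ h S C u v q Q Y T →
               (h :+ q :* (Q :* Q) :* (:1 :+ v :* Q) :* S :- C :* (:1 :- u :* (q :* (Q :* Y))) :* (v :* Q :* T))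
                 :+ (:1 :- v :* Q) :* (C :* (v :* Q :* T)) :=
               (h :+ q :* (Q :* Q) :* (:1 :+ v :* Q) :* (S :+ C :* (T :* Y))
                 :- C :* (:1 :+ u :* (q :* (Q :* Y))) :* (v :* Q :* (v :* Q :* T)))
                 :+ (u :* v :- :1) :* (q :* Q :* Q :* Y :* C :* T :* (:1 :+ v :* Q))) refl h S C u ū q Q Y T ⟩
        (h + G * (S + C * (T * Y)) - C * (1# + u * (q * (Q * Y))) * (τ * (τ * T))) + (u * ū - 1#) * (q * Q * Q * Y * C * T * (1# + ū * Q))
          ≈⟨ +-absorbs-≈1 u*ū≈1 _ _ ⟩
        h + G * (S + C * (T * Y)) - C * (1# + u * (q * (Q * Y))) * (τ * (τ * T))
          ≈⟨ +-cong (+-congˡ (*-congˡ (+-congˡ (*-congˡ (^-distrib-* τ q m)))))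
                    (-‿cong (*-congʳ (*-congˡ (+-congˡ (*-congˡ q^n+m+2))))) ⟨
        finePartial n (suc m) ∎
        where
        Q = q ^ suc n
        τ = ū * Q
        S = ∑ m (λ j → fineCoeff n (suc j) * (τ * q) ^ j)
        C = fineCoeff n (suc m)
        T = τ ^ m
        Y = q ^ m
        h = 1# + Q * Q
        G = q * (Q * Q) * plusFactor ū n
        q^n+m+2 : q ^ suc (n ℕ.+ suc m) ≈ q * (Q * Y)
        q^n+m+2 = trans (reflexive (≡.cong (λ z → q ^ suc z) (ℕₚ.+-suc n m))) (*-congˡ (^-homo-* q (suc n) m))

      fineSeries-partial : ∀ n m → let τ = ū * q ^ suc n in
        (1# - τ) * ∑ (suc m) (λ j → fineCoeff n j * τ ^ j) ≈ finePartial n m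
      fineSeries-partial n zero = finePartial-zero n
      fineSeries-partial n (suc m) = trans (distribˡ _ _ _) (trans (+-congʳ (fineSeries-partial n m)) (finePartial-suc n m))

    fineSeries-suc : ∀ n → let Q = q ^ suc n in fineSeries n ≈ minusFactor⁻¹ ū n *
      ((1# + Q * Q) + q * (Q * Q) * (plusFactor u n * plusFactor ū n) * minusFactor⁻¹ u (suc n) * fineSeries (suc n))
    fineSeries-suc n = Invertible-cancelˡ (minusFactor-invertible ū n) (begin
      minusFactor ū n * fineSeries n
        ≈⟨ *-congˡ (trans (+-congˡ (*-vanishʳ _ (monomial^K≈0 ū n))) (+-identityʳ _)) ⟨
      minusFactor ū n * ∑ (suc K) (λ j → fineCoeff n j * τ ^ j)
        ≈⟨ fineSeries-partial n K ⟩
      h + G * ∑ K (λ j → fineCoeff n (suc j) * (τ * q) ^ j) - fineCoeff n K * plusFactor u (n ℕ.+ K) * (τ * τ ^ K)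
        ≈⟨ +-cong (+-congˡ (*-congˡ shifted)) (-‿cong (*-congˡ (*-congˡ (monomial^K≈0 ū n)))) ⟩
      h + G * (p * i * fineSeries (suc n)) - fineCoeff n K * plusFactor u (n ℕ.+ K) * (τ * 0#)
        ≈⟨ solve 8 (λ h g p p′ i f z t → h :+ g :* p′ :* (p :* i :* f) :- z :* (t :* :0) := h :+ g :* (p :* p′) :* i :* f) refl
             h (q * (Q * Q)) p (plusFactor ū n) i (fineSeries (suc n)) (fineCoeff n K * plusFactor u (n ℕ.+ K)) τ ⟩
      rhs
        ≈⟨ *-identityˡ _ ⟨
      1# * rhs
        ≈⟨ *-congʳ (minusFactor-inverse ū n) ⟨
      minusFactor ū n * minusFactor⁻¹ ū n * rhs
        ≈⟨ *-assoc _ _ _ ⟩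
      minusFactor ū n * (minusFactor⁻¹ ū n * rhs) ∎)
      where
      Q = q ^ suc n
      τ = ū * Q
      h = 1# + Q * Q
      G = q * (Q * Q) * plusFactor ū n
      p = plusFactor u n
      i = minusFactor⁻¹ u (suc n)
      rhs = h + q * (Q * Q) * (p * plusFactor ū n) * i * fineSeries (suc n)
      shifted : ∑ K (λ j → fineCoeff n (suc j) * (τ * q) ^ j) ≈ p * i * fineSeries (suc n)
      shifted = trans (∑-cong K (λ j → trans (*-cong (fineCoeff-shift n j) (^-congˡ j rescale)) (*-assoc _ _ _))) (∑-*ˡ K _ _)
        where
        rescale : τ * q ≈ ū * q ^ suc (suc n)
        rescale = solve 3 (λ v Q q → v :* Q :* q := v :* (q :* Q)) refl ū Q q

    numeratorProduct : ℕ → Carrier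
    numeratorProduct n = ∏ n (λ i → plusFactor u i * plusFactor ū i)

    pole⁻¹ fineTerm fineRemainder : ℕ → Carrier
    pole⁻¹ i = minusFactor⁻¹ u i * minusFactor⁻¹ ū i
    fineTerm n = numeratorProduct n * ∏ (suc n) pole⁻¹
    fineRemainder n = numeratorProduct n * ∏ n pole⁻¹ * minusFactor⁻¹ u n

    q^square-suc : ∀ n → q ^ (suc (suc n) ℕ.* suc (suc n)) ≈ q ^ (suc n ℕ.* suc n) * (q * (q ^ suc n * q ^ suc n))
    q^square-suc n = begin
      q ^ (suc (suc n) ℕ.* suc (suc n))                         ≈⟨ q^-split (suc n ℕ.* suc n) _ (≡.sym (square-suc n)) ⟩
      q ^ (suc n ℕ.* suc n) * (q * q ^ (suc n ℕ.+ suc n))       ≈⟨ *-congˡ (*-congˡ (^-homo-* q (suc n) (suc n))) ⟩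
      q ^ (suc n ℕ.* suc n) * (q * (q ^ suc n * q ^ suc n))     ∎
      where
      square-suc : ∀ n → (2 ℕ.+ n) ℕ.* (2 ℕ.+ n) ≡ suc n ℕ.* suc n ℕ.+ suc (suc n ℕ.+ suc n)
      square-suc = ℕ-solve-∀

    rogersFine : ∀ n → q * minusFactor⁻¹ u 0 * fineSeries 0 ≈
      ∑ n (λ m → q ^ (suc m ℕ.* suc m) * (1# + q ^ suc m * q ^ suc m) * fineTerm m)
        + q ^ (suc n ℕ.* suc n) * fineRemainder n * fineSeries n
    rogersFine zero =
      solve 3 (λ q i p → q :* i :* p := :0 :+ q :* :1 :* (:1 :* :1 :* i) :* p) refl q (minusFactor⁻¹ u 0) (fineSeries 0)
    rogersFine (suc n) = begin
      q * minusFactor⁻¹ u 0 * fineSeries 0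
        ≈⟨ rogersFine n ⟩
      A + E * fineRemainder n * fineSeries n
        ≈⟨ +-congˡ (*-congˡ (fineSeries-suc n)) ⟩
      A + E * fineRemainder n * (minusFactor⁻¹ ū n * ((1# + Q * Q) + q * (Q * Q) * pp * minusFactor⁻¹ u (suc n) * fineSeries (suc n)))
        ≈⟨ solve 11 (λ A E p j i i′ h G pp i″ f → A :+ E :* (p :* j :* i) :* (i′ :* (h :+ G :* pp :* i″ :* f))
              := (A :+ E :* h :* (p :* (j :* (i :* i′)))) :+ (E :* G) :* ((p :* pp) :* (j :* (i :* i′)) :* i″) :* f) refl
              A E (numeratorProduct n) (∏ n pole⁻¹) (minusFactor⁻¹ u n) (minusFactor⁻¹ ū n) (1# + Q * Q) (q * (Q * Q))
              pp (minusFactor⁻¹ u (suc n)) (fineSeries (suc n)) ⟩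
      (A + E * (1# + Q * Q) * fineTerm n) + (E * (q * (Q * Q))) * fineRemainder (suc n) * fineSeries (suc n)
        ≈⟨ +-congˡ (*-congʳ (*-congʳ (q^square-suc n))) ⟨
      (A + E * (1# + Q * Q) * fineTerm n) + q ^ (suc (suc n) ℕ.* suc (suc n)) * fineRemainder (suc n) * fineSeries (suc n) ∎
      where
      Q = q ^ suc n
      E = q ^ (suc n ℕ.* suc n)
      pp = plusFactor u n * plusFactor ū n
      A = ∑ n (λ m → q ^ (suc m ℕ.* suc m) * (1# + q ^ suc m * q ^ suc m) * fineTerm m)

    pole : ℕ → Carrier
    pole r = minusFactor u r * minusFactor ū r

    pole-inverse : ∀ r → pole r * pole⁻¹ r ≈ 1#
    pole-inverse r = proj₂ (Invertible-* (minusFactor-invertible u r) (minusFactor-invertible ū r))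

    -- Modulo u ū = 1, both (1 + u xy)(1 + ū xy) and (1 − u qxy)(1 − ū qxy) are, up to a multiple of the pole
    -- (1 − u y)(1 − ū y), independent of u; here x = q^{n−r} and y = q^{r+1}.
    numeratorCoeff : ℕ → ℕ → Carrier
    numeratorCoeff n r = (1# + q ^ (n ∸ r)) * (1# + q ^ (n ∸ r) * q ^ suc r * q ^ suc r) * partialCoeff n r

    plusFactors*partialTerm : ∀ n r → r ℕ.≤ n → plusFactor u n * plusFactor ū n * (partialCoeff n r * pole⁻¹ r)
      ≈ - (q ^ (n ∸ r) * partialCoeff n r) + numeratorCoeff n r * pole⁻¹ r
    plusFactors*partialTerm n r r≤n = begin
      plusFactor u n * plusFactor ū n * (a * j)
        ≈⟨ *-congʳ (*-cong (+-congˡ (*-congˡ (q^n+1-split r≤n))) (+-congˡ (*-congˡ (q^n+1-split r≤n)))) ⟩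
      (1# + u * (x * y)) * (1# + ū * (x * y)) * (a * j)
        ≈⟨ solve 6 (λ u v x y a j → (:1 :+ u :* (x :* y)) :* (:1 :+ v :* (x :* y)) :* (a :* j) :=
              (:- (x :* a :* ((:1 :- u :* y) :* (:1 :- v :* y) :* j)) :+ (:1 :+ x) :* (:1 :+ x :* y :* y) :* a :* j)
              :+ (u :* v :- :1) :* ((x :* x :* y :* y :+ x :* y :* y) :* a :* j)) refl u ū x y a j ⟩
      (- (x * a * (pole r * j)) + numeratorCoeff n r * j) + (u * ū - 1#) * ((x * x * y * y + x * y * y) * a * j)
        ≈⟨ +-absorbs-≈1 u*ū≈1 _ _ ⟩
      - (x * a * (pole r * j)) + numeratorCoeff n r * j
        ≈⟨ +-congʳ (-‿cong (trans (*-congˡ (pole-inverse r)) (*-identityʳ _))) ⟩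
      - (x * a) + numeratorCoeff n r * j ∎
      where
      x = q ^ (n ∸ r)
      y = q ^ suc r
      a = partialCoeff n r
      j = pole⁻¹ r

    partialCoeff-suc : ∀ n r → r ℕ.≤ n → let x = q ^ (n ∸ r) in let y = q ^ suc r in
      (1# - q * x) * (1# - q * (x * y * y)) * partialCoeff (suc n) r ≈ numeratorCoeff n r
    partialCoeff-suc n r r≤n = begin
      A * B * (S * (ratio (suc N) * ratio (suc n ∸ r)))
        ≡⟨ ≡.cong (λ z → A * B * (S * (ratio (suc N) * ratio z))) (ℕₚ.+-∸-assoc 1 r≤n) ⟩
      A * B * (S * (ratio (suc N) * ratio (suc (n ∸ r))))
        ≈⟨ solve 5 (λ A B S G H → A :* B :* (S :* (G :* H)) := S :* ((B :* G) :* (A :* H))) refl _ _ _ _ _ ⟩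
      S * ((B * ratio (suc N)) * (A * ratio (suc (n ∸ r))))
        ≈⟨ *-congˡ (*-cong ratio-N (ratio-suc (n ∸ r))) ⟩
      S * (((1# + x * y * y) * ratio N) * ((1# + x) * ratio (n ∸ r)))
        ≈⟨ solve 5 (λ A B S G H → S :* ((B :* G) :* (A :* H)) := A :* B :* (S :* (G :* H))) refl _ _ _ _ _ ⟩
      numeratorCoeff n r ∎
      where
      x = q ^ (n ∸ r)
      y = q ^ suc r
      N = n ℕ.+ suc (suc r)
      S = sign r * ((1# - y) * (1# - y))
      A = 1# - q * x
      B = 1# - q * (x * y * y)
      ratio-N : B * ratio (suc N) ≈ (1# + x * y * y) * ratio N
      ratio-N = begin
        B * ratio (suc N)             ≈⟨ *-congʳ (+-congˡ (-‿cong (*-congˡ (q^n+r+2-split r≤n)))) ⟨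
        (1# - q ^ suc N) * ratio (suc N) ≈⟨ ratio-suc N ⟩
        (1# + q ^ N) * ratio N        ≈⟨ *-congʳ (+-congˡ (q^n+r+2-split r≤n)) ⟩
        (1# + x * y * y) * ratio N    ∎

    pole*partialTerm : ∀ n r → r ℕ.≤ n → pole (suc n) * (partialCoeff (suc n) r * pole⁻¹ r)
      ≈ q ^ (suc n ∸ r) * partialCoeff (suc n) r + numeratorCoeff n r * pole⁻¹ r
    pole*partialTerm n r r≤n = begin
      pole (suc n) * (a * j)
        ≈⟨ *-congʳ (*-cong (+-congˡ (-‿cong (*-congˡ (*-congˡ (q^n+1-split r≤n)))))
            (+-congˡ (-‿cong (*-congˡ (*-congˡ (q^n+1-split r≤n)))))) ⟩
      (1# - u * (q * (x * y))) * (1# - ū * (q * (x * y))) * (a * j)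
        ≈⟨ solve 7 (λ u v q x y a j → (:1 :- u :* (q :* (x :* y))) :* (:1 :- v :* (q :* (x :* y))) :* (a :* j) :=
              ((q :* x) :* a :* ((:1 :- u :* y) :* (:1 :- v :* y) :* j) :+ ((:1 :- q :* x) :* (:1 :- q :* (x :* y :* y)) :* a) :* j)
              :+ (u :* v :- :1) :* ((q :* q :* x :* x :* y :* y :- q :* x :* y :* y) :* a :* j)) refl u ū q x y a j ⟩
      (q * x * a * (pole r * j) + ((1# - q * x) * (1# - q * (x * y * y)) * a) * j) + (u * ū - 1#) * _
        ≈⟨ +-absorbs-≈1 u*ū≈1 _ _ ⟩
      q * x * a * (pole r * j) + ((1# - q * x) * (1# - q * (x * y * y)) * a) * j
        ≈⟨ +-cong (trans (*-congˡ (pole-inverse r)) (*-identityʳ _)) (*-congʳ (partialCoeff-suc n r r≤n)) ⟩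
      q * x * a + numeratorCoeff n r * j
        ≡⟨ ≡.cong (λ z → q ^ z * a + numeratorCoeff n r * j) (≡.sym (ℕₚ.+-∸-assoc 1 r≤n)) ⟩
      q ^ (suc n ∸ r) * a + numeratorCoeff n r * j ∎
      where
      x = q ^ (n ∸ r)
      y = q ^ suc r
      a = partialCoeff (suc n) r
      j = pole⁻¹ r

    private
      partialTerm : ℕ → ℕ → Carrier
      partialTerm n r = partialCoeff n r * pole⁻¹ r

      lastTerm : ∀ n → q ^ (n ∸ n) * partialCoeff (suc n) (suc n) ≈ pole (suc n) * partialTerm (suc n) (suc n)
      lastTerm n = begin
        q ^ (n ∸ n) * c            ≡⟨ ≡.cong (λ z → q ^ z * c) (ℕₚ.n∸n≡0 n) ⟩
        1# * c                     ≈⟨ *-congʳ (pole-inverse (suc n)) ⟨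
        pole (suc n) * j * c       ≈⟨ solve 3 (λ D J a → D :* J :* a := D :* (a :* J)) refl _ _ _ ⟩
        pole (suc n) * (c * j)     ∎
        where
        c = partialCoeff (suc n) (suc n)
        j = pole⁻¹ (suc n)

      ∑-partialTerm : ∀ n → plusFactor u n * plusFactor ū n * ∑ (suc n) (partialTerm n)
        ≈ pole (suc n) * ∑ (suc (suc n)) (partialTerm (suc n))
      ∑-partialTerm n = begin
        plusFactor u n * plusFactor ū n * ∑ (suc n) (partialTerm n)
          ≈⟨ ∑-*ˡ (suc n) _ _ ⟨
        ∑ (suc n) (λ r → plusFactor u n * plusFactor ū n * partialTerm n r)
          ≈⟨ ∑-cong< (suc n) (λ r r≤n → plusFactors*partialTerm n r (ℕₚ.≤-pred r≤n)) ⟩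
        ∑ (suc n) (λ r → - (q ^ (n ∸ r) * partialCoeff n r) + numeratorCoeff n r * pole⁻¹ r)
          ≈⟨ trans (∑-+ (suc n) _ _) (+-congʳ (trans (∑-neg (suc n) _) (-‿cong (partialCoeff-sum n)))) ⟩
        - (2# * sign n) + B
          ≈⟨ +-congʳ (solve 1 (λ s → :- (:2 :* s) := :2 :* (:- :1 :* s)) refl (sign n)) ⟩
        2# * sign (suc n) + B
          ≈⟨ +-congʳ (partialCoeff-sum (suc n)) ⟨
        (∑ (suc n) (λ r → q ^ (suc n ∸ r) * partialCoeff (suc n) r) + q ^ (n ∸ n) * partialCoeff (suc n) (suc n)) + B
          ≈⟨ solve 3 (λ x y z → (x :+ y) :+ z := (x :+ z) :+ y) refl _ _ _ ⟩
        (∑ (suc n) (λ r → q ^ (suc n ∸ r) * partialCoeff (suc n) r) + B) + q ^ (n ∸ n) * partialCoeff (suc n) (suc n)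
          ≈⟨ +-cong (trans (sym (∑-+ (suc n) _ _)) (∑-cong< (suc n) (λ r r≤n → sym (pole*partialTerm n r (ℕₚ.≤-pred r≤n))))) (lastTerm n) ⟩
        ∑ (suc (suc n)) (λ r → pole (suc n) * partialTerm (suc n) r)
          ≈⟨ ∑-*ˡ (suc (suc n)) _ _ ⟩
        pole (suc n) * ∑ (suc (suc n)) (partialTerm (suc n)) ∎
        where B = ∑ (suc n) (λ r → numeratorCoeff n r * pole⁻¹ r)

    partialFractions : ∀ n → 2# * fineTerm n ≈ ∑ (suc n) (λ r → partialCoeff n r * pole⁻¹ r)
    partialFractions zero = begin
      2# * fineTerm 0
        ≈⟨ solve 1 (λ j → :2 :* (:1 :* (:1 :* j)) := :0 :+ (:2 :* :1) :* j) refl (pole⁻¹ 0) ⟩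
      0# + 2# * 1# * pole⁻¹ 0
        ≈⟨ +-congˡ (*-congʳ (trans (sym (partialCoeff-sum 0)) (solve 1 (λ x → :0 :+ :1 :* x := x) refl (partialCoeff 0 0)))) ⟩
      0# + partialCoeff 0 0 * pole⁻¹ 0 ∎
    partialFractions (suc n) = Invertible-cancelˡ (pole⁻¹ (suc n) , pole-inverse (suc n)) (begin
      pole (suc n) * (2# * fineTerm (suc n))
        ≈⟨ solve 5 (λ D J p pp j → D :* (:2 :* ((p :* pp) :* (j :* J))) := pp :* (:2 :* (p :* j)) :* (D :* J)) refl
             (pole (suc n)) (pole⁻¹ (suc n)) (numeratorProduct n) pp (∏ (suc n) pole⁻¹) ⟩
      pp * (2# * fineTerm n) * (pole (suc n) * pole⁻¹ (suc n))
        ≈⟨ trans (*-congˡ (pole-inverse (suc n))) (*-identityʳ _) ⟩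
      pp * (2# * fineTerm n)
        ≈⟨ *-congˡ (partialFractions n) ⟩
      pp * ∑ (suc n) (partialTerm n)
        ≈⟨ ∑-partialTerm n ⟩
      pole (suc n) * ∑ (suc (suc n)) (partialTerm (suc n)) ∎)
      where pp = plusFactor u n * plusFactor ū n

    tailGF-fineCoeff : ∀ l → tailGF l ≈ minusFactor⁻¹ u 0 * fineCoeff 0 l
    tailGF-fineCoeff zero = *-comm _ _
    tailGF-fineCoeff (suc l) = begin
      boundedGF l * (plusFactor u l * minusFactor⁻¹ u l) * minusFactor⁻¹ u (suc l)
        ≈⟨ solve 4 (λ w e i j → w :* (e :* i) :* j := (w :* i) :* (e :* j)) refl _ _ _ _ ⟩
      tailGF l * (plusFactor u l * minusFactor⁻¹ u (suc l))
        ≈⟨ *-congʳ (tailGF-fineCoeff l) ⟩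
      minusFactor⁻¹ u 0 * fineCoeff 0 l * (plusFactor u l * minusFactor⁻¹ u (suc l))
        ≈⟨ *-assoc _ _ _ ⟩
      minusFactor⁻¹ u 0 * fineCoeff 0 (suc l) ∎

    rankSeries-fineSeries : rankSeries ≈ 1# + 2# * (q * minusFactor⁻¹ u 0 * fineSeries 0)
    rankSeries-fineSeries = +-congˡ (begin
      ∑ K (λ l → 2# * (ū ^ suc l * (u * q ^ suc l * tailGF l)))
        ≈⟨ ∑-cong K term ⟩
      ∑ K (λ l → 2# * (q * minusFactor⁻¹ u 0) * (fineCoeff 0 l * (ū * q ^ 1) ^ l))
        ≈⟨ trans (∑-*ˡ K _ _) (*-assoc _ _ _) ⟩
      2# * (q * minusFactor⁻¹ u 0 * fineSeries 0) ∎)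
      where
      term : ∀ l → 2# * (ū ^ suc l * (u * q ^ suc l * tailGF l)) ≈
        2# * (q * minusFactor⁻¹ u 0) * (fineCoeff 0 l * (ū * q ^ 1) ^ l)
      term l = begin
        2# * (ū * ū ^ l * (u * (q * q ^ l) * tailGF l))
          ≈⟨ *-congˡ (*-congˡ (*-congˡ (tailGF-fineCoeff l))) ⟩
        2# * (ū * ū ^ l * (u * (q * q ^ l) * (i * fineCoeff 0 l)))
          ≈⟨ solve 7 (λ v vl u q ql i c → :2 :* (v :* vl :* (u :* (q :* ql) :* (i :* c))) :=
                :2 :* (q :* i) :* (c :* (vl :* ql)) :+ (u :* v :- :1) :* (:2 :* (q :* i) :* (c :* (vl :* ql)))) refl
                ū (ū ^ l) u q (q ^ l) i (fineCoeff 0 l) ⟩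
        2# * (q * i) * (fineCoeff 0 l * (ū ^ l * q ^ l)) + (u * ū - 1#) * _
          ≈⟨ +-absorbs-≈1 u*ū≈1 _ _ ⟩
        2# * (q * i) * (fineCoeff 0 l * (ū ^ l * q ^ l))
          ≈⟨ *-congˡ (*-congˡ (trans (^-distrib-* ū (q ^ 1) l) (*-congˡ (^-congˡ l (*-identityʳ q))))) ⟨
        2# * (q * i) * (fineCoeff 0 l * (ū * q ^ 1) ^ l) ∎
        where i = minusFactor⁻¹ u 0

    private
      squarePower squareFactor lambertFactor : ℕ → Carrier
      squarePower m = q ^ (suc m ℕ.* suc m)
      squareFactor m = 1# + q ^ suc m * q ^ suc m
      lambertFactor r = sign r * squarePower r * ((1# - q ^ suc r) * (1# - q ^ suc r)) * pole⁻¹ r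

    squarePower-+ : ∀ r b → squarePower (r ℕ.+ b) ≈ squarePower r * q ^ (b ℕ.* (b ℕ.+ (suc r ℕ.+ suc r)))
    squarePower-+ r b = q^-split (suc r ℕ.* suc r) (b ℕ.* (b ℕ.+ (suc r ℕ.+ suc r))) (≡.sym (square r b))
      where
      square : ∀ r b → suc (r ℕ.+ b) ℕ.* suc (r ℕ.+ b) ≡ suc r ℕ.* suc r ℕ.+ b ℕ.* (b ℕ.+ (suc r ℕ.+ suc r))
      square = ℕ-solve-∀

    partialTerm-durfee : ∀ r b → squarePower (r ℕ.+ b) * squareFactor (r ℕ.+ b) * (partialCoeff (r ℕ.+ b) r * pole⁻¹ r)
      ≈ lambertFactor r * durfeeTerm (suc r ℕ.+ suc r) b
    partialTerm-durfee r b = begin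
      squarePower (r ℕ.+ b) * squareFactor (r ℕ.+ b) * (sign r * S * (ratio (r ℕ.+ b ℕ.+ suc (suc r)) * ratio (r ℕ.+ b ∸ r)) * pole⁻¹ r)
        ≈⟨ *-cong (*-cong (squarePower-+ r b) (+-congˡ (sym (q^-split (suc (r ℕ.+ b)) (suc (r ℕ.+ b)) (double r b)))))
             (*-congʳ (*-congˡ (reflexive (≡.cong₂ (λ y z → ratio y * ratio z) (upper r b) (ℕₚ.m+n∸m≡n r b))))) ⟩
      squarePower r * X * Y * (sign r * S * (ratio (b ℕ.+ s) * ratio b) * pole⁻¹ r)
        ≈⟨ solve 8 (λ E X Y s S G h J → E :* X :* Y :* (s :* S :* (G :* h) :* J) := s :* E :* S :* J :* (X :* Y :* (h :* G))) refl
             (squarePower r) X Y (sign r) S (ratio (b ℕ.+ s)) (ratio b) (pole⁻¹ r) ⟩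
      lambertFactor r * durfeeTerm s b ∎
      where
      s = suc r ℕ.+ suc r
      S = (1# - q ^ suc r) * (1# - q ^ suc r)
      X = q ^ (b ℕ.* (b ℕ.+ s))
      Y = 1# + q ^ (b ℕ.+ (b ℕ.+ s))
      double : ∀ r b → suc (r ℕ.+ b) ℕ.+ suc (r ℕ.+ b) ≡ b ℕ.+ (b ℕ.+ (suc r ℕ.+ suc r))
      double = ℕ-solve-∀
      upper : ∀ r b → r ℕ.+ b ℕ.+ (2 ℕ.+ r) ≡ b ℕ.+ (suc r ℕ.+ suc r)
      upper = ℕ-solve-∀

    partialTerm-sum : ∀ r → r ℕ.< K →
      ∑ (K ∸ r) (λ b → squarePower (r ℕ.+ b) * squareFactor (r ℕ.+ b) * (partialCoeff (r ℕ.+ b) r * pole⁻¹ r))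
      ≈ ratio K * lambertFactor r
    partialTerm-sum r r<K = begin
      ∑ (K ∸ r) (λ b → squarePower (r ℕ.+ b) * squareFactor (r ℕ.+ b) * (partialCoeff (r ℕ.+ b) r * pole⁻¹ r))
        ≈⟨ ∑-cong (K ∸ r) (partialTerm-durfee r) ⟩
      ∑ (K ∸ r) (λ b → lambertFactor r * durfeeTerm s b)
        ≈⟨ ∑-extend _ tail≈0 (ℕₚ.m∸n≤m K r) ⟨
      ∑ K (λ b → lambertFactor r * durfeeTerm s b)
        ≈⟨ ∑-*ˡ K _ _ ⟩
      lambertFactor r * durfeeSum s
        ≈⟨ *-congˡ (durfeeSum-value s) ⟩
      lambertFactor r * ratio K
        ≈⟨ *-comm _ _ ⟩
      ratio K * lambertFactor r ∎
      where
      s = suc r ℕ.+ suc r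
      tail≈0 : ∀ b → K ∸ r ℕ.≤ b → lambertFactor r * durfeeTerm s b ≈ 0#
      tail≈0 b K-r≤b = begin
        sign r * squarePower r * S * pole⁻¹ r * (X * Y * Z)
          ≈⟨ solve 7 (λ s E S J X Y Z → s :* E :* S :* J :* (X :* Y :* Z) := s :* S :* J :* Y :* Z :* (E :* X)) refl
               (sign r) (squarePower r) S (pole⁻¹ r) X Y Z ⟩
        sign r * S * pole⁻¹ r * Y * Z * (squarePower r * X)
          ≈⟨ *-vanishʳ _ (trans (sym (squarePower-+ r b)) (q^≥K (ℕₚ.≤-trans K≤ (ℕₚ.m≤m+n (suc (r ℕ.+ b)) _)))) ⟩
        0# ∎
        where
        S = (1# - q ^ suc r) * (1# - q ^ suc r)
        X = q ^ (b ℕ.* (b ℕ.+ s))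
        Y = 1# + q ^ (b ℕ.+ (b ℕ.+ s))
        Z = ratio b * ratio (b ℕ.+ s)
        K≤ : K ℕ.≤ suc (r ℕ.+ b)
        K≤ = ℕₚ.m≤n⇒m≤1+n (ℕₚ.≤-trans (ℕₚ.m≤n+m∸n K r) (ℕₚ.+-monoʳ-≤ r K-r≤b))

    rankSeries-Lambert : rankSeries ≈
      1# + ratio K * ∑ K (λ r → sign r * q ^ (suc r ℕ.* suc r) * ((1# - q ^ suc r) * (1# - q ^ suc r)) * pole⁻¹ r)
    rankSeries-Lambert = begin
      rankSeries
        ≈⟨ rankSeries-fineSeries ⟩
      1# + 2# * (q * minusFactor⁻¹ u 0 * fineSeries 0)
        ≈⟨ +-congˡ (*-congˡ (rogersFine K)) ⟩
      1# + 2# * (∑ K (λ m → squarePower m * squareFactor m * fineTerm m) + squarePower K * fineRemainder K * fineSeries K)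
        ≈⟨ +-congˡ (*-congˡ (trans (+-congˡ (*-vanishˡ _ (*-vanishˡ _ (q^≥K K≤square)))) (+-identityʳ _))) ⟩
      1# + 2# * ∑ K (λ m → squarePower m * squareFactor m * fineTerm m)
        ≈⟨ +-congˡ (trans (sym (∑-*ˡ K _ _)) (∑-cong K expand)) ⟩
      1# + ∑ K (λ m → ∑ (suc m) (λ r → squarePower m * squareFactor m * (partialCoeff m r * pole⁻¹ r)))
        ≈⟨ +-congˡ (∑-triangle K _) ⟩
      1# + ∑ K (λ r → ∑ (K ∸ r) (λ b → squarePower (r ℕ.+ b) * squareFactor (r ℕ.+ b) * (partialCoeff (r ℕ.+ b) r * pole⁻¹ r)))
        ≈⟨ +-congˡ (trans (∑-cong< K partialTerm-sum) (∑-*ˡ K _ _)) ⟩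
      1# + ratio K * ∑ K lambertFactor ∎
      where
      K≤square : K ℕ.≤ suc K ℕ.* suc K
      K≤square = ℕₚ.≤-trans (ℕₚ.n≤1+n K) (ℕₚ.m≤m*n (suc K) (suc K))
      expand : ∀ m → 2# * (squarePower m * squareFactor m * fineTerm m)
        ≈ ∑ (suc m) (λ r → squarePower m * squareFactor m * (partialCoeff m r * pole⁻¹ r))
      expand m = begin
        2# * (squarePower m * squareFactor m * fineTerm m)   ≈⟨ solve 3 (λ w x y → w :* (x :* y) := x :* (w :* y)) refl _ _ _ ⟩
        squarePower m * squareFactor m * (2# * fineTerm m)   ≈⟨ *-congˡ (partialFractions m) ⟩
        squarePower m * squareFactor m * ∑ (suc m) (λ r → partialCoeff m r * pole⁻¹ r)   ≈⟨ ∑-*ˡ (suc m) _ _ ⟨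
        ∑ (suc m) (λ r → squarePower m * squareFactor m * (partialCoeff m r * pole⁻¹ r)) ∎

  module AtOne = RankSeries 1# 1# (*-identityʳ 1#)

  ratio-boundedGF : ratio K ≈ 2# * AtOne.boundedGF K
  ratio-boundedGF = begin
    ratio K
      ≈⟨ ∏-* K (λ i → 1# + q ^ i) (minusFactor⁻¹ 1#) ⟩
    ∏ K (λ i → 1# + q ^ i) * ∏ K (minusFactor⁻¹ 1#)
      ≈⟨ *-congʳ (trans (*-congˡ (trans (+-congˡ q^K≈0) (+-identityʳ 1#))) (*-identityʳ _)) ⟨
    ∏ (suc K) (λ i → 1# + q ^ i) * ∏ K (minusFactor⁻¹ 1#)
      ≈⟨ *-congʳ (∏-head K _) ⟩
    2# * ∏ K (λ i → 1# + q ^ suc i) * ∏ K (minusFactor⁻¹ 1#)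
      ≈⟨ *-congʳ (*-congˡ (∏-cong K (λ i → +-congˡ (sym (*-identityˡ _))))) ⟩
    2# * ∏ K (plusFactor 1#) * ∏ K (minusFactor⁻¹ 1#)
      ≈⟨ *-assoc _ _ _ ⟩
    2# * (∏ K (plusFactor 1#) * ∏ K (minusFactor⁻¹ 1#))
      ≈⟨ *-congˡ (∏-* K (plusFactor 1#) (minusFactor⁻¹ 1#)) ⟨
    2# * AtOne.boundedGF K ∎

  private
    squareSum : Carrier
    squareSum = ∑ K (λ r → sign r * q ^ (suc r ℕ.* suc r))

  boundedGF-squareSum : AtOne.boundedGF K ≈ 1# + ratio K * squareSum
  boundedGF-squareSum = begin
    AtOne.boundedGF K
      ≈⟨ AtOne.boundedGF-sum K ⟩
    1# + ∑ K (λ l → 2# * (1# * q ^ suc l * AtOne.tailGF l))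
      ≈⟨ +-congˡ (∑-cong K (λ l → *-congˡ (trans (sym (*-identityˡ _)) (*-congʳ (sym (1^n≈1 (suc l))))))) ⟩
    AtOne.rankSeries
      ≈⟨ AtOne.rankSeries-Lambert ⟩
    1# + ratio K * ∑ K (λ r → sign r * q ^ (suc r ℕ.* suc r) * ((1# - q ^ suc r) * (1# - q ^ suc r)) * AtOne.pole⁻¹ r)
      ≈⟨ +-congˡ (*-congˡ (∑-cong K (λ r → trans (*-assoc _ _ _) (trans (*-congˡ (cancel-pole r)) (*-identityʳ _))))) ⟩
    1# + ratio K * squareSum ∎
    where
    cancel-pole : ∀ r → (1# - q ^ suc r) * (1# - q ^ suc r) * AtOne.pole⁻¹ r ≈ 1#
    cancel-pole r = trans (*-congʳ (*-cong unit-scale unit-scale)) (AtOne.pole-inverse r)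
      where
      unit-scale : 1# - q ^ suc r ≈ minusFactor 1# r
      unit-scale = +-congˡ (-‿cong (sym (*-identityˡ _)))

  -- Gauss's identity is the case u = 1, where every overpartition has weight 1.
  theta*boundedGF : theta * AtOne.boundedGF K ≈ 1#
  theta*boundedGF = begin
    theta * w
      ≈⟨ *-congʳ (+-congˡ (*-congˡ theta-neg)) ⟩
    (1# + 2# * (- squareSum)) * w
      ≈⟨ solve 2 (λ S w → (:1 :+ :2 :* (:- S)) :* w := w :- (:2 :* w) :* S) refl squareSum w ⟩
    w - (2# * w) * squareSum
      ≈⟨ +-cong boundedGF-squareSum (-‿cong (*-congʳ (sym ratio-boundedGF))) ⟩
    (1# + ratio K * squareSum) - ratio K * squareSum
      ≈⟨ solve 1 (λ x → :1 :+ x :- x := :1) refl (ratio K * squareSum) ⟩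
    1# ∎
    where
    w = AtOne.boundedGF K
    theta-neg : ∑ K (λ r → sign (suc r) * q ^ (suc r ℕ.* suc r)) ≈ - squareSum
    theta-neg = trans (∑-cong K (λ r → solve 2 (λ s x → (:- :1 :* s) :* x := :- (s :* x)) refl (sign r) (q ^ (suc r ℕ.* suc r))))
      (∑-neg K _)

  gauss : theta * ∏ K (plusFactor 1#) ≈ ∏ K (minusFactor 1#)
  gauss = begin
    theta * ∏ K (plusFactor 1#)
      ≈⟨ *-identityʳ _ ⟨
    theta * ∏ K (plusFactor 1#) * 1#
      ≈⟨ *-congˡ (trans (sym (∏-* K _ _)) (∏-one< K (λ i _ → minusFactor-inverse 1# i))) ⟨
    theta * ∏ K (plusFactor 1#) * (∏ K (minusFactor 1#) * ∏ K (minusFactor⁻¹ 1#))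
      ≈⟨ solve 4 (λ t e d i → t :* e :* (d :* i) := t :* (e :* i) :* d) refl _ _ _ _ ⟩
    theta * (∏ K (plusFactor 1#) * ∏ K (minusFactor⁻¹ 1#)) * ∏ K (minusFactor 1#)
      ≈⟨ *-congʳ (trans (*-congˡ (sym (∏-* K _ _))) theta*boundedGF) ⟩
    1# * ∏ K (minusFactor 1#)
      ≈⟨ *-identityˡ _ ⟩
    ∏ K (minusFactor 1#) ∎

  module RankTheta (u ū : Carrier) (u*ū≈1 : u * ū ≈ 1#) where
    open RankSeries u ū u*ū≈1

    theta*rankSeries : theta * rankSeries ≈
      1# + (2# * (2# - (u + ū))) * ∑ K (λ r → sign (suc r) * q ^ (suc r ℕ.* suc (suc r)) * pole⁻¹ r)
    theta*rankSeries = begin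
      theta * rankSeries
        ≈⟨ *-congˡ rankSeries-Lambert ⟩
      theta * (1# + ratio K * ∑ K (λ r → sign r * E r * ((1# - q ^ suc r) * (1# - q ^ suc r)) * pole⁻¹ r))
        ≈⟨ *-congˡ (+-congˡ (*-cong ratio-boundedGF (∑-cong K split))) ⟩
      theta * (1# + 2# * w * ∑ K (λ r → - (sign (suc r) * E r) + z * (sign (suc r) * E′ r * pole⁻¹ r)))
        ≈⟨ *-congˡ (+-congˡ (*-congˡ (trans (∑-+ K _ _) (+-cong (∑-neg K _) (∑-*ˡ K _ _))))) ⟩
      theta * (1# + 2# * w * (- S + z * L))
        ≈⟨ solve 5 (λ t w S z L → t :* (:1 :+ :2 :* w :* (:- S :+ z :* L)) := t :+ (t :* w) :* (:2 :* (:- S :+ z :* L)))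
              refl theta w S z L ⟩
      theta + (theta * w) * (2# * (- S + z * L))
        ≈⟨ +-congˡ (*-congʳ theta*boundedGF) ⟩
      theta + 1# * (2# * (- S + z * L))
        ≈⟨ solve 3 (λ S z L → (:1 :+ :2 :* S) :+ :1 :* (:2 :* (:- S :+ z :* L)) := :1 :+ (:2 :* z) :* L) refl S z L ⟩
      1# + (2# * z) * L ∎
      where
      w = AtOne.boundedGF K
      z = 2# - (u + ū)
      E E′ : ℕ → Carrier
      E r = q ^ (suc r ℕ.* suc r)
      E′ r = q ^ (suc r ℕ.* suc (suc r))
      S = ∑ K (λ r → sign (suc r) * E r)
      L = ∑ K (λ r → sign (suc r) * E′ r * pole⁻¹ r)
      E-shift : ∀ r → E′ r ≈ E r * q ^ suc r
      E-shift r = q^-split (suc r ℕ.* suc r) (suc r) (≡.sym (≡.trans (ℕₚ.*-suc (suc r) (suc r)) (ℕₚ.+-comm (suc r) _)))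
      split : ∀ r → sign r * E r * ((1# - q ^ suc r) * (1# - q ^ suc r)) * pole⁻¹ r
        ≈ - (sign (suc r) * E r) + z * (sign (suc r) * E′ r * pole⁻¹ r)
      split r = begin
        sign r * E r * ((1# - y) * (1# - y)) * pole⁻¹ r
          ≈⟨ solve 6 (λ s E y u v J → s :* E :* ((:1 :- y) :* (:1 :- y)) :* J
               := (s :* E :* ((:1 :- u :* y) :* (:1 :- v :* y) :* J) :+ (:2 :- (u :+ v)) :* ((:- :1 :* s) :* (E :* y) :* J))
                  :+ (u :* v :- :1) :* (:- (s :* E :* y :* y :* J))) refl (sign r) (E r) y u ū (pole⁻¹ r) ⟩
        (sign r * E r * (pole r * pole⁻¹ r) + z * (sign (suc r) * (E r * y) * pole⁻¹ r)) + (u * ū - 1#) * _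
          ≈⟨ +-absorbs-≈1 u*ū≈1 _ _ ⟩
        sign r * E r * (pole r * pole⁻¹ r) + z * (sign (suc r) * (E r * y) * pole⁻¹ r)
          ≈⟨ +-cong (trans (*-congˡ (pole-inverse r)) (solve 2 (λ s E → s :* E :* :1 := :- ((:- :1 :* s) :* E)) refl (sign r) (E r)))
                    (*-congˡ (*-congʳ (*-congˡ (sym (E-shift r))))) ⟩
        - (sign (suc r) * E r) + z * (sign (suc r) * E′ r * pole⁻¹ r) ∎
        where y = q ^ suc r

-- The triple product and the factorisations of the two theta series

module FiniteTripleProduct (R : CommutativeRing 0ℓ 0ℓ) (x y Q : CommutativeRing.Carrier R)
  (x*y≈Q : CommutativeRing._≈_ R (CommutativeRing._*_ R x y) Q) where
  open RingCalculus R

  gaussian : ℕ → ℕ → Carrier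
  gaussian N zero = 1#
  gaussian zero (suc i) = 0#
  gaussian (suc N) (suc i) = gaussian N (suc i) + Q ^ (N ∸ i) * gaussian N i

  gaussian-< : ∀ {N i} → N ℕ.< i → gaussian N i ≈ 0#
  gaussian-< {zero} {suc i} _ = refl
  gaussian-< {suc N} {suc i} (s≤s N<i) =
    trans (+-cong (gaussian-< (ℕₚ.m<n⇒m<1+n N<i)) (*-vanishʳ _ (gaussian-< N<i))) (+-identityʳ 0#)

  gaussian-pascal : ∀ N i → gaussian (suc N) (suc i) ≈ gaussian N i + Q ^ suc i * gaussian N (suc i)
  gaussian-pascal zero zero = solve 1 (λ Q → :0 :+ :1 :* :1 := :1 :+ (Q :* :1) :* :0) refl Q
  gaussian-pascal zero (suc i) = solve 1 (λ Q → :0 :+ :1 :* :0 := :0 :+ Q :* :0) refl (Q ^ suc (suc i))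
  gaussian-pascal (suc N) zero = begin
    (gaussian N 1 + Q ^ N * 1#) + (Q * Q ^ N) * 1#
      ≈⟨ +-congʳ (gaussian-pascal N 0) ⟩
    (1# + (Q * 1#) * gaussian N 1) + (Q * Q ^ N) * 1#
      ≈⟨ solve 3 (λ Q p b → (:1 :+ (Q :* :1) :* b) :+ (Q :* p) :* :1 := :1 :+ (Q :* :1) :* (b :+ p :* :1)) refl Q (Q ^ N) (gaussian N 1) ⟩
    1# + (Q * 1#) * (gaussian N 1 + Q ^ N * 1#) ∎
  gaussian-pascal (suc N) (suc i) = begin
    gaussian (suc N) (suc (suc i)) + P * gaussian (suc N) (suc i)
      ≈⟨ +-cong (gaussian-pascal N (suc i)) (*-congˡ (gaussian-pascal N i)) ⟩
    (b₁ + q₂ * b₂) + P * (b₀ + q₁ * b₁)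
      ≈⟨ solve 6 (λ b₀ b₁ b₂ P q₁ q₂ → (b₁ :+ q₂ :* b₂) :+ P :* (b₀ :+ q₁ :* b₁) := (b₁ :+ P :* b₀ :+ q₂ :* b₂) :+ P :* q₁ :* b₁)
          refl b₀ b₁ b₂ P q₁ q₂ ⟩
    (b₁ + P * b₀ + q₂ * b₂) + P * q₁ * b₁
      ≈⟨ +-congˡ exponents ⟩
    (b₁ + P * b₀ + q₂ * b₂) + q₂ * Q ^ (N ∸ suc i) * b₁
      ≈⟨ solve 6 (λ b₀ b₁ b₂ P q₂ r → (b₁ :+ P :* b₀ :+ q₂ :* b₂) :+ q₂ :* r :* b₁ := (b₁ :+ P :* b₀) :+ q₂ :* (b₂ :+ r :* b₁)) refl
           b₀ b₁ b₂ P q₂ (Q ^ (N ∸ suc i)) ⟩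
    (b₁ + P * b₀) + q₂ * (b₂ + Q ^ (N ∸ suc i) * b₁) ∎
    where
    P = Q ^ (N ∸ i)
    q₁ = Q ^ suc i
    q₂ = Q ^ suc (suc i)
    b₀ = gaussian N i
    b₁ = gaussian N (suc i)
    b₂ = gaussian N (suc (suc i))
    exponents : P * q₁ * b₁ ≈ q₂ * Q ^ (N ∸ suc i) * b₁
    exponents with ℕₚ.≤-<-connex (suc i) N
    ... | inj₂ N<i = trans (*-vanishʳ _ (gaussian-< N<i)) (sym (*-vanishʳ _ (gaussian-< N<i)))
    ... | inj₁ i<N = *-congʳ (begin
      Q ^ (N ∸ i) * Q ^ suc i                   ≈⟨ ^-homo-* Q (N ∸ i) (suc i) ⟨
      Q ^ (N ∸ i ℕ.+ suc i)                     ≡⟨ ≡.cong (Q ^_) total ⟩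
      Q ^ (suc (suc i) ℕ.+ (N ∸ suc i))         ≈⟨ ^-homo-* Q (suc (suc i)) (N ∸ suc i) ⟩
      Q ^ suc (suc i) * Q ^ (N ∸ suc i)         ∎)
      where
      total : N ∸ i ℕ.+ suc i ≡ suc (suc i) ℕ.+ (N ∸ suc i)
      total = ≡.trans (ℕₚ.+-suc (N ∸ i) i) (≡.cong suc (≡.trans (ℕₚ.m∸n+n≡m (ℕₚ.<⇒≤ i<N)) (≡.sym (ℕₚ.m+[n∸m]≡n i<N))))

  qFactorial : ℕ → Carrier
  qFactorial n = ∏ n (λ i → 1# - Q ^ suc i)

  gaussian-qFactorial : ∀ i j → gaussian (i ℕ.+ j) i * (qFactorial i * qFactorial j) ≈ qFactorial (i ℕ.+ j)
  gaussian-qFactorial zero j = solve 1 (λ x → :1 :* (:1 :* x) := x) refl (qFactorial j)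
  gaussian-qFactorial (suc i) j = begin
    (gaussian N (suc i) + Q ^ (N ∸ i) * gaussian N i) * (qFactorial i * (1# - q₁) * qFactorial j)
      ≈⟨ *-congʳ (+-congˡ (*-congʳ (reflexive (≡.cong (Q ^_) (ℕₚ.m+n∸m≡n i j))))) ⟩
    (gaussian N (suc i) + Q ^ j * gaussian N i) * (qFactorial i * (1# - q₁) * qFactorial j)
      ≈⟨ solve 6 (λ b′ p b f q₁ h → (b′ :+ p :* b) :* (f :* (:1 :- q₁) :* h) := b′ :* (f :* (:1 :- q₁) :* h)
                                   :+ (p :* (:1 :- q₁)) :* (b :* (f :* h))) refl
           (gaussian N (suc i)) (Q ^ j) (gaussian N i) (qFactorial i) q₁ (qFactorial j) ⟩
    gaussian N (suc i) * (qFactorial (suc i) * qFactorial j) + (Q ^ j * (1# - q₁)) * (gaussian N i * (qFactorial i * qFactorial j))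
      ≈⟨ +-cong (raised j) (*-congˡ (gaussian-qFactorial i j)) ⟩
    (1# - Q ^ j) * qFactorial N + (Q ^ j * (1# - q₁)) * qFactorial N
      ≈⟨ solve 3 (λ p q₁ f → (:1 :- p) :* f :+ (p :* (:1 :- q₁)) :* f := f :* (:1 :- q₁ :* p)) refl (Q ^ j) q₁ (qFactorial N) ⟩
    qFactorial N * (1# - q₁ * Q ^ j)
      ≈⟨ *-congˡ (+-congˡ (-‿cong (^-homo-* Q (suc i) j))) ⟨
    qFactorial N * (1# - Q ^ suc N) ∎
    where
    N = i ℕ.+ j
    q₁ = Q ^ suc i
    raised : ∀ j → gaussian (i ℕ.+ j) (suc i) * (qFactorial (suc i) * qFactorial j) ≈ (1# - Q ^ j) * qFactorial (i ℕ.+ j)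
    raised zero = trans (*-congʳ (gaussian-< (s≤s (ℕₚ.≤-reflexive (ℕₚ.+-identityʳ i)))))
      (solve 2 (λ x y → :0 :* x := (:1 :- :1) :* y) refl _ _)
    raised (suc j) = begin
      gaussian (i ℕ.+ suc j) (suc i) * (qFactorial (suc i) * (qFactorial j * (1# - Q ^ suc j)))
        ≡⟨ ≡.cong (λ z → gaussian z (suc i) * (qFactorial (suc i) * (qFactorial j * (1# - Q ^ suc j)))) (ℕₚ.+-suc i j) ⟩
      gaussian (suc i ℕ.+ j) (suc i) * (qFactorial (suc i) * (qFactorial j * (1# - Q ^ suc j)))
        ≈⟨ solve 4 (λ b f h w → b :* (f :* (h :* w)) := w :* (b :* (f :* h))) refl _ _ _ _ ⟩
      (1# - Q ^ suc j) * (gaussian (suc i ℕ.+ j) (suc i) * (qFactorial (suc i) * qFactorial j))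
        ≈⟨ *-congˡ (gaussian-qFactorial (suc i) j) ⟩
      (1# - Q ^ suc j) * qFactorial (suc i ℕ.+ j)
        ≡⟨ ≡.cong (λ z → (1# - Q ^ suc j) * qFactorial z) (≡.sym (ℕₚ.+-suc i j)) ⟩
      (1# - Q ^ suc j) * qFactorial (i ℕ.+ suc j) ∎

  -- Both recurrences of the Gaussian binomials have this shape, with (a , b) = (1 , Q^{N−i}) and (Q^i , 1).
  gaussian-sum-suc : ∀ N (a b f : ℕ → Carrier) → a 0 ≈ 1# →
    (∀ i → gaussian (suc N) (suc i) ≈ a (suc i) * gaussian N (suc i) + b i * gaussian N i) →
    ∑ (suc N) (λ i → gaussian N i * (a i * f i + b i * f (suc i))) ≈ ∑ (suc (suc N)) (λ i → gaussian (suc N) i * f i)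
  gaussian-sum-suc N a b f a₀≈1 pascal = begin
    ∑ (suc N) (λ i → gaussian N i * (a i * f i + b i * f (suc i)))
      ≈⟨ trans (∑-cong (suc N) (λ i → distribˡ _ _ _)) (∑-+ (suc N) _ _) ⟩
    ∑ (suc N) (λ i → gaussian N i * (a i * f i)) + B
      ≈⟨ +-congʳ (trans (+-congˡ (*-vanishˡ _ (gaussian-< {N} ℕₚ.≤-refl))) (+-identityʳ _)) ⟨
    ∑ (suc (suc N)) (λ i → gaussian N i * (a i * f i)) + B
      ≈⟨ trans (+-congʳ (∑-head (suc N) _)) (+-assoc _ _ _) ⟩
    1# * (a 0 * f 0) + (∑ (suc N) (λ i → gaussian N (suc i) * (a (suc i) * f (suc i))) + B)
      ≈⟨ +-cong (*-congˡ (trans (*-congʳ a₀≈1) (*-identityˡ _))) (sym (∑-+ (suc N) _ _)) ⟩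
    1# * f 0 + ∑ (suc N) (λ i → gaussian N (suc i) * (a (suc i) * f (suc i)) + gaussian N i * (b i * f (suc i)))
      ≈⟨ +-congˡ (∑-cong (suc N) (λ i → trans
           (solve 5 (λ g′ a t g b → g′ :* (a :* t) :+ g :* (b :* t) := (a :* g′ :+ b :* g) :* t) refl
             (gaussian N (suc i)) (a (suc i)) (f (suc i)) (gaussian N i) (b i))
           (*-congʳ (sym (pascal i))))) ⟩
    1# * f 0 + ∑ (suc N) (λ i → gaussian (suc N) (suc i) * f (suc i))
      ≈⟨ ∑-head (suc N) _ ⟨
    ∑ (suc (suc N)) (λ i → gaussian (suc N) i * f i) ∎
    where B = ∑ (suc N) (λ i → gaussian N i * (b i * f (suc i)))

  triangular : ℕ → ℕ
  triangular zero = 0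
  triangular (suc j) = triangular j ℕ.+ j

  xTerm yTerm : ℕ → Carrier
  xTerm j = (- x) ^ j * Q ^ triangular j
  yTerm j = (- y) ^ j * Q ^ triangular j

  -- thetaTerm n i is the term of index i − n ∈ ℤ
  thetaTerm : ℕ → ℕ → Carrier
  thetaTerm zero i = xTerm i
  thetaTerm (suc n) zero = yTerm (suc n)
  thetaTerm (suc n) (suc i) = thetaTerm n i

  thetaTerm-zero : ∀ n → thetaTerm n 0 ≈ yTerm n
  thetaTerm-zero zero = refl
  thetaTerm-zero (suc n) = refl

  triangularPower-suc : ∀ z j → (- z) ^ suc j * Q ^ triangular (suc j) ≈ (- z) * Q ^ j * ((- z) ^ j * Q ^ triangular j)
  triangularPower-suc z j = begin
    (- z) * (- z) ^ j * Q ^ (triangular j ℕ.+ j)       ≈⟨ *-congˡ (^-homo-* Q (triangular j) j) ⟩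
    (- z) * (- z) ^ j * (Q ^ triangular j * Q ^ j)     ≈⟨ solve 4 (λ z a b c → z :* a :* (b :* c) := z :* c :* (a :* b)) refl _ _ _ _ ⟩
    (- z) * Q ^ j * ((- z) ^ j * Q ^ triangular j)     ∎

  thetaTerm-x : ∀ m n i → i ℕ.≤ m ℕ.+ n → (- x) * Q ^ m * thetaTerm n i ≈ Q ^ (m ℕ.+ n ∸ i) * thetaTerm n (suc i)
  thetaTerm-x m zero i i≤m = begin
    (- x) * Q ^ m * xTerm i
      ≡⟨ ≡.cong (λ z → (- x) * Q ^ z * xTerm i) (≡.sym (ℕₚ.m∸n+n≡m (≡.subst (i ℕ.≤_) (ℕₚ.+-identityʳ m) i≤m))) ⟩
    (- x) * Q ^ (m ∸ i ℕ.+ i) * xTerm i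
      ≈⟨ *-congʳ (*-congˡ (^-homo-* Q (m ∸ i) i)) ⟩
    (- x) * (Q ^ (m ∸ i) * Q ^ i) * xTerm i
      ≈⟨ solve 4 (λ x a b c → x :* (a :* b) :* c := a :* (x :* b :* c)) refl _ _ _ _ ⟩
    Q ^ (m ∸ i) * ((- x) * Q ^ i * xTerm i)
      ≈⟨ *-congˡ (sym (triangularPower-suc x i)) ⟩
    Q ^ (m ∸ i) * xTerm (suc i)
      ≡⟨ ≡.cong (λ z → Q ^ (z ∸ i) * xTerm (suc i)) (≡.sym (ℕₚ.+-identityʳ m)) ⟩
    Q ^ (m ℕ.+ 0 ∸ i) * xTerm (suc i) ∎
  thetaTerm-x m (suc n) zero _ = begin
    (- x) * Q ^ m * yTerm (suc n)
      ≈⟨ *-congˡ (triangularPower-suc y n) ⟩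
    (- x) * Q ^ m * ((- y) * Q ^ n * yTerm n)
      ≈⟨ solve 5 (λ x y a b c → (:- x) :* a :* ((:- y) :* b :* c) := (x :* y) :* (a :* b) :* c) refl x y _ _ _ ⟩
    (x * y) * (Q ^ m * Q ^ n) * yTerm n
      ≈⟨ *-congʳ (*-cong x*y≈Q (sym (^-homo-* Q m n))) ⟩
    Q ^ suc (m ℕ.+ n) * yTerm n
      ≈⟨ *-cong (reflexive (≡.cong (Q ^_) (≡.sym (ℕₚ.+-suc m n)))) (sym (thetaTerm-zero n)) ⟩
    Q ^ (m ℕ.+ suc n) * thetaTerm n 0 ∎
  thetaTerm-x m (suc n) (suc i) i<m+n = begin
    (- x) * Q ^ m * thetaTerm n i
      ≈⟨ thetaTerm-x m n i (ℕₚ.≤-pred (≡.subst (suc i ℕ.≤_) (ℕₚ.+-suc m n) i<m+n)) ⟩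
    Q ^ (m ℕ.+ n ∸ i) * thetaTerm n (suc i)
      ≡⟨ ≡.cong (λ z → Q ^ (z ∸ suc i) * thetaTerm n (suc i)) (≡.sym (ℕₚ.+-suc m n)) ⟩
    Q ^ (m ℕ.+ suc n ∸ suc i) * thetaTerm n (suc i) ∎

  thetaTerm-y : ∀ n i → i ℕ.≤ n → (- y) * Q ^ n * thetaTerm n i ≈ Q ^ i * thetaTerm (suc n) i
  thetaTerm-y n zero _ = trans (*-congˡ (thetaTerm-zero n)) (trans (sym (triangularPower-suc y n)) (sym (*-identityˡ _)))
  thetaTerm-y (suc n) (suc i) (s≤s i≤n) = begin
    (- y) * (Q * Q ^ n) * thetaTerm n i      ≈⟨ solve 4 (λ y Q p t → y :* (Q :* p) :* t := Q :* (y :* p :* t)) refl _ _ _ _ ⟩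
    Q * ((- y) * Q ^ n * thetaTerm n i)      ≈⟨ *-congˡ (thetaTerm-y n i i≤n) ⟩
    Q * (Q ^ i * thetaTerm (suc n) i)        ≈⟨ *-assoc _ _ _ ⟨
    Q ^ suc i * thetaTerm (suc n) i          ∎

  product-y : ∀ n → ∏ n (λ i → 1# - y * Q ^ i) ≈ ∑ (suc n) (λ i → gaussian n i * thetaTerm n i)
  product-y zero = solve 0 (:1 := :0 :+ :1 :* (:1 :* :1)) refl
  product-y (suc n) = begin
    ∏ n (λ i → 1# - y * Q ^ i) * (1# - y * Q ^ n)
      ≈⟨ trans (*-congʳ (product-y n)) (sym (∑-*ʳ (suc n) _ _)) ⟩
    ∑ (suc n) (λ i → gaussian n i * thetaTerm n i * (1# - y * Q ^ n))
      ≈⟨ ∑-cong< (suc n) (λ i i≤n → trans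
           (solve 4 (λ g t y w → g :* t :* (:1 :- y :* w) := g :* ((:- y) :* w :* t :+ :1 :* t)) refl (gaussian n i)
               (thetaTerm n i) y (Q ^ n))
           (*-congˡ (+-congʳ (thetaTerm-y n i (ℕₚ.≤-pred i≤n))))) ⟩
    ∑ (suc n) (λ i → gaussian n i * (Q ^ i * thetaTerm (suc n) i + 1# * thetaTerm (suc n) (suc i)))
      ≈⟨ gaussian-sum-suc n (Q ^_) (λ _ → 1#) (thetaTerm (suc n)) refl (λ i →
           trans (gaussian-pascal n i) (trans (+-comm _ _) (+-congˡ (sym (*-identityˡ _))))) ⟩
    ∑ (suc (suc n)) (λ i → gaussian (suc n) i * thetaTerm (suc n) i) ∎

  product-xy : ∀ m n → ∏ m (λ i → 1# - x * Q ^ i) * ∏ n (λ i → 1# - y * Q ^ i)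
    ≈ ∑ (suc (m ℕ.+ n)) (λ i → gaussian (m ℕ.+ n) i * thetaTerm n i)
  product-xy zero n = trans (*-identityˡ _) (product-y n)
  product-xy (suc m) n = begin
    ∏ m (λ i → 1# - x * Q ^ i) * (1# - x * Q ^ m) * ∏ n (λ i → 1# - y * Q ^ i)
      ≈⟨ solve 3 (λ a b c → a :* b :* c := (a :* c) :* b) refl _ _ _ ⟩
    (∏ m (λ i → 1# - x * Q ^ i) * ∏ n (λ i → 1# - y * Q ^ i)) * (1# - x * Q ^ m)
      ≈⟨ trans (*-congʳ (product-xy m n)) (sym (∑-*ʳ (suc N) _ _)) ⟩
    ∑ (suc N) (λ i → gaussian N i * thetaTerm n i * (1# - x * Q ^ m))
      ≈⟨ ∑-cong< (suc N) (λ i i≤N → trans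
           (solve 4 (λ g t x w → g :* t :* (:1 :- x :* w) := g :* (:1 :* t :+ (:- x) :* w :* t)) refl (gaussian N i)
               (thetaTerm n i) x (Q ^ m))
           (*-congˡ (+-congˡ (thetaTerm-x m n i (ℕₚ.≤-pred i≤N))))) ⟩
    ∑ (suc N) (λ i → gaussian N i * (1# * thetaTerm n i + Q ^ (N ∸ i) * thetaTerm n (suc i)))
      ≈⟨ gaussian-sum-suc N (λ _ → 1#) (λ i → Q ^ (N ∸ i)) (thetaTerm n) refl (λ i → +-congʳ (sym (*-identityˡ _))) ⟩
    ∑ (suc (suc N)) (λ i → gaussian (suc N) i * thetaTerm n i) ∎
    where N = m ℕ.+ n

  thetaTerm-sum : ∀ n m → ∑ (suc (m ℕ.+ n)) (thetaTerm n) ≈ ∑ n (λ j → yTerm (suc j)) + ∑ (suc m) xTerm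
  thetaTerm-sum zero m rewrite ℕₚ.+-identityʳ m = sym (+-identityˡ _)
  thetaTerm-sum (suc n) m rewrite ℕₚ.+-suc m n = begin
    ∑ (suc (suc (m ℕ.+ n))) (thetaTerm (suc n))                             ≈⟨ ∑-head (suc (m ℕ.+ n)) _ ⟩
    yTerm (suc n) + ∑ (suc (m ℕ.+ n)) (thetaTerm n)                         ≈⟨ +-congˡ (thetaTerm-sum n m) ⟩
    yTerm (suc n) + (∑ n (λ j → yTerm (suc j)) + ∑ (suc m) xTerm)
      ≈⟨ solve 3 (λ y a b → y :+ (a :+ b) := (a :+ y) :+ b) refl _ _ _ ⟩
    (∑ n (λ j → yTerm (suc j)) + yTerm (suc n)) + ∑ (suc m) xTerm           ∎

  thetaTerm-below : ∀ n i → i ℕ.≤ n → thetaTerm n i ≈ yTerm (n ∸ i)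
  thetaTerm-below n zero _ = thetaTerm-zero n
  thetaTerm-below (suc n) (suc i) (s≤s i≤n) = thetaTerm-below n i i≤n

  thetaTerm-above : ∀ n i → thetaTerm n (n ℕ.+ i) ≡ xTerm i
  thetaTerm-above zero i = ≡.refl
  thetaTerm-above (suc n) i = thetaTerm-above n i

  module _ (K : ℕ) (x^K≈0 : IsNilpotent K x) (y^K≈0 : IsNilpotent K y) (Q^K≈0 : IsNilpotent K Q) where

    negPower≈0 : ∀ {z} → IsNilpotent K z → ∀ i → K ℕ.≤ i → (- z) ^ i ≈ 0#
    negPower≈0 {z} z^K≈0 i K≤i = begin
      (- z) ^ i            ≈⟨ ^-congˡ i (-1*x≈-x z) ⟨
      (- 1# * z) ^ i       ≈⟨ ^-distrib-* (- 1#) z i ⟩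
      sign i * z ^ i       ≈⟨ *-vanishʳ _ (IsNilpotent-^ z^K≈0 K≤i) ⟩
      0#                   ∎

    xTerm≈0 : ∀ i → K ℕ.≤ i → xTerm i ≈ 0#
    xTerm≈0 i K≤i = *-vanishˡ _ (negPower≈0 x^K≈0 i K≤i)

    yTerm≈0 : ∀ i → K ℕ.≤ i → yTerm i ≈ 0#
    yTerm≈0 i K≤i = *-vanishˡ _ (negPower≈0 y^K≈0 i K≤i)

    qFactorial-stable : ∀ j → qFactorial (K ℕ.+ j) ≈ qFactorial K
    qFactorial-stable j = ∏-extend _ (λ i K≤i → trans
      (+-congˡ (-‿cong (IsNilpotent-^ Q^K≈0 (ℕₚ.m≤n⇒m≤1+n K≤i)))) (solve 0 (:1 :- :0 := :1) refl)) (ℕₚ.m≤m+n K j)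

    qFactorial*gaussian : Invertible (qFactorial K) → ∀ i j → qFactorial K * gaussian ((K ℕ.+ i) ℕ.+ (K ℕ.+ j)) (K ℕ.+ i) ≈ 1#
    qFactorial*gaussian inv i j = Invertible-cancelˡ inv (begin
      qFactorial K * (qFactorial K * gaussian N (K ℕ.+ i))                 ≈⟨ solve 2 (λ f b → f :* (f :* b) := b :* (f :* f)) refl _ _ ⟩
      gaussian N (K ℕ.+ i) * (qFactorial K * qFactorial K)                 ≈⟨ *-congˡ (*-cong (qFactorial-stable i) (qFactorial-stable j)) ⟨
      gaussian N (K ℕ.+ i) * (qFactorial (K ℕ.+ i) * qFactorial (K ℕ.+ j)) ≈⟨ gaussian-qFactorial (K ℕ.+ i) (K ℕ.+ j) ⟩
      qFactorial N                                                         ≡⟨ ≡.cong qFactorial (ℕₚ.+-assoc K i (K ℕ.+ j)) ⟩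
      qFactorial (K ℕ.+ (i ℕ.+ (K ℕ.+ j)))                                 ≈⟨ qFactorial-stable _ ⟩
      qFactorial K                                                         ≈⟨ *-identityʳ _ ⟨
      qFactorial K * 1#                                                    ∎)
      where N = (K ℕ.+ i) ℕ.+ (K ℕ.+ j)

    -- Where the Gaussian binomial is not yet stable, the theta term already vanishes.
    qFactorial*gaussian*thetaTerm : Invertible (qFactorial K) → let M = K ℕ.+ K in ∀ i → i ℕ.≤ M ℕ.+ M →
      qFactorial K * (gaussian (M ℕ.+ M) i * thetaTerm M i) ≈ thetaTerm M i
    qFactorial*gaussian*thetaTerm inv i i≤2M with ℕₚ.≤-<-connex K i | ℕₚ.≤-<-connex K (K ℕ.+ K ℕ.+ (K ℕ.+ K) ∸ i)
    ... | inj₂ i<K | _ = trans (*-vanishʳ _ (*-vanishʳ _ term≈0)) (sym term≈0)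
      where
      M = K ℕ.+ K
      term≈0 : thetaTerm M i ≈ 0#
      term≈0 = trans (thetaTerm-below M i (ℕₚ.≤-trans (ℕₚ.<⇒≤ i<K) (ℕₚ.m≤m+n K K)))
        (yTerm≈0 (M ∸ i) (ℕₚ.m+n≤o⇒m≤o∸n K (ℕₚ.+-monoʳ-≤ K (ℕₚ.<⇒≤ i<K))))
    ... | inj₁ _ | inj₂ j<K = trans (*-vanishʳ _ (*-vanishʳ _ term≈0)) (sym term≈0)
      where
      M = K ℕ.+ K
      M+K≤i : M ℕ.+ K ℕ.≤ i
      M+K≤i = ℕₚ.+-cancelʳ-≤ K (M ℕ.+ K) i (ℕₚ.≤-trans (ℕₚ.≤-reflexive (ℕₚ.+-assoc M K K))
        (ℕₚ.≤-trans (ℕₚ.≤-reflexive (≡.sym (ℕₚ.m+[n∸m]≡n i≤2M))) (ℕₚ.+-monoʳ-≤ i (ℕₚ.<⇒≤ j<K))))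
      term≈0 : thetaTerm M i ≈ 0#
      term≈0 = begin
        thetaTerm M i                  ≡⟨ ≡.cong (thetaTerm M) (ℕₚ.m+[n∸m]≡n (ℕₚ.≤-trans (ℕₚ.m≤m+n M K) M+K≤i)) ⟨
        thetaTerm M (M ℕ.+ (i ∸ M))    ≡⟨ thetaTerm-above M (i ∸ M) ⟩
        xTerm (i ∸ M)                  ≈⟨ xTerm≈0 (i ∸ M) (ℕₚ.m+n≤o⇒m≤o∸n K (ℕₚ.≤-trans (ℕₚ.≤-reflexive (ℕₚ.+-comm K M)) M+K≤i)) ⟩
        0#                             ∎
    ... | inj₁ K≤i | inj₁ K≤j = begin
      qFactorial K * (gaussian (M ℕ.+ M) i * thetaTerm M i)
        ≈⟨ *-assoc _ _ _ ⟨
      qFactorial K * gaussian (M ℕ.+ M) i * thetaTerm M i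
        ≡⟨ ≡.cong₂ (λ a b → qFactorial K * gaussian a b * thetaTerm M i) total (≡.sym (ℕₚ.m+[n∸m]≡n K≤i)) ⟩
      qFactorial K * gaussian ((K ℕ.+ (i ∸ K)) ℕ.+ (K ℕ.+ (M ℕ.+ M ∸ i ∸ K))) (K ℕ.+ (i ∸ K)) * thetaTerm M i
        ≈⟨ *-congʳ (qFactorial*gaussian inv (i ∸ K) (M ℕ.+ M ∸ i ∸ K)) ⟩
      1# * thetaTerm M i
        ≈⟨ *-identityˡ _ ⟩
      thetaTerm M i ∎
      where
      M = K ℕ.+ K
      total : M ℕ.+ M ≡ (K ℕ.+ (i ∸ K)) ℕ.+ (K ℕ.+ (M ℕ.+ M ∸ i ∸ K))
      total = ≡.trans (≡.sym (ℕₚ.m+[n∸m]≡n i≤2M)) (≡.cong₂ ℕ._+_ (≡.sym (ℕₚ.m+[n∸m]≡n K≤i)) (≡.sym (ℕₚ.m+[n∸m]≡n K≤j)))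

    tripleProduct : Invertible (qFactorial K) →
      qFactorial K * (∏ (K ℕ.+ K) (λ i → 1# - x * Q ^ i) * ∏ (K ℕ.+ K) (λ i → 1# - y * Q ^ i))
      ≈ 1# + ∑ K (λ j → xTerm (suc j) + yTerm (suc j))
    tripleProduct inv = begin
      qFactorial K * (∏ M (λ i → 1# - x * Q ^ i) * ∏ M (λ i → 1# - y * Q ^ i))
        ≈⟨ *-congˡ (product-xy M M) ⟩
      qFactorial K * ∑ (suc (M ℕ.+ M)) (λ i → gaussian (M ℕ.+ M) i * thetaTerm M i)
        ≈⟨ ∑-*ˡ (suc (M ℕ.+ M)) _ _ ⟨
      ∑ (suc (M ℕ.+ M)) (λ i → qFactorial K * (gaussian (M ℕ.+ M) i * thetaTerm M i))
        ≈⟨ ∑-cong< (suc (M ℕ.+ M)) (λ i i≤2M → qFactorial*gaussian*thetaTerm inv i (ℕₚ.≤-pred i≤2M)) ⟩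
      ∑ (suc (M ℕ.+ M)) (thetaTerm M)
        ≈⟨ thetaTerm-sum M M ⟩
      ∑ M (λ j → yTerm (suc j)) + ∑ (suc M) xTerm
        ≈⟨ +-cong (shorten yTerm yTerm≈0) (∑-head M xTerm) ⟩
      ∑ K (λ j → yTerm (suc j)) + (1# * 1# + ∑ M (λ j → xTerm (suc j)))
        ≈⟨ +-congˡ (+-cong (*-identityʳ 1#) (shorten xTerm xTerm≈0)) ⟩
      ∑ K (λ j → yTerm (suc j)) + (1# + ∑ K (λ j → xTerm (suc j)))
        ≈⟨ solve 2 (λ a b → a :+ (:1 :+ b) := :1 :+ (b :+ a)) refl _ _ ⟩
      1# + (∑ K (λ j → xTerm (suc j)) + ∑ K (λ j → yTerm (suc j)))
        ≈⟨ +-congˡ (∑-+ K _ _) ⟨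
      1# + ∑ K (λ j → xTerm (suc j) + yTerm (suc j)) ∎
      where
      M = K ℕ.+ K
      shorten : ∀ f → (∀ i → K ℕ.≤ i → f i ≈ 0#) → ∑ M (λ j → f (suc j)) ≈ ∑ K (λ j → f (suc j))
      shorten f f≈0 = ∑-extend _ (λ i K≤i → f≈0 (suc i) (ℕₚ.m≤n⇒m≤1+n K≤i)) (ℕₚ.m≤m+n K K)

module ThetaSeries (R : CommutativeRing 0ℓ 0ℓ) where
  open RingCalculus R

  -- Truncations of (c z; z)_∞, of Σ_{n∈ℤ} (−1)ⁿ z^{n²} and of Σ_{n∈ℤ} (−1)ⁿ z^{3n²+2n}
  euler : Carrier → ℕ → Carrier → Carrier
  euler c K z = ∏ K (λ i → 1# - c * z ^ suc i)

  thetaTerm octagonalTerm : Carrier → ℕ → Carrier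
  thetaTerm z r = sign (suc r) * z ^ (suc r ℕ.* suc r)
  octagonalTerm z j = sign (suc j) * z ^ (suc j ℕ.* (3 ℕ.* suc j ℕ.+ 2)) + sign (suc j) * z ^ (suc j ℕ.* (3 ℕ.* j ℕ.+ 1))

  thetaAt octagonalAt : ℕ → Carrier → Carrier
  thetaAt K z = 1# + 2# * ∑ K (thetaTerm z)
  octagonalAt K z = 1# + ∑ K (octagonalTerm z)

  thetaAt-cong : ∀ K {z z′} → z ≈ z′ → thetaAt K z ≈ thetaAt K z′
  thetaAt-cong K z≈z′ = +-congˡ (*-congˡ (∑-cong K (λ r → *-congˡ (^-congˡ (suc r ℕ.* suc r) z≈z′))))

  octagonalAt-cong : ∀ K {z z′} → z ≈ z′ → octagonalAt K z ≈ octagonalAt K z′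
  octagonalAt-cong K z≈z′ = +-congˡ (∑-cong K (λ j → +-cong
    (*-congˡ (^-congˡ (suc j ℕ.* (3 ℕ.* suc j ℕ.+ 2)) z≈z′)) (*-congˡ (^-congˡ (suc j ℕ.* (3 ℕ.* j ℕ.+ 1)) z≈z′))))

  euler-double : ∀ K z → euler 1# K z * euler (- 1#) K z ≈ euler 1# K (z * z)
  euler-double K z = begin
    euler 1# K z * euler (- 1#) K z
      ≈⟨ ∏-* K _ _ ⟨
    ∏ K (λ i → (1# - 1# * z ^ suc i) * (1# - (- 1#) * z ^ suc i))
      ≈⟨ ∏-cong K (λ i → trans
           (solve 1 (λ x → (:1 :- :1 :* x) :* (:1 :- (:- :1) :* x) := :1 :- :1 :* (x :* x)) refl (z ^ suc i))
           (+-congˡ (-‿cong (*-congˡ (sym (^-distrib-* z z (suc i))))))) ⟩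
    euler 1# K (z * z) ∎

  euler-cong : ∀ c K {z z′} → z ≈ z′ → euler c K z ≈ euler c K z′
  euler-cong c K z≈z′ = ∏-cong K (λ i → +-congˡ (-‿cong (*-congˡ (^-congˡ (suc i) z≈z′))))

  module _ (k : ℕ) {z : Carrier} (z^K≈0 : IsNilpotent (suc k) z) where
    private
      open module T = Truncated R z k z^K≈0 using (K; minusFactor; plusFactor)

    euler-invertible : ∀ c → Invertible (euler c K z)
    euler-invertible c = Invertible-∏ K (T.minusFactor-invertible c)

    euler-stable : ∀ c {n} → K ℕ.≤ n → euler c n z ≈ euler c K z
    euler-stable c = ∏-extend (minusFactor c) (λ i K≤i → T.minusFactor-stable c i (ℕₚ.<⇒≤ K≤i))

    theta*euler : thetaAt K z * euler (- 1#) K z ≈ euler 1# K z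
    theta*euler = trans (*-congˡ (∏-cong K (λ i → sym (T.plusFactor≈minusFactor i)))) T.gauss

  module TriSection (q : Carrier) (k : ℕ) (q^K≈0 : IsNilpotent (suc k) q) where
    private
      K = suc k

      -- thetaTerm q at 3i and at 3i + 1, up to sign
      lowTerm highTerm : ℕ → Carrier
      lowTerm i = sign i * q ^ (suc (i ℕ.* 3 ℕ.+ 0) ℕ.* suc (i ℕ.* 3 ℕ.+ 0))
      highTerm i = sign (suc i) * (q * (q ^ 3) ^ (suc i ℕ.* (3 ℕ.* i ℕ.+ 1)))

      sign-block : ∀ i r → sign (suc (i ℕ.* 3 ℕ.+ r)) ≈ sign i * sign (suc r)
      sign-block i r = begin
        sign (suc (i ℕ.* 3 ℕ.+ r))      ≡⟨ ≡.cong sign (ℕₚ.+-suc (i ℕ.* 3) r) ⟨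
        sign (i ℕ.* 3 ℕ.+ suc r)        ≈⟨ sign-+ (i ℕ.* 3) (suc r) ⟩
        sign (i ℕ.* 3) * sign (suc r)   ≈⟨ *-congʳ (sign-*3 i) ⟩
        sign i * sign (suc r)           ∎

      q*cube-power : ∀ n {m} → suc (3 ℕ.* n) ≡ m → q * (q ^ 3) ^ n ≈ q ^ m
      q*cube-power n 1+3n≡m = trans (*-congˡ (^-assocʳ q 3 n)) (reflexive (≡.cong (q ^_) 1+3n≡m))

      thetaTerm-low : ∀ i → thetaTerm q (i ℕ.* 3 ℕ.+ 0) ≈ - lowTerm i
      thetaTerm-low i = trans (*-congʳ (sign-block i 0)) (solve 2 (λ s x → s :* (:- :1 :* :1) :* x := :- (s :* x)) refl _ _)

      thetaTerm-high : ∀ i → thetaTerm q (i ℕ.* 3 ℕ.+ 1) ≈ - highTerm i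
      thetaTerm-high i = trans (*-cong (sign-block i 1) (sym (q*cube-power (suc i ℕ.* (3 ℕ.* i ℕ.+ 1)) (exponent i))))
        (solve 2 (λ s x → s :* (:- :1 :* (:- :1 :* :1)) :* x := :- ((:- :1 :* s) :* x)) refl _ _)
        where
        exponent : ∀ i → suc (3 ℕ.* (suc i ℕ.* (3 ℕ.* i ℕ.+ 1))) ≡ suc (i ℕ.* 3 ℕ.+ 1) ℕ.* suc (i ℕ.* 3 ℕ.+ 1)
        exponent = ℕ-solve-∀

      thetaTerm-multiple : ∀ i → thetaTerm q (i ℕ.* 3 ℕ.+ 2) ≈ thetaTerm (q ^ 9) i
      thetaTerm-multiple i = *-cong
        (trans (sign-block i 2) (solve 1 (λ s → s :* (:- :1 :* (:- :1 :* (:- :1 :* :1))) := :- :1 :* s) refl (sign i)))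
        (trans (reflexive (≡.cong (q ^_) (exponent i))) (sym (^-assocʳ q 9 (suc i ℕ.* suc i))))
        where
        exponent : ∀ i → suc (i ℕ.* 3 ℕ.+ 2) ℕ.* suc (i ℕ.* 3 ℕ.+ 2) ≡ 9 ℕ.* (suc i ℕ.* suc i)
        exponent = ℕ-solve-∀

      lowTerm-sum : ∑ K lowTerm ≈ q + ∑ K (lowTerm ∘ suc)
      lowTerm-sum = begin
        ∑ K lowTerm                      ≈⟨ ∑-extend lowTerm lowTerm≈0 (ℕₚ.n≤1+n K) ⟨
        ∑ (suc K) lowTerm                ≈⟨ ∑-head K lowTerm ⟩
        lowTerm 0 + ∑ K (lowTerm ∘ suc)  ≈⟨ +-congʳ (solve 1 (λ q → :1 :* (q :* :1) := q) refl q) ⟩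
        q + ∑ K (lowTerm ∘ suc)          ∎
        where
        lowTerm≈0 : ∀ i → K ℕ.≤ i → lowTerm i ≈ 0#
        lowTerm≈0 i K≤i = *-vanishʳ _ (IsNilpotent-^ q^K≈0 (ℕₚ.≤-trans K≤i (ℕₚ.≤-trans i≤3i+1 (ℕₚ.m≤m*n n n))))
          where
          n = suc (i ℕ.* 3 ℕ.+ 0)
          i≤3i+1 : i ℕ.≤ n
          i≤3i+1 = ℕₚ.m≤n⇒m≤1+n (ℕₚ.≤-trans (ℕₚ.m≤m*n i 3) (ℕₚ.m≤m+n (i ℕ.* 3) 0))

      octagonalTerm-terms : ∀ j → q * octagonalTerm (q ^ 3) j ≈ lowTerm (suc j) + highTerm j
      octagonalTerm-terms j = trans
        (solve 4 (λ q s x y → q :* (s :* x :+ s :* y) := s :* (q :* x) :+ s :* (q :* y)) refl q (sign (suc j)) _ _)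
        (+-congʳ (*-congˡ (q*cube-power (suc j ℕ.* (3 ℕ.* suc j ℕ.+ 2)) (exponent j))))
        where
        exponent : ∀ j → suc (3 ℕ.* (suc j ℕ.* (3 ℕ.* suc j ℕ.+ 2))) ≡ suc (suc j ℕ.* 3 ℕ.+ 0) ℕ.* suc (suc j ℕ.* 3 ℕ.+ 0)
        exponent = ℕ-solve-∀

      octagonalAt-terms : q * octagonalAt K (q ^ 3) ≈ q + (∑ K (lowTerm ∘ suc) + ∑ K highTerm)
      octagonalAt-terms = begin
        q * octagonalAt K (q ^ 3)                       ≈⟨ distribˡ q _ _ ⟩
        q * 1# + q * ∑ K (octagonalTerm (q ^ 3))        ≈⟨ +-cong (*-identityʳ q) (sym (∑-*ˡ K q _)) ⟩
        q + ∑ K (λ j → q * octagonalTerm (q ^ 3) j)     ≈⟨ +-congˡ (trans (∑-cong K octagonalTerm-terms) (∑-+ K _ _)) ⟩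
        q + (∑ K (lowTerm ∘ suc) + ∑ K highTerm)        ∎

    thetaAt-trisection : thetaAt K q ≈ thetaAt K (q ^ 9) - 2# * (q * octagonalAt K (q ^ 3))
    thetaAt-trisection = begin
      1# + 2# * ∑ K (thetaTerm q)
        ≈⟨ +-congˡ (*-congˡ (∑-extend (thetaTerm q) thetaTerm≈0 (ℕₚ.m≤m*n K 3))) ⟨
      1# + 2# * ∑ (K ℕ.* 3) (thetaTerm q)
        ≈⟨ +-congˡ (*-congˡ (trans (∑-blocks 3 K _) (∑-cong K (λ i →
             +-cong (+-cong (trans (+-identityˡ _) (thetaTerm-low i)) (thetaTerm-high i)) (thetaTerm-multiple i))))) ⟩
      1# + 2# * ∑ K (λ i → - lowTerm i + - highTerm i + thetaTerm (q ^ 9) i)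
        ≈⟨ +-congˡ (*-congˡ (trans (∑-+ K _ _) (+-congʳ (trans (∑-+ K _ _)
             (+-cong (trans (∑-neg K _) (-‿cong lowTerm-sum)) (∑-neg K _)))))) ⟩
      1# + 2# * (- (q + ∑ K (lowTerm ∘ suc)) + - ∑ K highTerm + ∑ K (thetaTerm (q ^ 9)))
        ≈⟨ solve 4 (λ q a b g → :1 :+ :2 :* (:- (q :+ a) :+ :- b :+ g) := (:1 :+ :2 :* g) :- :2 :* (q :+ (a :+ b))) refl q _ _ _ ⟩
      thetaAt K (q ^ 9) - 2# * (q + (∑ K (lowTerm ∘ suc) + ∑ K highTerm))
        ≈⟨ +-congˡ (-‿cong (*-congˡ octagonalAt-terms)) ⟨
      thetaAt K (q ^ 9) - 2# * (q * octagonalAt K (q ^ 3)) ∎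
      where
      thetaTerm≈0 : ∀ r → K ℕ.≤ r → thetaTerm q r ≈ 0#
      thetaTerm≈0 r K≤r = *-vanishʳ _ (IsNilpotent-^ q^K≈0 (ℕₚ.≤-trans (ℕₚ.m≤n⇒m≤1+n K≤r) (ℕₚ.m≤m*n (suc r) (suc r))))

-- The product of θ over the three values ω^i q, ω³ = 1
module ThetaNorm (R : CommutativeRing 0ℓ 0ℓ) (q ω : CommutativeRing.Carrier R) (k : ℕ)
  (q^K≈0 : RingCalculus.IsNilpotent R (suc k) q) (ω²+ω+1≈0 : RingCalculus.IsPrimitiveCubeRoot R ω) where
  open RingCalculus R
  open ThetaSeries R
  private
    K = suc k

  conjugateFactor : Carrier → ℕ → Carrier
  conjugateFactor c i = (1# - c * q ^ suc i) * (1# - c * (ω * q) ^ suc i) * (1# - c * ((ω * ω) * q) ^ suc i)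

  conjugateFactor-expand : ∀ c i {o} → ω ^ suc i ≈ o → let x = c * q ^ suc i in
    conjugateFactor c i ≈ (1# - x) * (1# - o * x) * (1# - o * o * x)
  conjugateFactor-expand c i {o} ω^n≈o = *-cong (*-congˡ (factor ω^n≈o)) (factor (trans (^-distrib-* ω ω n) (*-cong ω^n≈o ω^n≈o)))
    where
    n = suc i
    factor : ∀ {a p} → a ^ n ≈ p → 1# - c * (a * q) ^ n ≈ 1# - p * (c * q ^ n)
    factor {a} {p} a^n≈p = +-congˡ (-‿cong (begin
      c * (a * q) ^ n      ≈⟨ *-congˡ (trans (^-distrib-* a q n) (*-congʳ a^n≈p)) ⟩
      c * (p * q ^ n)      ≈⟨ solve 3 (λ c p z → c :* (p :* z) := p :* (c :* z)) refl c p (q ^ n) ⟩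
      p * (c * q ^ n)      ∎))

  1-x³ : ∀ {o} → IsPrimitiveCubeRoot o → ∀ x → (1# - x) * (1# - o * x) * (1# - o * o * x) ≈ 1# - x * x * x
  1-x³ {o} o²+o+1≈0 x = begin
    (1# - x) * (1# - o * x) * (1# - o * o * x)
      ≈⟨ solve 2 (λ x o → (:1 :- x) :* (:1 :- o :* x) :* (:1 :- o :* o :* x) := (:1 :- x :* x :* x)
           :+ (o :* o :+ o :+ :1) :* (:- x :+ x :* x :* o :- x :* x :* x :* (o :- :1))) refl x o ⟩
    (1# - x * x * x) + (o * o + o + 1#) * _
      ≈⟨ +-absorbs-≈0 o²+o+1≈0 _ _ ⟩
    1# - x * x * x ∎

  ω-power : ∀ i r → ω ^ (i ℕ.* 3 ℕ.+ r) ≈ ω ^ r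
  ω-power i r = begin
    ω ^ (i ℕ.* 3 ℕ.+ r)        ≈⟨ ^-homo-* ω (i ℕ.* 3) r ⟩
    ω ^ (i ℕ.* 3) * ω ^ r      ≡⟨ ≡.cong (λ n → ω ^ n * ω ^ r) (ℕₚ.*-comm i 3) ⟩
    ω ^ (3 ℕ.* i) * ω ^ r      ≈⟨ *-congʳ (trans (sym (^-assocʳ ω 3 i)) (trans (^-congˡ i (cubeRoot³≈1 ω²+ω+1≈0)) (1^n≈1 i))) ⟩
    1# * ω ^ r                 ≈⟨ *-identityˡ _ ⟩
    ω ^ r                      ∎

  ω²-primitive : IsPrimitiveCubeRoot (ω * ω)
  ω²-primitive = begin
    ω * ω * (ω * ω) + ω * ω + 1#
      ≈⟨ solve 1 (λ w → w :* w :* (w :* w) :+ w :* w :+ :1 := :0 :+ (w :* w :+ w :+ :1) :* (w :* w :- w :+ :1)) refl ω ⟩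
    0# + (ω * ω + ω + 1#) * (ω * ω - ω + 1#)
      ≈⟨ +-absorbs-≈0 ω²+ω+1≈0 _ _ ⟩
    0# ∎

  module _ (c : Carrier) (c³≈c : c * c * c ≈ c) where

    cubeFactor : ℕ → Carrier
    cubeFactor i = 1# - c * (q ^ 3) ^ suc i

    private
      cubeFactor-primitive : ∀ i {o} → IsPrimitiveCubeRoot o → ω ^ suc i ≈ o → conjugateFactor c i ≈ cubeFactor i
      cubeFactor-primitive i {o} o-primitive ω^n≈o = begin
        conjugateFactor c i                          ≈⟨ conjugateFactor-expand c i ω^n≈o ⟩
        (1# - x) * (1# - o * x) * (1# - o * o * x)   ≈⟨ 1-x³ o-primitive x ⟩
        1# - x * x * x                               ≈⟨ +-congˡ (-‿cong cube) ⟩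
        cubeFactor i                                 ∎
        where
        x = c * q ^ suc i
        cube : x * x * x ≈ c * (q ^ 3) ^ suc i
        cube = begin
          x * x * x
            ≈⟨ solve 2 (λ c z → (c :* z) :* (c :* z) :* (c :* z) := (c :* c :* c) :* (z :* (z :* (z :* :1)))) refl c (q ^ suc i) ⟩
          (c * c * c) * (q ^ suc i) ^ 3    ≈⟨ *-cong c³≈c (^-assocʳ q (suc i) 3) ⟩
          c * q ^ (suc i ℕ.* 3)            ≡⟨ ≡.cong (λ n → c * q ^ n) (ℕₚ.*-comm (suc i) 3) ⟩
          c * q ^ (3 ℕ.* suc i)            ≈⟨ *-congˡ (^-assocʳ q 3 (suc i)) ⟨
          c * (q ^ 3) ^ suc i              ∎

      conjugateFactor-0 : ∀ i → conjugateFactor c (i ℕ.* 3 ℕ.+ 0) ≈ cubeFactor (i ℕ.* 3 ℕ.+ 0)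
      conjugateFactor-0 i = cubeFactor-primitive (i ℕ.* 3 ℕ.+ 0) ω²+ω+1≈0
        (trans (reflexive (≡.cong (ω ^_) (≡.sym (ℕₚ.+-suc (i ℕ.* 3) 0)))) (trans (ω-power i 1) (*-identityʳ ω)))

      conjugateFactor-1 : ∀ i → conjugateFactor c (i ℕ.* 3 ℕ.+ 1) ≈ cubeFactor (i ℕ.* 3 ℕ.+ 1)
      conjugateFactor-1 i = cubeFactor-primitive (i ℕ.* 3 ℕ.+ 1) ω²-primitive
        (trans (reflexive (≡.cong (ω ^_) (≡.sym (ℕₚ.+-suc (i ℕ.* 3) 1)))) (trans (ω-power i 2) (*-congˡ (*-identityʳ ω))))

      conjugateFactor-2 : ∀ i → conjugateFactor c (i ℕ.* 3 ℕ.+ 2) ≈ cubeFactor i * cubeFactor i * cubeFactor i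
      conjugateFactor-2 i = begin
        conjugateFactor c n                             ≈⟨ conjugateFactor-expand c n ω^[3i+3]≈1 ⟩
        (1# - x) * (1# - 1# * x) * (1# - 1# * 1# * x)
          ≈⟨ solve 1 (λ x → (:1 :- x) :* (:1 :- :1 :* x) :* (:1 :- :1 :* :1 :* x) := (:1 :- x) :* (:1 :- x) :* (:1 :- x)) refl x ⟩
        (1# - x) * (1# - x) * (1# - x)                  ≈⟨ *-cong (*-cong 1-x 1-x) 1-x ⟩
        cubeFactor i * cubeFactor i * cubeFactor i      ∎
        where
        n = i ℕ.* 3 ℕ.+ 2
        x = c * q ^ suc n
        exponent : ∀ i → suc (i ℕ.* 3 ℕ.+ 2) ≡ 3 ℕ.* suc i
        exponent = ℕ-solve-∀
        ω^[3i+3]≈1 : ω ^ suc n ≈ 1#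
        ω^[3i+3]≈1 = trans (reflexive (≡.cong (ω ^_) (≡.sym (ℕₚ.+-suc (i ℕ.* 3) 2)))) (trans (ω-power i 3) (cubeRoot³≈1 ω²+ω+1≈0))
        1-x : 1# - x ≈ cubeFactor i
        1-x = +-congˡ (-‿cong (*-congˡ (trans (reflexive (≡.cong (q ^_) (exponent i))) (sym (^-assocʳ q 3 (suc i))))))

      ninthFactor : ∀ i → 1# - c * (q ^ 9) ^ suc i ≈ cubeFactor (i ℕ.* 3 ℕ.+ 2)
      ninthFactor i = +-congˡ (-‿cong (*-congˡ (begin
        (q ^ 9) ^ suc i                       ≈⟨ ^-assocʳ q 9 (suc i) ⟩
        q ^ (9 ℕ.* suc i)                     ≡⟨ ≡.cong (q ^_) (exponent i) ⟩
        q ^ (3 ℕ.* suc (i ℕ.* 3 ℕ.+ 2))       ≈⟨ ^-assocʳ q 3 (suc (i ℕ.* 3 ℕ.+ 2)) ⟨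
        (q ^ 3) ^ suc (i ℕ.* 3 ℕ.+ 2)         ∎)))
        where
        exponent : ∀ i → 9 ℕ.* suc i ≡ 3 ℕ.* suc (i ℕ.* 3 ℕ.+ 2)
        exponent = ℕ-solve-∀

    conjugateFactor-stable : ∏ (K ℕ.* 3) (conjugateFactor c) ≈ euler c K q * euler c K (ω * q) * euler c K ((ω * ω) * q)
    conjugateFactor-stable = begin
      ∏ (K ℕ.* 3) (conjugateFactor c)
        ≈⟨ trans (∏-* (K ℕ.* 3) _ _) (*-congʳ (∏-* (K ℕ.* 3) _ _)) ⟩
      euler c (K ℕ.* 3) q * euler c (K ℕ.* 3) (ω * q) * euler c (K ℕ.* 3) ((ω * ω) * q)
        ≈⟨ *-cong (*-cong (stable q^K≈0) (stable (IsNilpotent-scale {K} q^K≈0 ω))) (stable (IsNilpotent-scale {K} q^K≈0 (ω * ω))) ⟩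
      euler c K q * euler c K (ω * q) * euler c K ((ω * ω) * q) ∎
      where
      stable : ∀ {z} → IsNilpotent K z → euler c (K ℕ.* 3) z ≈ euler c K z
      stable z^K≈0 = euler-stable k z^K≈0 c (ℕₚ.m≤m*n K 3)

    euler-norm : euler c K q * euler c K (ω * q) * euler c K ((ω * ω) * q) * euler c K (q ^ 9)
      ≈ euler c K (q ^ 3) * (euler c K (q ^ 3) * euler c K (q ^ 3) * euler c K (q ^ 3))
    euler-norm = begin
      euler c K q * euler c K (ω * q) * euler c K ((ω * ω) * q) * euler c K (q ^ 9)
        ≈⟨ *-congʳ (sym conjugateFactor-stable) ⟩
      ∏ (K ℕ.* 3) (conjugateFactor c) * euler c K (q ^ 9)
        ≈⟨ *-cong (∏-blocks 3 K (conjugateFactor c)) (∏-cong K ninthFactor) ⟩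
      ∏ K (λ i → ∏ 3 (λ r → conjugateFactor c (i ℕ.* 3 ℕ.+ r))) * ∏ K (λ i → cubeFactor (i ℕ.* 3 ℕ.+ 2))
        ≈⟨ ∏-* K _ _ ⟨
      ∏ K (λ i → ∏ 3 (λ r → conjugateFactor c (i ℕ.* 3 ℕ.+ r)) * cubeFactor (i ℕ.* 3 ℕ.+ 2))
        ≈⟨ ∏-cong K (λ i → trans
             (*-congʳ (*-cong (*-cong (*-congˡ (conjugateFactor-0 i)) (conjugateFactor-1 i)) (conjugateFactor-2 i)))
             (solve 4 (λ a b c x → :1 :* a :* b :* (c :* c :* c) :* x := (:1 :* a :* b :* x) :* (c :* c :* c)) refl _ _ _ _)) ⟩
      ∏ K (λ i → ∏ 3 (λ r → cubeFactor (i ℕ.* 3 ℕ.+ r)) * (cubeFactor i * cubeFactor i * cubeFactor i))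
        ≈⟨ trans (∏-* K _ _) (*-congˡ (trans (∏-* K _ _) (*-congʳ (∏-* K _ _)))) ⟩
      ∏ K (λ i → ∏ 3 (λ r → cubeFactor (i ℕ.* 3 ℕ.+ r))) * (euler c K (q ^ 3) * euler c K (q ^ 3) * euler c K (q ^ 3))
        ≈⟨ *-congʳ (trans (sym (∏-blocks 3 K cubeFactor)) (euler-stable k (IsNilpotent-power {K} q^K≈0 2) c (ℕₚ.m≤m*n K 3))) ⟩
      euler c K (q ^ 3) * (euler c K (q ^ 3) * euler c K (q ^ 3) * euler c K (q ^ 3)) ∎

  thetaAt-norm : let t = thetaAt K (q ^ 3) in
    thetaAt K q * thetaAt K (ω * q) * thetaAt K ((ω * ω) * q) * thetaAt K (q ^ 9) ≈ t * (t * t * t)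
  thetaAt-norm = Invertible-cancelˡ
    (Invertible-* (Invertible-* (Invertible-* (euler-invertible k q^K≈0 (- 1#)) (euler-invertible k ωq-nil (- 1#)))
        (euler-invertible k ω²q-nil (- 1#)))
      (euler-invertible k q⁹-nil (- 1#))) (begin
    e₀ * e₁ * e₂ * e₉ * (thetaAt K q * thetaAt K (ω * q) * thetaAt K ((ω * ω) * q) * thetaAt K (q ^ 9))
      ≈⟨ solve 8 (λ a b c d x y z w → a :* b :* c :* d :* (x :* y :* z :* w) := (x :* a) :* (y :* b) :* (z :* c) :* (w :* d)) refl
           e₀ e₁ e₂ e₉ (thetaAt K q) (thetaAt K (ω * q)) (thetaAt K ((ω * ω) * q)) (thetaAt K (q ^ 9)) ⟩
    (thetaAt K q * e₀) * (thetaAt K (ω * q) * e₁) * (thetaAt K ((ω * ω) * q) * e₂) * (thetaAt K (q ^ 9) * e₉)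
      ≈⟨ *-cong (*-cong (*-cong (theta*euler k q^K≈0) (theta*euler k ωq-nil)) (theta*euler k ω²q-nil)) (theta*euler k q⁹-nil) ⟩
    euler 1# K q * euler 1# K (ω * q) * euler 1# K ((ω * ω) * q) * euler 1# K (q ^ 9)
      ≈⟨ euler-norm 1# (solve 0 (:1 :* :1 :* :1 := :1) refl) ⟩
    d₃ * (d₃ * d₃ * d₃)
      ≈⟨ *-cong factored (*-cong (*-cong factored factored) factored) ⟩
    (t * e₃) * ((t * e₃) * (t * e₃) * (t * e₃))
      ≈⟨ solve 2 (λ t e → (t :* e) :* ((t :* e) :* (t :* e) :* (t :* e)) := (e :* (e :* e :* e)) :* (t :* (t :* t :* t))) refl t e₃ ⟩
    (e₃ * (e₃ * e₃ * e₃)) * (t * (t * t * t))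
      ≈⟨ *-congʳ (euler-norm (- 1#) (solve 0 ((:- :1) :* (:- :1) :* (:- :1) := :- :1) refl)) ⟨
    e₀ * e₁ * e₂ * e₉ * (t * (t * t * t)) ∎)
    where
    e₀ = euler (- 1#) K q
    e₁ = euler (- 1#) K (ω * q)
    e₂ = euler (- 1#) K ((ω * ω) * q)
    e₃ = euler (- 1#) K (q ^ 3)
    e₉ = euler (- 1#) K (q ^ 9)
    d₃ = euler 1# K (q ^ 3)
    t = thetaAt K (q ^ 3)
    ωq-nil : IsNilpotent K (ω * q)
    ωq-nil = IsNilpotent-scale {K} q^K≈0 ω
    ω²q-nil : IsNilpotent K ((ω * ω) * q)
    ω²q-nil = IsNilpotent-scale {K} q^K≈0 (ω * ω)
    q⁹-nil : IsNilpotent K (q ^ 9)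
    q⁹-nil = IsNilpotent-power {K} q^K≈0 8
    factored : d₃ ≈ t * e₃
    factored = sym (theta*euler k (IsNilpotent-power {K} q^K≈0 2))

  private
    a b : Carrier
    a = thetaAt K (q ^ 9)
    b = - (2# * (q * octagonalAt K (q ^ 3)))

    thetaAt-scaled : ∀ c → c ^ 3 ≈ 1# → thetaAt K (c * q) ≈ a + c * b
    thetaAt-scaled c c³≈1 = begin
      thetaAt K (c * q)
        ≈⟨ TriSection.thetaAt-trisection (c * q) k (IsNilpotent-scale {K} q^K≈0 c) ⟩
      thetaAt K ((c * q) ^ 9) - 2# * (c * q * octagonalAt K ((c * q) ^ 3))
        ≈⟨ +-cong (thetaAt-cong K (unscale 9 c⁹≈1)) (-‿cong (*-congˡ (*-congˡ (octagonalAt-cong K (unscale 3 c³≈1))))) ⟩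
      a - 2# * (c * q * octagonalAt K (q ^ 3))
        ≈⟨ +-congˡ (solve 3 (λ c q b → :- (:2 :* (c :* q :* b)) := c :* (:- (:2 :* (q :* b)))) refl c q _) ⟩
      a + c * b ∎
      where
      c⁹≈1 : c ^ 9 ≈ 1#
      c⁹≈1 = trans (sym (^-assocʳ c 3 3)) (trans (^-congˡ 3 c³≈1) (1^n≈1 3))
      unscale : ∀ n → c ^ n ≈ 1# → (c * q) ^ n ≈ q ^ n
      unscale n c^n≈1 = trans (^-distrib-* c q n) (trans (*-congʳ c^n≈1) (*-identityˡ _))

  theta-octagonal-norm : (a * a * a + b * b * b) * a ≈ let t = thetaAt K (q ^ 3) in t * (t * t * t)
  theta-octagonal-norm = trans (*-congʳ (begin
    a * a * a + b * b * b
      ≈⟨ +-absorbs-≈0 ω²+ω+1≈0 _ _ ⟨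
    (a * a * a + b * b * b) + (ω * ω + ω + 1#) * (a * a * b + ω * a * b * b + (ω - 1#) * b * b * b)
      ≈⟨ solve 3 (λ w a b → (a :* a :* a :+ b :* b :* b)
                       :+ (w :* w :+ w :+ :1) :* (a :* a :* b :+ w :* a :* b :* b :+ (w :- :1) :* b :* b :* b)
           := (a :+ b) :* (a :+ w :* b) :* (a :+ w :* w :* b)) refl ω a b ⟩
    (a + b) * (a + ω * b) * (a + ω * ω * b)
      ≈⟨ *-cong (*-cong (TriSection.thetaAt-trisection q k q^K≈0) (thetaAt-scaled ω ω³≈1)) (thetaAt-scaled (ω * ω) ω⁶≈1) ⟨
    thetaAt K q * thetaAt K (ω * q) * thetaAt K ((ω * ω) * q) ∎)) thetaAt-norm
    where
    ω³≈1 : ω ^ 3 ≈ 1#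
    ω³≈1 = cubeRoot³≈1 ω²+ω+1≈0
    ω⁶≈1 : (ω * ω) ^ 3 ≈ 1#
    ω⁶≈1 = cubeRoot³≈1 ω²-primitive

-- Σ_{n∈ℤ} (−1)ⁿ q^{3n²+2n} as a product: the triple product with base q⁶
module OctagonalProduct (R : CommutativeRing 0ℓ 0ℓ) (q : CommutativeRing.Carrier R) (k : ℕ)
  (q^K≈0 : RingCalculus.IsNilpotent R (suc k) q) where
  open RingCalculus R
  open ThetaSeries R
  private
    K M : ℕ
    K = suc k
    M = K ℕ.+ K

    power^K≈0 : ∀ b → IsNilpotent K (q ^ suc b)
    power^K≈0 = IsNilpotent-power {K} q^K≈0

  factor : ℕ → Carrier
  factor n = 1# - 1# * q ^ n

  factor-stable : ∀ {n} → K ℕ.≤ n → factor n ≈ 1#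
  factor-stable K≤n = trans (+-congˡ (-‿cong (*-vanishʳ 1# (IsNilpotent-^ q^K≈0 K≤n)))) (solve 0 (:1 :- :0 := :1) refl)

  modSix : ℕ → Carrier
  modSix r = ∏ M (λ i → factor (suc (i ℕ.* 6 ℕ.+ r)))

  modSix-invertible : ∀ r → Invertible (modSix r)
  modSix-invertible r = Invertible-∏ M (λ i → Truncated.minusFactor-invertible R q k q^K≈0 1# (i ℕ.* 6 ℕ.+ r))

  euler-multiples : ∀ b m → euler 1# K (q ^ suc b) ≈ ∏ (M ℕ.* suc m) (λ i → factor (suc b ℕ.* suc i))
  euler-multiples b m = begin
    euler 1# K (q ^ suc b)
      ≈⟨ ∏-cong K (λ i → +-congˡ (-‿cong (*-congˡ (^-assocʳ q (suc b) (suc i))))) ⟩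
    ∏ K (λ i → factor (suc b ℕ.* suc i))
      ≈⟨ ∏-extend _ (λ i K≤i → factor-stable (ℕₚ.≤-trans (ℕₚ.m≤n⇒m≤1+n K≤i) (ℕₚ.m≤n*m (suc i) (suc b)))) K≤ ⟨
    ∏ (M ℕ.* suc m) (λ i → factor (suc b ℕ.* suc i)) ∎
    where
    K≤ : K ℕ.≤ M ℕ.* suc m
    K≤ = ℕₚ.≤-trans (ℕₚ.m≤m+n K K) (ℕₚ.m≤m*n M (suc m))

  private
    residueFactor : ℕ → ℕ → Carrier
    residueFactor r i = factor (suc (i ℕ.* 6 ℕ.+ r))

  euler₁ : euler 1# K q ≈ modSix 0 * modSix 1 * modSix 2 * modSix 3 * modSix 4 * modSix 5
  euler₁ = begin
    euler 1# K q
      ≈⟨ trans (euler-cong 1# K (sym (*-identityʳ q))) (euler-multiples 0 5) ⟩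
    ∏ (M ℕ.* 6) (λ i → factor (1 ℕ.* suc i))
      ≈⟨ ∏-blocks 6 M _ ⟩
    ∏ M (λ i → ∏ 6 (λ r → factor (1 ℕ.* suc (i ℕ.* 6 ℕ.+ r))))
      ≈⟨ ∏-cong M (λ i → trans
           (∏-cong 6 (λ r → reflexive (≡.cong factor (ℕₚ.*-identityˡ (suc (i ℕ.* 6 ℕ.+ r))))))
           (solve 6 (λ a b c d e f → :1 :* a :* b :* c :* d :* e :* f := a :* b :* c :* d :* e :* f) refl _ _ _ _ _ _)) ⟩
    ∏ M (λ i → G 0 i * G 1 i * G 2 i * G 3 i * G 4 i * G 5 i)
      ≈⟨ trans (∏-* M _ _) (*-congʳ (trans (∏-* M _ _) (*-congʳ (trans (∏-* M _ _) (*-congʳ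
           (trans (∏-* M _ _) (*-congʳ (∏-* M _ _)))))))) ⟩
    modSix 0 * modSix 1 * modSix 2 * modSix 3 * modSix 4 * modSix 5 ∎
    where G = residueFactor

  euler₂ : euler 1# K (q ^ 2) ≈ modSix 1 * modSix 3 * modSix 5
  euler₂ = begin
    euler 1# K (q ^ 2)
      ≈⟨ euler-multiples 1 2 ⟩
    ∏ (M ℕ.* 3) (λ i → factor (2 ℕ.* suc i))
      ≈⟨ ∏-blocks 3 M _ ⟩
    ∏ M (λ i → ∏ 3 (λ r → factor (2 ℕ.* suc (i ℕ.* 3 ℕ.+ r))))
      ≈⟨ ∏-cong M (λ i → trans (∏-cong 3 (λ r → reflexive (≡.cong factor (index i r))))
           (solve 3 (λ a b c → :1 :* a :* b :* c := a :* b :* c) refl _ _ _)) ⟩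
    ∏ M (λ i → G 1 i * G 3 i * G 5 i)
      ≈⟨ trans (∏-* M _ _) (*-congʳ (∏-* M _ _)) ⟩
    modSix 1 * modSix 3 * modSix 5 ∎
    where
    G = residueFactor
    index : ∀ i r → 2 ℕ.* suc (i ℕ.* 3 ℕ.+ r) ≡ suc (i ℕ.* 6 ℕ.+ (1 ℕ.+ 2 ℕ.* r))
    index = ℕ-solve-∀

  euler₃ : euler 1# K (q ^ 3) ≈ modSix 2 * modSix 5
  euler₃ = begin
    euler 1# K (q ^ 3)
      ≈⟨ euler-multiples 2 1 ⟩
    ∏ (M ℕ.* 2) (λ i → factor (3 ℕ.* suc i))
      ≈⟨ ∏-blocks 2 M _ ⟩
    ∏ M (λ i → ∏ 2 (λ r → factor (3 ℕ.* suc (i ℕ.* 2 ℕ.+ r))))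
      ≈⟨ ∏-cong M (λ i → trans (∏-cong 2 (λ r → reflexive (≡.cong factor (index i r))))
           (solve 2 (λ a b → :1 :* a :* b := a :* b) refl _ _)) ⟩
    ∏ M (λ i → residueFactor 2 i * residueFactor 5 i)
      ≈⟨ ∏-* M _ _ ⟩
    modSix 2 * modSix 5 ∎
    where
    index : ∀ i r → 3 ℕ.* suc (i ℕ.* 2 ℕ.+ r) ≡ suc (i ℕ.* 6 ℕ.+ (2 ℕ.+ 3 ℕ.* r))
    index = ℕ-solve-∀

  euler₆ : euler 1# K (q ^ 6) ≈ modSix 5
  euler₆ = begin
    euler 1# K (q ^ 6)                         ≈⟨ euler-multiples 5 0 ⟩
    ∏ (M ℕ.* 1) (λ i → factor (6 ℕ.* suc i))   ≡⟨ ≡.cong (λ m → ∏ m (λ i → factor (6 ℕ.* suc i))) (ℕₚ.*-identityʳ M) ⟩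
    ∏ M (λ i → factor (6 ℕ.* suc i))           ≈⟨ ∏-cong M (λ i → reflexive (≡.cong factor (index i))) ⟩
    modSix 5                                   ∎
    where
    index : ∀ i → 6 ℕ.* suc i ≡ suc (i ℕ.* 6 ℕ.+ 5)
    index = ℕ-solve-∀

  odd*euler⁻₁ : (modSix 0 * modSix 4) * modSix 2 * euler (- 1#) K q ≈ 1#
  odd*euler⁻₁ = Invertible-cancelˡ (Invertible-* (Invertible-* (modSix-invertible 1) (modSix-invertible 3)) (modSix-invertible 5)) (begin
    modSix 1 * modSix 3 * modSix 5 * ((modSix 0 * modSix 4) * modSix 2 * euler (- 1#) K q)
      ≈⟨ solve 7 (λ a b c d e f p → b :* d :* f :* ((a :* e) :* c :* p) := a :* b :* c :* d :* e :* f :* p) refl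
           (modSix 0) (modSix 1) (modSix 2) (modSix 3) (modSix 4) (modSix 5) (euler (- 1#) K q) ⟩
    modSix 0 * modSix 1 * modSix 2 * modSix 3 * modSix 4 * modSix 5 * euler (- 1#) K q
      ≈⟨ *-congʳ euler₁ ⟨
    euler 1# K q * euler (- 1#) K q
      ≈⟨ trans (euler-double K q) (euler-cong 1# K (*-congˡ (sym (*-identityʳ q)))) ⟩
    euler 1# K (q ^ 2)
      ≈⟨ euler₂ ⟩
    modSix 1 * modSix 3 * modSix 5
      ≈⟨ *-identityʳ _ ⟨
    modSix 1 * modSix 3 * modSix 5 * 1# ∎)

  odd*euler⁻₃ : modSix 2 * euler (- 1#) K (q ^ 3) ≈ 1#
  odd*euler⁻₃ = Invertible-cancelˡ (modSix-invertible 5) (begin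
    modSix 5 * (modSix 2 * euler (- 1#) K (q ^ 3))   ≈⟨ solve 3 (λ a b p → a :* (b :* p) := b :* a :* p) refl _ _ _ ⟩
    modSix 2 * modSix 5 * euler (- 1#) K (q ^ 3)     ≈⟨ *-congʳ euler₃ ⟨
    euler 1# K (q ^ 3) * euler (- 1#) K (q ^ 3)      ≈⟨ trans (euler-double K (q ^ 3)) (euler-cong 1# K (sym (^-homo-* q 3 3))) ⟩
    euler 1# K (q ^ 6)                               ≈⟨ euler₆ ⟩
    modSix 5                                         ≈⟨ *-identityʳ _ ⟨
    modSix 5 * 1#                                    ∎)

  units*euler⁻₁ : (modSix 0 * modSix 4) * euler (- 1#) K q ≈ euler (- 1#) K (q ^ 3)
  units*euler⁻₁ = begin
    c * p                            ≈⟨ *-identityʳ _ ⟨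
    c * p * 1#                       ≈⟨ *-congˡ odd*euler⁻₃ ⟨
    c * p * (modSix 2 * p₃)          ≈⟨ solve 4 (λ c p z p₃ → c :* p :* (z :* p₃) := c :* z :* p :* p₃) refl c p (modSix 2) p₃ ⟩
    c * modSix 2 * p * p₃            ≈⟨ *-congʳ odd*euler⁻₁ ⟩
    1# * p₃                          ≈⟨ *-identityˡ _ ⟩
    p₃                               ∎
    where
    c = modSix 0 * modSix 4
    p = euler (- 1#) K q
    p₃ = euler (- 1#) K (q ^ 3)

  private
    module Triple = FiniteTripleProduct R (q ^ 5) (q ^ 1) (q ^ 6) (sym (^-homo-* q 5 1))

    qFactorial≈euler : Triple.qFactorial K ≈ euler 1# K (q ^ 6)
    qFactorial≈euler = ∏-cong K (λ i → +-congˡ (-‿cong (sym (*-identityˡ _))))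

    column : ∀ r → ∏ M (λ i → 1# - q ^ suc r * (q ^ 6) ^ i) ≈ modSix r
    column r = ∏-cong M (λ i → +-congˡ (-‿cong (begin
      q ^ suc r * (q ^ 6) ^ i          ≈⟨ *-congˡ (^-assocʳ q 6 i) ⟩
      q ^ suc r * q ^ (6 ℕ.* i)        ≈⟨ ^-homo-* q (suc r) (6 ℕ.* i) ⟨
      q ^ suc (r ℕ.+ 6 ℕ.* i)          ≡⟨ ≡.cong (q ^_) (index r i) ⟩
      q ^ suc (i ℕ.* 6 ℕ.+ r)          ≈⟨ *-identityˡ _ ⟨
      1# * q ^ suc (i ℕ.* 6 ℕ.+ r)     ∎)))
      where
      index : ∀ r i → suc (r ℕ.+ 6 ℕ.* i) ≡ suc (i ℕ.* 6 ℕ.+ r)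
      index = ℕ-solve-∀

    triangular-square : ∀ j → Triple.triangular j ℕ.+ Triple.triangular j ℕ.+ j ≡ j ℕ.* j
    triangular-square zero = ≡.refl
    triangular-square (suc j) = ≡.trans (regroup (Triple.triangular j) j)
      (≡.trans (≡.cong (ℕ._+ (1 ℕ.+ (j ℕ.+ j))) (triangular-square j)) (square-suc j))
      where
      regroup : ∀ t j → (t ℕ.+ j) ℕ.+ (t ℕ.+ j) ℕ.+ suc j ≡ (t ℕ.+ t ℕ.+ j) ℕ.+ (1 ℕ.+ (j ℕ.+ j))
      regroup = ℕ-solve-∀
      square-suc : ∀ j → j ℕ.* j ℕ.+ (1 ℕ.+ (j ℕ.+ j)) ≡ suc j ℕ.* suc j
      square-suc = ℕ-solve-∀

    tripleTerm : ∀ b n e → b ℕ.* n ℕ.+ 6 ℕ.* Triple.triangular n ≡ e →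
      (- (q ^ b)) ^ n * (q ^ 6) ^ Triple.triangular n ≈ sign n * q ^ e
    tripleTerm b n e exponent = begin
      (- (q ^ b)) ^ n * (q ^ 6) ^ t
        ≈⟨ *-cong (trans (^-congˡ n (sym (-1*x≈-x _))) (^-distrib-* (- 1#) (q ^ b) n)) (^-assocʳ q 6 t) ⟩
      sign n * (q ^ b) ^ n * q ^ (6 ℕ.* t)          ≈⟨ trans (*-assoc _ _ _) (*-congˡ (*-congʳ (^-assocʳ q b n))) ⟩
      sign n * (q ^ (b ℕ.* n) * q ^ (6 ℕ.* t))      ≈⟨ *-congˡ (^-homo-* q (b ℕ.* n) (6 ℕ.* t)) ⟨
      sign n * q ^ (b ℕ.* n ℕ.+ 6 ℕ.* t)            ≡⟨ ≡.cong (λ m → sign n * q ^ m) exponent ⟩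
      sign n * q ^ e                                ∎
      where t = Triple.triangular n

    exponent₅ : ∀ n → 5 ℕ.* n ℕ.+ 6 ℕ.* Triple.triangular n ≡ n ℕ.* (3 ℕ.* n ℕ.+ 2)
    exponent₅ n = ≡.trans (regroup n (Triple.triangular n))
      (≡.trans (≡.cong (λ z → 3 ℕ.* z ℕ.+ 2 ℕ.* n) (triangular-square n)) (factorise n))
      where
      regroup : ∀ n t → 5 ℕ.* n ℕ.+ 6 ℕ.* t ≡ 3 ℕ.* (t ℕ.+ t ℕ.+ n) ℕ.+ 2 ℕ.* n
      regroup = ℕ-solve-∀
      factorise : ∀ n → 3 ℕ.* (n ℕ.* n) ℕ.+ 2 ℕ.* n ≡ n ℕ.* (3 ℕ.* n ℕ.+ 2)
      factorise = ℕ-solve-∀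

    exponent₁ : ∀ j → 1 ℕ.* suc j ℕ.+ 6 ℕ.* Triple.triangular (suc j) ≡ suc j ℕ.* (3 ℕ.* j ℕ.+ 1)
    exponent₁ j = ≡.trans (regroup j (Triple.triangular j))
      (≡.trans (≡.cong (λ z → 3 ℕ.* z ℕ.+ (1 ℕ.+ 4 ℕ.* j)) (triangular-square j)) (factorise j))
      where
      regroup : ∀ j t → 1 ℕ.* suc j ℕ.+ 6 ℕ.* (t ℕ.+ j) ≡ 3 ℕ.* (t ℕ.+ t ℕ.+ j) ℕ.+ (1 ℕ.+ 4 ℕ.* j)
      regroup = ℕ-solve-∀
      factorise : ∀ j → 3 ℕ.* (j ℕ.* j) ℕ.+ (1 ℕ.+ 4 ℕ.* j) ≡ suc j ℕ.* (3 ℕ.* j ℕ.+ 1)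
      factorise = ℕ-solve-∀

  octagonal*euler : octagonalAt K q * euler (- 1#) K q ≈ euler 1# K (q ^ 6) * euler (- 1#) K (q ^ 3)
  octagonal*euler = begin
    octagonalAt K q * euler (- 1#) K q
      ≈⟨ *-congʳ (+-congˡ (∑-cong K (λ j → +-cong
           (tripleTerm 5 (suc j) _ (exponent₅ (suc j))) (tripleTerm 1 (suc j) _ (exponent₁ j))))) ⟨
    (1# + ∑ K (λ j → Triple.xTerm (suc j) + Triple.yTerm (suc j))) * euler (- 1#) K q
      ≈⟨ *-congʳ (Triple.tripleProduct K (power^K≈0 4) (power^K≈0 0) (power^K≈0 5) qFactorial-invertible) ⟨
    Triple.qFactorial K * (∏ M (λ i → 1# - q ^ 5 * (q ^ 6) ^ i) * ∏ M (λ i → 1# - q ^ 1 * (q ^ 6) ^ i)) * euler (- 1#) K q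
      ≈⟨ *-congʳ (*-cong qFactorial≈euler (*-cong (column 4) (column 0))) ⟩
    euler 1# K (q ^ 6) * (modSix 4 * modSix 0) * euler (- 1#) K q
      ≈⟨ solve 4 (λ f a b p → f :* (a :* b) :* p := f :* ((b :* a) :* p)) refl _ _ _ _ ⟩
    euler 1# K (q ^ 6) * ((modSix 0 * modSix 4) * euler (- 1#) K q)
      ≈⟨ *-congˡ units*euler⁻₁ ⟩
    euler 1# K (q ^ 6) * euler (- 1#) K (q ^ 3) ∎
    where
    qFactorial-invertible : Invertible (Triple.qFactorial K)
    qFactorial-invertible =
      let e⁻¹ , e*e⁻¹≈1 = euler-invertible k (power^K≈0 5) 1# in e⁻¹ , trans (*-congʳ qFactorial≈euler) e*e⁻¹≈1

-- R[ω] with ω² = −1 − ω; the pair (a , b) is a + bω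
module Eisenstein (R : CommutativeRing 0ℓ 0ℓ) where
  open RingCalculus R

  infix 4 _≈ᵉ_
  record _≈ᵉ_ (x y : Carrier × Carrier) : Set where
    constructor _,_
    field
      re : proj₁ x ≈ proj₁ y
      im : proj₂ x ≈ proj₂ y
  open _≈ᵉ_ public

  _+ᵉ_ _*ᵉ_ : Carrier × Carrier → Carrier × Carrier → Carrier × Carrier
  (a , b) +ᵉ (c , d) = a + c , b + d
  (a , b) *ᵉ (c , d) = a * c - b * d , a * d + b * c - b * d

  -ᵉ_ : Carrier × Carrier → Carrier × Carrier
  -ᵉ (a , b) = - a , - b

  eisensteinRing : CommutativeRing 0ℓ 0ℓ
  eisensteinRing = record
    { Carrier = Carrier × Carrier ; _≈_ = _≈ᵉ_ ; _+_ = _+ᵉ_ ; _*_ = _*ᵉ_ ; -_ = -ᵉ_ ; 0# = 0# , 0# ; 1# = 1# , 0#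
    ; isCommutativeRing = record
      { isRing = record
        { +-isAbelianGroup = record
          { isGroup = record
            { isMonoid = record
              { isSemigroup = record
                { isMagma = record
                  { isEquivalence = record
                    { refl = refl , refl
                    ; sym = λ (p , r) → sym p , sym r
                    ; trans = λ (p , r) (p′ , r′) → trans p p′ , trans r r′ }
                  ; ∙-cong = λ (p , r) (p′ , r′) → +-cong p p′ , +-cong r r′ }
                ; assoc = λ _ _ _ → +-assoc _ _ _ , +-assoc _ _ _ }
              ; identity = (λ _ → +-identityˡ _ , +-identityˡ _) , (λ _ → +-identityʳ _ , +-identityʳ _) }
            ; inverse = (λ _ → -‿inverseˡ _ , -‿inverseˡ _) , (λ _ → -‿inverseʳ _ , -‿inverseʳ _)
            ; ⁻¹-cong = λ (p , r) → -‿cong p , -‿cong r }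
          ; comm = λ _ _ → +-comm _ _ , +-comm _ _ }
        ; *-cong = λ (p , r) (p′ , r′) →
            +-cong (*-cong p p′) (-‿cong (*-cong r r′)) , +-cong (+-cong (*-cong p r′) (*-cong r p′)) (-‿cong (*-cong r r′))
        ; *-assoc = λ (a , b) (c , d) (e , f) →
            solve 6 (λ a b c d e f → (a :* c :- b :* d) :* e :- (a :* d :+ b :* c :- b :* d) :* f
              := a :* (c :* e :- d :* f) :- b :* (c :* f :+ d :* e :- d :* f)) refl a b c d e f
          , solve 6 (λ a b c d e f → (a :* c :- b :* d) :* f :+ (a :* d :+ b :* c :- b :* d) :* e :- (a :* d :+ b :* c :- b :* d) :* f
              := a :* (c :* f :+ d :* e :- d :* f) :+ b :* (c :* e :- d :* f) :- b :* (c :* f :+ d :* e :- d :* f)) refl a b c d e f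
        ; *-identity =
            (λ (a , b) → solve 2 (λ a b → :1 :* a :- :0 :* b := a) refl a b
                       , solve 2 (λ a b → :1 :* b :+ :0 :* a :- :0 :* b := b) refl a b)
          , (λ (a , b) → solve 2 (λ a b → a :* :1 :- b :* :0 := a) refl a b
                       , solve 2 (λ a b → a :* :0 :+ b :* :1 :- b :* :0 := b) refl a b)
        ; distrib =
            (λ (a , b) (c , d) (e , f) →
              solve 6 (λ a b c d e f → a :* (c :+ e) :- b :* (d :+ f) := (a :* c :- b :* d) :+ (a :* e :- b :* f)) refl a b c d e f
            , solve 6 (λ a b c d e f → a :* (d :+ f) :+ b :* (c :+ e) :- b :* (d :+ f)
                := (a :* d :+ b :* c :- b :* d) :+ (a :* f :+ b :* e :- b :* f)) refl a b c d e f)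
          , (λ (a , b) (c , d) (e , f) →
              solve 6 (λ a b c d e f → (c :+ e) :* a :- (d :+ f) :* b := (c :* a :- d :* b) :+ (e :* a :- f :* b)) refl a b c d e f
            , solve 6 (λ a b c d e f → (c :+ e) :* b :+ (d :+ f) :* a :- (d :+ f) :* b
                := (c :* b :+ d :* a :- d :* b) :+ (e :* b :+ f :* a :- f :* b)) refl a b c d e f) }
      ; *-comm = λ (a , b) (c , d) →
            solve 4 (λ a b c d → a :* c :- b :* d := c :* a :- d :* b) refl a b c d
          , solve 4 (λ a b c d → a :* d :+ b :* c :- b :* d := c :* b :+ d :* a :- d :* b) refl a b c d } }

  ι : Carrier → Carrier × Carrier
  ι a = a , 0#

  ω : Carrier × Carrier
  ω = 0# , 1#

  ω-primitive : RingCalculus.IsPrimitiveCubeRoot eisensteinRing ω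
  ω-primitive = solve 0 (((:0 :* :0 :- :1 :* :1) :+ :0) :+ :1 := :0) refl
              , solve 0 (((:0 :* :1 :+ :1 :* :0 :- :1 :* :1) :+ :1) :+ :0 := :0) refl

  ι-isRingHomomorphism : RingHomomorphism R eisensteinRing ι
  ι-isRingHomomorphism = record
    { isSemiringHomomorphism = record
      { isNearSemiringHomomorphism = record
        { +-isMonoidHomomorphism = record
          { isMagmaHomomorphism = record
            { isRelHomomorphism = record { cong = λ p → p , refl }
            ; homo = λ _ _ → refl , sym (+-identityʳ 0#) }
          ; ε-homo = refl , refl }
        ; *-homo = λ x y → solve 2 (λ a b → a :* b := a :* b :- :0 :* :0) refl x y
                         , solve 2 (λ a b → :0 := a :* :0 :+ :0 :* b :- :0 :* :0) refl x y }
      ; 1#-homo = refl , refl }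
    ; -‿homo = λ _ → refl , sym -0#≈0# }

  ω*ι : ∀ y → ω *ᵉ ι y ≈ᵉ (0# , y)
  ω*ι y = solve 1 (λ y → :0 :* y :- :1 :* :0 := :0) refl y
        , solve 1 (λ y → :0 :* :0 :+ :1 :* y :- :1 :* :0 := y) refl y

  ω*ω*ι : ∀ y → ω *ᵉ (ω *ᵉ ι y) ≈ᵉ (- y , - y)
  ω*ω*ι y = CommutativeRing.trans eisensteinRing (CommutativeRing.*-congˡ eisensteinRing (ω*ι y))
    ( solve 1 (λ y → :0 :* :0 :- :1 :* y := :- y) refl y
    , solve 1 (λ y → :0 :* y :+ :1 :* :0 :- :1 :* y := :- y) refl y )

module Homomorphism (R S : CommutativeRing 0ℓ 0ℓ) {h : CommutativeRing.Carrier R → CommutativeRing.Carrier S}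
  (h-isRingHomomorphism : RingHomomorphism R S h) where
  open IsRingHomomorphism h-isRingHomomorphism public
    using (⟦⟧-cong; +-homo; *-homo; -‿homo; 0#-homo; 1#-homo)
  private
    module R where
      open RingCalculus R public
      open ThetaSeries R public using (thetaAt; octagonalAt)
  open RingCalculus S
  open ThetaSeries S

  2#-homo : h R.2# ≈ 2#
  2#-homo = trans (+-homo _ _) (+-cong 1#-homo 1#-homo)

  ^-homo : ∀ x n → h (x R.^ n) ≈ h x ^ n
  ^-homo x zero = 1#-homo
  ^-homo x (suc n) = trans (*-homo x _) (*-congˡ (^-homo x n))

  ∑-homo : ∀ n f → h (R.∑ n f) ≈ ∑ n (λ i → h (f i))
  ∑-homo zero f = 0#-homo
  ∑-homo (suc n) f = trans (+-homo _ _) (+-congʳ (∑-homo n f))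

  sign-homo : ∀ n → h (R.sign n) ≈ sign n
  sign-homo n = trans (^-homo _ n) (^-congˡ n (trans (-‿homo R.1#) (-‿cong 1#-homo)))

  sign*^-homo : ∀ n z e → h (R.sign n R.* z R.^ e) ≈ sign n * h z ^ e
  sign*^-homo n z e = trans (*-homo _ _) (*-cong (sign-homo n) (^-homo z e))

  cube-homo : ∀ x → h (x R.* x R.* x) ≈ h x * h x * h x
  cube-homo x = trans (*-homo _ x) (*-congʳ (*-homo x x))

  thetaAt-homo : ∀ K z → h (R.thetaAt K z) ≈ thetaAt K (h z)
  thetaAt-homo K z = trans (+-homo _ _) (+-cong 1#-homo (trans (*-homo _ _) (*-cong 2#-homo
    (trans (∑-homo K _) (∑-cong K (λ r → sign*^-homo (suc r) z (suc r ℕ.* suc r)))))))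

  octagonalAt-homo : ∀ K z → h (R.octagonalAt K z) ≈ octagonalAt K (h z)
  octagonalAt-homo K z = trans (+-homo _ _) (+-cong 1#-homo (trans (∑-homo K _) (∑-cong K (λ j → trans (+-homo _ _)
    (+-cong (sign*^-homo (suc j) z (suc j ℕ.* (3 ℕ.* suc j ℕ.+ 2))) (sign*^-homo (suc j) z (suc j ℕ.* (3 ℕ.* j ℕ.+ 1))))))))

  IsNilpotent-homo : ∀ K {q} → R.IsNilpotent K q → IsNilpotent K (h q)
  IsNilpotent-homo K {q} q^K≈0 = trans (sym (^-homo q K)) (trans (⟦⟧-cong q^K≈0) 0#-homo)

-- An identity between elements of R that holds in an extension by a primitive cube root of unity holds in R.
module NormDescent (R S : CommutativeRing 0ℓ 0ℓ) {h : CommutativeRing.Carrier R → CommutativeRing.Carrier S}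
  (h-isRingHomomorphism : RingHomomorphism R S h)
  (h-injective : Injective (CommutativeRing._≈_ R) (CommutativeRing._≈_ S) h)
  (ω : CommutativeRing.Carrier S) (ω-primitive : RingCalculus.IsPrimitiveCubeRoot S ω) where
  private
    module R where
      open RingCalculus R public
      open ThetaSeries R public
  open RingCalculus S
  open ThetaSeries S
  open Homomorphism R S h-isRingHomomorphism

  module _ (q : R.Carrier) (k : ℕ) (q^K≈0 : R.IsNilpotent (suc k) q)
    {a b t : R.Carrier} (a≈ : a R.≈ R.thetaAt (suc k) (q R.^ 9))
    (b≈ : b R.≈ R.- (R.2# R.* (q R.* R.octagonalAt (suc k) (q R.^ 3))))
    (t≈ : t R.≈ R.thetaAt (suc k) (q R.^ 3)) where
    private
      K = suc k

      theta-image : ∀ {x} n → x R.≈ R.thetaAt K (q R.^ n) → h x ≈ thetaAt K (h q ^ n)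
      theta-image n x≈ = trans (⟦⟧-cong x≈) (trans (thetaAt-homo K (q R.^ n)) (thetaAt-cong K (^-homo q n)))

      octagonal-image : h b ≈ - (2# * (h q * octagonalAt K (h q ^ 3)))
      octagonal-image = begin
        h b                                                  ≈⟨ trans (⟦⟧-cong b≈) (-‿homo _) ⟩
        - h (R.2# R.* (q R.* R.octagonalAt K (q R.^ 3)))     ≈⟨ -‿cong (trans (*-homo _ _) (*-cong 2#-homo (*-homo _ _))) ⟩
        - (2# * (h q * h (R.octagonalAt K (q R.^ 3))))       ≈⟨ -‿cong (*-congˡ (*-congˡ octagonal-cube)) ⟩
        - (2# * (h q * octagonalAt K (h q ^ 3)))             ∎
        where
        octagonal-cube : h (R.octagonalAt K (q R.^ 3)) ≈ octagonalAt K (h q ^ 3)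
        octagonal-cube = trans (octagonalAt-homo K (q R.^ 3)) (octagonalAt-cong K (^-homo q 3))

      cube-image : ∀ {x y} → h x ≈ y → h (x R.* x R.* x) ≈ y * y * y
      cube-image {x} hx≈y = trans (cube-homo x) (*-cong (*-cong hx≈y hx≈y) hx≈y)

    norm-descended : (a R.* a R.* a R.+ b R.* b R.* b) R.* a R.≈ t R.* (t R.* t R.* t)
    norm-descended = h-injective (trans
      (trans (*-homo _ _) (*-cong (trans (+-homo _ _) (+-cong (cube-image (theta-image 9 a≈)) (cube-image octagonal-image)))
          (theta-image 9 a≈)))
      (trans (ThetaNorm.theta-octagonal-norm S (h q) ω k (IsNilpotent-homo K q^K≈0) ω-primitive)
        (sym (trans (*-homo _ _) (*-cong (theta-image 3 t≈) (cube-image (theta-image 3 t≈)))))))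

-- A ring that embeds into the product of its truncations by q^{k+1}, with an endomorphism v : q ↦ q³.
-- Being abstract, it keeps the type checker from unfolding series into coefficients.
record TruncationTower : Set₁ where
  field
    full : CommutativeRing 0ℓ 0ℓ
    truncation : ℕ → CommutativeRing 0ℓ 0ℓ
  module Full = RingCalculus full
  module Truncation (k : ℕ) = RingCalculus (truncation k)
  field
    π : ∀ k → Full.Carrier → Truncation.Carrier k
    π-isRingHomomorphism : ∀ k → RingHomomorphism full (truncation k) (π k)
    π-jointlyInjective : ∀ {x y} → (∀ k → Truncation._≈_ k (π k x) (π k y)) → x Full.≈ y
    q : Full.Carrier
    q-nilpotent : ∀ k → Truncation.IsNilpotent k (suc k) (π k q)
    v : Full.Carrier → Full.Carrier
    v-isRingHomomorphism : RingHomomorphism full full v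
    v-cong-truncation : ∀ k {x y} → Truncation._≈_ k (π k x) (π k y) → Truncation._≈_ k (π k (v x)) (π k (v y))
    v-q : v q Full.≈ q Full.^ 3
    θ octagonal : Full.Carrier
    θ-truncated : ∀ k → Truncation._≈_ k (π k θ) (ThetaSeries.thetaAt (truncation k) (suc k) (π k q))
    octagonal-truncated : ∀ k → Truncation._≈_ k (π k octagonal) (ThetaSeries.octagonalAt (truncation k) (suc k) (π k q))

module TowerIdentities (tower : TruncationTower) where
  open TruncationTower tower
  private
    module V = Homomorphism full full v-isRingHomomorphism
    module FullTheta = ThetaSeries full

  module AtTruncation (k : ℕ) where
    open RingCalculus (truncation k)
    open ThetaSeries (truncation k)
    open Homomorphism full (truncation k) (π-isRingHomomorphism k)
    private
      K = suc k
      x : Carrier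
      x = π k q

    v-thetaAt : ∀ {y z w} → π k y ≈ thetaAt K (π k z) → v z Full.≈ w → π k (v y) ≈ thetaAt K (π k w)
    v-thetaAt {y} {z} {w} y≈ vz≈w = begin
      π k (v y)                        ≈⟨ v-cong-truncation k (trans y≈ (sym (thetaAt-homo K z))) ⟩
      π k (v (FullTheta.thetaAt K z))  ≈⟨ ⟦⟧-cong (V.thetaAt-homo K z) ⟩
      π k (FullTheta.thetaAt K (v z))  ≈⟨ thetaAt-homo K (v z) ⟩
      thetaAt K (π k (v z))            ≈⟨ thetaAt-cong K (⟦⟧-cong vz≈w) ⟩
      thetaAt K (π k w)                ∎

    v-octagonalAt : ∀ {y z w} → π k y ≈ octagonalAt K (π k z) → v z Full.≈ w → π k (v y) ≈ octagonalAt K (π k w)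
    v-octagonalAt {y} {z} {w} y≈ vz≈w = begin
      π k (v y)                            ≈⟨ v-cong-truncation k (trans y≈ (sym (octagonalAt-homo K z))) ⟩
      π k (v (FullTheta.octagonalAt K z))  ≈⟨ ⟦⟧-cong (V.octagonalAt-homo K z) ⟩
      π k (FullTheta.octagonalAt K (v z))  ≈⟨ octagonalAt-homo K (v z) ⟩
      octagonalAt K (π k (v z))            ≈⟨ octagonalAt-cong K (⟦⟧-cong vz≈w) ⟩
      octagonalAt K (π k w)                ∎

    v-q³ : v (q Full.^ 3) Full.≈ q Full.^ 9
    v-q³ = Full.trans (V.^-homo q 3) (Full.trans (Full.^-congˡ 3 v-q) (Full.^-assocʳ q 3 3))

    vθ-truncated : π k (v θ) ≈ thetaAt K (x ^ 3)
    vθ-truncated = trans (v-thetaAt (θ-truncated k) v-q) (thetaAt-cong K (^-homo q 3))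

    vvθ-truncated : π k (v (v θ)) ≈ thetaAt K (x ^ 9)
    vvθ-truncated = trans (v-thetaAt (v-thetaAt (θ-truncated k) v-q) v-q³) (thetaAt-cong K (^-homo q 9))

    v-octagonal-truncated : π k (v octagonal) ≈ octagonalAt K (x ^ 3)
    v-octagonal-truncated = trans (v-octagonalAt (octagonal-truncated k) v-q) (octagonalAt-cong K (^-homo q 3))

    crossTerm-truncated : π k (Full.- (Full.2# Full.* (q Full.* v octagonal))) ≈ - (2# * (x * octagonalAt K (x ^ 3)))
    crossTerm-truncated = trans (-‿homo _)
      (-‿cong (trans (*-homo _ _) (*-cong 2#-homo (trans (*-homo _ _) (*-congˡ v-octagonal-truncated)))))

    θ-trisection : π k θ ≈ π k (v (v θ) Full.- Full.2# Full.* (q Full.* v octagonal))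
    θ-trisection = begin
      π k θ                                                    ≈⟨ θ-truncated k ⟩
      thetaAt K x                                              ≈⟨ TriSection.thetaAt-trisection x k (q-nilpotent k) ⟩
      thetaAt K (x ^ 9) - 2# * (x * octagonalAt K (x ^ 3))     ≈⟨ +-cong vvθ-truncated crossTerm-truncated ⟨
      π k (v (v θ)) + π k (Full.- (Full.2# Full.* (q Full.* v octagonal)))   ≈⟨ +-homo _ _ ⟨
      π k (v (v θ) Full.- Full.2# Full.* (q Full.* v octagonal)) ∎

    open Eisenstein (truncation k) using (eisensteinRing; ι; ι-isRingHomomorphism; re; ω; ω-primitive)

    θ-norm : let a = v (v θ) in let b = Full.- (Full.2# Full.* (q Full.* v octagonal)) in let t = v θ in
      π k ((a Full.* a Full.* a Full.+ b Full.* b Full.* b) Full.* a) ≈ π k (t Full.* (t Full.* t Full.* t))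
    θ-norm = trans (trans (*-homo _ _) (*-congʳ (trans (+-homo _ _) (+-cong (cube-homo _) (cube-homo _)))))
      (trans (NormDescent.norm-descended (truncation k) eisensteinRing ι-isRingHomomorphism re ω ω-primitive
                x k (q-nilpotent k) vvθ-truncated crossTerm-truncated vθ-truncated)
        (sym (trans (*-homo _ _) (*-congˡ (cube-homo _)))))

  open Full

  θ-trisection : θ ≈ v (v θ) - 2# * (q * v octagonal)
  θ-trisection = π-jointlyInjective AtTruncation.θ-trisection

  -- A (A³ − 8qB³) = θ⁴ for A = v θ, obtained after applying v
  v-norm : v ((v θ * v θ * v θ - 2# * 2# * 2# * (q * (octagonal * octagonal * octagonal))) * v θ) ≈ v (θ * (θ * θ * θ))
  v-norm = begin
    v ((v θ * v θ * v θ - 2# * 2# * 2# * (q * (octagonal * octagonal * octagonal))) * v θ)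
      ≈⟨ trans (V.*-homo _ (v θ)) (*-congʳ (trans (V.+-homo _ _) (+-cong (V.cube-homo (v θ)) (trans (V.-‿homo _) (-‿cong v-cross))))) ⟩
    (a * a * a - 2# * 2# * 2# * (q ^ 3 * (c * c * c))) * a
      ≈⟨ solve 3 (λ a q c → (a :* a :* a :- :2 :* :2 :* :2 :* ((q :* (q :* (q :* :1))) :* (c :* c :* c))) :* a
           := (a :* a :* a :+ (:- (:2 :* (q :* c))) :* (:- (:2 :* (q :* c))) :* (:- (:2 :* (q :* c)))) :* a) refl a q c ⟩
    (a * a * a + b * b * b) * a
      ≈⟨ π-jointlyInjective AtTruncation.θ-norm ⟩
    v θ * (v θ * v θ * v θ)
      ≈⟨ trans (V.*-homo θ _) (*-congˡ (V.cube-homo θ)) ⟨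
    v (θ * (θ * θ * θ)) ∎
    where
    a = v (v θ)
    c = v octagonal
    b = - (2# * (q * c))
    v-cross : v (2# * 2# * 2# * (q * (octagonal * octagonal * octagonal))) ≈ 2# * 2# * 2# * (q ^ 3 * (c * c * c))
    v-cross = trans (V.*-homo _ _) (*-cong
      (trans (V.cube-homo 2#) (*-cong (*-cong V.2#-homo V.2#-homo) V.2#-homo))
      (trans (V.*-homo q _) (*-cong v-q (V.cube-homo octagonal))))

-- The rank generating function of overpartitions

module ListSums (R : CommutativeRing 0ℓ 0ℓ) where
  open RingCalculus R

  ∑ᴸ : {A : Set} → List A → (A → Carrier) → Carrier
  ∑ᴸ [] f = 0#
  ∑ᴸ (x ∷ xs) f = f x + ∑ᴸ xs f

  ∑ᴸ-cong : {A : Set} (xs : List A) {f g : A → Carrier} → (∀ x → f x ≈ g x) → ∑ᴸ xs f ≈ ∑ᴸ xs g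
  ∑ᴸ-cong [] f≈g = refl
  ∑ᴸ-cong (x ∷ xs) f≈g = +-cong (f≈g x) (∑ᴸ-cong xs f≈g)

  ∑ᴸ-++ : {A : Set} (xs ys : List A) (f : A → Carrier) → ∑ᴸ (xs ++ ys) f ≈ ∑ᴸ xs f + ∑ᴸ ys f
  ∑ᴸ-++ [] ys f = sym (+-identityˡ _)
  ∑ᴸ-++ (x ∷ xs) ys f = trans (+-congˡ (∑ᴸ-++ xs ys f)) (sym (+-assoc _ _ _))

  ∑ᴸ-map : {A B : Set} (g : A → B) (xs : List A) (f : B → Carrier) → ∑ᴸ (map g xs) f ≈ ∑ᴸ xs (f ∘ g)
  ∑ᴸ-map g [] f = refl
  ∑ᴸ-map g (x ∷ xs) f = +-congˡ (∑ᴸ-map g xs f)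

  ∑ᴸ-concatMap : {A B : Set} (g : A → List B) (xs : List A) (f : B → Carrier) →
    ∑ᴸ (concatMap g xs) f ≈ ∑ᴸ xs (λ x → ∑ᴸ (g x) f)
  ∑ᴸ-concatMap g [] f = refl
  ∑ᴸ-concatMap g (x ∷ xs) f = trans (∑ᴸ-++ (g x) (concatMap g xs) f) (+-congˡ (∑ᴸ-concatMap g xs f))

  ∑ᴸ-*ˡ : {A : Set} (xs : List A) (c : Carrier) (f : A → Carrier) → ∑ᴸ xs (λ x → c * f x) ≈ c * ∑ᴸ xs f
  ∑ᴸ-*ˡ [] c f = sym (zeroʳ c)
  ∑ᴸ-*ˡ (x ∷ xs) c f = trans (+-congˡ (∑ᴸ-*ˡ xs c f)) (sym (distribˡ c _ _))

  ∑ᴸ-zero : {A : Set} (xs : List A) {f : A → Carrier} → (∀ x → f x ≈ 0#) → ∑ᴸ xs f ≈ 0#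
  ∑ᴸ-zero [] f≈0 = refl
  ∑ᴸ-zero (x ∷ xs) f≈0 = trans (+-cong (f≈0 x) (∑ᴸ-zero xs f≈0)) (+-identityʳ 0#)

  ∑ᴸ-applyUpTo : {A : Set} (g : ℕ → A) (n : ℕ) (f : A → Carrier) → ∑ᴸ (applyUpTo g n) f ≈ ∑ n (f ∘ g)
  ∑ᴸ-applyUpTo g zero f = refl
  ∑ᴸ-applyUpTo g (suc n) f = trans (+-congˡ (∑ᴸ-applyUpTo (g ∘ suc) n f)) (sym (∑-head n _))

  ∑ᴸ-alphabet : ∀ n (f : ℕ × Bool → Carrier) → ∑ᴸ (alphabet n) f ≈ ∑ n (λ i → f (suc i , true) + f (suc i , false))
  ∑ᴸ-alphabet n f = begin
    ∑ᴸ (alphabet n) f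
      ≈⟨ ∑ᴸ-concatMap (λ p → (suc p , true) ∷ (suc p , false) ∷ []) (upTo n) f ⟩
    ∑ᴸ (upTo n) (λ p → f (suc p , true) + (f (suc p , false) + 0#))
      ≈⟨ ∑ᴸ-applyUpTo (λ i → i) n _ ⟩
    ∑ n (λ p → f (suc p , true) + (f (suc p , false) + 0#))
      ≈⟨ ∑-cong n (λ i → +-congˡ (+-identityʳ _)) ⟩
    ∑ n (λ i → f (suc i , true) + f (suc i , false)) ∎

  ∑ᴸ-allLists : {A : Set} (xs : List A) (m : ℕ) (f : List A → Carrier) →
    ∑ᴸ (allLists xs (suc m)) f ≈ f [] + ∑ᴸ xs (λ x → ∑ᴸ (allLists xs m) (λ l → f (x ∷ l)))
  ∑ᴸ-allLists xs m f = +-congˡ (trans (∑ᴸ-concatMap (λ x → map (x ∷_) (allLists xs m)) xs f)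
    (∑ᴸ-cong xs (λ x → ∑ᴸ-map (x ∷_) (allLists xs m) f)))

  [_]_ : Bool → Carrier → Carrier
  [ b ] c = if b then c else 0#

  []-∧ : ∀ b b′ c → [ b ∧ b′ ] c ≈ [ b ] ([ b′ ] c)
  []-∧ true b′ c = refl
  []-∧ false b′ c = refl

  []-cong : ∀ b {c c′} → c ≈ c′ → [ b ] c ≈ [ b ] c′
  []-cong true c≈c′ = c≈c′
  []-cong false c≈c′ = refl

  []-* : ∀ b c c′ → [ b ] (c * c′) ≈ c * [ b ] c′
  []-* true c c′ = refl
  []-* false c c′ = sym (zeroʳ c)

  ∑ᴸ-[] : {A : Set} (xs : List A) (b : Bool) (f : A → Carrier) → ∑ᴸ xs (λ x → [ b ] f x) ≈ [ b ] ∑ᴸ xs f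
  ∑ᴸ-[] xs true f = refl
  ∑ᴸ-[] xs false f = ∑ᴸ-zero xs (λ _ → refl)

  ∑-[≤] : ∀ n r (f : ℕ → Carrier) → r ℕ.< n → ∑ n (λ i → [ suc i ≤ᵇ suc r ] f i) ≈ ∑ (suc r) f
  ∑-[≤] n r f r<n = trans (∑-extend _ above r<n) (∑-cong< (suc r) (λ i i≤r → below i (ℕₚ.≤-pred i≤r)))
    where
    below : ∀ i → i ℕ.≤ r → [ suc i ≤ᵇ suc r ] f i ≈ f i
    below i i≤r with suc i ≤ᵇ suc r | ℕₚ.≤⇒≤ᵇ (s≤s i≤r)
    ... | true | _ = refl
    above : ∀ i → suc r ℕ.≤ i → [ suc i ≤ᵇ suc r ] f i ≈ 0#
    above i r<i with suc i ≤ᵇ suc r | ℕₚ.≤ᵇ⇒≤ (suc i) (suc r)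
    ... | false | _ = refl
    ... | true | i≤r = ⊥-elim (ℕₚ.<⇒≱ r<i (ℕₚ.≤-pred (i≤r _)))

headPart : OverPart → ℕ
headPart [] = 0
headPart ((p , _) ∷ _) = p

valid : OverPart → Bool
valid l = allPositive l ∧ canonical l

mayFollow : ℕ → OverPart → Bool
mayFollow p l = allPositive l ∧ canonical ((p , true) ∷ l)

canonical-head : ∀ p b b′ l → canonical ((p , b) ∷ l) ≡ canonical ((p , b′) ∷ l)
canonical-head p b b′ [] = ≡.refl
canonical-head p b b′ (x ∷ l) = ≡.refl

mayPrecede : ℕ → ℕ → Bool → Bool
mayPrecede r i b = (suc i ≤ᵇ suc r) ∧ (not (i ≡ᵇ r) ∨ not b)

mayFollow-∷ : ∀ r i b l → mayFollow (suc r) ((suc i , b) ∷ l) ≡ mayPrecede r i b ∧ mayFollow (suc i) l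
mayFollow-∷ r i b l = shuffle (allPositive l) (suc i ≤ᵇ suc r) (not (i ≡ᵇ r) ∨ not b) (canonical-head (suc i) b true l)
  where
  shuffle : ∀ a x y {z z′} → z ≡ z′ → a ∧ (x ∧ y ∧ z) ≡ (x ∧ y) ∧ (a ∧ z′)
  shuffle a true true ≡.refl = ≡.refl
  shuffle a true false ≡.refl = Boolₚ.∧-zeroʳ a
  shuffle a false y ≡.refl = Boolₚ.∧-zeroʳ a

module OverpartitionSeries (R : CommutativeRing 0ℓ 0ℓ) (q u ū : CommutativeRing.Carrier R) (k : ℕ)
  (q^K≈0 : RingCalculus.IsNilpotent R (suc k) q)
  (u*ū≈1 : CommutativeRing._≈_ R (CommutativeRing._*_ R u ū) (CommutativeRing.1# R)) where
  open Truncated R q k q^K≈0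
  open RankSeries u ū u*ū≈1 using (boundedGF; tailGF; boundedGF-sum; rankSeries)
  open ListSums R

  weight : OverPart → Carrier
  weight [] = 1#
  weight ((p , _) ∷ l) = u * q ^ p * weight l

  followersGF : ℕ → ℕ → ℕ → Carrier
  followersGF n m p = ∑ᴸ (allLists (alphabet n) m) (λ l → [ mayFollow p l ] weight l)

  -- The contributions of a first part i + 1 ≤ r + 1 not overlined and of a first part i + 1 ≤ r overlined
  nextPart : ℕ → (ℕ → Carrier) → Carrier
  nextPart r f = ∑ (suc r) (λ i → u * q ^ i * f i) + ∑ r (λ i → u * q ^ i * f i)

  nextPart-cong : ∀ r {f g} → (∀ i → i ℕ.≤ r → f i ≈ g i) → nextPart r f ≈ nextPart r g
  nextPart-cong r f≈g = +-cong
    (∑-cong< (suc r) (λ i i≤r → *-congˡ (f≈g i (ℕₚ.≤-pred i≤r)))) (∑-cong< r (λ i i<r → *-congˡ (f≈g i (ℕₚ.<⇒≤ i<r))))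

  nextPart-linear : ∀ r f c g → nextPart r (λ i → f i + c * g i) ≈ nextPart r f + c * nextPart r g
  nextPart-linear r f c g = begin
    nextPart r (λ i → f i + c * g i)
      ≈⟨ +-cong (linear (suc r)) (linear r) ⟩
    (∑ (suc r) F + c * ∑ (suc r) G) + (∑ r F + c * ∑ r G)
      ≈⟨ solve 5 (λ a b x y c → (a :+ c :* b) :+ (x :+ c :* y) := (a :+ x) :+ c :* (b :+ y)) refl _ _ _ _ c ⟩
    nextPart r f + c * nextPart r g ∎
    where
    F G : ℕ → Carrier
    F i = u * q ^ i * f i
    G i = u * q ^ i * g i
    linear : ∀ n → ∑ n (λ i → u * q ^ i * (f i + c * g i)) ≈ ∑ n F + c * ∑ n G
    linear n = begin
      ∑ n (λ i → u * q ^ i * (f i + c * g i))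
        ≈⟨ ∑-cong n (λ i → solve 4 (λ a f c g → a :* (f :+ c :* g) := a :* f :+ c :* (a :* g)) refl (u * q ^ i) (f i) c (g i)) ⟩
      ∑ n (λ i → F i + c * G i)                ≈⟨ trans (∑-+ n F _) (+-congˡ (∑-*ˡ n c G)) ⟩
      ∑ n F + c * ∑ n G                        ∎

  q*nextPart : ∀ r f → q * nextPart r f ≈ ∑ (suc r) (λ i → u * q ^ suc i * f i) + ∑ r (λ i → u * q ^ suc i * f i)
  q*nextPart r f = trans (distribˡ q _ _) (+-cong (absorb (suc r)) (absorb r))
    where
    absorb : ∀ n → q * ∑ n (λ i → u * q ^ i * f i) ≈ ∑ n (λ i → u * q ^ suc i * f i)
    absorb n = trans (sym (∑-*ˡ n q _))
      (∑-cong n (λ i → solve 4 (λ q u x f → q :* (u :* x :* f) := u :* (q :* x) :* f) refl q u (q ^ i) (f i)))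

  followersGF-after : ∀ n m r i b →
    ∑ᴸ (allLists (alphabet n) m) (λ l → [ mayFollow (suc r) ((suc i , b) ∷ l) ] weight ((suc i , b) ∷ l))
    ≈ [ mayPrecede r i b ] (u * q ^ suc i * followersGF n m (suc i))
  followersGF-after n m r i b = begin
    ∑ᴸ lists (λ l → [ mayFollow (suc r) ((suc i , b) ∷ l) ] (u * q ^ suc i * weight l))
      ≈⟨ ∑ᴸ-cong lists (λ l → trans (reflexive (≡.cong (λ z → [ z ] (u * q ^ suc i * weight l)) (mayFollow-∷ r i b l)))
           (trans ([]-∧ (mayPrecede r i b) _ _) ([]-cong (mayPrecede r i b) ([]-* (mayFollow (suc i) l) _ _)))) ⟩
    ∑ᴸ lists (λ l → [ mayPrecede r i b ] (u * q ^ suc i * [ mayFollow (suc i) l ] weight l))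
      ≈⟨ ∑ᴸ-[] lists (mayPrecede r i b) _ ⟩
    [ mayPrecede r i b ] ∑ᴸ lists (λ l → u * q ^ suc i * [ mayFollow (suc i) l ] weight l)
      ≈⟨ []-cong (mayPrecede r i b) (∑ᴸ-*ˡ lists _ _) ⟩
    [ mayPrecede r i b ] (u * q ^ suc i * followersGF n m (suc i)) ∎
    where lists = allLists (alphabet n) m

  ∑-mayPrecede-plain : ∀ n r f → r ℕ.< n → ∑ n (λ i → [ mayPrecede r i false ] f i) ≈ ∑ (suc r) f
  ∑-mayPrecede-plain n r f r<n =
    trans (∑-cong n (λ i → reflexive (≡.cong (λ b → [ b ] f i) (x∧[y∨true]≡x (suc i ≤ᵇ suc r) (not (i ≡ᵇ r)))))) (∑-[≤] n r f r<n)
    where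
    x∧[y∨true]≡x : ∀ x y → x ∧ (y ∨ true) ≡ x
    x∧[y∨true]≡x x y = ≡.trans (≡.cong (x ∧_) (Boolₚ.∨-zeroʳ y)) (Boolₚ.∧-identityʳ x)

  ∑-mayPrecede-overlined : ∀ n r f → r ℕ.< n → ∑ n (λ i → [ mayPrecede r i true ] f i) ≈ ∑ r f
  ∑-mayPrecede-overlined n r f r<n = begin
    ∑ n (λ i → [ mayPrecede r i true ] f i)
      ≈⟨ ∑-cong n (λ i → []-∧ (suc i ≤ᵇ suc r) _ _) ⟩
    ∑ n (λ i → [ suc i ≤ᵇ suc r ] ([ not (i ≡ᵇ r) ∨ false ] f i))
      ≈⟨ ∑-[≤] n r _ r<n ⟩
    ∑ r (λ i → [ not (i ≡ᵇ r) ∨ false ] f i) + [ not (r ≡ᵇ r) ∨ false ] f r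
      ≈⟨ +-cong (∑-cong< r (λ i i<r → reflexive (≡.cong (λ b → [ not b ∨ false ] f i) (dec-false (i ℕ.≟ r) (ℕₚ.<⇒≢ i<r)))))
                (reflexive (≡.cong (λ b → [ not b ∨ false ] f r) (dec-true (r ℕ.≟ r) ≡.refl))) ⟩
    ∑ r f + 0#
      ≈⟨ +-identityʳ _ ⟩
    ∑ r f ∎

  followersGF-suc : ∀ n m r → r ℕ.< n → followersGF n (suc m) (suc r) ≈ 1# + q * nextPart r (λ i → followersGF n m (suc i))
  followersGF-suc n m r r<n = begin
    followersGF n (suc m) (suc r)
      ≈⟨ ∑ᴸ-allLists (alphabet n) m _ ⟩
    1# + ∑ᴸ (alphabet n) (λ x → ∑ᴸ (allLists (alphabet n) m) (λ l → [ mayFollow (suc r) (x ∷ l) ] weight (x ∷ l)))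
      ≈⟨ +-congˡ (∑ᴸ-alphabet n _) ⟩
    1# + ∑ n (λ i → after i true + after i false)
      ≈⟨ +-congˡ (∑-cong n (λ i → +-cong (followersGF-after n m r i true) (followersGF-after n m r i false))) ⟩
    1# + ∑ n (λ i → [ mayPrecede r i true ] f i + [ mayPrecede r i false ] f i)
      ≈⟨ +-congˡ (trans (∑-+ n _ _) (+-comm _ _)) ⟩
    1# + (∑ n (λ i → [ mayPrecede r i false ] f i) + ∑ n (λ i → [ mayPrecede r i true ] f i))
      ≈⟨ +-congˡ (+-cong (∑-mayPrecede-plain n r f r<n) (∑-mayPrecede-overlined n r f r<n)) ⟩
    1# + (∑ (suc r) f + ∑ r f)
      ≈⟨ +-congˡ (q*nextPart r _) ⟨
    1# + q * nextPart r (λ i → followersGF n m (suc i)) ∎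
    where
    f : ℕ → Carrier
    f i = u * q ^ suc i * followersGF n m (suc i)
    after : ℕ → Bool → Carrier
    after i b = ∑ᴸ (allLists (alphabet n) m) (λ l → [ mayFollow (suc r) ((suc i , b) ∷ l) ] weight ((suc i , b) ∷ l))

  tailGF-suc : ∀ r → tailGF r ≈ 1# + q * nextPart r tailGF
  tailGF-suc r = begin
    tailGF r
      ≈⟨ solve 2 (λ v x → v := v :* (:1 :- x) :+ x :* v) refl (tailGF r) (u * q ^ suc r) ⟩
    boundedGF r * minusFactor⁻¹ u r * minusFactor u r + H r
      ≈⟨ +-congʳ (trans (trans (*-assoc _ _ _) (*-congˡ (trans (*-comm _ _) (minusFactor-inverse u r))))
          (trans (*-identityʳ _) (boundedGF-sum r))) ⟩
    (1# + ∑ r (λ l → 2# * H l)) + H r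
      ≈⟨ +-congʳ (+-congˡ (∑-*ˡ r _ H)) ⟩
    (1# + 2# * ∑ r H) + H r
      ≈⟨ solve 2 (λ s h → (:1 :+ :2 :* s) :+ h := :1 :+ ((s :+ h) :+ s)) refl (∑ r H) (H r) ⟩
    1# + (∑ (suc r) H + ∑ r H)
      ≈⟨ +-congˡ (q*nextPart r tailGF) ⟨
    1# + q * nextPart r tailGF ∎
    where
    H : ℕ → Carrier
    H l = u * q ^ suc l * tailGF l

  truncationError : ℕ → ℕ → Carrier
  truncationError zero r = - nextPart r tailGF
  truncationError (suc m) r = nextPart r (truncationError m)

  followersGF-tailGF : ∀ n m r → r ℕ.< n → followersGF n m (suc r) ≈ tailGF r + q ^ suc m * truncationError m r
  followersGF-tailGF n zero r _ = begin
    1# + 0#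
      ≈⟨ solve 2 (λ q l → :1 :+ :0 := (:1 :+ q :* l) :+ (q :* :1) :* (:- l)) refl q (nextPart r tailGF) ⟩
    (1# + q * nextPart r tailGF) + q ^ 1 * - nextPart r tailGF
      ≈⟨ +-congʳ (tailGF-suc r) ⟨
    tailGF r + q ^ 1 * truncationError 0 r ∎
  followersGF-tailGF n (suc m) r r<n = begin
    followersGF n (suc m) (suc r)
      ≈⟨ followersGF-suc n m r r<n ⟩
    1# + q * nextPart r (λ i → followersGF n m (suc i))
      ≈⟨ +-congˡ (*-congˡ (trans (nextPart-cong r (λ i i≤r → followersGF-tailGF n m i (ℕₚ.≤-<-trans i≤r r<n)))
           (nextPart-linear r tailGF (q ^ suc m) (truncationError m)))) ⟩
    1# + q * (nextPart r tailGF + q ^ suc m * nextPart r (truncationError m))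
      ≈⟨ solve 4 (λ q l x e → :1 :+ q :* (l :+ x :* e) := (:1 :+ q :* l) :+ (q :* x) :* e) refl q _ _ _ ⟩
    (1# + q * nextPart r tailGF) + q ^ suc (suc m) * truncationError (suc m) r
      ≈⟨ +-congʳ (tailGF-suc r) ⟨
    tailGF r + q ^ suc (suc m) * truncationError (suc m) r ∎

  startingWith : ∀ n m i b →
    ∑ᴸ (allLists (alphabet n) m) (λ l → [ valid ((suc i , b) ∷ l) ] (ū ^ suc i * weight ((suc i , b) ∷ l)))
      ≈ ū ^ suc i * (u * q ^ suc i) * followersGF n m (suc i)
  startingWith n m i b = trans (∑ᴸ-cong (allLists (alphabet n) m) (λ l → begin
      [ valid ((suc i , b) ∷ l) ] (ū ^ suc i * (u * q ^ suc i * weight l))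
        ≡⟨ ≡.cong (λ z → [ allPositive l ∧ z ] (ū ^ suc i * (u * q ^ suc i * weight l))) (canonical-head (suc i) b true l) ⟩
      [ mayFollow (suc i) l ] (ū ^ suc i * (u * q ^ suc i * weight l))
        ≈⟨ []-cong (mayFollow (suc i) l) (sym (*-assoc _ _ _)) ⟩
      [ mayFollow (suc i) l ] (ū ^ suc i * (u * q ^ suc i) * weight l)
        ≈⟨ []-* (mayFollow (suc i) l) _ _ ⟩
      ū ^ suc i * (u * q ^ suc i) * [ mayFollow (suc i) l ] weight l ∎))
    (∑ᴸ-*ˡ (allLists (alphabet n) m) _ _)

  overpartitions-rankSeries : ∀ m → k ≡ suc m →
    ∑ᴸ (candidates (suc m)) (λ l → [ valid l ] (ū ^ headPart l * weight l)) ≈ rankSeries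
  overpartitions-rankSeries m k≡n = begin
    ∑ᴸ (candidates n) (λ l → [ valid l ] (ū ^ headPart l * weight l))
      ≈⟨ ∑ᴸ-allLists (alphabet n) m _ ⟩
    1# * 1# + ∑ᴸ (alphabet n) (λ x → ∑ᴸ (allLists (alphabet n) m) (λ l → [ valid (x ∷ l) ] (ū ^ proj₁ x * weight (x ∷ l))))
      ≈⟨ +-cong (*-identityʳ 1#) (trans (∑ᴸ-alphabet n _)
           (∑-cong< n (λ i i<n → trans (+-cong (startingWith n m i true) (startingWith n m i false)) (bothStarts i i<n)))) ⟩
    1# + ∑ n term
      ≈⟨ +-congˡ (trans (sym (+-identityʳ _)) (+-congˡ (sym last≈0))) ⟩
    1# + ∑ (suc n) term
      ≡⟨ ≡.cong (λ z → 1# + ∑ (suc z) term) (≡.sym k≡n) ⟩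
    rankSeries ∎
    where
    n = suc m
    term : ℕ → Carrier
    term l = 2# * (ū ^ suc l * (u * q ^ suc l * tailGF l))
    q^n+1≈0 : q ^ suc n ≈ 0#
    q^n+1≈0 = q^≥K (ℕₚ.≤-reflexive (≡.cong suc k≡n))
    bothStarts : ∀ i → i ℕ.< n → ū ^ suc i * (u * q ^ suc i) * followersGF n m (suc i)
      + ū ^ suc i * (u * q ^ suc i) * followersGF n m (suc i) ≈ term i
    bothStarts i i<n = begin
      A * followersGF n m (suc i) + A * followersGF n m (suc i)
        ≈⟨ +-cong (*-congˡ (followersGF-tailGF n m i i<n)) (*-congˡ (followersGF-tailGF n m i i<n)) ⟩
      A * (tailGF i + q ^ n * truncationError m i) + A * (tailGF i + q ^ n * truncationError m i)
        ≈⟨ solve 7 (λ w u q x v y e → (w :* (u :* (q :* x)) :* (v :+ y :* e)) :+ (w :* (u :* (q :* x)) :* (v :+ y :* e))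
              := :2 :* (w :* (u :* (q :* x) :* v)) :+ (q :* y) :* (:2 :* w :* u :* x :* e)) refl
             (ū ^ suc i) u q (q ^ i) (tailGF i) (q ^ n) (truncationError m i) ⟩
      term i + q ^ suc n * _
        ≈⟨ +-absorbs-≈0 q^n+1≈0 _ _ ⟩
      term i ∎
      where A = ū ^ suc i * (u * q ^ suc i)
    last≈0 : term n ≈ 0#
    last≈0 = *-vanishʳ _ (*-vanishʳ _ (*-vanishˡ _ (*-vanishʳ u q^n+1≈0)))

-- (r + 1)(r + 1 + v) for the v ≡ c + 1 (mod 3), v = 3t + c + 1
lambertExponent : ℕ → ℕ → ℕ → ℕ
lambertExponent c r t = suc r ℕ.* suc (suc r ℕ.+ (t ℕ.* 3 ℕ.+ c))

module CubicRankSeries (R : CommutativeRing 0ℓ 0ℓ) (q : CommutativeRing.Carrier R) (k : ℕ)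
  (q^K≈0 : RingCalculus.IsNilpotent R (suc k) q) where
  open Truncated R q k q^K≈0 public

  trinomial trinomial⁻¹ : ℕ → Carrier
  trinomial r = 1# + q ^ suc r + q ^ suc r * q ^ suc r
  trinomial⁻¹ r = (1# - q ^ suc r) * minusFactor⁻¹ 1# (2 ℕ.+ 3 ℕ.* r)

  trinomial-inverse : ∀ r → trinomial r * trinomial⁻¹ r ≈ 1#
  trinomial-inverse r = begin
    trinomial r * trinomial⁻¹ r
      ≈⟨ solve 2 (λ y i → (:1 :+ y :+ y :* y) :* ((:1 :- y) :* i) := (:1 :- :1 :* (y :* y :* y)) :* i) refl y _ ⟩
    (1# - 1# * (y * y * y)) * minusFactor⁻¹ 1# (2 ℕ.+ 3 ℕ.* r)
      ≈⟨ *-congʳ (+-congˡ (-‿cong (*-congˡ cube))) ⟨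
    minusFactor 1# (2 ℕ.+ 3 ℕ.* r) * minusFactor⁻¹ 1# (2 ℕ.+ 3 ℕ.* r)
      ≈⟨ minusFactor-inverse 1# (2 ℕ.+ 3 ℕ.* r) ⟩
    1# ∎
    where
    y = q ^ suc r
    exponent : ∀ r → (suc r ℕ.+ suc r) ℕ.+ suc r ≡ suc (2 ℕ.+ 3 ℕ.* r)
    exponent = ℕ-solve-∀
    cube : q ^ suc (2 ℕ.+ 3 ℕ.* r) ≈ y * y * y
    cube = trans (q^-split (suc r ℕ.+ suc r) (suc r) (exponent r)) (*-congʳ (^-homo-* q (suc r) (suc r)))

  6# : Carrier
  6# = 2# * (2# + 1#)

  lambertTerm : ℕ → Carrier
  lambertTerm r = sign (suc r) * q ^ (suc r ℕ.* suc (suc r)) * trinomial⁻¹ r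

  lambertSeries cubicRankSeries : Carrier
  lambertSeries = 1# + 6# * ∑ K lambertTerm
  cubicRankSeries = AtOne.boundedGF K * lambertSeries

  theta*cubicRankSeries : theta * cubicRankSeries ≈ lambertSeries
  theta*cubicRankSeries = trans (sym (*-assoc _ _ _)) (trans (*-congʳ theta*boundedGF) (*-identityˡ _))

  lambertTerm-expand : ∀ r → lambertTerm r ≈
    ∑ K (λ t → sign (suc r) * q ^ lambertExponent 0 r t - sign (suc r) * q ^ lambertExponent 1 r t)
  lambertTerm-expand r = begin
    s * q ^ a * ((1# - q ^ suc r) * ∑ K f)
      ≈⟨ *-assoc (s * q ^ a) _ _ ⟨
    s * q ^ a * (1# - q ^ suc r) * ∑ K f
      ≈⟨ ∑-*ˡ K (s * q ^ a * (1# - q ^ suc r)) f ⟨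
    ∑ K (λ t → s * q ^ a * (1# - q ^ suc r) * f t)
      ≈⟨ ∑-cong K (λ t → trans
           (solve 4 (λ s a b f → s :* a :* (:1 :- b) :* f := s :* (a :* f) :- s :* (a :* b :* f)) refl s (q ^ a) (q ^ suc r) (f t))
           (+-cong (*-congˡ (first t)) (-‿cong (*-congˡ (second t))))) ⟩
    ∑ K (λ t → s * q ^ lambertExponent 0 r t - s * q ^ lambertExponent 1 r t) ∎
    where
    s = sign (suc r)
    a = suc r ℕ.* suc (suc r)
    c = suc (2 ℕ.+ 3 ℕ.* r)
    f : ℕ → Carrier
    f t = (1# * q ^ c) ^ t
    f-power : ∀ t → f t ≈ q ^ (c ℕ.* t)
    f-power t = trans (^-congˡ t (*-identityˡ (q ^ c))) (^-assocʳ q c t)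
    first : ∀ t → q ^ a * f t ≈ q ^ lambertExponent 0 r t
    first t = trans (*-congˡ (f-power t)) (sym (q^-split a (c ℕ.* t) (exponent r t)))
      where
      exponent : ∀ r t → suc r ℕ.* suc (suc r) ℕ.+ (3 ℕ.+ 3 ℕ.* r) ℕ.* t ≡ suc r ℕ.* suc (suc r ℕ.+ (t ℕ.* 3 ℕ.+ 0))
      exponent = ℕ-solve-∀
    second : ∀ t → q ^ a * q ^ suc r * f t ≈ q ^ lambertExponent 1 r t
    second t = trans (*-cong (sym (^-homo-* q a (suc r))) (f-power t)) (sym (q^-split (a ℕ.+ suc r) (c ℕ.* t) (exponent r t)))
      where
      exponent : ∀ r t → suc r ℕ.* suc (suc r) ℕ.+ suc r ℕ.+ (3 ℕ.+ 3 ℕ.* r) ℕ.* t ≡ suc r ℕ.* suc (suc r ℕ.+ (t ℕ.* 3 ℕ.+ 1))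
      exponent = ℕ-solve-∀

-- The rank series at a primitive cube root of unity lies in R.
module RankDescent (R S : CommutativeRing 0ℓ 0ℓ) {h : CommutativeRing.Carrier R → CommutativeRing.Carrier S}
  (h-isRingHomomorphism : RingHomomorphism R S h)
  (ω : CommutativeRing.Carrier S) (ω-primitive : RingCalculus.IsPrimitiveCubeRoot S ω)
  (q : CommutativeRing.Carrier R) (k : ℕ) (q^K≈0 : RingCalculus.IsNilpotent R (suc k) q) where
  private
    module R = CubicRankSeries R q k q^K≈0
  open R using (K)
  open Homomorphism R S h-isRingHomomorphism
  open RingCalculus S

  private
    ω²*ω≈1 : ω * ω * ω ≈ 1#
    ω²*ω≈1 = trans (solve 1 (λ w → w :* w :* w := w :* (w :* (w :* :1))) refl ω) (cubeRoot³≈1 ω-primitive)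

    hq-nilpotent : IsNilpotent K (h q)
    hq-nilpotent = IsNilpotent-homo K q^K≈0

    module S where
      open Truncated S (h q) k hq-nilpotent public using (theta; module RankTheta)
      open Truncated.RankSeries S (h q) k hq-nilpotent (ω * ω) ω ω²*ω≈1 public using (pole; pole⁻¹; pole-inverse; rankSeries)

  trinomial⁻¹-homo : ∀ r → h (R.trinomial⁻¹ r) ≈ S.pole⁻¹ r
  trinomial⁻¹-homo r = Invertible-cancelˡ (S.pole⁻¹ r , S.pole-inverse r) (begin
    S.pole r * h (R.trinomial⁻¹ r)             ≈⟨ *-congʳ (sym trinomial-pole) ⟩
    h (R.trinomial r) * h (R.trinomial⁻¹ r)    ≈⟨ *-homo _ _ ⟨
    h (R.trinomial r R.* R.trinomial⁻¹ r)      ≈⟨ trans (⟦⟧-cong (R.trinomial-inverse r)) 1#-homo ⟩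
    1#                                         ≈⟨ S.pole-inverse r ⟨
    S.pole r * S.pole⁻¹ r                      ∎)
    where
    z = h q ^ suc r
    trinomial-pole : h (R.trinomial r) ≈ S.pole r
    trinomial-pole = begin
      h (R.trinomial r)
        ≈⟨ trans (+-homo _ _) (+-cong (trans (+-homo _ _) (+-cong 1#-homo (^-homo q (suc r))))
             (trans (*-homo _ _) (*-cong (^-homo q (suc r)) (^-homo q (suc r))))) ⟩
      1# + z + z * z
        ≈⟨ +-absorbs-≈0 ω-primitive _ _ ⟨
      (1# + z + z * z) + (ω * ω + ω + 1#) * (- z + (ω - 1#) * z * z)
        ≈⟨ solve 2 (λ w z → (:1 :+ z :+ z :* z) :+ (w :* w :+ w :+ :1) :* (:- z :+ (w :- :1) :* z :* z)
             := (:1 :- w :* w :* z) :* (:1 :- w :* z)) refl ω z ⟩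
      S.pole r ∎

  6#-homo : h R.6# ≈ 2# * (2# - (ω * ω + ω))
  6#-homo = begin
    h R.6#
      ≈⟨ trans (*-homo _ _) (*-cong 2#-homo (trans (+-homo _ _) (+-cong 2#-homo 1#-homo))) ⟩
    2# * (2# + 1#)
      ≈⟨ +-absorbs-≈0 ω-primitive _ _ ⟨
    2# * (2# + 1#) + (ω * ω + ω + 1#) * (- 2#)
      ≈⟨ solve 1 (λ w → :2 :* (:2 :+ :1) :+ (w :* w :+ w :+ :1) :* (:- :2) := :2 :* (:2 :- (w :* w :+ w))) refl ω ⟩
    2# * (2# - (ω * ω + ω)) ∎

  lambertSeries-homo : h R.lambertSeries ≈ S.theta * S.rankSeries
  lambertSeries-homo = begin
    h R.lambertSeries
      ≈⟨ trans (+-homo _ _) (+-cong 1#-homo (trans (*-homo _ _) (*-cong 6#-homo (trans (∑-homo K _) (∑-cong K (λ r →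
           trans (*-homo _ _) (*-cong (sign*^-homo (suc r) q (suc r ℕ.* suc (suc r))) (trinomial⁻¹-homo r)))))))) ⟩
    1# + (2# * (2# - (ω * ω + ω))) * ∑ K (λ r → sign (suc r) * h q ^ (suc r ℕ.* suc (suc r)) * S.pole⁻¹ r)
      ≈⟨ S.RankTheta.theta*rankSeries (ω * ω) ω ω²*ω≈1 ⟨
    S.theta * S.rankSeries ∎

  cubicRankSeries-homo : h R.cubicRankSeries ≈ S.rankSeries
  cubicRankSeries-homo = begin
    h R.cubicRankSeries                 ≈⟨ *-homo _ _ ⟩
    w * h R.lambertSeries               ≈⟨ *-congˡ lambertSeries-homo ⟩
    w * (S.theta * S.rankSeries)        ≈⟨ *-assoc _ _ _ ⟨
    w * S.theta * S.rankSeries          ≈⟨ *-congʳ w*theta≈1 ⟩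
    1# * S.rankSeries                   ≈⟨ *-identityˡ _ ⟩
    S.rankSeries                        ∎
    where
    w = h (R.AtOne.boundedGF K)
    w*theta≈1 : w * S.theta ≈ 1#
    w*theta≈1 = begin
      w * S.theta                              ≈⟨ *-congˡ (thetaAt-homo K q) ⟨
      w * h R.theta                            ≈⟨ trans (*-comm _ _) (sym (*-homo _ _)) ⟩
      h (R.theta R.* R.AtOne.boundedGF K)      ≈⟨ trans (⟦⟧-cong R.theta*boundedGF) 1#-homo ⟩
      1#                                       ∎

  open OverpartitionSeries S (h q) (ω * ω) ω k hq-nilpotent ω²*ω≈1 using (weight; overpartitions-rankSeries)
  open ListSums S

  weight-power : ∀ l → weight l ≈ ω ^ (2 ℕ.* length l) * h (q R.^ partsSum l)
  weight-power [] = sym (trans (*-identityˡ _) 1#-homo)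
  weight-power ((p , b) ∷ l) = begin
    ω * ω * h q ^ p * weight l
      ≈⟨ *-cong (*-congˡ (sym (^-homo q p))) (weight-power l) ⟩
    ω * ω * h (q R.^ p) * (ω ^ (2 ℕ.* length l) * h (q R.^ partsSum l))
      ≈⟨ solve 4 (λ w a b c → w :* w :* a :* (b :* c) := (w :* (w :* b)) :* (a :* c)) refl ω _ _ _ ⟩
    ω ^ (2 ℕ.+ 2 ℕ.* length l) * (h (q R.^ p) * h (q R.^ partsSum l))
      ≈⟨ *-cong (reflexive (≡.cong (ω ^_) (≡.sym (ℕₚ.*-suc 2 (length l)))))
           (trans (sym (*-homo _ _)) (⟦⟧-cong (R.sym (R.^-homo-* q p (partsSum l))))) ⟩
    ω ^ (2 ℕ.* suc (length l)) * h (q R.^ (p ℕ.+ partsSum l)) ∎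

  cubicRankSeries-overpartitions : ∀ m → k ≡ suc m → h R.cubicRankSeries ≈
    ∑ᴸ (candidates (suc m)) (λ l → [ valid l ] (ω ^ (headPart l ℕ.+ 2 ℕ.* length l) * h (q R.^ partsSum l)))
  cubicRankSeries-overpartitions m k≡n = begin
    h R.cubicRankSeries
      ≈⟨ cubicRankSeries-homo ⟩
    S.rankSeries
      ≈⟨ overpartitions-rankSeries m k≡n ⟨
    ∑ᴸ (candidates (suc m)) (λ l → [ valid l ] (ω ^ headPart l * weight l))
      ≈⟨ ∑ᴸ-cong (candidates (suc m)) (λ l → []-cong (valid l) (trans (*-congˡ (weight-power l))
           (trans (sym (*-assoc _ _ _)) (*-congʳ (sym (^-homo-* ω (headPart l) (2 ℕ.* length l))))))) ⟩
    ∑ᴸ (candidates (suc m)) (λ l → [ valid l ] (ω ^ (headPart l ℕ.+ 2 ℕ.* length l) * h (q R.^ partsSum l))) ∎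

-- The value at ωⁿ of the functional ω ↦ −1, i.e. a + bω ↦ a − b
ωFunctional : ℕ → ℤ
ωFunctional 0 = + 1
ωFunctional 1 = -[1+ 0 ]
ωFunctional 2 = + 0
ωFunctional (suc (suc (suc n))) = ωFunctional n

indicator : Bool → ℤ
indicator b = if b then + 1 else + 0

classDifference : ℤ → ℤ
classDifference x = indicator (congMod x (+ 0) 3) ℤ.- indicator (congMod x (+ 1) 3)

classDifference-period : ∀ x y → x ≡ y ℤ.+ + 3 → classDifference x ≡ classDifference y
classDifference-period x y ≡.refl = ≡.cong₂ (λ a b → indicator a ℤ.- indicator b) (period (+ 0)) (period (+ 1))
  where
  3∣3 : + 3 ℤ∣.∣ + 3
  3∣3 = ℤ∣.∣-refl
  +3-cancel : ∀ z → (z ℤ.+ + 3) ℤ.- + 3 ≡ z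
  +3-cancel = ℤ-solve-∀
  reassociate : ∀ y s → (y ℤ.+ + 3) ℤ.- s ≡ (y ℤ.- s) ℤ.+ + 3
  reassociate = ℤ-solve-∀
  3∣-+3 : ∀ z → does (3 ∣? ∣ z ℤ.+ + 3 ∣) ≡ does (3 ∣? ∣ z ∣)
  3∣-+3 z = does-⇔ (mk⇔
    (λ 3∣z+3 → ℤ∣.∣⇒∣ᵤ {+ 3} {z} (≡.subst (+ 3 ℤ∣.∣_) (+3-cancel z) (ℤ∣.∣m∣n⇒∣m-n (ℤ∣.∣ᵤ⇒∣ {+ 3} {z ℤ.+ + 3} 3∣z+3) 3∣3)))
    (λ 3∣z → ℤ∣.∣⇒∣ᵤ {+ 3} {z ℤ.+ + 3} (ℤ∣.∣m∣n⇒∣m+n (ℤ∣.∣ᵤ⇒∣ {+ 3} {z} 3∣z) 3∣3)))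
    (3 ∣? ∣ z ℤ.+ + 3 ∣) (3 ∣? ∣ z ∣)
  period : ∀ s → congMod (y ℤ.+ + 3) s 3 ≡ congMod y s 3
  period s = ≡.trans (≡.cong (λ z → does (3 ∣? ∣ z ∣)) (reassociate y s)) (3∣-+3 (y ℤ.- s))

-- The exponent h + 2l ≡ h − l (mod 3) is the rank of an overpartition with largest part h and l parts.
ωFunctional-rank : ∀ h l → ωFunctional (h ℕ.+ 2 ℕ.* l) ≡ classDifference (+ h ℤ.- + l)
ωFunctional-rank (suc (suc (suc h))) l = ≡.trans (ωFunctional-rank h l) (≡.sym
  (classDifference-period (+ (3 ℕ.+ h) ℤ.- + l) (+ h ℤ.- + l) (3+h (+ h) (+ l))))
  where
  3+h : ∀ x y → (+ 3 ℤ.+ x) ℤ.- y ≡ (x ℤ.- y) ℤ.+ + 3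
  3+h = ℤ-solve-∀
ωFunctional-rank h (suc (suc (suc l))) = ≡.trans (≡.cong ωFunctional (exponent h l)) (≡.trans (ωFunctional-rank h l)
  (classDifference-period (+ h ℤ.- + l) (+ h ℤ.- + (3 ℕ.+ l)) (3+l (+ h) (+ l))))
  where
  exponent : ∀ h l → h ℕ.+ 2 ℕ.* (3 ℕ.+ l) ≡ 6 ℕ.+ (h ℕ.+ 2 ℕ.* l)
  exponent = ℕ-solve-∀
  3+l : ∀ x y → x ℤ.- y ≡ (x ℤ.- (+ 3 ℤ.+ y)) ℤ.+ + 3
  3+l = ℤ-solve-∀
ωFunctional-rank 0 0 = ≡.refl
ωFunctional-rank 0 1 = ≡.refl
ωFunctional-rank 0 2 = ≡.refl
ωFunctional-rank 1 0 = ≡.refl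
ωFunctional-rank 1 1 = ≡.refl
ωFunctional-rank 1 2 = ≡.refl
ωFunctional-rank 2 0 = ≡.refl
ωFunctional-rank 2 1 = ≡.refl
ωFunctional-rank 2 2 = ≡.refl

module ℤ-ListSums = ListSums ℤₚ.+-*-commutativeRing
open ℤ-ListSums using (∑ᴸ; ∑ᴸ-cong)

length-filter : {A : Set} (p : A → Bool) (xs : List A) → + length (filterᵇ p xs) ≡ ∑ᴸ xs (λ x → indicator (p x))
length-filter p [] = ≡.refl
length-filter p (x ∷ xs) with p x
... | true = ≡.cong (λ z → + 1 ℤ.+ z) (length-filter p xs)
... | false = ≡.trans (length-filter p xs) (≡.sym (ℤₚ.+-identityˡ _))

∑ᴸ-minus : {A : Set} (xs : List A) (f g : A → ℤ) → ∑ᴸ xs f ℤ.- ∑ᴸ xs g ≡ ∑ᴸ xs (λ x → f x ℤ.- g x)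
∑ᴸ-minus [] f g = ≡.refl
∑ᴸ-minus (x ∷ xs) f g = ≡.trans (regroup (f x) (∑ᴸ xs f) (g x) (∑ᴸ xs g)) (≡.cong (λ z → (f x ℤ.- g x) ℤ.+ z) (∑ᴸ-minus xs f g))
  where
  regroup : ∀ a b c d → (a ℤ.+ b) ℤ.- (c ℤ.+ d) ≡ (a ℤ.- c) ℤ.+ (b ℤ.- d)
  regroup = ℤ-solve-∀

largestPart-head : ∀ l → canonical l ≡ true → largestPart l ≡ headPart l
largestPart-head [] _ = ≡.refl
largestPart-head ((p , b) ∷ []) _ = ℕₚ.⊔-identityʳ p
largestPart-head ((p , b) ∷ (p′ , b′) ∷ l) c = ≡.trans (≡.cong (p ⊔_) (largestPart-head ((p′ , b′) ∷ l) canonical-tail)) (ℕₚ.m≥n⇒m⊔n≡m p′≤p)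
  where
  canonical-tail : canonical ((p′ , b′) ∷ l) ≡ true
  canonical-tail = Boolₚ.∧-conicalʳ (not (p′ ≡ᵇ p) ∨ not b′) _ (Boolₚ.∧-conicalʳ (p′ ≤ᵇ p) _ c)
  p′≤p : p′ ℕ.≤ p
  p′≤p = ℕₚ.≤ᵇ⇒≤ p′ p (≡.subst Bool.T (≡.sym (Boolₚ.∧-conicalˡ (p′ ≤ᵇ p) _ c)) tt)

contribution : ℕ → OverPart → ℤ
contribution n l = if valid l then ωFunctional (headPart l ℕ.+ 2 ℕ.* length l) ℤ.* mono (+ 1) (partsSum l) n else + 0

Nbar-difference : ∀ m →
  + Nbar (+ 0) 3 (suc m) ℤ.- + Nbar (+ 1) 3 (suc m) ≡ ∑ᴸ (candidates (suc m)) (contribution (suc m))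
Nbar-difference m = begin
  + Nbar (+ 0) 3 n ℤ.- + Nbar (+ 1) 3 n
    ≡⟨ ≡.cong₂ ℤ._-_ (length-filter (counted (+ 0)) cs) (length-filter (counted (+ 1)) cs) ⟩
  ∑ᴸ cs (λ l → indicator (counted (+ 0) l)) ℤ.- ∑ᴸ cs (λ l → indicator (counted (+ 1) l))
    ≡⟨ ∑ᴸ-minus cs (λ l → indicator (counted (+ 0) l)) (λ l → indicator (counted (+ 1) l)) ⟩
  ∑ᴸ cs (λ l → indicator (counted (+ 0) l) ℤ.- indicator (counted (+ 1) l))
    ≡⟨ ∑ᴸ-cong cs pointwise ⟩
  ∑ᴸ cs (contribution n) ∎
  where
  open ≡.≡-Reasoning
  n = suc m
  cs = candidates n
  counted : ℤ → OverPart → Bool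
  counted s l = isOverpartitionOf n l ∧ congMod (rank l) s 3
  ≡ᵇ-sym : ∀ s → (n ≡ᵇ s) ≡ (s ≡ᵇ n)
  ≡ᵇ-sym s = does-⇔ (mk⇔ ≡.sym ≡.sym) (n ℕ.≟ s) (s ℕ.≟ n)
  pointwise : ∀ l → indicator (counted (+ 0) l) ℤ.- indicator (counted (+ 1) l) ≡ contribution n l
  pointwise l rewrite ≡ᵇ-sym (partsSum l) with partsSum l ≡ᵇ n | allPositive l | canonical l in canonical-l
  ... | true | true | true = begin
    classDifference (+ largestPart l ℤ.- + length l)
      ≡⟨ ≡.cong (λ p → classDifference (+ p ℤ.- + length l)) (largestPart-head l canonical-l) ⟩
    classDifference (+ headPart l ℤ.- + length l)
      ≡⟨ ωFunctional-rank (headPart l) (length l) ⟨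
    ωFunctional (headPart l ℕ.+ 2 ℕ.* length l)
      ≡⟨ ℤₚ.*-identityʳ _ ⟨
    ωFunctional (headPart l ℕ.+ 2 ℕ.* length l) ℤ.* + 1 ∎
  ... | true | true | false = ≡.refl
  ... | true | false | _ = ≡.refl
  ... | false | true | true = ≡.sym (ℤₚ.*-zeroʳ (ωFunctional (headPart l ℕ.+ 2 ℕ.* length l)))
  ... | false | true | false = ≡.refl
  ... | false | false | _ = ≡.refl

module RankFunctional (R S : CommutativeRing 0ℓ 0ℓ) {h : CommutativeRing.Carrier R → CommutativeRing.Carrier S}
  (h-isRingHomomorphism : RingHomomorphism R S h)
  (ω : CommutativeRing.Carrier S) (ω-primitive : RingCalculus.IsPrimitiveCubeRoot S ω)
  (q : CommutativeRing.Carrier R) (k : ℕ) (q^K≈0 : RingCalculus.IsNilpotent R (suc k) q)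
  {coeff : CommutativeRing.Carrier R → ℤ} {eval : CommutativeRing.Carrier S → ℤ}
  (eval-isMonoidHomomorphism : IsMonoidHomomorphism (CommutativeRing.+-rawMonoid S) ℤ.+-0-rawMonoid eval)
  (eval-1 : ∀ y → eval (h y) ≡ coeff y)
  (eval-ω : ∀ y → eval (CommutativeRing._*_ S ω (h y)) ≡ ℤ.- coeff y)
  (eval-ω² : ∀ y → eval (CommutativeRing._*_ S ω (CommutativeRing._*_ S ω (h y))) ≡ + 0) where
  private
    module R = CubicRankSeries R q k q^K≈0
    module S-ListSums = ListSums S
    open module Eval = IsMonoidHomomorphism eval-isMonoidHomomorphism
      using () renaming (⟦⟧-cong to eval-cong; homo to eval-+; ε-homo to eval-0)
  open RankDescent R S h-isRingHomomorphism ω ω-primitive q k q^K≈0 using (cubicRankSeries-overpartitions)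
  open RingCalculus S using (_≈_; _*_; _^_; trans; *-identityˡ; *-identityʳ; *-congʳ; *-congˡ; *-assoc; ^-homo-*; cubeRoot³≈1; Carrier)

  eval-∑ᴸ : {A : Set} (xs : List A) (f : A → Carrier) → eval (S-ListSums.∑ᴸ xs f) ≡ ∑ᴸ xs (λ x → eval (f x))
  eval-∑ᴸ [] f = eval-0
  eval-∑ᴸ (x ∷ xs) f = ≡.trans (eval-+ (f x) (S-ListSums.∑ᴸ xs f)) (≡.cong (λ z → eval (f x) ℤ.+ z) (eval-∑ᴸ xs f))

  eval-ω^ : ∀ i y → eval (ω ^ i * h y) ≡ ωFunctional i ℤ.* coeff y
  eval-ω^ 0 y = ≡.trans (eval-cong (*-identityˡ _)) (≡.trans (eval-1 y) (≡.sym (ℤₚ.*-identityˡ (coeff y))))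
  eval-ω^ 1 y = ≡.trans (eval-cong (*-congʳ (*-identityʳ ω))) (≡.trans (eval-ω y) (≡.sym (ℤₚ.-1*i≡-i (coeff y))))
  eval-ω^ 2 y = ≡.trans (eval-cong (trans (*-congʳ (*-congˡ (*-identityʳ ω))) (*-assoc ω ω (h y))))
    (≡.trans (eval-ω² y) (≡.sym (ℤₚ.*-zeroˡ (coeff y))))
  eval-ω^ (suc (suc (suc i))) y = ≡.trans (eval-cong (*-congʳ ω^3+i)) (eval-ω^ i y)
    where
    ω^3+i : ω ^ (3 ℕ.+ i) ≈ ω ^ i
    ω^3+i = trans (^-homo-* ω 3 i) (trans (*-congʳ (cubeRoot³≈1 ω-primitive)) (*-identityˡ _))

  cubicRankSeries-coeff : ∀ m → k ≡ suc m → (∀ s → coeff (q R.^ s) ≡ mono (+ 1) s (suc m)) →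
    coeff R.cubicRankSeries ≡ + Nbar (+ 0) 3 (suc m) ℤ.- + Nbar (+ 1) 3 (suc m)
  cubicRankSeries-coeff m k≡n coeff-q^ = begin
    coeff R.cubicRankSeries
      ≡⟨ eval-1 R.cubicRankSeries ⟨
    eval (h R.cubicRankSeries)
      ≡⟨ ≡.trans (eval-cong (cubicRankSeries-overpartitions m k≡n)) (eval-∑ᴸ (candidates (suc m)) _) ⟩
    ∑ᴸ (candidates (suc m)) (λ l → eval (S-ListSums.[ valid l ] (ω ^ (headPart l ℕ.+ 2 ℕ.* length l) * h (q R.^ partsSum l))))
      ≡⟨ ∑ᴸ-cong (candidates (suc m)) term ⟩
    ∑ᴸ (candidates (suc m)) (contribution (suc m))
      ≡⟨ Nbar-difference m ⟨
    + Nbar (+ 0) 3 (suc m) ℤ.- + Nbar (+ 1) 3 (suc m) ∎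
    where
    open ≡.≡-Reasoning
    term : ∀ l → eval (S-ListSums.[ valid l ] (ω ^ (headPart l ℕ.+ 2 ℕ.* length l) * h (q R.^ partsSum l))) ≡ contribution (suc m) l
    term l with valid l
    ... | false = eval-0
    ... | true = ≡.trans (eval-ω^ (headPart l ℕ.+ 2 ℕ.* length l) (q R.^ partsSum l))
          (≡.cong (ωFunctional (headPart l ℕ.+ 2 ℕ.* length l) ℤ.*_) (coeff-q^ (partsSum l)))

-- Solving a F₀ − 2b y F₂ = T₀, a F₁ − 2b F₀ = 0, a F₂ − 2b F₁ = T₂ by Cramer's rule; the determinant is a³ − 8y b³.
module CyclicSystem (R : CommutativeRing 0ℓ 0ℓ) where
  open RingCalculus R

  module Solution {y a b t F₀ F₁ F₂ T₀ T₂ : Carrier} (t-invertible : Invertible t) (a-invertible : Invertible a)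
    (equation₀ : a * F₀ - 2# * (b * (y * F₂)) ≈ T₀)
    (equation₁ : a * F₁ - 2# * (b * F₀) ≈ 0#)
    (equation₂ : a * F₂ - 2# * (b * F₁) ≈ T₂)
    (numerator : a * T₀ + 2# * (b * (y * T₂)) ≈ t * (t * t))
    (determinant : (a * a * a - 2# * 2# * 2# * (y * (b * b * b))) * a ≈ t * (t * t * t)) where

    t*F₀ : t * F₀ ≈ a * a
    t*F₀ = Invertible-cancelˡ (Invertible-* t-invertible (Invertible-* t-invertible t-invertible)) (begin
      t * (t * t) * (t * F₀)
        ≈⟨ solve 2 (λ t f → t :* (t :* t) :* (t :* f) := t :* (t :* t :* t) :* f) refl t F₀ ⟩
      t * (t * t * t) * F₀
        ≈⟨ *-congʳ determinant ⟨
      (a * a * a - 2# * 2# * 2# * (y * (b * b * b))) * a * F₀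
        ≈⟨ solve 6 (λ y a b f₀ f₁ f₂ → (a :* a :* a :- :2 :* :2 :* :2 :* (y :* (b :* b :* b))) :* a :* f₀
             := a :* a :* (a :* (a :* f₀ :- :2 :* (b :* (y :* f₂))) :+ :2 :* (b :* (y :* (a :* f₂ :- :2 :* (b :* f₁)))))
                :+ (:2 :* :2 :* (y :* (b :* b :* a))) :* (a :* f₁ :- :2 :* (b :* f₀))) refl y a b F₀ F₁ F₂ ⟩
      a * a * (a * (a * F₀ - 2# * (b * (y * F₂))) + 2# * (b * (y * (a * F₂ - 2# * (b * F₁)))))
        + 2# * 2# * (y * (b * b * a)) * (a * F₁ - 2# * (b * F₀))
        ≈⟨ +-cong (*-congˡ (+-cong (*-congˡ equation₀) (*-congˡ (*-congˡ (*-congˡ equation₂))))) (*-congˡ equation₁) ⟩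
      a * a * (a * T₀ + 2# * (b * (y * T₂))) + 2# * 2# * (y * (b * b * a)) * 0#
        ≈⟨ +-cong (*-congˡ numerator) (zeroʳ _) ⟩
      a * a * (t * (t * t)) + 0#
        ≈⟨ trans (+-identityʳ _) (*-comm _ _) ⟩
      t * (t * t) * (a * a) ∎)

    a*F₁ : a * F₁ ≈ 2# * (b * F₀)
    a*F₁ = trans (solve 2 (λ x z → x := (x :- z) :+ z) refl (a * F₁) (2# * (b * F₀))) (trans (+-congʳ equation₁) (+-identityˡ _))

    t*F₁ : t * F₁ ≈ 2# * (a * b)
    t*F₁ = Invertible-cancelˡ a-invertible (begin
      a * (t * F₁)              ≈⟨ solve 3 (λ a t f → a :* (t :* f) := t :* (a :* f)) refl a t F₁ ⟩
      t * (a * F₁)              ≈⟨ *-congˡ a*F₁ ⟩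
      t * (2# * (b * F₀))       ≈⟨ solve 3 (λ t b f → t :* (:2 :* (b :* f)) := :2 :* (b :* (t :* f))) refl t b F₀ ⟩
      2# * (b * (t * F₀))       ≈⟨ *-congˡ (*-congˡ t*F₀) ⟩
      2# * (b * (a * a))        ≈⟨ solve 2 (λ a b → :2 :* (b :* (a :* a)) := a :* (:2 :* (a :* b))) refl a b ⟩
      a * (2# * (a * b))        ∎)

    a*F₂ : a * F₂ ≈ T₂ + 2# * (b * F₁)
    a*F₂ = trans (solve 2 (λ x z → x := (x :- z) :+ z) refl (a * F₂) (2# * (b * F₁))) (+-congʳ equation₂)

    -- e_b and e_b⁻ stand for the products (q^b;q^b)_∞ and (−q^b;q^b)_∞.
    module EulerQuotients {e₁ e₁⁻ e₂ e₃ e₃⁻ e₆ : Carrier}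
      (t-quotient : t * e₁⁻ ≈ e₁) (a-quotient : a * e₃⁻ ≈ e₃) (b-quotient : b * e₁⁻ ≈ e₆ * e₃⁻) (doubling : e₁ * e₁⁻ ≈ e₂) where

      F₀-product : F₀ * (e₁ * e₃⁻ * e₃⁻) ≈ e₃ * e₃ * e₁⁻
      F₀-product = begin
        F₀ * (e₁ * e₃⁻ * e₃⁻)            ≈⟨ *-congˡ (*-congʳ (*-congʳ t-quotient)) ⟨
        F₀ * (t * e₁⁻ * e₃⁻ * e₃⁻)
          ≈⟨ solve 4 (λ f t p p₃ → f :* (t :* p :* p₃ :* p₃) := (t :* f) :* (p :* p₃ :* p₃)) refl F₀ t e₁⁻ e₃⁻ ⟩
        t * F₀ * (e₁⁻ * e₃⁻ * e₃⁻)       ≈⟨ *-congʳ t*F₀ ⟩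
        a * a * (e₁⁻ * e₃⁻ * e₃⁻)        ≈⟨ solve 3 (λ a p p₃ → a :* a :* (p :* p₃ :* p₃) := (a :* p₃) :* (a :* p₃) :* p) refl a e₁⁻ e₃⁻ ⟩
        a * e₃⁻ * (a * e₃⁻) * e₁⁻        ≈⟨ *-congʳ (*-cong a-quotient a-quotient) ⟩
        e₃ * e₃ * e₁⁻                    ∎

      F₁-product : F₁ * e₁ ≈ 2# * (e₃ * e₆)
      F₁-product = begin
        F₁ * e₁                          ≈⟨ *-congˡ t-quotient ⟨
        F₁ * (t * e₁⁻)                   ≈⟨ solve 3 (λ f t p → f :* (t :* p) := (t :* f) :* p) refl F₁ t e₁⁻ ⟩
        t * F₁ * e₁⁻                     ≈⟨ *-congʳ t*F₁ ⟩
        2# * (a * b) * e₁⁻               ≈⟨ solve 3 (λ a b p → :2 :* (a :* b) :* p := :2 :* (a :* (b :* p))) refl a b e₁⁻ ⟩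
        2# * (a * (b * e₁⁻))             ≈⟨ *-congˡ (*-congˡ b-quotient) ⟩
        2# * (a * (e₆ * e₃⁻))            ≈⟨ solve 3 (λ a x y → :2 :* (a :* (x :* y)) := :2 :* ((a :* y) :* x)) refl a e₆ e₃⁻ ⟩
        2# * (a * e₃⁻ * e₆)              ≈⟨ *-congˡ (*-congʳ a-quotient) ⟩
        2# * (e₃ * e₆)                   ∎

      crossTerm : 2# * (b * F₁) * e₃⁻ * e₂ ≈ 2# * 2# * (e₃⁻ * e₃⁻ * e₆ * e₆) * e₃
      crossTerm = begin
        2# * (b * F₁) * e₃⁻ * e₂
          ≈⟨ *-congˡ doubling ⟨
        2# * (b * F₁) * e₃⁻ * (e₁ * e₁⁻)
          ≈⟨ solve 5 (λ b f p₃ p m → :2 :* (b :* f) :* p₃ :* (p :* m) := :2 :* (b :* m) :* p₃ :* (f :* p)) refl b F₁ e₃⁻ e₁ e₁⁻ ⟩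
        2# * (b * e₁⁻) * e₃⁻ * (F₁ * e₁)
          ≈⟨ *-cong (*-congʳ (*-congˡ b-quotient)) F₁-product ⟩
        2# * (e₆ * e₃⁻) * e₃⁻ * (2# * (e₃ * e₆))
          ≈⟨ solve 3 (λ p₆ m p₃ → :2 :* (p₆ :* m) :* m :* (:2 :* (p₃ :* p₆)) := :2 :* :2 :* (m :* m :* p₆ :* p₆) :* p₃) refl e₆ e₃⁻ e₃ ⟩
        2# * 2# * (e₃⁻ * e₃⁻ * e₆ * e₆) * e₃ ∎

      F₂-product : F₂ * (e₃ * e₂) ≈ 2# * 2# * (e₃⁻ * e₃⁻ * e₆ * e₆) * e₃ + T₂ * e₃⁻ * e₂
      F₂-product = begin
        F₂ * (e₃ * e₂)
          ≈⟨ *-congˡ (*-congʳ a-quotient) ⟨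
        F₂ * (a * e₃⁻ * e₂)
          ≈⟨ solve 4 (λ f a p p₂ → f :* (a :* p :* p₂) := (a :* f) :* p :* p₂) refl F₂ a e₃⁻ e₂ ⟩
        a * F₂ * e₃⁻ * e₂
          ≈⟨ *-congʳ (*-congʳ a*F₂) ⟩
        (T₂ + 2# * (b * F₁)) * e₃⁻ * e₂
          ≈⟨ solve 5 (λ t b f p p₂ → (t :+ :2 :* (b :* f)) :* p :* p₂ := :2 :* (b :* f) :* p :* p₂ :+ t :* p :* p₂) refl T₂ b F₁ e₃⁻ e₂ ⟩
        2# * (b * F₁) * e₃⁻ * e₂ + T₂ * e₃⁻ * e₂
          ≈⟨ +-congʳ crossTerm ⟩
        2# * 2# * (e₃⁻ * e₃⁻ * e₆ * e₆) * e₃ + T₂ * e₃⁻ * e₂ ∎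

      F₂-quotient : ∀ {c s i₂ i₃} → T₂ ≈ - (c * s) → e₂ * i₂ ≈ 1# → e₃ * i₃ ≈ 1# →
        F₂ ≈ 2# * 2# * (e₃⁻ * e₃⁻ * e₆ * e₆) * i₂ - c * e₃⁻ * i₃ * s
      F₂-quotient {c} {s} {i₂} {i₃} T₂≈ e₂*i₂≈1 e₃*i₃≈1 = Invertible-cancelˡ (Invertible-* (i₃ , e₃*i₃≈1) (i₂ , e₂*i₂≈1)) (begin
        e₃ * e₂ * F₂
          ≈⟨ trans (*-comm _ F₂) F₂-product ⟩
        2# * 2# * p * e₃ + T₂ * e₃⁻ * e₂
          ≈⟨ +-congˡ (*-congʳ (*-congʳ T₂≈)) ⟩
        2# * 2# * p * e₃ + - (c * s) * e₃⁻ * e₂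
          ≈⟨ +-cong (*-identityʳ _) (*-identityʳ _) ⟨
        2# * 2# * p * e₃ * 1# + - (c * s) * e₃⁻ * e₂ * 1#
          ≈⟨ +-cong (*-congˡ e₂*i₂≈1) (*-congˡ e₃*i₃≈1) ⟨
        2# * 2# * p * e₃ * (e₂ * i₂) + - (c * s) * e₃⁻ * e₂ * (e₃ * i₃)
          ≈⟨ solve 8 (λ p c s m p₂ p₃ i₂ i₃ → :2 :* :2 :* p :* p₃ :* (p₂ :* i₂) :+ :- (c :* s) :* m :* p₂ :* (p₃ :* i₃)
               := p₃ :* p₂ :* (:2 :* :2 :* p :* i₂ :- c :* m :* i₃ :* s)) refl p c s e₃⁻ e₂ e₃ i₂ i₃ ⟩
        e₃ * e₂ * (2# * 2# * p * i₂ - c * e₃⁻ * i₃ * s) ∎)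
        where p = e₃⁻ * e₃⁻ * e₆ * e₆

module QuotientCalculus (R : CommutativeRing 0ℓ 0ℓ) where
  open RingCalculus R

  inverse-cancelˡ : ∀ {x y} z → x * y ≈ 1# → x * (y * z) ≈ z
  inverse-cancelˡ {x} {y} z xy≈1 = trans (sym (*-assoc x y z)) (trans (*-congʳ xy≈1) (*-identityˡ z))

  product⇒quotient : ∀ {x y z y⁻¹} → y * y⁻¹ ≈ 1# → x * y ≈ z → x ≈ z * y⁻¹
  product⇒quotient {x} {y} {z} {y⁻¹} yy⁻¹≈1 xy≈z = begin
    x                  ≈⟨ *-identityʳ x ⟨
    x * 1#             ≈⟨ *-congˡ yy⁻¹≈1 ⟨
    x * (y * y⁻¹)      ≈⟨ *-assoc x y y⁻¹ ⟨
    x * y * y⁻¹        ≈⟨ *-congʳ xy≈z ⟩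
    z * y⁻¹            ∎

  quotient-unique : ∀ {x x′ y y′ z z′} → Invertible x → x ≈ x′ → z ≈ z′ → x * y ≈ z → x′ * y′ ≈ z′ → y ≈ y′
  quotient-unique x-invertible x≈x′ z≈z′ xy≈z x′y′≈z′ = Invertible-cancelˡ x-invertible
    (trans xy≈z (trans z≈z′ (trans (sym x′y′≈z′) (*-congʳ (sym x≈x′)))))

  *-distribʳ-minus : ∀ {x a b q} y → x ≈ a - 2# * (q * b) → x * y ≈ a * y - 2# * (b * (q * y))
  *-distribʳ-minus {x} {a} {b} {q} y x≈a-2qb = trans (*-congʳ x≈a-2qb)
    (solve 4 (λ a b q y → (a :- :2 :* (q :* b)) :* y := a :* y :- :2 :* (b :* (q :* y))) refl a b q y)

  *-distribʳ-plus : ∀ {x a b q} y → x ≈ a + 2# * (q * b) → x * y ≈ a * y + 2# * (b * (q * y))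
  *-distribʳ-plus {x} {a} {b} {q} y x≈a+2qb = trans (*-congʳ x≈a+2qb)
    (solve 4 (λ a b q y → (a :+ :2 :* (q :* b)) :* y := a :* y :+ :2 :* (b :* (q :* y))) refl a b q y)

module EulerRelations (R : CommutativeRing 0ℓ 0ℓ) (q : CommutativeRing.Carrier R) (k : ℕ)
  (q^K≈0 : RingCalculus.IsNilpotent R (suc k) q) where
  open RingCalculus R
  open ThetaSeries R
  private
    K : ℕ
    K = suc k

  minusProduct plusProduct : ℕ → Carrier
  minusProduct b = euler 1# K (q ^ b)
  plusProduct b = euler (- 1#) K (q ^ b)

  q≈q^1 : q ≈ q ^ 1
  q≈q^1 = sym (*-identityʳ q)

  theta-relation : ∀ b .{{_ : ℕ.NonZero b}} {t e⁻ e} → t ≈ thetaAt K (q ^ b) → e⁻ ≈ plusProduct b → e ≈ minusProduct b → t * e⁻ ≈ e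
  theta-relation (suc b) t≈ e⁻≈ e≈ =
    trans (*-cong t≈ e⁻≈) (trans (theta*euler k {q ^ suc b} (IsNilpotent-power {K} q^K≈0 b)) (sym e≈))

  theta-relation-1 : ∀ {t e⁻ e} → t ≈ thetaAt K q → e⁻ ≈ plusProduct 1 → e ≈ minusProduct 1 → t * e⁻ ≈ e
  theta-relation-1 t≈ = theta-relation 1 (trans t≈ (thetaAt-cong K q≈q^1))

  octagonal-relation : ∀ {o e₁⁻ e₆ e₃⁻} → o ≈ octagonalAt K q → e₁⁻ ≈ plusProduct 1 → e₆ ≈ minusProduct 6 → e₃⁻ ≈ plusProduct 3 →
    o * e₁⁻ ≈ e₆ * e₃⁻
  octagonal-relation o≈ e₁⁻≈ e₆≈ e₃⁻≈ = trans (*-cong o≈ (trans e₁⁻≈ (euler-cong (- 1#) K (sym q≈q^1))))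
    (trans (OctagonalProduct.octagonal*euler R q k q^K≈0) (sym (*-cong e₆≈ e₃⁻≈)))

  double-relation : ∀ {e₁ e₁⁻ e₂} → e₁ ≈ minusProduct 1 → e₁⁻ ≈ plusProduct 1 → e₂ ≈ minusProduct 2 → e₁ * e₁⁻ ≈ e₂
  double-relation e₁≈ e₁⁻≈ e₂≈ = trans (*-cong e₁≈ e₁⁻≈)
    (trans (euler-double K (q ^ 1)) (trans (euler-cong 1# K (sym (^-homo-* q 1 1))) (sym e₂≈)))

-- The ring of power series and its truncations

module ℤ-Calculus = RingCalculus ℤₚ.+-*-commutativeRing
open ℤ-Calculus using
  ( ∑; ∑-cong<; ∑-cong; ∑-zero<; ∑-+; ∑-head; ∑-split; ∑-extend; ∑-blocks; ∑-swap; ∑-reverse; ∑-triangle; ∑-*ˡ; ∑-*ʳ; ∑-neg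
  ; sign; sign-+; sign-*3; sign²≈1 )

Σ<-∑ : ∀ n f → Σ< n f ≡ ∑ n f
Σ<-∑ zero f = ≡.refl
Σ<-∑ (suc n) f = ≡.cong (ℤ._+ f n) (Σ<-∑ n f)

⊗-coeff : ∀ f g n → (f ⊗ g) n ≡ ∑ (suc n) (λ i → f i ℤ.* g (n ∸ i))
⊗-coeff f g n = Σ<-∑ (suc n) _

zeroPS : PS
zeroPS _ = + 0

negPS : PS → PS
negPS f n = ℤ.- f n

⊗-comm : ∀ f g → f ⊗ g ≗ g ⊗ f
⊗-comm f g n = begin
  (f ⊗ g) n                                             ≡⟨ ⊗-coeff f g n ⟩
  ∑ (suc n) (λ i → f i ℤ.* g (n ∸ i))                   ≡⟨ ∑-reverse n _ ⟩
  ∑ (suc n) (λ i → f (n ∸ i) ℤ.* g (n ∸ (n ∸ i)))       ≡⟨ ∑-cong< (suc n) (λ i i≤n → flip i (ℕₚ.≤-pred i≤n)) ⟩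
  ∑ (suc n) (λ i → g i ℤ.* f (n ∸ i))                   ≡⟨ ⊗-coeff g f n ⟨
  (g ⊗ f) n                                             ∎
  where
  open ≡.≡-Reasoning
  flip : ∀ i → i ℕ.≤ n → f (n ∸ i) ℤ.* g (n ∸ (n ∸ i)) ≡ g i ℤ.* f (n ∸ i)
  flip i i≤n = ≡.trans (ℤₚ.*-comm (f (n ∸ i)) _) (≡.cong (λ j → g j ℤ.* f (n ∸ i)) (ℕₚ.m∸[m∸n]≡n i≤n))

⊗-assoc : ∀ f g h → (f ⊗ g) ⊗ h ≗ f ⊗ (g ⊗ h)
⊗-assoc f g h n = begin
  ((f ⊗ g) ⊗ h) n
    ≡⟨ ⊗-coeff (f ⊗ g) h n ⟩
  ∑ (suc n) (λ i → (f ⊗ g) i ℤ.* h (n ∸ i))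
    ≡⟨ ∑-cong (suc n) (λ i → ≡.trans (≡.cong (ℤ._* h (n ∸ i)) (⊗-coeff f g i)) (≡.sym (∑-*ʳ (suc i) _ _))) ⟩
  ∑ (suc n) (λ i → ∑ (suc i) (λ j → f j ℤ.* g (i ∸ j) ℤ.* h (n ∸ i)))
    ≡⟨ ∑-triangle (suc n) _ ⟩
  ∑ (suc n) (λ j → ∑ (suc n ∸ j) (λ b → f j ℤ.* g (j ℕ.+ b ∸ j) ℤ.* h (n ∸ (j ℕ.+ b))))
    ≡⟨ ∑-cong< (suc n) (λ j j≤n → column j (ℕₚ.≤-pred j≤n)) ⟩
  ∑ (suc n) (λ j → f j ℤ.* (g ⊗ h) (n ∸ j))
    ≡⟨ ⊗-coeff f (g ⊗ h) n ⟨
  (f ⊗ (g ⊗ h)) n ∎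
  where
  open ≡.≡-Reasoning
  column : ∀ j → j ℕ.≤ n →
    ∑ (suc n ∸ j) (λ b → f j ℤ.* g (j ℕ.+ b ∸ j) ℤ.* h (n ∸ (j ℕ.+ b))) ≡ f j ℤ.* (g ⊗ h) (n ∸ j)
  column j j≤n = begin
    ∑ (suc n ∸ j) (λ b → f j ℤ.* g (j ℕ.+ b ∸ j) ℤ.* h (n ∸ (j ℕ.+ b)))
      ≡⟨ ≡.cong (λ l → ∑ l (λ b → f j ℤ.* g (j ℕ.+ b ∸ j) ℤ.* h (n ∸ (j ℕ.+ b)))) (ℕₚ.+-∸-assoc 1 j≤n) ⟩
    ∑ (suc (n ∸ j)) (λ b → f j ℤ.* g (j ℕ.+ b ∸ j) ℤ.* h (n ∸ (j ℕ.+ b)))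
      ≡⟨ ∑-cong (suc (n ∸ j)) (λ b → ≡.trans (ℤₚ.*-assoc (f j) _ _)
           (≡.cong (f j ℤ.*_) (≡.cong₂ (λ y z → g y ℤ.* h z) (ℕₚ.m+n∸m≡n j b) (≡.sym (ℕₚ.∸-+-assoc n j b))))) ⟩
    ∑ (suc (n ∸ j)) (λ b → f j ℤ.* (g b ℤ.* h (n ∸ j ∸ b)))
      ≡⟨ ∑-*ˡ (suc (n ∸ j)) (f j) _ ⟩
    f j ℤ.* ∑ (suc (n ∸ j)) (λ b → g b ℤ.* h (n ∸ j ∸ b))
      ≡⟨ ≡.cong (f j ℤ.*_) (⊗-coeff g h (n ∸ j)) ⟨
    f j ℤ.* (g ⊗ h) (n ∸ j) ∎

constPS-⊗ : ∀ {f} c g → f ≗ constPS c → ∀ n → (f ⊗ g) n ≡ c ℤ.* g n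
constPS-⊗ {f} c g f≗c n = begin
  (f ⊗ g) n                                                      ≡⟨ ⊗-coeff f g n ⟩
  ∑ (suc n) (λ i → f i ℤ.* g (n ∸ i))                            ≡⟨ ∑-head n _ ⟩
  f 0 ℤ.* g n ℤ.+ ∑ n (λ i → f (suc i) ℤ.* g (n ∸ suc i))        ≡⟨ ≡.cong₂ ℤ._+_ (≡.cong (ℤ._* g n) (f≗c 0))
                                                                      (∑-zero< n (λ i _ → ≡.cong (ℤ._* g (n ∸ suc i)) (f≗c (suc i)))) ⟩
  c ℤ.* g n ℤ.+ + 0                                              ≡⟨ ℤₚ.+-identityʳ (c ℤ.* g n) ⟩
  c ℤ.* g n                                                      ∎
  where open ≡.≡-Reasoning

⊗-identityˡ : ∀ f → onePS ⊗ f ≗ f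
⊗-identityˡ f n = ≡.trans (constPS-⊗ (+ 1) f (λ _ → ≡.refl) n) (ℤₚ.*-identityˡ (f n))

⊗-zeroʳ : ∀ f {g} → g ≗ zeroPS → f ⊗ g ≗ zeroPS
⊗-zeroʳ f {g} g≗0 n = ≡.trans (⊗-coeff f g n)
  (∑-zero< (suc n) (λ i _ → ≡.trans (≡.cong (f i ℤ.*_) (g≗0 (n ∸ i))) (ℤₚ.*-zeroʳ (f i))))

⊗-distribˡ : ∀ f g h → f ⊗ (g ⊕ h) ≗ (f ⊗ g) ⊕ (f ⊗ h)
⊗-distribˡ f g h n = begin
  (f ⊗ (g ⊕ h)) n
    ≡⟨ ⊗-coeff f (g ⊕ h) n ⟩
  ∑ (suc n) (λ i → f i ℤ.* (g (n ∸ i) ℤ.+ h (n ∸ i)))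
    ≡⟨ ∑-cong (suc n) (λ i → ℤₚ.*-distribˡ-+ (f i) _ _) ⟩
  ∑ (suc n) (λ i → f i ℤ.* g (n ∸ i) ℤ.+ f i ℤ.* h (n ∸ i))
    ≡⟨ ∑-+ (suc n) _ _ ⟩
  ∑ (suc n) (λ i → f i ℤ.* g (n ∸ i)) ℤ.+ ∑ (suc n) (λ i → f i ℤ.* h (n ∸ i))
    ≡⟨ ≡.cong₂ ℤ._+_ (⊗-coeff f g n) (⊗-coeff f h n) ⟨
  ((f ⊗ g) ⊕ (f ⊗ h)) n ∎
  where open ≡.≡-Reasoning

infix 4 _≈[_]_
record _≈[_]_ (f : PS) (P : ℕ → Set) (g : PS) : Set where
  constructor agree
  field at : ∀ i → P i → f i ≡ g i
open _≈[_]_ public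

≗⇒≈ : ∀ {P f g} → f ≗ g → f ≈[ P ] g
≗⇒≈ f≗g = agree (λ i _ → f≗g i)

DownwardClosed : (ℕ → Set) → Set
DownwardClosed P = ∀ {i j} → i ℕ.≤ j → P j → P i

⊗-cong-≈ : ∀ {P} → DownwardClosed P → ∀ {f f′ g g′} → f ≈[ P ] f′ → g ≈[ P ] g′ → f ⊗ g ≈[ P ] f′ ⊗ g′
⊗-cong-≈ down {f} {f′} {g} {g′} f≈f′ g≈g′ = agree λ n Pn → ≡.trans (⊗-coeff f g n) (≡.trans
  (∑-cong< (suc n) (λ i i≤n → ≡.cong₂ ℤ._*_
    (at f≈f′ i (down (ℕₚ.≤-pred i≤n) Pn)) (at g≈g′ (n ∸ i) (down (ℕₚ.m∸n≤m n i) Pn))))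
  (≡.sym (⊗-coeff f′ g′ n)))

⊗-cong : ∀ {f f′ g g′} → f ≗ f′ → g ≗ g′ → f ⊗ g ≗ f′ ⊗ g′
⊗-cong f≗f′ g≗g′ n = at (⊗-cong-≈ {λ _ → ⊤} (λ _ _ → tt) (≗⇒≈ f≗f′) (≗⇒≈ g≗g′)) n tt

PSRingOn : (P : ℕ → Set) → DownwardClosed P → CommutativeRing 0ℓ 0ℓ
PSRingOn P down = record
  { Carrier = PS ; _≈_ = _≈[ P ]_ ; _+_ = _⊕_ ; _*_ = _⊗_ ; -_ = negPS ; 0# = zeroPS ; 1# = onePS
  ; isCommutativeRing = record
    { isRing = record
      { +-isAbelianGroup = record
        { isGroup = record
          { isMonoid = record
            { isSemigroup = record
              { isMagma = record
                { isEquivalence = record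
                  { refl = ≗⇒≈ (λ _ → ≡.refl)
                  ; sym = λ f≈g → agree λ i Pi → ≡.sym (at f≈g i Pi)
                  ; trans = λ f≈g g≈h → agree λ i Pi → ≡.trans (at f≈g i Pi) (at g≈h i Pi) }
                ; ∙-cong = λ f≈f′ g≈g′ → agree λ i Pi → ≡.cong₂ ℤ._+_ (at f≈f′ i Pi) (at g≈g′ i Pi) }
              ; assoc = λ f g h → ≗⇒≈ λ i → ℤₚ.+-assoc (f i) (g i) (h i) }
            ; identity = (λ f → ≗⇒≈ λ i → ℤₚ.+-identityˡ (f i)) , (λ f → ≗⇒≈ λ i → ℤₚ.+-identityʳ (f i)) }
          ; inverse = (λ f → ≗⇒≈ λ i → ℤₚ.+-inverseˡ (f i)) , (λ f → ≗⇒≈ λ i → ℤₚ.+-inverseʳ (f i))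
          ; ⁻¹-cong = λ f≈g → agree λ i Pi → ≡.cong ℤ.-_ (at f≈g i Pi) }
        ; comm = λ f g → ≗⇒≈ λ i → ℤₚ.+-comm (f i) (g i) }
      ; *-cong = ⊗-cong-≈ down
      ; *-assoc = λ f g h → ≗⇒≈ (⊗-assoc f g h)
      ; *-identity = (λ f → ≗⇒≈ (⊗-identityˡ f)) , (λ f → ≗⇒≈ λ i → ≡.trans (⊗-comm f onePS i) (⊗-identityˡ f i))
      ; distrib = (λ f g h → ≗⇒≈ (⊗-distribˡ f g h))
                , (λ f g h → ≗⇒≈ λ i → ≡.trans (⊗-comm (g ⊕ h) f i)
                    (≡.trans (⊗-distribˡ f g h i) (≡.cong₂ ℤ._+_ (⊗-comm f g i) (⊗-comm f h i)))) }
    ; *-comm = λ f g → ≗⇒≈ (⊗-comm f g) } }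

TruncatedPS : ℕ → CommutativeRing 0ℓ 0ℓ
TruncatedPS K = PSRingOn (ℕ._< K) ℕₚ.≤-<-trans

FullPS : CommutativeRing 0ℓ 0ℓ
FullPS = PSRingOn (λ _ → ⊤) (λ _ _ → tt)

infix 4 _≈⟨<_⟩_ _≈∞_
_≈⟨<_⟩_ : PS → ℕ → PS → Set
f ≈⟨< K ⟩ g = CommutativeRing._≈_ (TruncatedPS K) f g

_≈∞_ : PS → PS → Set
_≈∞_ = CommutativeRing._≈_ FullPS

≈∞⇒≗ : ∀ {f g} → f ≈∞ g → f ≗ g
≈∞⇒≗ f≈g n = at f≈g n tt

≈∞⇒≈< : ∀ {f g} K → f ≈∞ g → f ≈⟨< K ⟩ g
≈∞⇒≈< K f≈g = agree (λ n _ → at f≈g n tt)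

≈<⇒≈∞ : ∀ {f g} → (∀ k → f ≈⟨< suc k ⟩ g) → f ≈∞ g
≈<⇒≈∞ f≈g = agree (λ n _ → at (f≈g n) n ℕₚ.≤-refl)

X : PS
X = mono (+ 1) 1

X⊗-suc : ∀ f n → (X ⊗ f) (suc n) ≡ f n
X⊗-suc f n = begin
  (X ⊗ f) (suc n)                                        ≡⟨ ⊗-coeff X f (suc n) ⟩
  ∑ (suc (suc n)) (λ i → X i ℤ.* f (suc n ∸ i))          ≡⟨ ∑-head (suc n) _ ⟩
  + 0 ℤ.+ ∑ (suc n) (λ i → X (suc i) ℤ.* f (n ∸ i))      ≡⟨ ℤₚ.+-identityˡ _ ⟩
  ∑ (suc n) (λ i → X (suc i) ℤ.* f (n ∸ i))              ≡⟨ ∑-cong (suc n) (λ { zero → ≡.refl ; (suc i) → ≡.refl }) ⟩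
  ∑ (suc n) (λ i → onePS i ℤ.* f (n ∸ i))                ≡⟨ ⊗-coeff onePS f n ⟨
  (onePS ⊗ f) n                                          ≡⟨ ⊗-identityˡ f n ⟩
  f n                                                    ∎
  where open ≡.≡-Reasoning

module TruncatedCalculus (K : ℕ) = RingCalculus (TruncatedPS K)

X^ : ℕ → ℕ → PS
X^ K e = TruncatedCalculus._^_ K X e

X^-mono : ∀ K e → X^ K e ≗ mono (+ 1) e
X^-mono K zero zero = ≡.refl
X^-mono K zero (suc n) = ≡.refl
X^-mono K (suc e) zero = ≡.refl
X^-mono K (suc e) (suc n) = ≡.trans (X⊗-suc (X^ K e) n) (X^-mono K e n)

mono-< : ∀ c {e n} → n ℕ.< e → mono c e n ≡ + 0
mono-< c {suc e} {zero} _ = ≡.refl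
mono-< c {suc e} {suc n} (s≤s n<e) = mono-< c {e} {n} n<e

X-nilpotent : ∀ K → TruncatedCalculus.IsNilpotent K K X
X-nilpotent K = agree λ i i<K → ≡.trans (X^-mono K K i) (mono-< (+ 1) i<K)

module RankCoefficients (k : ℕ) where
  private
    K = suc k
  open Eisenstein (TruncatedPS K)
  open CubicRankSeries (TruncatedPS K) X k (X-nilpotent K) public
    using (lambertSeries; lambertTerm; lambertTerm-expand; cubicRankSeries; theta*cubicRankSeries)
  private
    eval : PS × PS → ℤ
    eval (f , g) = f k ℤ.- g k

    eval-cong : ∀ {x y} → x ≈ᵉ y → eval x ≡ eval y
    eval-cong x≈y = ≡.cong₂ ℤ._-_ (at (re x≈y) k ℕₚ.≤-refl) (at (im x≈y) k ℕₚ.≤-refl)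

    eval-+ : ∀ x y → eval (x +ᵉ y) ≡ eval x ℤ.+ eval y
    eval-+ (f , g) (f′ , g′) = regroup (f k) (f′ k) (g k) (g′ k)
      where
      regroup : ∀ a b c d → (a ℤ.+ b) ℤ.- (c ℤ.+ d) ≡ (a ℤ.- c) ℤ.+ (b ℤ.- d)
      regroup = ℤ-solve-∀

    eval-isMonoidHomomorphism : IsMonoidHomomorphism (CommutativeRing.+-rawMonoid eisensteinRing) ℤ.+-0-rawMonoid eval
    eval-isMonoidHomomorphism = record
      { isMagmaHomomorphism = record { isRelHomomorphism = record { cong = eval-cong } ; homo = eval-+ } ; ε-homo = ≡.refl }

    eval-ω : ∀ y → eval (ω *ᵉ ι y) ≡ ℤ.- y k
    eval-ω y = ≡.trans (eval-cong (ω*ι y)) (ℤₚ.+-identityˡ (ℤ.- y k))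

    eval-ω² : ∀ y → eval (ω *ᵉ (ω *ᵉ ι y)) ≡ + 0
    eval-ω² y = ≡.trans (eval-cong (ω*ω*ι y)) (ℤₚ.+-inverseʳ (ℤ.- y k))

  cubicRankSeries-Nbar : ∀ m → k ≡ suc m → cubicRankSeries k ≡ + Nbar (+ 0) 3 (suc m) ℤ.- + Nbar (+ 1) 3 (suc m)
  cubicRankSeries-Nbar m ≡.refl = RankFunctional.cubicRankSeries-coeff (TruncatedPS K) eisensteinRing ι-isRingHomomorphism
    ω ω-primitive X k (X-nilpotent K) {λ f → f k} eval-isMonoidHomomorphism (λ y → ℤₚ.+-identityʳ (y k)) eval-ω eval-ω²
    m ≡.refl (λ s → X^-mono K s k)

open import Data.Integer using (_+_; _*_; _-_; -_; _≟_)
open import Relation.Binary.PropositionalEquality using (refl; sym; trans; cong; cong₂)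

<-∣+∣ : ∀ {m n} c x → ∣ c ∣ ℕ.≤ n → m ℕ.+ n ℕ.< ∣ x ∣ → m ℕ.< ∣ c + x ∣
<-∣+∣ {m} {n} c x ∣c∣≤n m+n<∣x∣ = ℕₚ.+-cancelʳ-< n m ∣ c + x ∣ (begin-strict
  m ℕ.+ n               <⟨ m+n<∣x∣ ⟩
  ∣ x ∣                 ≡⟨ cong ∣_∣ (cancel c x) ⟩
  ∣ c + x - c ∣         ≤⟨ ℤₚ.∣i-j∣≤∣i∣+∣j∣ (c + x) c ⟩
  ∣ c + x ∣ ℕ.+ ∣ c ∣   ≤⟨ ℕₚ.+-monoʳ-≤ ∣ c + x ∣ ∣c∣≤n ⟩
  ∣ c + x ∣ ℕ.+ n       ∎)
  where
  open ℕₚ.≤-Reasoning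
  cancel : ∀ c x → x ≡ c + x - c
  cancel = ℤ-solve-∀

∣suc-suc∣≤ : ∀ i j {N} → i ℕ.< N → j ℕ.< N → ∣ + suc j - + suc i ∣ ℕ.≤ N
∣suc-suc∣≤ i j {N} i<N j<N = begin
  ∣ + suc j - + suc i ∣     ≡⟨ cong ∣_∣ (ℤₚ.m-n≡m⊖n (suc j) (suc i)) ⟩
  ∣ suc j ℤ.⊖ suc i ∣       ≤⟨ ℤₚ.∣m⊝n∣≤m⊔n (suc j) (suc i) ⟩
  suc j ⊔ suc i             ≤⟨ ℕₚ.⊔-lub j<N i<N ⟩
  N                         ∎
  where open ℕₚ.≤-Reasoning

open ≡.≡-Reasoning

-- Residues modulo 3

ℤ/3 : Set
ℤ/3 = Fin 3

infix 4 _≟₃_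
_≟₃_ : (x y : ℤ/3) → Dec (x ≡ y)
_≟₃_ = Finₚ._≟_

suc₃ : ℤ/3 → ℤ/3
suc₃ 0F = 1F
suc₃ 1F = 2F
suc₃ 2F = 0F

infixl 6 _+₃_
infixl 7 _*₃_
infix 8 -₃_
_+₃_ _*₃_ : ℤ/3 → ℤ/3 → ℤ/3
0F +₃ y = y
1F +₃ y = suc₃ y
2F +₃ y = suc₃ (suc₃ y)
0F *₃ y = 0F
1F *₃ y = y
2F *₃ y = y +₃ y

-₃_ : ℤ/3 → ℤ/3
-₃ x = 2F *₃ x

mod₃ℕ : ℕ → ℤ/3
mod₃ℕ zero = 0F
mod₃ℕ (suc n) = suc₃ (mod₃ℕ n)

mod₃ : ℤ → ℤ/3
mod₃ (+ n) = mod₃ℕ n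
mod₃ -[1+ n ] = -₃ mod₃ℕ (suc n)

mod₃-suc : ∀ x → mod₃ (x + + 1) ≡ suc₃ (mod₃ x)
mod₃-suc (+ n) = cong mod₃ℕ (ℕₚ.+-comm n 1)
mod₃-suc -[1+ zero ] = refl
mod₃-suc -[1+ suc n ] = from-yes (Finₚ.all? λ a → -₃ suc₃ a ≟₃ suc₃ (-₃ suc₃ (suc₃ a))) (mod₃ℕ n)

mod₃-+-pos : ∀ x n → mod₃ (x + + n) ≡ mod₃ x +₃ mod₃ℕ n
mod₃-+-pos x zero = trans (cong mod₃ (ℤₚ.+-identityʳ x)) (from-yes (Finₚ.all? λ a → a ≟₃ (a +₃ 0F)) (mod₃ x))
mod₃-+-pos x (suc n) = begin
  mod₃ (x + (+ 1 + + n))         ≡⟨ cong mod₃ (regroup x (+ n)) ⟩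
  mod₃ (x + + n + + 1)           ≡⟨ mod₃-suc (x + + n) ⟩
  suc₃ (mod₃ (x + + n))          ≡⟨ cong suc₃ (mod₃-+-pos x n) ⟩
  suc₃ (mod₃ x +₃ mod₃ℕ n)       ≡⟨ from-yes (Finₚ.all? λ a → Finₚ.all? λ b → suc₃ (a +₃ b) ≟₃ (a +₃ suc₃ b)) (mod₃ x) (mod₃ℕ n) ⟩
  mod₃ x +₃ suc₃ (mod₃ℕ n)       ∎
  where
  regroup : ∀ x n → x + (+ 1 + n) ≡ x + n + + 1
  regroup = ℤ-solve-∀

-₃-involutive : ∀ a → a ≡ -₃ -₃ a
-₃-involutive = from-yes (Finₚ.all? λ a → a ≟₃ -₃ -₃ a)

mod₃-neg : ∀ x → mod₃ (- x) ≡ -₃ mod₃ x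
mod₃-neg (+ zero) = refl
mod₃-neg (+ suc n) = refl
mod₃-neg -[1+ n ] = -₃-involutive (mod₃ℕ (suc n))

mod₃-+ : ∀ x y → mod₃ (x + y) ≡ mod₃ x +₃ mod₃ y
mod₃-+ x (+ n) = mod₃-+-pos x n
mod₃-+ x -[1+ n ] = begin
  mod₃ (x - + suc n)                                           ≡⟨ cancel (mod₃ (x - + suc n)) (mod₃ℕ (suc n)) ⟩
  mod₃ (x - + suc n) +₃ mod₃ℕ (suc n) +₃ -₃ mod₃ℕ (suc n)      ≡⟨ cong (_+₃ -₃ mod₃ℕ (suc n)) (mod₃-+-pos (x - + suc n) (suc n)) ⟨
  mod₃ (x - + suc n + + suc n) +₃ -₃ mod₃ℕ (suc n)             ≡⟨ cong (λ z → mod₃ z +₃ -₃ mod₃ℕ (suc n)) (regroup x (+ suc n)) ⟩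
  mod₃ x +₃ -₃ mod₃ℕ (suc n)                                   ∎
  where
  cancel : ∀ a b → a ≡ a +₃ b +₃ -₃ b
  cancel = from-yes (Finₚ.all? λ a → Finₚ.all? λ b → a ≟₃ a +₃ b +₃ -₃ b)
  regroup : ∀ x n → x - n + n ≡ x
  regroup = ℤ-solve-∀

mod₃-minus : ∀ x y → mod₃ (x - y) ≡ mod₃ x +₃ -₃ mod₃ y
mod₃-minus x y = trans (mod₃-+ x (- y)) (cong (mod₃ x +₃_) (mod₃-neg y))

mod₃-*-pos : ∀ x n → mod₃ (x * + n) ≡ mod₃ x *₃ mod₃ℕ n
mod₃-*-pos x zero = trans (cong mod₃ (ℤₚ.*-zeroʳ x)) (from-yes (Finₚ.all? λ a → 0F ≟₃ (a *₃ 0F)) (mod₃ x))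
mod₃-*-pos x (suc n) = begin
  mod₃ (x * (+ 1 + + n))             ≡⟨ cong mod₃ (expand x (+ n)) ⟩
  mod₃ (x + x * + n)                 ≡⟨ mod₃-+ x (x * + n) ⟩
  mod₃ x +₃ mod₃ (x * + n)           ≡⟨ cong (mod₃ x +₃_) (mod₃-*-pos x n) ⟩
  mod₃ x +₃ mod₃ x *₃ mod₃ℕ n        ≡⟨ from-yes (Finₚ.all? λ a → Finₚ.all? λ b → (a +₃ a *₃ b) ≟₃ (a *₃ suc₃ b)) (mod₃ x) (mod₃ℕ n) ⟩
  mod₃ x *₃ suc₃ (mod₃ℕ n)           ∎
  where
  expand : ∀ x n → x * (+ 1 + n) ≡ x + x * n
  expand = ℤ-solve-∀

mod₃-* : ∀ x y → mod₃ (x * y) ≡ mod₃ x *₃ mod₃ y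
mod₃-* x (+ n) = mod₃-*-pos x n
mod₃-* x -[1+ n ] = begin
  mod₃ (x * -[1+ n ])                ≡⟨ cong mod₃ (ℤₚ.neg-distribʳ-* x (+ suc n)) ⟨
  mod₃ (- (x * + suc n))             ≡⟨ mod₃-neg (x * + suc n) ⟩
  -₃ mod₃ (x * + suc n)              ≡⟨ cong -₃_ (mod₃-*-pos x (suc n)) ⟩
  -₃ (mod₃ x *₃ mod₃ℕ (suc n))       ≡⟨ from-yes (Finₚ.all? λ a → Finₚ.all? λ b → (-₃ (a *₃ b)) ≟₃ (a *₃ (-₃ b))) (mod₃ x) (mod₃ℕ (suc n)) ⟩
  mod₃ x *₃ (-₃ mod₃ℕ (suc n))       ∎

mod₃ℕ-+ : ∀ m n → mod₃ℕ (m ℕ.+ n) ≡ mod₃ℕ m +₃ mod₃ℕ n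
mod₃ℕ-+ m n = mod₃-+ (+ m) (+ n)

mod₃ℕ-* : ∀ m n → mod₃ℕ (m ℕ.* n) ≡ mod₃ℕ m *₃ mod₃ℕ n
mod₃ℕ-* m n = trans (cong mod₃ (ℤₚ.pos-* m n)) (mod₃-* (+ m) (+ n))

suc₃³ : ∀ a → suc₃ (suc₃ (suc₃ a)) ≡ a
suc₃³ = from-yes (Finₚ.all? λ a → suc₃ (suc₃ (suc₃ a)) ≟₃ a)

mod₃ℕ-*3+ : ∀ t r → mod₃ℕ (t ℕ.* 3 ℕ.+ r) ≡ mod₃ℕ r
mod₃ℕ-*3+ zero r = refl
mod₃ℕ-*3+ (suc t) r = trans (suc₃³ (mod₃ℕ (t ℕ.* 3 ℕ.+ r))) (mod₃ℕ-*3+ t r)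

mod₃ℕ-*3 : ∀ t → mod₃ℕ (t ℕ.* 3) ≡ 0F
mod₃ℕ-*3 t = trans (cong mod₃ℕ (sym (ℕₚ.+-identityʳ (t ℕ.* 3)))) (mod₃ℕ-*3+ t 0)

mod₃ℕ≡0⇒∃*3 : ∀ n → mod₃ℕ n ≡ 0F → ∃ λ t → n ≡ t ℕ.* 3
mod₃ℕ≡0⇒∃*3 0 _ = 0 , refl
mod₃ℕ≡0⇒∃*3 (suc (suc (suc n))) n≡0 with mod₃ℕ≡0⇒∃*3 n (trans (sym (suc₃³ (mod₃ℕ n))) n≡0)
... | t , refl = suc t , refl

mod₃-root : ∀ k → mod₃ (k * k) ≡ 0F → mod₃ k ≡ 0F
mod₃-root k k²≡0 = from-yes (Finₚ.all? λ a → a *₃ a ≟₃ 0F →-dec a ≟₃ 0F) (mod₃ k) (trans (sym (mod₃-* k k)) k²≡0)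

χ₃ ε₃ : ℤ/3 → ℤ
χ₃ 0F = + 0
χ₃ 1F = + 1
χ₃ 2F = -[1+ 0 ]
ε₃ 0F = + 1
ε₃ 1F = -[1+ 0 ]
ε₃ 2F = -[1+ 0 ]

ψ₃ : ℤ/3 → ℤ/3 → ℤ
ψ₃ 0F b = χ₃ b
ψ₃ a@1F b = χ₃ a
ψ₃ a@2F b = χ₃ a

χ ε : ℤ → ℤ
χ x = χ₃ (mod₃ x)
ε x = ε₃ (mod₃ x)

-- The genus character of the form [2a , 2k , −b], whose determinant −(k² + 2ab) is divisible by 3 wherever ψ is used
ψ : ℤ → ℤ → ℤ
ψ a b = ψ₃ (mod₃ a) (mod₃ b)

disc : ℤ → ℤ → ℤ → ℤ
disc k a b = k * k + + 2 * a * b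

disc₃ : ℤ/3 → ℤ/3 → ℤ/3 → ℤ/3
disc₃ k a b = k *₃ k +₃ 2F *₃ a *₃ b

mod₃-disc : ∀ k a b → mod₃ (disc k a b) ≡ disc₃ (mod₃ k) (mod₃ a) (mod₃ b)
mod₃-disc k a b = begin
  mod₃ (k * k + + 2 * a * b)                         ≡⟨ mod₃-+ (k * k) (+ 2 * a * b) ⟩
  mod₃ (k * k) +₃ mod₃ (+ 2 * a * b)                 ≡⟨ cong₂ _+₃_ (mod₃-* k k) (mod₃-* (+ 2 * a) b) ⟩
  mod₃ k *₃ mod₃ k +₃ mod₃ (+ 2 * a) *₃ mod₃ b       ≡⟨ cong (λ z → mod₃ k *₃ mod₃ k +₃ z *₃ mod₃ b) (mod₃-* (+ 2) a) ⟩
  disc₃ (mod₃ k) (mod₃ a) (mod₃ b)                   ∎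

mod₃-disc-slanted : ∀ j b m → mod₃ (disc (j + b) (m - j) b) ≡ disc₃ (mod₃ j +₃ mod₃ b) (mod₃ m +₃ -₃ mod₃ j) (mod₃ b)
mod₃-disc-slanted j b m = trans (mod₃-disc (j + b) (m - j) b) (cong₂ (λ k a → disc₃ k a (mod₃ b)) (mod₃-+ j b) (mod₃-minus m j))

ψ-sym : ∀ k a b → mod₃ (disc k a b) ≡ 0F → ψ a b ≡ ψ b a
ψ-sym k a b disc≡0 = from-yes (Finₚ.all? λ k → Finₚ.all? λ a → Finₚ.all? λ b →
  disc₃ k a b ≟₃ 0F →-dec ψ₃ a b ≟ ψ₃ b a) (mod₃ k) (mod₃ a) (mod₃ b) (trans (sym (mod₃-disc k a b)) disc≡0)

ψ-neg : ∀ a b → ψ (- a) b ≡ - ψ a (- b)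
ψ-neg a b = trans (cong (λ z → ψ₃ z (mod₃ b)) (mod₃-neg a)) (trans (table (mod₃ a) (mod₃ b))
  (cong (λ z → - ψ₃ (mod₃ a) z) (sym (mod₃-neg b))))
  where
  table : ∀ a b → ψ₃ (-₃ a) b ≡ - ψ₃ a (-₃ b)
  table = from-yes (Finₚ.all? λ a → Finₚ.all? λ b → ψ₃ (-₃ a) b ≟ - ψ₃ a (-₃ b))

ψ-reflect : ∀ j b m → mod₃ (disc (j + b) (m - j) b) ≡ 0F → ψ (m - j) b ≡ ψ (m + j) b
ψ-reflect j b m disc≡0 = begin
  ψ (m - j) b                            ≡⟨ cong (λ z → ψ₃ z (mod₃ b)) (mod₃-minus m j) ⟩
  ψ₃ (mod₃ m +₃ -₃ mod₃ j) (mod₃ b)    ≡⟨ table (mod₃ j) (mod₃ b) (mod₃ m) (trans (sym (mod₃-disc-slanted j b m)) disc≡0) ⟩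
  ψ₃ (mod₃ m +₃ mod₃ j) (mod₃ b)         ≡⟨ cong (λ z → ψ₃ z (mod₃ b)) (mod₃-+ m j) ⟨
  ψ (m + j) b                            ∎
  where
  table : ∀ j b m → disc₃ (j +₃ b) (m +₃ -₃ j) b ≡ 0F → ψ₃ (m +₃ -₃ j) b ≡ ψ₃ (m +₃ j) b
  table = from-yes (Finₚ.all? λ j → Finₚ.all? λ b → Finₚ.all? λ m →
    disc₃ (j +₃ b) (m +₃ -₃ j) b ≟₃ 0F →-dec ψ₃ (m +₃ -₃ j) b ≟ ψ₃ (m +₃ j) b)

ψ-balanced : ∀ a b → mod₃ (disc (b - a) a b) ≡ 0F → ψ a b ≡ + 0
ψ-balanced a b disc≡0 = table (mod₃ a) (mod₃ b) (trans (sym residue) disc≡0)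
  where
  table : ∀ a b → disc₃ (b +₃ -₃ a) a b ≡ 0F → ψ₃ a b ≡ + 0
  table = from-yes (Finₚ.all? λ a → Finₚ.all? λ b → disc₃ (b +₃ -₃ a) a b ≟₃ 0F →-dec ψ₃ a b ≟ + 0)
  residue : mod₃ (disc (b - a) a b) ≡ disc₃ (mod₃ b +₃ -₃ mod₃ a) (mod₃ a) (mod₃ b)
  residue = trans (mod₃-disc (b - a) a b) (cong (λ k → disc₃ k (mod₃ a) (mod₃ b)) (mod₃-minus b a))

-- Finite sums over ℤ

-- Opaque, so that arguments can be inferred.
opaque
  δ : ℤ → ℤ → ℤ
  δ x y = indicator (does (x ≟ y))

  *-δ-cong : ∀ {x y f g} → (x ≡ y → f ≡ g) → f * δ x y ≡ g * δ x y
  *-δ-cong {x} {y} {f} {g} f≡g with x ≟ y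
  ... | yes x≡y = cong (_* + 1) (f≡g x≡y)
  ... | no _ = trans (ℤₚ.*-zeroʳ f) (sym (ℤₚ.*-zeroʳ g))

  δ-≢ : ∀ {x y} → x ≢ y → δ x y ≡ + 0
  δ-≢ {x} {y} x≢y = cong indicator (dec-false (x ≟ y) x≢y)

  δ-refl : ∀ x → δ x x ≡ + 1
  δ-refl x = cong indicator (dec-true (x ≟ x) refl)

  δ-⇔ : ∀ {x y x′ y′} → (x ≡ y → x′ ≡ y′) → (x′ ≡ y′ → x ≡ y) → δ x y ≡ δ x′ y′
  δ-⇔ {x} {y} {x′} {y′} to from = cong indicator (does-⇔ (mk⇔ to from) (x ≟ y) (x′ ≟ y′))

*-δ-≢ : ∀ f {x y} → x ≢ y → f * δ x y ≡ + 0
*-δ-≢ f x≢y = trans (cong (f *_) (δ-≢ x≢y)) (ℤₚ.*-zeroʳ f)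

δ-transpose : ∀ k x n → δ x (n - k) ≡ δ (k + x) n
δ-transpose k x n = δ-⇔ (λ x≡n-k → trans (cong (λ z → k + z) x≡n-k) (cancelʳ k n)) (λ k+x≡n → trans (cancelˡ k x) (cong (_- k) k+x≡n))
  where
  cancelʳ : ∀ k n → k + (n - k) ≡ n
  cancelʳ = ℤ-solve-∀
  cancelˡ : ∀ k x → x ≡ k + x - k
  cancelˡ = ℤ-solve-∀

x≡-x⇒x≡0 : ∀ x → x ≡ - x → x ≡ + 0
x≡-x⇒x≡0 (+ zero) _ = refl

opaque
  ∑⁺ : ℕ → (ℤ → ℤ) → ℤ
  ∑⁺ N f = ∑ N (λ i → f (+ suc i))

  ∑⁺-∑ : ∀ N f → ∑⁺ N f ≡ ∑ N (λ i → f (+ suc i))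
  ∑⁺-∑ N f = refl

  ∑⁺-cong< : ∀ N {f g} → (∀ i → i ℕ.< N → f (+ suc i) ≡ g (+ suc i)) → ∑⁺ N f ≡ ∑⁺ N g
  ∑⁺-cong< N f≡g = ∑-cong< N f≡g

  ∑⁺-+ : ∀ N f g → ∑⁺ N (λ x → f x + g x) ≡ ∑⁺ N f + ∑⁺ N g
  ∑⁺-+ N f g = ∑-+ N _ _

  ∑⁺-*ˡ : ∀ N c f → ∑⁺ N (λ x → c * f x) ≡ c * ∑⁺ N f
  ∑⁺-*ˡ N c f = ∑-*ˡ N c _

  ∑⁺-neg : ∀ N f → ∑⁺ N (λ x → - f x) ≡ - ∑⁺ N f
  ∑⁺-neg N f = ∑-neg N _

  ∑⁺-swap : ∀ M N (f : ℤ → ℤ → ℤ) → ∑⁺ M (λ x → ∑⁺ N (f x)) ≡ ∑⁺ N (λ y → ∑⁺ M (λ x → f x y))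
  ∑⁺-swap M N f = ∑-swap M N (λ i j → f (+ suc i) (+ suc j))

  ∑⁺-head : ∀ N f → ∑⁺ (suc N) f ≡ f (+ 1) + ∑⁺ N (λ x → f (+ 1 + x))
  ∑⁺-head N f = ∑-head N _

  ∑⁺-last : ∀ N f → ∑⁺ (suc N) f ≡ ∑⁺ N f + f (+ suc N)
  ∑⁺-last N f = refl

  ∑⁺-extend : ∀ {M N} f → (∀ i → M ℕ.≤ i → f (+ suc i) ≡ + 0) → M ℕ.≤ N → ∑⁺ N f ≡ ∑⁺ M f
  ∑⁺-extend f tail≡0 M≤N = ∑-extend _ tail≡0 M≤N

∑⁺-cong : ∀ N {f g} → (∀ x → f x ≡ g x) → ∑⁺ N f ≡ ∑⁺ N g
∑⁺-cong N f≡g = ∑⁺-cong< N (λ i _ → f≡g (+ suc i))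

∑⁺-zero : ∀ N {f} → (∀ i → i ℕ.< N → f (+ suc i) ≡ + 0) → ∑⁺ N f ≡ + 0
∑⁺-zero N {f} f≡0 = trans (∑⁺-∑ N f) (∑-zero< N f≡0)

∑⁺² : ℕ → (ℤ → ℤ → ℤ) → ℤ
∑⁺² N f = ∑⁺ N (λ x → ∑⁺ N (f x))

∑⁺²-cong< : ∀ N {f g} → (∀ i j → i ℕ.< N → j ℕ.< N → f (+ suc i) (+ suc j) ≡ g (+ suc i) (+ suc j)) → ∑⁺² N f ≡ ∑⁺² N g
∑⁺²-cong< N f≡g = ∑⁺-cong< N (λ i i<N → ∑⁺-cong< N (λ j j<N → f≡g i j i<N j<N))

∑⁺²-cong : ∀ N {f g} → (∀ x y → f x y ≡ g x y) → ∑⁺² N f ≡ ∑⁺² N g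
∑⁺²-cong N f≡g = ∑⁺-cong N (λ x → ∑⁺-cong N (f≡g x))

∑⁺²-zero : ∀ N {f} → (∀ i j → f (+ suc i) (+ suc j) ≡ + 0) → ∑⁺² N f ≡ + 0
∑⁺²-zero N f≡0 = ∑⁺-zero N (λ i _ → ∑⁺-zero N (λ j _ → f≡0 i j))

∑⁺²-+ : ∀ N f g → ∑⁺² N (λ x y → f x y + g x y) ≡ ∑⁺² N f + ∑⁺² N g
∑⁺²-+ N f g = trans (∑⁺-cong N (λ x → ∑⁺-+ N (f x) (g x))) (∑⁺-+ N _ _)

∑⁺²-*ˡ : ∀ N c f → ∑⁺² N (λ x y → c * f x y) ≡ c * ∑⁺² N f
∑⁺²-*ˡ N c f = trans (∑⁺-cong N (λ x → ∑⁺-*ˡ N c (f x))) (∑⁺-*ˡ N c _)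

∑⁺²-neg : ∀ N f → ∑⁺² N (λ x y → - f x y) ≡ - ∑⁺² N f
∑⁺²-neg N f = trans (∑⁺-cong N (λ x → ∑⁺-neg N (f x))) (∑⁺-neg N _)

∑⁺²-antisym : ∀ N f → (∀ x y → f x y ≡ - f y x) → ∑⁺² N f ≡ + 0
∑⁺²-antisym N f f-antisym = x≡-x⇒x≡0 _ (begin
  ∑⁺² N f                       ≡⟨ ∑⁺²-cong N f-antisym ⟩
  ∑⁺² N (λ x y → - f y x)       ≡⟨ ∑⁺²-neg N (λ x y → f y x) ⟩
  - ∑⁺² N (λ x y → f y x)       ≡⟨ cong -_ (∑⁺-swap N N (λ x y → f y x)) ⟩
  - ∑⁺² N f                     ∎)

opaque
  ∑± : ℕ → (ℤ → ℤ) → ℤ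
  ∑± N f = f (+ 0) + (∑⁺ N f + ∑⁺ N (λ m → f (- m)))

  ∑±-unfold : ∀ N f → ∑± N f ≡ f (+ 0) + (∑⁺ N f + ∑⁺ N (λ m → f (- m)))
  ∑±-unfold N f = refl

∑±-cong : ∀ N {f g} → (∀ x → f x ≡ g x) → ∑± N f ≡ ∑± N g
∑±-cong N {f} {g} f≡g = begin
  ∑± N f                                            ≡⟨ ∑±-unfold N f ⟩
  f (+ 0) + (∑⁺ N f + ∑⁺ N (λ m → f (- m)))         ≡⟨ cong₂ _+_ (f≡g (+ 0)) (cong₂ _+_ (∑⁺-cong N f≡g) (∑⁺-cong N (λ m → f≡g (- m)))) ⟩
  g (+ 0) + (∑⁺ N g + ∑⁺ N (λ m → g (- m)))         ≡⟨ ∑±-unfold N g ⟨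
  ∑± N g                                            ∎

∑±-zero : ∀ N {f} → (∀ x → f x ≡ + 0) → ∑± N f ≡ + 0
∑±-zero N {f} f≡0 = trans (∑±-unfold N f) (cong₂ _+_ (f≡0 (+ 0)) (cong₂ _+_ (∑⁺-zero N (λ _ _ → f≡0 _)) (∑⁺-zero N (λ _ _ → f≡0 _))))

∑±-+ : ∀ N f g → ∑± N (λ x → f x + g x) ≡ ∑± N f + ∑± N g
∑±-+ N f g = begin
  ∑± N (λ x → f x + g x)
    ≡⟨ ∑±-unfold N _ ⟩
  f (+ 0) + g (+ 0) + (∑⁺ N (λ x → f x + g x) + ∑⁺ N (λ m → f (- m) + g (- m)))
    ≡⟨ cong (λ z → f (+ 0) + g (+ 0) + z) (cong₂ _+_ (∑⁺-+ N f g) (∑⁺-+ N (λ m → f (- m)) (λ m → g (- m)))) ⟩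
  f (+ 0) + g (+ 0) + (∑⁺ N f + ∑⁺ N g + (∑⁺ N (λ m → f (- m)) + ∑⁺ N (λ m → g (- m))))
    ≡⟨ regroup (f (+ 0)) (g (+ 0)) (∑⁺ N f) (∑⁺ N g) _ _ ⟩
  f (+ 0) + (∑⁺ N f + ∑⁺ N (λ m → f (- m))) + (g (+ 0) + (∑⁺ N g + ∑⁺ N (λ m → g (- m))))
    ≡⟨ cong₂ _+_ (∑±-unfold N f) (∑±-unfold N g) ⟨
  ∑± N f + ∑± N g ∎
  where
  regroup : ∀ a b c d e h → a + b + (c + d + (e + h)) ≡ a + (c + e) + (b + (d + h))
  regroup = ℤ-solve-∀

∑±-*ˡ : ∀ N c f → ∑± N (λ x → c * f x) ≡ c * ∑± N f
∑±-*ˡ N c f = begin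
  ∑± N (λ x → c * f x)
    ≡⟨ ∑±-unfold N _ ⟩
  c * f (+ 0) + (∑⁺ N (λ x → c * f x) + ∑⁺ N (λ m → c * f (- m)))
    ≡⟨ cong (λ z → c * f (+ 0) + z) (cong₂ _+_ (∑⁺-*ˡ N c f) (∑⁺-*ˡ N c (λ m → f (- m)))) ⟩
  c * f (+ 0) + (c * ∑⁺ N f + c * ∑⁺ N (λ m → f (- m)))
    ≡⟨ factor c (f (+ 0)) (∑⁺ N f) _ ⟩
  c * (f (+ 0) + (∑⁺ N f + ∑⁺ N (λ m → f (- m))))
    ≡⟨ cong (c *_) (∑±-unfold N f) ⟨
  c * ∑± N f ∎
  where
  factor : ∀ c a b d → c * a + (c * b + c * d) ≡ c * (a + (b + d))
  factor = ℤ-solve-∀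

∑±-neg : ∀ N f → ∑± N (λ x → - f x) ≡ - ∑± N f
∑±-neg N f = trans (∑±-cong N (λ x → sym (ℤₚ.-1*i≡-i (f x)))) (trans (∑±-*ˡ N -[1+ 0 ] f) (ℤₚ.-1*i≡-i (∑± N f)))

∑±-reflect : ∀ N f → ∑± N (λ x → f (- x)) ≡ ∑± N f
∑±-reflect N f = begin
  ∑± N (λ x → f (- x))
    ≡⟨ ∑±-unfold N _ ⟩
  f (+ 0) + (∑⁺ N (λ m → f (- m)) + ∑⁺ N (λ m → f (- - m)))
    ≡⟨ cong (λ z → f (+ 0) + z) (trans (ℤₚ.+-comm (∑⁺ N (λ m → f (- m))) _)
        (cong (λ z → z + ∑⁺ N (λ m → f (- m))) (∑⁺-cong N (λ m → cong f (ℤₚ.neg-involutive m))))) ⟩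
  f (+ 0) + (∑⁺ N f + ∑⁺ N (λ m → f (- m)))
    ≡⟨ ∑±-unfold N f ⟨
  ∑± N f ∎

∑±-odd : ∀ N f → (∀ x → f x ≡ - f (- x)) → ∑± N f ≡ + 0
∑±-odd N f f-odd = x≡-x⇒x≡0 _ (begin
  ∑± N f                      ≡⟨ ∑±-cong N f-odd ⟩
  ∑± N (λ x → - f (- x))      ≡⟨ ∑±-neg N (λ x → f (- x)) ⟩
  - ∑± N (λ x → f (- x))      ≡⟨ cong -_ (∑±-reflect N f) ⟩
  - ∑± N f                    ∎)

∑±-∑ : ∀ M N (f : ℤ → ℕ → ℤ) → ∑± M (λ x → ∑ N (f x)) ≡ ∑ N (λ i → ∑± M (λ x → f x i))
∑±-∑ M zero f = ∑±-zero M (λ _ → refl)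
∑±-∑ M (suc N) f = trans (∑±-+ M _ _) (cong (_+ ∑± M (λ x → f x N)) (∑±-∑ M N f))

∑±-∑⁺ : ∀ M N (f : ℤ → ℤ → ℤ) → ∑± M (λ x → ∑⁺ N (f x)) ≡ ∑⁺ N (λ y → ∑± M (λ x → f x y))
∑±-∑⁺ M N f = begin
  ∑± M (λ x → ∑⁺ N (f x))                      ≡⟨ ∑±-cong M (λ x → ∑⁺-∑ N (f x)) ⟩
  ∑± M (λ x → ∑ N (λ i → f x (+ suc i)))       ≡⟨ ∑±-∑ M N (λ x i → f x (+ suc i)) ⟩
  ∑ N (λ i → ∑± M (λ x → f x (+ suc i)))       ≡⟨ ∑⁺-∑ N (λ y → ∑± M (λ x → f x y)) ⟨
  ∑⁺ N (λ y → ∑± M (λ x → f x y))              ∎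

∑±-swap : ∀ M N (f : ℤ → ℤ → ℤ) → ∑± M (λ x → ∑± N (f x)) ≡ ∑± N (λ y → ∑± M (λ x → f x y))
∑±-swap M N f = begin
  ∑± M (λ x → ∑± N (f x))
    ≡⟨ ∑±-cong M (λ x → ∑±-unfold N (f x)) ⟩
  ∑± M (λ x → f x (+ 0) + (∑⁺ N (f x) + ∑⁺ N (λ m → f x (- m))))
    ≡⟨ trans (∑±-+ M _ _) (cong (λ z → ∑± M (λ x → f x (+ 0)) + z) (∑±-+ M _ _)) ⟩
  ∑± M (λ x → f x (+ 0)) + (∑± M (λ x → ∑⁺ N (f x)) + ∑± M (λ x → ∑⁺ N (λ m → f x (- m))))
    ≡⟨ cong (λ z → ∑± M (λ x → f x (+ 0)) + z) (cong₂ _+_ (∑±-∑⁺ M N f) (∑±-∑⁺ M N (λ x m → f x (- m)))) ⟩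
  ∑± M (λ x → f x (+ 0)) + (∑⁺ N (λ y → ∑± M (λ x → f x y)) + ∑⁺ N (λ m → ∑± M (λ x → f x (- m))))
    ≡⟨ ∑±-unfold N (λ y → ∑± M (λ x → f x y)) ⟨
  ∑± N (λ y → ∑± M (λ x → f x y)) ∎

Supported : ℕ → (ℤ → ℤ) → Set
Supported N f = ∀ x → N ℕ.< ∣ x ∣ → f x ≡ + 0

∑±-extend : ∀ {M N} f → Supported M f → M ℕ.≤ N → ∑± N f ≡ ∑± M f
∑±-extend {M} {N} f supported M≤N = begin
  ∑± N f                                           ≡⟨ ∑±-unfold N f ⟩
  f (+ 0) + (∑⁺ N f + ∑⁺ N (λ m → f (- m)))        ≡⟨ cong (λ z → f (+ 0) + z) (cong₂ _+_
                                                        (∑⁺-extend f (λ i M≤i → supported (+ suc i) (s≤s M≤i)) M≤N)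
                                                        (∑⁺-extend (λ m → f (- m)) (λ i M≤i → supported -[1+ i ] (s≤s M≤i)) M≤N)) ⟩
  f (+ 0) + (∑⁺ M f + ∑⁺ M (λ m → f (- m)))        ≡⟨ ∑±-unfold M f ⟨
  ∑± M f                                           ∎

Supported-translate : ∀ {N n f} c → Supported N f → ∣ c ∣ ℕ.≤ n → Supported (N ℕ.+ n) (λ x → f (c + x))
Supported-translate c supported ∣c∣≤n x N+n<∣x∣ = supported (c + x) (<-∣+∣ c x ∣c∣≤n N+n<∣x∣)

∑±-shift : ∀ N f → f (+ suc (suc N)) ≡ + 0 → f -[1+ N ] ≡ + 0 → ∑± (suc N) (λ x → f (+ 1 + x)) ≡ ∑± (suc N) f
∑±-shift N f last≡0 first≡0 = begin
  ∑± (suc N) (λ x → f (+ 1 + x))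
    ≡⟨ ∑±-unfold (suc N) _ ⟩
  f (+ 1) + (∑⁺ (suc N) (λ x → f (+ 1 + x)) + ∑⁺ (suc N) (λ m → f (+ 1 - m)))
    ≡⟨ cong (λ z → f (+ 1) + z) (cong₂ _+_ (trans (∑⁺-last N _) (cong (λ z → ∑⁺ N (λ x → f (+ 1 + x)) + z) last≡0))
         (trans (∑⁺-head N _) (cong (λ z → f (+ 0) + z) (∑⁺-cong N (λ m → cong f (cancel m)))))) ⟩
  f (+ 1) + (∑⁺ N (λ x → f (+ 1 + x)) + + 0 + (f (+ 0) + ∑⁺ N (λ m → f (- m))))
    ≡⟨ regroup (f (+ 1)) _ (f (+ 0)) _ ⟩
  f (+ 0) + (f (+ 1) + ∑⁺ N (λ x → f (+ 1 + x)) + (∑⁺ N (λ m → f (- m)) + + 0))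
    ≡⟨ cong (λ z → f (+ 0) + z) (cong₂ _+_ (∑⁺-head N f)
         (trans (∑⁺-last N _) (cong (λ z → ∑⁺ N (λ m → f (- m)) + z) first≡0))) ⟨
  f (+ 0) + (∑⁺ (suc N) f + ∑⁺ (suc N) (λ m → f (- m)))
    ≡⟨ ∑±-unfold (suc N) f ⟨
  ∑± (suc N) f ∎
  where
  cancel : ∀ m → + 1 - (+ 1 + m) ≡ - m
  cancel = ℤ-solve-∀
  regroup : ∀ a b c d → a + (b + + 0 + (c + d)) ≡ c + (a + b + (d + + 0))
  regroup = ℤ-solve-∀

∑±-translate : ∀ {N n} c f → Supported N f → ∣ c ∣ ℕ.≤ n → ∑± N f ≡ ∑± (N ℕ.+ n) (λ x → f (c + x))
∑±-translate {N} {n} c f supported ∣c∣≤n = trans (translate c ∣c∣≤n)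
  (∑±-extend (λ x → f (c + x)) (Supported-translate c supported ∣c∣≤n) (ℕₚ.n≤1+n (N ℕ.+ n)))
  where
  shift : ∀ c → ∣ c ∣ ℕ.≤ n → ∑± (suc (N ℕ.+ n)) (λ x → f (c + (+ 1 + x))) ≡ ∑± (suc (N ℕ.+ n)) (λ x → f (c + x))
  shift c ∣c∣≤n = ∑±-shift (N ℕ.+ n) (λ x → f (c + x))
    (Supported-translate c supported ∣c∣≤n (+ suc (suc (N ℕ.+ n))) (s≤s (ℕₚ.n≤1+n (N ℕ.+ n))))
    (Supported-translate c supported ∣c∣≤n -[1+ N ℕ.+ n ] ℕₚ.≤-refl)
  start : ∑± N f ≡ ∑± (suc (N ℕ.+ n)) (λ x → f (+ 0 + x))
  start = trans (sym (∑±-extend f supported (ℕₚ.m≤n⇒m≤1+n (ℕₚ.m≤m+n N n))))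
    (∑±-cong (suc (N ℕ.+ n)) (λ x → cong f (sym (ℤₚ.+-identityˡ x))))
  up : ∀ m x → + m + (+ 1 + x) ≡ + suc m + x
  up m x = regroup (+ m) x
    where
    regroup : ∀ m x → m + (+ 1 + x) ≡ + 1 + m + x
    regroup = ℤ-solve-∀
  down : ∀ m x → -[1+ m ] + (+ 1 + x) ≡ - + m + x
  down m x = regroup (+ m) x
    where
    regroup : ∀ m x → - (+ 1 + m) + (+ 1 + x) ≡ - m + x
    regroup = ℤ-solve-∀
  downward : ∀ m → m ℕ.≤ n → ∑± N f ≡ ∑± (suc (N ℕ.+ n)) (λ x → f (- + m + x))
  downward zero _ = start
  downward (suc m) m<n = trans (downward m (ℕₚ.<⇒≤ m<n))
    (trans (∑±-cong _ (λ x → cong f (sym (down m x)))) (shift -[1+ m ] m<n))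
  translate : ∀ c → ∣ c ∣ ℕ.≤ n → ∑± N f ≡ ∑± (suc (N ℕ.+ n)) (λ x → f (c + x))
  translate (+ zero) _ = start
  translate (+ suc m) m<n = trans (translate (+ m) (ℕₚ.<⇒≤ m<n))
    (trans (sym (shift (+ m) (ℕₚ.<⇒≤ m<n))) (∑±-cong _ (λ x → cong f (up m x))))
  translate -[1+ m ] m<n = downward (suc m) m<n

square : ℤ → ℕ
square k = ∣ k ∣ ℕ.* ∣ k ∣

k*k≡square : ∀ k → k * k ≡ + square k
k*k≡square (+ n) = sym (ℤₚ.pos-* n n)
k*k≡square -[1+ n ] = refl

∣k∣≤square : ∀ k → ∣ k ∣ ℕ.≤ square k
∣k∣≤square (+ zero) = z≤n
∣k∣≤square (+ suc n) = ℕₚ.m≤m*n (suc n) (suc n)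
∣k∣≤square -[1+ n ] = ℕₚ.m≤m*n (suc n) (suc n)

square+-≢ : ∀ {N} k n → N ℕ.< ∣ k ∣ ⊎ N ℕ.< n → k * k + + n ≢ + N
square+-≢ {N} k n large k²+n≡N = ℕₚ.<-irrefl (ℤₚ.+-injective (trans (sym k²+n≡N) (cong (_+ + n) (k*k≡square k)))) (bound large)
  where
  bound : N ℕ.< ∣ k ∣ ⊎ N ℕ.< n → N ℕ.< square k ℕ.+ n
  bound (inj₁ N<k) = ℕₚ.<-≤-trans N<k (ℕₚ.≤-trans (∣k∣≤square k) (ℕₚ.m≤m+n (square k) n))
  bound (inj₂ N<n) = ℕₚ.<-≤-trans N<n (ℕₚ.m≤n+m n (square k))

square-≢ : ∀ {N} k → N ℕ.< ∣ k ∣ → k * k ≢ + N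
square-≢ k N<k k²≡N = square+-≢ k 0 (inj₁ N<k) (trans (ℤₚ.+-identityʳ (k * k)) k²≡N)

module WeightedSums (N : ℕ) (3∣N : mod₃ℕ N ≡ 0F) (weight : ℤ → ℤ → ℤ → ℤ)
  (weight-swap : ∀ k a b → weight k a b ≡ weight (- k) b a)
  (weight-exchange : ∀ m s b → weight (m + s + b) (- s) b ≡ weight (m + b + s) (- b) s) where

  term : ℤ → ℤ → ℤ → ℤ
  term k a b = ψ a b * weight k a b * δ (disc k a b) (+ N)

  fullSum positiveSum slantedSum diagonalSum : ℤ
  fullSum = ∑⁺² N (λ a b → ∑± N (λ k → term k a b))
  positiveSum = ∑⁺² N (λ a b → ∑⁺ N (λ m → term (b - a + m) a b))
  slantedSum = ∑⁺² N (λ b m → ∑± N (λ j → term (j + b) (m - j) b))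
  diagonalSum = ∑⁺² N (λ b m → term (m + b) (+ 0) b)

  private
    mod₃-disc≡0 : ∀ k a b → disc k a b ≡ + N → mod₃ (disc k a b) ≡ 0F
    mod₃-disc≡0 k a b disc≡N = trans (cong mod₃ disc≡N) 3∣N

    +2*suc*suc : ∀ i j → + 2 * + suc i * + suc j ≡ + (2 ℕ.* suc i ℕ.* suc j)
    +2*suc*suc i j = sym (trans (ℤₚ.pos-* (2 ℕ.* suc i) (suc j)) (cong (_* + suc j) (ℤₚ.pos-* 2 (suc i))))

    term-≢ : ∀ k a b → disc k a b ≢ + N → term k a b ≡ + 0
    term-≢ k a b = *-δ-≢ (ψ a b * weight k a b)

  term-large : ∀ k i j → N ℕ.< ∣ k ∣ ⊎ N ℕ.≤ i → term k (+ suc i) (+ suc j) ≡ + 0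
  term-large k i j large = term-≢ k (+ suc i) (+ suc j) (λ disc≡N → square+-≢ k (2 ℕ.* suc i ℕ.* suc j) (bound large)
    (trans (cong (λ z → k * k + z) (sym (+2*suc*suc i j))) disc≡N))
    where
    bound : N ℕ.< ∣ k ∣ ⊎ N ℕ.≤ i → N ℕ.< ∣ k ∣ ⊎ N ℕ.< 2 ℕ.* suc i ℕ.* suc j
    bound (inj₁ N<k) = inj₁ N<k
    bound (inj₂ N≤i) = inj₂ (ℕₚ.<-≤-trans (s≤s N≤i) (ℕₚ.≤-trans (ℕₚ.m≤n*m (suc i) 2) (ℕₚ.m≤m*n (2 ℕ.* suc i) (suc j))))

  slanted-large : ∀ i m j → N ℕ.< ∣ j ∣ ⊎ N ℕ.< m → term (j + + suc i) (+ m - j) (+ suc i) ≡ + 0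
  slanted-large i m j large = term-≢ (j + + suc i) (+ m - j) (+ suc i) (λ disc≡N → square+-≢ j n (bound large)
    (trans (cong (λ z → j * j + z) +n) (trans (sym (disc-slanted j (+ suc i) (+ m))) disc≡N)))
    where
    n = suc i ℕ.* suc i ℕ.+ 2 ℕ.* suc i ℕ.* m
    +n : + n ≡ + suc i * + suc i + + 2 * + suc i * + m
    +n = cong₂ _+_ (ℤₚ.pos-* (suc i) (suc i)) (trans (ℤₚ.pos-* (2 ℕ.* suc i) m) (cong (_* + m) (ℤₚ.pos-* 2 (suc i))))
    disc-slanted : ∀ j b m → (j + b) * (j + b) + + 2 * (m - j) * b ≡ j * j + (b * b + + 2 * b * m)
    disc-slanted = ℤ-solve-∀
    bound : N ℕ.< ∣ j ∣ ⊎ N ℕ.< m → N ℕ.< ∣ j ∣ ⊎ N ℕ.< n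
    bound (inj₁ N<j) = inj₁ N<j
    bound (inj₂ N<m) = inj₂ (ℕₚ.<-≤-trans N<m (ℕₚ.≤-trans (ℕₚ.m≤n*m m (2 ℕ.* suc i)) (ℕₚ.m≤n+m (2 ℕ.* suc i ℕ.* m) (suc i ℕ.* suc i))))

  term-swap : ∀ k a b → term k a b ≡ term (- k) b a
  term-swap k a b = begin
    ψ a b * weight k a b * δ (disc k a b) (+ N)
      ≡⟨ *-δ-cong (λ disc≡N → cong (_* weight k a b) (ψ-sym k a b (mod₃-disc≡0 k a b disc≡N))) ⟩
    ψ b a * weight k a b * δ (disc k a b) (+ N)
      ≡⟨ cong₂ (λ w d → ψ b a * w * δ d (+ N)) (weight-swap k a b) (disc-swap k a b) ⟩
    term (- k) b a ∎
    where
    disc-swap : ∀ k a b → k * k + + 2 * a * b ≡ - k * - k + + 2 * b * a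
    disc-swap = ℤ-solve-∀

  term-balanced : ∀ a b → term (b - a) a b ≡ + 0
  term-balanced a b = *-δ-cong {f = ψ a b * weight (b - a) a b} {g = + 0}
    (λ disc≡N → cong (_* weight (b - a) a b) (ψ-balanced a b (mod₃-disc≡0 (b - a) a b disc≡N)))

  term-exchange : ∀ m s b → term (m + s + b) (- s) b ≡ - term (m + b + s) (- b) s
  term-exchange m s b = begin
    ψ (- s) b * weight k (- s) b * δ (disc k (- s) b) (+ N)
      ≡⟨ *-δ-cong (λ disc≡N → cong (_* weight k (- s) b) (ψ-exchange disc≡N)) ⟩
    - ψ (- b) s * weight k (- s) b * δ (disc k (- s) b) (+ N)
      ≡⟨ cong₂ (λ w d → - ψ (- b) s * w * δ d (+ N)) (weight-exchange m s b) (disc-exchange m s b) ⟩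
    - ψ (- b) s * weight (m + b + s) (- b) s * δ (disc (m + b + s) (- b) s) (+ N)
      ≡⟨ neg-out (ψ (- b) s) _ _ ⟩
    - term (m + b + s) (- b) s ∎
    where
    k = m + s + b
    ψ-exchange : disc k (- s) b ≡ + N → ψ (- s) b ≡ - ψ (- b) s
    ψ-exchange disc≡N = begin
      ψ (- s) b          ≡⟨ ψ-sym k (- s) b (mod₃-disc≡0 k (- s) b disc≡N) ⟩
      ψ b (- s)          ≡⟨ ℤₚ.neg-involutive (ψ b (- s)) ⟨
      - - ψ b (- s)      ≡⟨ cong -_ (ψ-neg b s) ⟨
      - ψ (- b) s        ∎
    disc-exchange : ∀ m s b → (m + s + b) * (m + s + b) + + 2 * (- s) * b ≡ (m + b + s) * (m + b + s) + + 2 * (- b) * s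
    disc-exchange = ℤ-solve-∀
    neg-out : ∀ p w d → - p * w * d ≡ - (p * w * d)
    neg-out = ℤ-solve-∀

  slanted-term : ∀ b m a → term (m - a + b) (m - (m - a)) b ≡ term (b - a + m) a b
  slanted-term b m a = cong₂ (λ k a → term k a b) (regroup b m a) (cancel m a)
    where
    regroup : ∀ b m a → m - a + b ≡ b - a + m
    regroup = ℤ-solve-∀
    cancel : ∀ m a → m - (m - a) ≡ a
    cancel = ℤ-solve-∀

  positive-large : ∀ i j m → N ℕ.≤ m → term (+ suc j - + suc i + + suc m) (+ suc i) (+ suc j) ≡ + 0
  positive-large i j m N≤m = trans (sym (slanted-term (+ suc j) (+ suc m) (+ suc i)))
    (slanted-large j (suc m) (+ suc m - + suc i) (inj₂ (s≤s N≤m)))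

  fullSum≡2positiveSum : fullSum ≡ positiveSum + positiveSum
  fullSum≡2positiveSum = begin
    fullSum
      ≡⟨ ∑⁺²-cong< N split ⟩
    ∑⁺² N (λ a b → row a b + row b a)
      ≡⟨ ∑⁺²-+ N row (λ a b → row b a) ⟩
    positiveSum + ∑⁺² N (λ a b → row b a)
      ≡⟨ cong (λ z → positiveSum + z) (∑⁺-swap N N (λ a b → row b a)) ⟩
    positiveSum + positiveSum ∎
    where
    row : ℤ → ℤ → ℤ
    row a b = ∑⁺ N (λ m → term (b - a + m) a b)
    split : ∀ i j → i ℕ.< N → j ℕ.< N →
      ∑± N (λ k → term k (+ suc i) (+ suc j)) ≡ row (+ suc i) (+ suc j) + row (+ suc j) (+ suc i)
    split i j i<N j<N = begin
      ∑± N (λ k → term k a b)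
        ≡⟨ ∑±-translate (b - a) (λ k → term k a b) (λ k N<k → term-large k i j (inj₁ N<k)) (∣suc-suc∣≤ i j i<N j<N) ⟩
      ∑± (N ℕ.+ N) (λ x → term (b - a + x) a b)
        ≡⟨ ∑±-unfold (N ℕ.+ N) _ ⟩
      term (b - a + + 0) a b + (∑⁺ (N ℕ.+ N) (λ m → term (b - a + m) a b) + ∑⁺ (N ℕ.+ N) (λ m → term (b - a - m) a b))
        ≡⟨ cong₂ _+_ (trans (cong (λ k → term k a b) (ℤₚ.+-identityʳ (b - a))) (term-balanced a b))
             (cong₂ _+_ (truncate i j) (trans (∑⁺-cong (N ℕ.+ N) reverse) (truncate j i))) ⟩
      + 0 + (row a b + row b a)
        ≡⟨ ℤₚ.+-identityˡ _ ⟩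
      row a b + row b a ∎
      where
      a = + suc i
      b = + suc j
      truncate : ∀ i j → ∑⁺ (N ℕ.+ N) (λ m → term (+ suc j - + suc i + m) (+ suc i) (+ suc j)) ≡ row (+ suc i) (+ suc j)
      truncate i j = ∑⁺-extend (λ m → term (+ suc j - + suc i + m) (+ suc i) (+ suc j)) (positive-large i j) (ℕₚ.m≤m+n N N)
      reverse : ∀ m → term (b - a - m) a b ≡ term (a - b + m) b a
      reverse m = trans (term-swap (b - a - m) a b) (cong (λ k → term k b a) (negated a b m))
        where
        negated : ∀ a b m → - (b - a - m) ≡ a - b + m
        negated = ℤ-solve-∀

  private
    above below : ℤ → ℤ → ℤ
    above b m = ∑⁺ N (λ s → term (m + s + b) (- s) b)
    below b m = ∑⁺ N (λ a → term (b - a + m) a b)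

    slantedRow : ∀ j i → i ℕ.< N → ∑± N (λ k → term (k + + suc j) (+ suc i - k) (+ suc j)) ≡
      term (+ suc i + + suc j) (+ 0) (+ suc j) + (above (+ suc j) (+ suc i) + below (+ suc j) (+ suc i))
    slantedRow j i i<N = begin
      ∑± N slanted
        ≡⟨ ∑±-translate m slanted (λ k N<k → slanted-large j (suc i) k (inj₁ N<k)) i<N ⟩
      ∑± (N ℕ.+ N) (λ x → slanted (m + x))
        ≡⟨ ∑±-unfold (N ℕ.+ N) _ ⟩
      slanted (m + + 0) + (∑⁺ (N ℕ.+ N) (λ s → slanted (m + s)) + ∑⁺ (N ℕ.+ N) (λ a → slanted (m - a)))
        ≡⟨ cong₂ _+_ (cong₂ (λ k a → term k a b) (cong (_+ b) (ℤₚ.+-identityʳ m)) (trans (cancel m (+ 0)) refl))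
             (cong₂ _+_
               (trans (∑⁺-extend (λ s → slanted (m + s)) above-large (ℕₚ.m≤m+n N N))
                 (∑⁺-cong N (λ s → cong (λ a → term (m + s + b) a b) (cancel m s))))
               (trans (∑⁺-cong (N ℕ.+ N) (slanted-term b m))
                 (∑⁺-extend (λ a → term (b - a + m) a b) below-large (ℕₚ.m≤m+n N N)))) ⟩
      term (m + b) (+ 0) b + (above b m + below b m) ∎
      where
      b = + suc j
      m = + suc i
      slanted : ℤ → ℤ
      slanted k = term (k + b) (m - k) b
      cancel : ∀ m s → m - (m + s) ≡ - s
      cancel = ℤ-solve-∀
      above-large : ∀ s → N ℕ.≤ s → slanted (m + + suc s) ≡ + 0
      above-large s N≤s = slanted-large j (suc i) (m + + suc s) (inj₁ (ℕₚ.<-≤-trans (s≤s N≤s) (ℕₚ.m≤n+m (suc s) (suc i))))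
      below-large : ∀ a → N ℕ.≤ a → term (b - + suc a + m) (+ suc a) b ≡ + 0
      below-large a N≤a = term-large (b - + suc a + m) a j (inj₂ N≤a)

  slantedSum≡diagonal+positive : slantedSum ≡ diagonalSum + positiveSum
  slantedSum≡diagonal+positive = begin
    slantedSum
      ≡⟨ ∑⁺²-cong< N (λ j i _ → slantedRow j i) ⟩
    ∑⁺² N (λ b m → term (m + b) (+ 0) b + (above b m + below b m))
      ≡⟨ trans (∑⁺²-+ N _ _) (cong (λ z → diagonalSum + z) (∑⁺²-+ N above below)) ⟩
    diagonalSum + (∑⁺² N above + ∑⁺² N below)
      ≡⟨ cong (λ z → diagonalSum + z) (cong₂ _+_ above-cancels below-positive) ⟩
    diagonalSum + (+ 0 + positiveSum)
      ≡⟨ cong (λ z → diagonalSum + z) (ℤₚ.+-identityˡ positiveSum) ⟩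
    diagonalSum + positiveSum ∎
    where
    above-cancels : ∑⁺² N above ≡ + 0
    above-cancels = trans (∑⁺-swap N N above) (∑⁺-zero N (λ i _ →
      ∑⁺²-antisym N (λ b s → term (+ suc i + s + b) (- s) b) (λ b s → term-exchange (+ suc i) s b)))
    below-positive : ∑⁺² N below ≡ positiveSum
    below-positive = trans (∑⁺-cong N (λ b → ∑⁺-swap N N (λ m a → term (b - a + m) a b)))
      (∑⁺-swap N N (λ b a → ∑⁺ N (λ m → term (b - a + m) a b)))

∑⁺²-antidiagonals : ∀ N f → (∀ i j → N ℕ.≤ i ℕ.+ j → f (+ suc i) (+ suc j) ≡ + 0) →
  ∑⁺² N f ≡ ∑ N (λ n → ∑ (suc n) (λ i → f (+ suc i) (+ suc (n ∸ i))))
∑⁺²-antidiagonals N f f≡0 = begin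
  ∑⁺² N f
    ≡⟨ trans (∑⁺-∑ N _) (∑-cong N (λ i → ∑⁺-∑ N (f (+ suc i)))) ⟩
  ∑ N (λ i → ∑ N (F i))
    ≡⟨ ∑-cong N (λ i → ∑-extend (F i) (λ j N∸i≤j → f≡0 i j (beyond i j N∸i≤j)) (ℕₚ.m∸n≤m N i)) ⟩
  ∑ N (λ i → ∑ (N ∸ i) (F i))
    ≡⟨ ∑-cong N (λ i → ∑-cong (N ∸ i) (λ j → cong (F i) (sym (ℕₚ.m+n∸m≡n i j)))) ⟩
  ∑ N (λ i → ∑ (N ∸ i) (λ j → F i (i ℕ.+ j ∸ i)))
    ≡⟨ ∑-triangle N (λ n i → F i (n ∸ i)) ⟨
  ∑ N (λ n → ∑ (suc n) (λ i → F i (n ∸ i))) ∎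
  where
  F : ℕ → ℕ → ℤ
  F i j = f (+ suc i) (+ suc j)
  beyond : ∀ i j → N ∸ i ℕ.≤ j → N ℕ.≤ i ℕ.+ j
  beyond i j N∸i≤j = ℕₚ.≤-trans (ℕₚ.m≤n+m∸n N i) (ℕₚ.+-monoʳ-≤ i N∸i≤j)

χ₃-partialSum : ℤ/3 → ℤ
χ₃-partialSum 0F = + 0
χ₃-partialSum 1F = + 1
χ₃-partialSum 2F = + 0

∑-χ : ∀ n → ∑ n (λ i → χ (+ suc i)) ≡ χ₃-partialSum (mod₃ℕ n)
∑-χ zero = refl
∑-χ (suc n) = trans (cong (_+ χ (+ suc n)) (∑-χ n))
  (from-yes (Finₚ.all? λ a → (χ₃-partialSum a + χ₃ (suc₃ a)) ≟ χ₃-partialSum (suc₃ a)) (mod₃ℕ n))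

-- Σ χ(b) c over b + c = n + 1 with b, c > 0
χ-moment : ℕ → ℤ
χ-moment n = ∑ n (λ i → χ (+ suc i) * + (n ∸ i))

χ-moment-suc : ∀ n → χ-moment (suc n) ≡ χ-moment n + χ₃-partialSum (mod₃ℕ (suc n))
χ-moment-suc n = begin
  ∑ n (λ i → χ (+ suc i) * + (suc n ∸ i)) + χ (+ suc n) * + (suc n ∸ n)
    ≡⟨ cong₂ _+_ (∑-cong< n (λ i i<n → trans (cong (λ z → χ (+ suc i) * + z) (ℕₚ.+-∸-assoc 1 (ℕₚ.<⇒≤ i<n)))
                    (expand (χ (+ suc i)) (+ (n ∸ i)))))
                 (trans (cong (λ z → χ (+ suc n) * + z) (ℕₚ.m+n∸n≡m 1 n)) (ℤₚ.*-identityʳ _)) ⟩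
  ∑ n (λ i → χ (+ suc i) * + (n ∸ i) + χ (+ suc i)) + χ (+ suc n)
    ≡⟨ cong (_+ χ (+ suc n)) (∑-+ n _ _) ⟩
  χ-moment n + ∑ n (λ i → χ (+ suc i)) + χ (+ suc n)
    ≡⟨ ℤₚ.+-assoc (χ-moment n) _ _ ⟩
  χ-moment n + ∑ (suc n) (λ i → χ (+ suc i))
    ≡⟨ cong (λ z → χ-moment n + z) (∑-χ (suc n)) ⟩
  χ-moment n + χ₃-partialSum (mod₃ℕ (suc n)) ∎
  where
  expand : ∀ c x → c * (+ 1 + x) ≡ c * x + c
  expand = ℤ-solve-∀

χ-moment-value : ∀ t → χ-moment (2 ℕ.+ t ℕ.* 3) ≡ + suc t
χ-moment-value zero = refl
χ-moment-value (suc t) = begin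
  χ-moment (5 ℕ.+ n)
    ≡⟨ trans (χ-moment-suc (4 ℕ.+ n)) (cong (_+ p 5) (trans (χ-moment-suc (3 ℕ.+ n)) (cong (_+ p 4) (χ-moment-suc (2 ℕ.+ n))))) ⟩
  χ-moment (2 ℕ.+ n) + p 3 + p 4 + p 5
    ≡⟨ cong₂ (λ x a → x + χ₃-partialSum (suc₃ (suc₃ (suc₃ a))) + χ₃-partialSum (suc₃ (suc₃ (suc₃ (suc₃ a))))
         + χ₃-partialSum (suc₃ (suc₃ (suc₃ (suc₃ (suc₃ a)))))) (χ-moment-value t) (mod₃ℕ-*3 t) ⟩
  + suc t + + 0 + + 1 + + 0
    ≡⟨ simplify (+ suc t) ⟩
  + suc (suc t) ∎
  where
  n = t ℕ.* 3
  p : ℕ → ℤ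
  p i = χ₃-partialSum (mod₃ℕ (i ℕ.+ n))
  simplify : ∀ x → x + + 0 + + 1 + + 0 ≡ + 1 + x
  simplify = ℤ-solve-∀

module LevelSums (M : ℕ) where
  N : ℕ
  N = M ℕ.* 3

  3∣N : mod₃ℕ N ≡ 0F
  3∣N = mod₃ℕ-*3 M

  quadraticWeight : ℤ → ℤ → ℤ → ℤ
  quadraticWeight k a b = (k - b) * (k + a)

  module Unweighted = WeightedSums N 3∣N (λ _ _ _ → + 1) (λ _ _ _ → refl) (λ _ _ _ → refl)

  private
    quadraticWeight-swap : ∀ k a b → (k - b) * (k + a) ≡ (- k - a) * (- k + b)
    quadraticWeight-swap = ℤ-solve-∀

    quadraticWeight-exchange : ∀ m s b → (m + s + b - b) * (m + s + b + - s) ≡ (m + b + s - s) * (m + b + s + - b)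
    quadraticWeight-exchange = ℤ-solve-∀

    disc-zero : ∀ b m → (m + b) * (m + b) + + 2 * + 0 * b ≡ (m + b) * (m + b)
    disc-zero = ℤ-solve-∀

  module Quadratic = WeightedSums N 3∣N quadraticWeight quadraticWeight-swap quadraticWeight-exchange

  unweighted-diagonal : Unweighted.diagonalSum ≡ + 0
  unweighted-diagonal = ∑⁺²-antisym N _ (λ b m → begin
    ψ (+ 0) b * + 1 * δ (disc (m + b) (+ 0) b) (+ N)
      ≡⟨ *-δ-cong (λ disc≡N → cong (_* + 1) (χ-exchange b m disc≡N)) ⟩
    - ψ (+ 0) m * + 1 * δ (disc (m + b) (+ 0) b) (+ N)
      ≡⟨ cong (λ d → - ψ (+ 0) m * + 1 * δ d (+ N)) (disc-exchange b m) ⟩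
    - ψ (+ 0) m * + 1 * δ (disc (b + m) (+ 0) m) (+ N)
      ≡⟨ neg-out (ψ (+ 0) m) _ ⟩
    - (ψ (+ 0) m * + 1 * δ (disc (b + m) (+ 0) m) (+ N)) ∎)
    where
    disc-exchange : ∀ b m → (m + b) * (m + b) + + 2 * + 0 * b ≡ (b + m) * (b + m) + + 2 * + 0 * m
    disc-exchange = ℤ-solve-∀
    neg-out : ∀ p d → - p * + 1 * d ≡ - (p * + 1 * d)
    neg-out = ℤ-solve-∀
    χ-exchange : ∀ b m → disc (m + b) (+ 0) b ≡ + N → χ b ≡ - χ m
    χ-exchange b m disc≡N = from-yes (Finₚ.all? λ b → Finₚ.all? λ m → ((m +₃ b) *₃ (m +₃ b) ≟₃ 0F) →-dec (χ₃ b ≟ - χ₃ m))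
      (mod₃ b) (mod₃ m) (begin
      (mod₃ m +₃ mod₃ b) *₃ (mod₃ m +₃ mod₃ b)    ≡⟨ cong₂ _*₃_ (mod₃-+ m b) (mod₃-+ m b) ⟨
      mod₃ (m + b) *₃ mod₃ (m + b)                ≡⟨ mod₃-* (m + b) (m + b) ⟨
      mod₃ ((m + b) * (m + b))                    ≡⟨ cong mod₃ (trans (sym (disc-zero b m)) disc≡N) ⟩
      mod₃ℕ N                                     ≡⟨ 3∣N ⟩
      0F                                          ∎)

  fullSum≡2slantedSum : Unweighted.fullSum ≡ Unweighted.slantedSum + Unweighted.slantedSum
  fullSum≡2slantedSum = trans Unweighted.fullSum≡2positiveSum (cong₂ _+_ (sym slanted≡positive) (sym slanted≡positive))
    where
    slanted≡positive : Unweighted.slantedSum ≡ Unweighted.positiveSum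
    slanted≡positive = begin
      Unweighted.slantedSum                               ≡⟨ Unweighted.slantedSum≡diagonal+positive ⟩
      Unweighted.diagonalSum + Unweighted.positiveSum     ≡⟨ cong (_+ Unweighted.positiveSum) unweighted-diagonal ⟩
      + 0 + Unweighted.positiveSum                        ≡⟨ ℤₚ.+-identityˡ _ ⟩
      Unweighted.positiveSum                              ∎

  quadratic-slanted : Quadratic.slantedSum ≡ + 0
  quadratic-slanted = ∑⁺²-zero N (λ i j → ∑±-odd N _ (odd (+ suc i) (+ suc j)))
    where
    odd : ∀ b m j → Quadratic.term (j + b) (m - j) b ≡ - Quadratic.term (- j + b) (m - - j) b
    odd b m j = begin
      ψ (m - j) b * quadraticWeight (j + b) (m - j) b * δ (disc (j + b) (m - j) b) (+ N)
        ≡⟨ *-δ-cong (λ disc≡N → cong (_* quadraticWeight (j + b) (m - j) b) (trans (ψ-reflect j b m (trans (cong mod₃ disc≡N) 3∣N))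
             (cong (λ z → ψ (m + z) b) (sym (ℤₚ.neg-involutive j))))) ⟩
      ψ (m - - j) b * quadraticWeight (j + b) (m - j) b * δ (disc (j + b) (m - j) b) (+ N)
        ≡⟨ cong (λ d → ψ (m - - j) b * quadraticWeight (j + b) (m - j) b * δ d (+ N)) (disc-reflect j b m) ⟩
      ψ (m - - j) b * quadraticWeight (j + b) (m - j) b * δ (disc (- j + b) (m - - j) b) (+ N)
        ≡⟨ weight-odd (ψ (m - - j) b) j b m _ ⟩
      - Quadratic.term (- j + b) (m - - j) b ∎
      where
      disc-reflect : ∀ j b m → (j + b) * (j + b) + + 2 * (m - j) * b ≡ (- j + b) * (- j + b) + + 2 * (m - - j) * b
      disc-reflect = ℤ-solve-∀
      weight-odd : ∀ p j b m d → p * ((j + b - b) * (j + b + (m - j))) * d ≡ - (p * ((- j + b - b) * (- j + b + (m - - j))) * d)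
      weight-odd = ℤ-solve-∀

  positiveSquareRoots : ℤ
  positiveSquareRoots = ∑⁺ N (λ w → δ (w * w) (+ N))

  private
    diagonalTerm : ℤ → ℤ → ℤ
    diagonalTerm b m = χ b * (m * (m + b)) * δ ((m + b) * (m + b)) (+ N)

    diagonalTerm-large : ∀ i j → N ℕ.≤ i ℕ.+ j → diagonalTerm (+ suc i) (+ suc j) ≡ + 0
    diagonalTerm-large i j N≤i+j = *-δ-≢ (χ (+ suc i) * (+ suc j * (+ suc j + + suc i))) (square-≢ (+ suc j + + suc i)
      (s≤s (ℕₚ.≤-trans N≤i+j (ℕₚ.≤-trans (ℕₚ.≤-reflexive (ℕₚ.+-comm i j)) (ℕₚ.+-monoʳ-≤ j (ℕₚ.n≤1+n i))))))

    χ-moment-root : ∀ n → + suc (suc n) * + suc (suc n) ≡ + N → χ-moment (suc n) * + suc (suc n) ≡ + M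
    χ-moment-root n w²≡N with mod₃ℕ≡0⇒∃*3 (suc (suc n)) (mod₃-root (+ suc (suc n)) (trans (cong mod₃ w²≡N) 3∣N))
    ... | suc t , refl = ℤₚ.*-cancelʳ-≡ (χ-moment (2 ℕ.+ t ℕ.* 3) * w) (+ M) (+ 3) (begin
      χ-moment (2 ℕ.+ t ℕ.* 3) * w * + 3     ≡⟨ cong (λ z → z * w * + 3) (χ-moment-value t) ⟩
      + suc t * w * + 3                      ≡⟨ regroup (+ suc t) w ⟩
      + suc t * + 3 * w                      ≡⟨ cong (_* w) (ℤₚ.pos-* (suc t) 3) ⟨
      w * w                                  ≡⟨ w²≡N ⟩
      + N                                    ≡⟨ ℤₚ.pos-* M 3 ⟩
      + M * + 3                              ∎)
      where
      w = + (suc t ℕ.* 3)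
      regroup : ∀ t w → t * w * + 3 ≡ t * + 3 * w
      regroup = ℤ-solve-∀

    diagonalTerm-antidiagonal : ∀ n → ∑ (suc n) (λ i → diagonalTerm (+ suc i) (+ suc (n ∸ i))) ≡
      + M * δ (+ suc (suc n) * + suc (suc n)) (+ N)
    diagonalTerm-antidiagonal n = begin
      ∑ (suc n) (λ i → diagonalTerm (+ suc i) (+ suc (n ∸ i)))
        ≡⟨ ∑-cong< (suc n) (λ i i≤n → trans
             (cong₂ (λ x y → χ (+ suc i) * (+ x * + y) * δ (+ y * + y) (+ N)) (sym (ℕₚ.+-∸-assoc 1 (ℕₚ.≤-pred i≤n)))
                 (sum i (ℕₚ.≤-pred i≤n)))
             (cong (_* δ (w * w) (+ N)) (sym (ℤₚ.*-assoc (χ (+ suc i)) _ w)))) ⟩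
      ∑ (suc n) (λ i → χ (+ suc i) * + (suc n ∸ i) * w * δ (w * w) (+ N))
        ≡⟨ ∑-*ʳ (suc n) (δ (w * w) (+ N)) _ ⟩
      ∑ (suc n) (λ i → χ (+ suc i) * + (suc n ∸ i) * w) * δ (w * w) (+ N)
        ≡⟨ cong (_* δ (w * w) (+ N)) (∑-*ʳ (suc n) w _) ⟩
      χ-moment (suc n) * w * δ (w * w) (+ N)
        ≡⟨ *-δ-cong (χ-moment-root n) ⟩
      + M * δ (w * w) (+ N) ∎
      where
      w = + suc (suc n)
      sum : ∀ i → i ℕ.≤ n → suc (n ∸ i) ℕ.+ suc i ≡ suc (suc n)
      sum i i≤n = cong suc (trans (ℕₚ.+-suc (n ∸ i) i) (cong suc (ℕₚ.m∸n+n≡m i≤n)))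

    positiveSquareRoots-tail : ∑ N (λ n → δ (+ suc (suc n) * + suc (suc n)) (+ N)) ≡ positiveSquareRoots
    positiveSquareRoots-tail = begin
      ∑ N (λ n → f (+ suc (suc n)))               ≡⟨ ∑⁺-∑ N (λ x → f (+ 1 + x)) ⟨
      ∑⁺ N (λ x → f (+ 1 + x))                    ≡⟨ ℤₚ.+-identityˡ _ ⟨
      + 0 + ∑⁺ N (λ x → f (+ 1 + x))              ≡⟨ cong (_+ ∑⁺ N (λ x → f (+ 1 + x))) (δ-≢ (1≢3M M)) ⟨
      f (+ 1) + ∑⁺ N (λ x → f (+ 1 + x))          ≡⟨ ∑⁺-head N f ⟨
      ∑⁺ (suc N) f                                ≡⟨ ∑⁺-extend f (λ i N≤i → δ-≢ (square-≢ (+ suc i) (s≤s N≤i))) (ℕₚ.n≤1+n N) ⟩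
      ∑⁺ N f                                      ∎
      where
      f : ℤ → ℤ
      f w = δ (w * w) (+ N)
      1≢3M : ∀ M → + 1 ≢ + (M ℕ.* 3)
      1≢3M zero ()
      1≢3M (suc M) ()

  quadratic-diagonal : Quadratic.diagonalSum ≡ + M * positiveSquareRoots
  quadratic-diagonal = begin
    Quadratic.diagonalSum
      ≡⟨ ∑⁺²-cong N (λ b m → cong₂ (λ w d → χ b * w * δ d (+ N)) (weight b m) (disc-zero b m)) ⟩
    ∑⁺² N diagonalTerm
      ≡⟨ ∑⁺²-antidiagonals N diagonalTerm diagonalTerm-large ⟩
    ∑ N (λ n → ∑ (suc n) (λ i → diagonalTerm (+ suc i) (+ suc (n ∸ i))))
      ≡⟨ ∑-cong N diagonalTerm-antidiagonal ⟩
    ∑ N (λ n → + M * δ (+ suc (suc n) * + suc (suc n)) (+ N))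
      ≡⟨ ∑-*ˡ N (+ M) _ ⟩
    + M * ∑ N (λ n → δ (+ suc (suc n) * + suc (suc n)) (+ N))
      ≡⟨ cong (+ M *_) positiveSquareRoots-tail ⟩
    + M * positiveSquareRoots ∎
    where
    weight : ∀ b m → (m + b - b) * (m + b + + 0) ≡ m * (m + b)
    weight = ℤ-solve-∀

  quadratic-fullSum : Quadratic.fullSum ≡ - (+ 2 * (+ M * positiveSquareRoots))
  quadratic-fullSum = begin
    Quadratic.fullSum
      ≡⟨ Quadratic.fullSum≡2positiveSum ⟩
    Quadratic.positiveSum + Quadratic.positiveSum
      ≡⟨ complete Quadratic.positiveSum Quadratic.diagonalSum ⟩
    + 2 * (Quadratic.diagonalSum + Quadratic.positiveSum) - + 2 * Quadratic.diagonalSum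
      ≡⟨ cong₂ (λ h d → + 2 * h - + 2 * d) (trans (sym Quadratic.slantedSum≡diagonal+positive) quadratic-slanted) quadratic-diagonal ⟩
    + 2 * + 0 - + 2 * (+ M * positiveSquareRoots)
      ≡⟨ ℤₚ.+-identityˡ _ ⟩
    - (+ 2 * (+ M * positiveSquareRoots)) ∎
    where
    complete : ∀ x d → x + x ≡ + 2 * (d + x) - + 2 * d
    complete = ℤ-solve-∀

paritySign parityEven : Parity → ℤ
paritySign 0ℙ = + 1
paritySign 1ℙ = -[1+ 0 ]
parityEven 0ℙ = + 1
parityEven 1ℙ = + 0

even : ℕ → ℤ
even n = parityEven (ℕ.parity n)

sign-parity : ∀ n → sign n ≡ paritySign (ℕ.parity n)
sign-parity 0 = refl
sign-parity 1 = refl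
sign-parity (suc (suc n)) = trans (twice (sign n)) (sign-parity n)
  where
  twice : ∀ s → -[1+ 0 ] * (-[1+ 0 ] * s) ≡ s
  twice = ℤ-solve-∀

parity-+*2 : ∀ m n → ℕ.parity (m ℕ.+ n ℕ.* 2) ≡ ℕ.parity m
parity-+*2 m n = begin
  ℕ.parity (m ℕ.+ n ℕ.* 2)                     ≡⟨ ℙₚ.+-homo-+ m (n ℕ.* 2) ⟩
  ℕ.parity m ℙ.+ ℕ.parity (n ℕ.* 2)            ≡⟨ cong (ℕ.parity m ℙ.+_) (trans (ℙₚ.*-homo-* n 2) (ℙₚ.*-zeroʳ (ℕ.parity n))) ⟩
  ℕ.parity m ℙ.+ 0ℙ                            ≡⟨ ℙₚ.+-identityʳ (ℕ.parity m) ⟩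
  ℕ.parity m                                   ∎

∑-even : ∀ N (g : ℕ → ℤ) → ∑ (N ℕ.* 2) (λ i → even (suc i) * g (suc i)) ≡ ∑ N (λ i → g (suc i ℕ.* 2))
∑-even zero g = refl
∑-even (suc N) g = begin
  ∑ (N ℕ.* 2) f + even (suc (N ℕ.* 2)) * g (suc (N ℕ.* 2)) + even (N ℕ.* 2) * g (suc N ℕ.* 2)
    ≡⟨ cong₂ (λ p r → ∑ (N ℕ.* 2) f + parityEven p * g (suc (N ℕ.* 2)) + parityEven r * g (suc N ℕ.* 2)) (parity-+*2 1 N) (parity-+*2 0 N) ⟩
  ∑ (N ℕ.* 2) f + + 0 + + 1 * g (suc N ℕ.* 2)
    ≡⟨ cong₂ _+_ (trans (ℤₚ.+-identityʳ _) (∑-even N g)) (ℤₚ.*-identityˡ _) ⟩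
  ∑ N (λ i → g (suc i ℕ.* 2)) + g (suc N ℕ.* 2) ∎
  where
  f : ℕ → ℤ
  f i = even (suc i) * g (suc i)

[_<_] : ℕ → ℕ → ℤ
[ m < n ] = indicator (does (m ℕ.<? n))

[<]-true : ∀ {m n} → m ℕ.< n → [ m < n ] ≡ + 1
[<]-true {m} {n} m<n = cong indicator (dec-true (m ℕ.<? n) m<n)

[<]-false : ∀ {m n} → n ℕ.≤ m → [ m < n ] ≡ + 0
[<]-false {m} {n} n≤m = cong indicator (dec-false (m ℕ.<? n) (ℕₚ.≤⇒≯ n≤m))

χ-antisym : ∀ x y → χ (x - y) ≡ - χ (y - x)
χ-antisym x y = begin
  χ₃ (mod₃ (x - y))                        ≡⟨ cong χ₃ (mod₃-minus x y) ⟩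
  χ₃ (mod₃ x +₃ -₃ mod₃ y)               ≡⟨ table (mod₃ x) (mod₃ y) ⟩
  - χ₃ (mod₃ y +₃ -₃ mod₃ x)             ≡⟨ cong (λ z → - χ₃ z) (mod₃-minus y x) ⟨
  - χ₃ (mod₃ (y - x))                      ∎
  where
  table : ∀ a b → χ₃ (a +₃ -₃ b) ≡ - χ₃ (b +₃ -₃ a)
  table = from-yes (Finₚ.all? λ a → Finₚ.all? λ b → χ₃ (a +₃ -₃ b) ≟ - χ₃ (b +₃ -₃ a))

mod₃-double : ∀ x → mod₃ (x + x) ≡ -₃ mod₃ x
mod₃-double x = trans (mod₃-+ x x) (from-yes (Finₚ.all? λ a → a +₃ a ≟₃ -₃ a) (mod₃ x))

ψ-ε-χ : ∀ k a b → mod₃ (disc k a b) ≡ 0F → ψ a b ≡ ε k * χ (b - (a + a))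
ψ-ε-χ k a b disc≡0 = begin
  ψ a b                                             ≡⟨ table (mod₃ k) (mod₃ a) (mod₃ b) (trans (sym (mod₃-disc k a b)) disc≡0) ⟩
  ε k * χ₃ (mod₃ b +₃ -₃ -₃ mod₃ a)             ≡⟨ cong (λ z → ε k * χ₃ (mod₃ b +₃ -₃ z)) (mod₃-double a) ⟨
  ε k * χ₃ (mod₃ b +₃ (-₃ mod₃ (a + a)))            ≡⟨ cong (λ z → ε k * χ₃ z) (mod₃-minus b (a + a)) ⟨
  ε k * χ (b - (a + a))                             ∎
  where
  table : ∀ k a b → disc₃ k a b ≡ 0F → ψ₃ a b ≡ ε₃ k * χ₃ (b +₃ -₃ -₃ a)
  table = from-yes (Finₚ.all? λ k → Finₚ.all? λ a → Finₚ.all? λ b →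
    disc₃ k a b ≟₃ 0F →-dec ψ₃ a b ≟ ε₃ k * χ₃ (b +₃ -₃ -₃ a))

ψ-ε-χ-slanted : ∀ j b m → mod₃ (disc (j + b) (m - j) b) ≡ 0F → ψ (m - j) b ≡ ε j * χ (b - (b + (m + m)))
ψ-ε-χ-slanted j b m disc≡0 = begin
  ψ (m - j) b
    ≡⟨ cong (λ a → ψ₃ a (mod₃ b)) (mod₃-minus m j) ⟩
  ψ₃ (mod₃ m +₃ -₃ mod₃ j) (mod₃ b)
    ≡⟨ table (mod₃ j) (mod₃ b) (mod₃ m) (trans (sym (mod₃-disc-slanted j b m)) disc≡0) ⟩
  ε j * χ₃ (mod₃ m)
    ≡⟨ cong (λ z → ε j * χ₃ z) (-₃-involutive (mod₃ m)) ⟩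
  ε j * χ₃ (-₃ -₃ mod₃ m)
    ≡⟨ cong (λ z → ε j * χ₃ (-₃ z)) (mod₃-double m) ⟨
  ε j * χ₃ (-₃ mod₃ (m + m))
    ≡⟨ cong (λ z → ε j * χ₃ z) (trans (cong mod₃ (cancel b m)) (mod₃-neg (m + m))) ⟨
  ε j * χ (b - (b + (m + m))) ∎
  where
  table : ∀ j b m → disc₃ (j +₃ b) (m +₃ -₃ j) b ≡ 0F → ψ₃ (m +₃ -₃ j) b ≡ ε₃ j * χ₃ m
  table = from-yes (Finₚ.all? λ j → Finₚ.all? λ b → Finₚ.all? λ m →
    disc₃ (j +₃ b) (m +₃ -₃ j) b ≟₃ 0F →-dec ψ₃ (m +₃ -₃ j) b ≟ ε₃ j * χ₃ m)
  cancel : ∀ b m → b - (b + (m + m)) ≡ - (m + m)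
  cancel = ℤ-solve-∀

module PairSums (M : ℕ) where
  open LevelSums M public

  twistedCount : ℤ → ℤ → ℤ
  twistedCount n v = ∑± N (λ k → ε k * χ (v - n) * δ (k * k + n * v) (+ N))

  twistedCount-antisym : ∀ n v → twistedCount n v ≡ - twistedCount v n
  twistedCount-antisym n v = trans (∑±-cong N antisym) (∑±-neg N _)
    where
    antisym : ∀ k → ε k * χ (v - n) * δ (k * k + n * v) (+ N) ≡ - (ε k * χ (n - v) * δ (k * k + v * n) (+ N))
    antisym k = trans (cong₂ (λ x y → ε k * x * δ (k * k + y) (+ N)) (χ-antisym v n) (ℤₚ.*-comm n v))
      (neg-out (ε k) (χ (n - v)) _)
      where
      neg-out : ∀ e c d → e * - c * d ≡ - (e * c * d)
      neg-out = ℤ-solve-∀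

  twistedCount-large : ∀ i j → N ℕ.≤ i → twistedCount (+ suc i) (+ suc j) ≡ + 0
  twistedCount-large i j N≤i = ∑±-zero N (λ k → *-δ-≢ (ε k * χ (+ suc j - + suc i)) (λ k²+nv≡N →
    square+-≢ k (suc i ℕ.* suc j) (inj₂ (ℕₚ.<-≤-trans (s≤s N≤i) (ℕₚ.m≤m*n (suc i) (suc j))))
      (trans (cong (λ z → k * k + z) (ℤₚ.pos-* (suc i) (suc j))) k²+nv≡N)))

  private
    evenᶻ : ℤ → ℤ
    evenᶻ n = even (∣ n ∣)

    fullTerm slantedTerm signedTerm slantedTermᵀ : ℤ → ℤ → ℤ
    fullTerm n v = evenᶻ n * twistedCount n v
    slantedTerm n v = [ ∣ v ∣ < ∣ n ∣ ] * even (∣ n ∣ ℕ.+ ∣ v ∣) * twistedCount n v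
    slantedTermᵀ n v = [ ∣ n ∣ < ∣ v ∣ ] * even (∣ n ∣ ℕ.+ ∣ v ∣) * twistedCount n v
    signedTerm n v = [ ∣ n ∣ < ∣ v ∣ ] * sign (∣ n ∣ ℕ.* ∣ v ∣ ℕ.+ ∣ n ∣) * twistedCount n v

    mod₃≡0 : ∀ {x} → x ≡ + N → mod₃ x ≡ 0F
    mod₃≡0 x≡N = trans (cong mod₃ x≡N) 3∣N

    +suc*2 : ∀ i → + (suc i ℕ.* 2) ≡ + suc i + + suc i
    +suc*2 i = trans (ℤₚ.pos-* (suc i) 2) (double (+ suc i))
      where
      double : ∀ x → x * + 2 ≡ x + x
      double = ℤ-solve-∀

  fullTerm-column : ∀ j → ∑⁺ N (λ a → twistedCount (a + a) (+ suc j)) ≡ ∑⁺ N (λ n → fullTerm n (+ suc j))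
  fullTerm-column j = begin
    ∑⁺ N (λ a → twistedCount (a + a) v)
      ≡⟨ ∑⁺-∑ N (λ a → twistedCount (a + a) v) ⟩
    ∑ N (λ i → twistedCount (+ suc i + + suc i) v)
      ≡⟨ ∑-cong N (λ i → cong (λ n → twistedCount n v) (sym (+suc*2 i))) ⟩
    ∑ N (λ i → twistedCount (+ (suc i ℕ.* 2)) v)
      ≡⟨ ∑-even N (λ n → twistedCount (+ n) v) ⟨
    ∑ (N ℕ.* 2) (λ i → fullTerm (+ suc i) v)
      ≡⟨ ∑⁺-∑ (N ℕ.* 2) (λ n → fullTerm n v) ⟨
    ∑⁺ (N ℕ.* 2) (λ n → fullTerm n v)
      ≡⟨ ∑⁺-extend (λ n → fullTerm n v) (λ i N≤i → trans (cong (even (suc i) *_) (twistedCount-large i j N≤i)) (ℤₚ.*-zeroʳ (even (suc i))))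
           (ℕₚ.m≤m*n N 2) ⟩
    ∑⁺ N (λ n → fullTerm n v) ∎
    where
    v = + suc j

  fullSum-twistedCount : Unweighted.fullSum ≡ ∑⁺² N fullTerm
  fullSum-twistedCount = begin
    Unweighted.fullSum
      ≡⟨ ∑⁺²-cong N (λ a b → ∑±-cong N (term a b)) ⟩
    ∑⁺² N (λ a b → twistedCount (a + a) b)
      ≡⟨ ∑⁺-swap N N (λ a b → twistedCount (a + a) b) ⟩
    ∑⁺ N (λ b → ∑⁺ N (λ a → twistedCount (a + a) b))
      ≡⟨ ∑⁺-cong< N (λ j _ → fullTerm-column j) ⟩
    ∑⁺ N (λ b → ∑⁺ N (λ n → fullTerm n b))
      ≡⟨ ∑⁺-swap N N (λ b n → fullTerm n b) ⟩
    ∑⁺² N fullTerm ∎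
    where
    term : ∀ a b k → Unweighted.term k a b ≡ ε k * χ (b - (a + a)) * δ (k * k + (a + a) * b) (+ N)
    term a b k = begin
      ψ a b * + 1 * δ (disc k a b) (+ N)
        ≡⟨ *-δ-cong (λ disc≡N → trans (ℤₚ.*-identityʳ (ψ a b)) (ψ-ε-χ k a b (mod₃≡0 disc≡N))) ⟩
      ε k * χ (b - (a + a)) * δ (disc k a b) (+ N)
        ≡⟨ cong (λ d → ε k * χ (b - (a + a)) * δ d (+ N)) (disc-double k a b) ⟩
      ε k * χ (b - (a + a)) * δ (k * k + (a + a) * b) (+ N) ∎
      where
      disc-double : ∀ k a b → k * k + + 2 * a * b ≡ k * k + (a + a) * b
      disc-double = ℤ-solve-∀

  slantedTerm-column : ∀ j → ∑⁺ N (λ m → twistedCount (+ suc j + (m + m)) (+ suc j)) ≡ ∑⁺ N (λ n → slantedTerm n (+ suc j))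
  slantedTerm-column j = begin
    ∑⁺ N (λ m → twistedCount (v + (m + m)) v)
      ≡⟨ ∑⁺-∑ N (λ m → twistedCount (v + (m + m)) v) ⟩
    ∑ N (λ i → twistedCount (v + (+ suc i + + suc i)) v)
      ≡⟨ ∑-cong N (λ i → cong (λ n → twistedCount (v + n) v) (sym (+suc*2 i))) ⟩
    ∑ N (λ i → shifted (suc i ℕ.* 2))
      ≡⟨ ∑-even N shifted ⟨
    ∑ (N ℕ.* 2) (λ i → even (suc i) * shifted (suc i))
      ≡⟨ ℤₚ.+-identityˡ _ ⟨
    + 0 + ∑ (N ℕ.* 2) (λ i → even (suc i) * shifted (suc i))
      ≡⟨ cong₂ _+_ (∑-zero< (suc j) below) (∑-cong (N ℕ.* 2) above) ⟨
    ∑ (suc j) f + ∑ (N ℕ.* 2) (λ i → f (suc j ℕ.+ i))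
      ≡⟨ ∑-split (suc j) (N ℕ.* 2) f ⟨
    ∑ (suc j ℕ.+ N ℕ.* 2) f
      ≡⟨ ∑⁺-∑ (suc j ℕ.+ N ℕ.* 2) (λ n → slantedTerm n v) ⟨
    ∑⁺ (suc j ℕ.+ N ℕ.* 2) (λ n → slantedTerm n v)
      ≡⟨ ∑⁺-extend (λ n → slantedTerm n v) (λ i N≤i → trans (cong (c i *_) (twistedCount-large i j N≤i)) (ℤₚ.*-zeroʳ (c i)))
           (ℕₚ.≤-trans (ℕₚ.m≤m*n N 2) (ℕₚ.m≤n+m (N ℕ.* 2) (suc j))) ⟩
    ∑⁺ N (λ n → slantedTerm n v) ∎
    where
    v = + suc j
    c f shifted : ℕ → ℤ
    c i = [ suc j < suc i ] * even (suc i ℕ.+ suc j)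
    f i = slantedTerm (+ suc i) v
    shifted t = twistedCount (v + + t) v
    below : ∀ i → i ℕ.< suc j → f i ≡ + 0
    below i i≤j = cong (λ z → z * even (suc i ℕ.+ suc j) * twistedCount (+ suc i) v) ([<]-false i≤j)
    above : ∀ i → f (suc j ℕ.+ i) ≡ even (suc i) * shifted (suc i)
    above i = cong₂ _*_
      (trans (cong₂ _*_ ([<]-true (s≤s (ℕₚ.m≤m+n (suc j) i))) (cong parityEven parity)) (ℤₚ.*-identityˡ (even (suc i))))
      (cong (λ n → twistedCount (+ n) v) (sym (ℕₚ.+-suc (suc j) i)))
      where
      regroup : ∀ i j → suc (suc j ℕ.+ i) ℕ.+ suc j ≡ suc i ℕ.+ suc j ℕ.* 2
      regroup = ℕ-solve-∀
      parity : ℕ.parity (suc (suc j ℕ.+ i) ℕ.+ suc j) ≡ ℕ.parity (suc i)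
      parity = trans (cong ℕ.parity (regroup i j)) (parity-+*2 (suc i) (suc j))

  slantedSum-twistedCount : Unweighted.slantedSum ≡ ∑⁺² N slantedTerm
  slantedSum-twistedCount = begin
    Unweighted.slantedSum
      ≡⟨ ∑⁺²-cong N (λ b m → ∑±-cong N (term b m)) ⟩
    ∑⁺ N (λ b → ∑⁺ N (λ m → twistedCount (b + (m + m)) b))
      ≡⟨ ∑⁺-cong< N (λ j _ → slantedTerm-column j) ⟩
    ∑⁺ N (λ b → ∑⁺ N (λ n → slantedTerm n b))
      ≡⟨ ∑⁺-swap N N (λ b n → slantedTerm n b) ⟩
    ∑⁺² N slantedTerm ∎
    where
    term : ∀ b m j → Unweighted.term (j + b) (m - j) b ≡ ε j * χ (b - (b + (m + m))) * δ (j * j + (b + (m + m)) * b) (+ N)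
    term b m j = begin
      ψ (m - j) b * + 1 * δ (disc (j + b) (m - j) b) (+ N)
        ≡⟨ *-δ-cong (λ disc≡N → trans (ℤₚ.*-identityʳ (ψ (m - j) b)) (ψ-ε-χ-slanted j b m (mod₃≡0 disc≡N))) ⟩
      ε j * χ (b - (b + (m + m))) * δ (disc (j + b) (m - j) b) (+ N)
        ≡⟨ cong (λ d → ε j * χ (b - (b + (m + m))) * δ d (+ N)) (disc-slanted j b m) ⟩
      ε j * χ (b - (b + (m + m))) * δ (j * j + (b + (m + m)) * b) (+ N) ∎
      where
      disc-slanted : ∀ j b m → (j + b) * (j + b) + + 2 * (m - j) * b ≡ j * j + (b + (m + m)) * b
      disc-slanted = ℤ-solve-∀

  private
    coefficient : ℕ → ℕ → ℤ
    coefficient n v = [ n < v ] * sign (n ℕ.* v ℕ.+ n) - even n - [ n < v ] * even (n ℕ.+ v)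

    coefficient-< : ∀ {n v} → n ℕ.< v → coefficient n v ≡ - even v
    coefficient-< {n} {v} n<v = begin
      coefficient n v
        ≡⟨ cong (λ z → z * sign (n ℕ.* v ℕ.+ n) - even n - z * even (n ℕ.+ v)) ([<]-true n<v) ⟩
      + 1 * sign (n ℕ.* v ℕ.+ n) - even n - + 1 * even (n ℕ.+ v)
        ≡⟨ cong₂ (λ x y → x - even n - y)
             (trans (ℤₚ.*-identityˡ _) (trans (sign-parity (n ℕ.* v ℕ.+ n))
                 (cong paritySign (trans (ℙₚ.+-homo-+ (n ℕ.* v) n) (cong (ℙ._+ p) (ℙₚ.*-homo-* n v))))))
             (trans (ℤₚ.*-identityˡ _) (cong parityEven (ℙₚ.+-homo-+ n v))) ⟩
      paritySign (p ℙ.* r ℙ.+ p) - parityEven p - parityEven (p ℙ.+ r)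
        ≡⟨ table p r ⟩
      - even v ∎
      where
      p = ℕ.parity n
      r = ℕ.parity v
      table : ∀ p r → paritySign (p ℙ.* r ℙ.+ p) - parityEven p - parityEven (p ℙ.+ r) ≡ - parityEven r
      table 0ℙ 0ℙ = refl
      table 0ℙ 1ℙ = refl
      table 1ℙ 0ℙ = refl
      table 1ℙ 1ℙ = refl

    coefficient-> : ∀ {n v} → v ℕ.< n → coefficient n v ≡ - even n
    coefficient-> {n} {v} v<n = trans
      (cong (λ z → z * sign (n ℕ.* v ℕ.+ n) - even n - z * even (n ℕ.+ v)) ([<]-false (ℕₚ.<⇒≤ v<n)))
      (drop-zeros (sign (n ℕ.* v ℕ.+ n)) (even n) (even (n ℕ.+ v)))
      where
      drop-zeros : ∀ s e f → + 0 * s - e - + 0 * f ≡ - e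
      drop-zeros = ℤ-solve-∀

    coefficient-sym : ∀ n v → coefficient n v ≡ coefficient v n
    coefficient-sym n v with ℕₚ.<-cmp n v
    ... | tri< n<v _ _ = trans (coefficient-< n<v) (sym (coefficient-> n<v))
    ... | tri≈ _ refl _ = refl
    ... | tri> _ _ v<n = trans (coefficient-> v<n) (sym (coefficient-< v<n))

  signed-full-slantedᵀ : ∑⁺² N signedTerm ≡ ∑⁺² N fullTerm + ∑⁺² N slantedTermᵀ
  signed-full-slantedᵀ = begin
    ∑⁺² N signedTerm
      ≡⟨ ∑⁺²-cong N (λ n v → decompose [ ∣ n ∣ < ∣ v ∣ ] (sign (∣ n ∣ ℕ.* ∣ v ∣ ℕ.+ ∣ n ∣)) (evenᶻ n) (even (∣ n ∣ ℕ.+ ∣ v ∣))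
          (twistedCount n v)) ⟩
    ∑⁺² N (λ n v → coefficient (∣ n ∣) (∣ v ∣) * twistedCount n v + (fullTerm n v + slantedTermᵀ n v))
      ≡⟨ trans (∑⁺²-+ N _ _) (cong₂ _+_ balanced (∑⁺²-+ N fullTerm slantedTermᵀ)) ⟩
    + 0 + (∑⁺² N fullTerm + ∑⁺² N slantedTermᵀ)
      ≡⟨ ℤₚ.+-identityˡ _ ⟩
    ∑⁺² N fullTerm + ∑⁺² N slantedTermᵀ ∎
    where
    decompose : ∀ l s e f c → l * s * c ≡ (l * s - e - l * f) * c + (e * c + l * f * c)
    decompose = ℤ-solve-∀
    balanced : ∑⁺² N (λ n v → coefficient (∣ n ∣) (∣ v ∣) * twistedCount n v) ≡ + 0
    balanced = ∑⁺²-antisym N _ (λ n v → trans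
      (cong₂ _*_ (coefficient-sym (∣ n ∣) (∣ v ∣)) (twistedCount-antisym n v))
      (sym (ℤₚ.neg-distribʳ-* (coefficient (∣ v ∣) (∣ n ∣)) (twistedCount v n))))

  slantedᵀ : ∑⁺² N slantedTermᵀ ≡ - Unweighted.slantedSum
  slantedᵀ = begin
    ∑⁺² N slantedTermᵀ
      ≡⟨ ∑⁺-swap N N slantedTermᵀ ⟩
    ∑⁺² N (λ n v → slantedTermᵀ v n)
      ≡⟨ ∑⁺²-cong N transposed ⟩
    ∑⁺² N (λ n v → - slantedTerm n v)
      ≡⟨ ∑⁺²-neg N slantedTerm ⟩
    - ∑⁺² N slantedTerm
      ≡⟨ cong -_ slantedSum-twistedCount ⟨
    - Unweighted.slantedSum ∎
    where
    transposed : ∀ n v → slantedTermᵀ v n ≡ - slantedTerm n v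
    transposed n v = trans
      (cong₂ (λ x y → [ ∣ v ∣ < ∣ n ∣ ] * even x * y) (ℕₚ.+-comm (∣ v ∣) (∣ n ∣)) (twistedCount-antisym v n))
      (sym (ℤₚ.neg-distribʳ-* ([ ∣ v ∣ < ∣ n ∣ ] * even (∣ n ∣ ℕ.+ ∣ v ∣)) (twistedCount n v)))

  signedPairs≡slantedSum : ∑⁺² N (λ n v → [ ∣ n ∣ < ∣ v ∣ ] * sign (∣ n ∣ ℕ.* ∣ v ∣ ℕ.+ ∣ n ∣) * twistedCount n v) ≡ Unweighted.slantedSum
  signedPairs≡slantedSum = begin
    ∑⁺² N signedTerm
      ≡⟨ signed-full-slantedᵀ ⟩
    ∑⁺² N fullTerm + ∑⁺² N slantedTermᵀ
      ≡⟨ cong₂ _+_ (trans (sym fullSum-twistedCount) fullSum≡2slantedSum) slantedᵀ ⟩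
    Unweighted.slantedSum + Unweighted.slantedSum - Unweighted.slantedSum
      ≡⟨ cancel Unweighted.slantedSum ⟩
    Unweighted.slantedSum ∎
    where
    cancel : ∀ h → h + h - h ≡ h
    cancel = ℤ-solve-∀

divisorSum : ℕ → ℕ → (ℤ → ℤ → ℤ) → ℤ → ℤ
divisorSum d N c x = ∑⁺² N (λ a b → c a b * δ (+ d * a * b) x)

-- The coefficient of q^x in 1 + e Σ c(a, b) q^{dab}
lambert : ℕ → ℤ → (ℤ → ℤ → ℤ) → ℤ → ℤ
lambert d e c x = δ (+ 0) x + e * divisorSum d ∣ x ∣ c x

private
  +d*a*b : ∀ d i j → + d * + suc i * + suc j ≡ + (d ℕ.* suc i ℕ.* suc j)
  +d*a*b d i j = trans (cong (_* + suc j) (sym (ℤₚ.pos-* d (suc i)))) (sym (ℤₚ.pos-* (d ℕ.* suc i) (suc j)))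

  product-large : ∀ d i j {m} → m ℕ.≤ i ⊎ m ℕ.≤ j → m ℕ.< suc d ℕ.* suc i ℕ.* suc j
  product-large d i j (inj₁ m≤i) = ℕₚ.<-≤-trans (s≤s m≤i) (ℕₚ.≤-trans (ℕₚ.m≤n*m (suc i) (suc d)) (ℕₚ.m≤m*n (suc d ℕ.* suc i) (suc j)))
  product-large d i j (inj₂ m≤j) = ℕₚ.<-≤-trans (s≤s m≤j) (ℕₚ.m≤n*m (suc j) (suc d ℕ.* suc i))

divisorSum-negative : ∀ d N c m → divisorSum d N c -[1+ m ] ≡ + 0
divisorSum-negative d N c m = ∑⁺²-zero N (λ i j → *-δ-≢ (c (+ suc i) (+ suc j)) (positive i j))
  where
  positive : ∀ i j → + d * + suc i * + suc j ≢ -[1+ m ]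
  positive i j dab≡x with trans (sym (+d*a*b d i j)) dab≡x
  ... | ()

divisorSum-extend : ∀ d c x N → x ℤ.≤ + N → divisorSum (suc d) N c x ≡ divisorSum (suc d) ∣ x ∣ c x
divisorSum-extend d c (+ m) N (ℤ.+≤+ m≤N) = trans
  (∑⁺-cong< N (λ i _ → ∑⁺-extend (λ b → c (+ suc i) b * δ (+ suc d * + suc i * b) (+ m)) (λ j m≤j → vanishes i j (inj₂ m≤j)) m≤N))
  (∑⁺-extend (λ a → ∑⁺ m (λ b → c a b * δ (+ suc d * a * b) (+ m))) (λ i m≤i → ∑⁺-zero m (λ j _ → vanishes i j (inj₁ m≤i))) m≤N)
  where
  vanishes : ∀ i j → m ℕ.≤ i ⊎ m ℕ.≤ j → c (+ suc i) (+ suc j) * δ (+ suc d * + suc i * + suc j) (+ m) ≡ + 0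
  vanishes i j large = *-δ-≢ (c (+ suc i) (+ suc j)) (λ dab≡m →
    ℕₚ.<-irrefl (ℤₚ.+-injective (trans (sym dab≡m) (+d*a*b (suc d) i j))) (product-large d i j large))
divisorSum-extend d c -[1+ m ] N _ = trans (divisorSum-negative (suc d) N c m) (sym (divisorSum-negative (suc d) (suc m) c m))

lambert-negative : ∀ d e c m → lambert d e c -[1+ m ] ≡ + 0
lambert-negative d e c m = trans (cong₂ (λ x y → x + e * y) (δ-≢ (λ ())) (divisorSum-negative d (suc m) c m))
  (trans (ℤₚ.+-identityˡ _) (ℤₚ.*-zeroʳ e))

x-k²≤x : ∀ x k → x - k * k ℤ.≤ x
x-k²≤x x k = ≡.subst (λ z → x - z ℤ.≤ x) (sym (k*k≡square k)) (ℤₚ.i-j≤i x (+ square k))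

∑±-lambert : ∀ N d e c (f : ℤ → ℤ) → ∑± N (λ k → f k * lambert (suc d) e c (+ N - k * k)) ≡
  ∑± N (λ k → f k * δ (k * k) (+ N)) + e * ∑⁺² N (λ a b → ∑± N (λ k → f k * c a b * δ (k * k + + suc d * a * b) (+ N)))
∑±-lambert N d e c f = begin
  ∑± N (λ k → f k * lambert (suc d) e c (+ N - k * k))
    ≡⟨ ∑±-cong N (λ k → trans
         (cong₂ (λ x y → f k * (x + e * y)) (trans (δ-transpose (k * k) (+ 0) (+ N)) (cong (λ z → δ z (+ N)) (ℤₚ.+-identityʳ (k * k))))
           (sym (divisorSum-extend d c (+ N - k * k) N (x-k²≤x (+ N) k))))
         (expand (f k) _ e _)) ⟩
  ∑± N (λ k → f k * δ (k * k) (+ N) + e * (f k * divisorSum (suc d) N c (+ N - k * k)))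
    ≡⟨ trans (∑±-+ N _ _) (cong (λ z → ∑± N (λ k → f k * δ (k * k) (+ N)) + z) (∑±-*ˡ N e _)) ⟩
  ∑± N (λ k → f k * δ (k * k) (+ N)) + e * ∑± N (λ k → f k * divisorSum (suc d) N c (+ N - k * k))
    ≡⟨ cong (λ z → ∑± N (λ k → f k * δ (k * k) (+ N)) + e * z) interchanged ⟩
  ∑± N (λ k → f k * δ (k * k) (+ N)) + e * ∑⁺² N (λ a b → ∑± N (λ k → f k * c a b * δ (k * k + + suc d * a * b) (+ N))) ∎
  where
  expand : ∀ f u e v → f * (u + e * v) ≡ f * u + e * (f * v)
  expand = ℤ-solve-∀
  shifted : ∀ k a b → f k * (c a b * δ (+ suc d * a * b) (+ N - k * k)) ≡ f k * c a b * δ (k * k + + suc d * a * b) (+ N)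
  shifted k a b = trans (sym (ℤₚ.*-assoc (f k) (c a b) _)) (cong (f k * c a b *_) (δ-transpose (k * k) (+ suc d * a * b) (+ N)))
  interchanged : ∑± N (λ k → f k * divisorSum (suc d) N c (+ N - k * k)) ≡
    ∑⁺² N (λ a b → ∑± N (λ k → f k * c a b * δ (k * k + + suc d * a * b) (+ N)))
  interchanged = begin
    ∑± N (λ k → f k * divisorSum (suc d) N c (+ N - k * k))
      ≡⟨ ∑±-cong N (λ k → sym (∑⁺²-*ˡ N (f k) _)) ⟩
    ∑± N (λ k → ∑⁺² N (λ a b → f k * (c a b * δ (+ suc d * a * b) (+ N - k * k))))
      ≡⟨ ∑±-cong N (λ k → ∑⁺²-cong N (shifted k)) ⟩
    ∑± N (λ k → ∑⁺² N (λ a b → f k * c a b * δ (k * k + + suc d * a * b) (+ N)))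
      ≡⟨ ∑±-∑⁺ N N _ ⟩
    ∑⁺ N (λ a → ∑± N (λ k → ∑⁺ N (λ b → f k * c a b * δ (k * k + + suc d * a * b) (+ N))))
      ≡⟨ ∑⁺-cong N (λ a → ∑±-∑⁺ N N _) ⟩
    ∑⁺² N (λ a b → ∑± N (λ k → f k * c a b * δ (k * k + + suc d * a * b) (+ N))) ∎

-- Half the number of representations by the hexagonal form, as a divisor sum
ℓ : ℤ → ℤ
ℓ = lambert 2 (+ 3) ψ

module DivisorSide (M : ℕ) where
  open LevelSums M public

  squareRoots : ℤ
  squareRoots = ∑± N (λ k → δ (k * k) (+ N))

  ∑±-ℓ : ∑± N (λ k → ℓ (+ N - k * k)) ≡ squareRoots + + 3 * Unweighted.fullSum
  ∑±-ℓ = begin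
    ∑± N (λ k → ℓ (+ N - k * k))
      ≡⟨ ∑±-cong N (λ k → sym (ℤₚ.*-identityˡ _)) ⟩
    ∑± N (λ k → + 1 * ℓ (+ N - k * k))
      ≡⟨ ∑±-lambert N 1 (+ 3) ψ (λ _ → + 1) ⟩
    ∑± N (λ k → + 1 * δ (k * k) (+ N)) + + 3 * ∑⁺² N (λ a b → ∑± N (λ k → + 1 * ψ a b * δ (disc k a b) (+ N)))
      ≡⟨ cong₂ (λ x y → x + + 3 * y) (∑±-cong N (λ k → ℤₚ.*-identityˡ _))
           (∑⁺²-cong N (λ a b → ∑±-cong N (λ k → cong (_* δ (disc k a b) (+ N)) (ℤₚ.*-comm (+ 1) (ψ a b))))) ⟩
    squareRoots + + 3 * Unweighted.fullSum ∎

  private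
    recursionWeight : ℤ → ℤ
    recursionWeight k = + 3 * (k * k) - + N

    squareRoots-positive : M ≢ 0 → squareRoots ≡ positiveSquareRoots + positiveSquareRoots
    squareRoots-positive M≢0 = begin
      squareRoots
        ≡⟨ ∑±-unfold N _ ⟩
      δ (+ 0) (+ N) + (positiveSquareRoots + ∑⁺ N (λ w → δ (- w * - w) (+ N)))
        ≡⟨ cong₂ (λ x y → x + (positiveSquareRoots + y)) (δ-≢ (0≢3M M M≢0)) (∑⁺-cong N (λ w → cong (λ z → δ z (+ N)) (neg² w))) ⟩
      + 0 + (positiveSquareRoots + positiveSquareRoots)
        ≡⟨ ℤₚ.+-identityˡ _ ⟩
      positiveSquareRoots + positiveSquareRoots ∎
      where
      0≢3M : ∀ M → M ≢ 0 → + 0 ≢ + (M ℕ.* 3)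
      0≢3M zero M≢0 _ = M≢0 refl
      0≢3M (suc M) _ ()
      neg² : ∀ w → - w * - w ≡ w * w
      neg² = ℤ-solve-∀

    squareTerms : M ≢ 0 → ∑± N (λ k → recursionWeight k * δ (k * k) (+ N)) ≡ + 2 * (+ M * + 3) * (positiveSquareRoots + positiveSquareRoots)
    squareTerms M≢0 = begin
      ∑± N (λ k → recursionWeight k * δ (k * k) (+ N))
        ≡⟨ ∑±-cong N (λ k → *-δ-cong (λ k²≡N → trans (cong (λ z → + 3 * z - + N) k²≡N) (double (+ N)))) ⟩
      ∑± N (λ k → + 2 * + N * δ (k * k) (+ N))
        ≡⟨ ∑±-*ˡ N (+ 2 * + N) _ ⟩
      + 2 * + N * squareRoots
        ≡⟨ cong₂ (λ x y → + 2 * x * y) (ℤₚ.pos-* M 3) (squareRoots-positive M≢0) ⟩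
      + 2 * (+ M * + 3) * (positiveSquareRoots + positiveSquareRoots) ∎
      where
      double : ∀ n → + 3 * n - n ≡ + 2 * n
      double = ℤ-solve-∀

    divisorTerms : ∑⁺² N (λ a b → ∑± N (λ k → recursionWeight k * ψ a b * δ (disc k a b) (+ N))) ≡ + 2 * Quadratic.fullSum
    divisorTerms = trans (∑⁺²-cong N row) (∑⁺²-*ˡ N (+ 2) _)
      where
      -- 3k² − (k² + 2ab) = (k − b)(k + a) + (−k − b)(−k + a)
      symmetrized : ∀ k a b p → (+ 3 * (k * k) - (k * k + + 2 * a * b)) * p ≡ p * ((k - b) * (k + a)) + p * ((- k - b) * (- k + a))
      symmetrized = ℤ-solve-∀
      disc-neg : ∀ k a b → k * k + + 2 * a * b ≡ - k * - k + + 2 * a * b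
      disc-neg = ℤ-solve-∀
      term : ∀ a b k → recursionWeight k * ψ a b * δ (disc k a b) (+ N) ≡ Quadratic.term k a b + Quadratic.term (- k) a b
      term a b k = begin
        recursionWeight k * ψ a b * δ (disc k a b) (+ N)
          ≡⟨ *-δ-cong (λ disc≡N → trans (cong (λ n → (+ 3 * (k * k) - n) * ψ a b) (sym disc≡N)) (symmetrized k a b (ψ a b))) ⟩
        (ψ a b * quadraticWeight k a b + ψ a b * quadraticWeight (- k) a b) * δ (disc k a b) (+ N)
          ≡⟨ ℤₚ.*-distribʳ-+ (δ (disc k a b) (+ N)) (ψ a b * quadraticWeight k a b) (ψ a b * quadraticWeight (- k) a b) ⟩
        Quadratic.term k a b + ψ a b * quadraticWeight (- k) a b * δ (disc k a b) (+ N)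
          ≡⟨ cong (λ d → Quadratic.term k a b + ψ a b * quadraticWeight (- k) a b * δ d (+ N)) (disc-neg k a b) ⟩
        Quadratic.term k a b + Quadratic.term (- k) a b ∎
      row : ∀ a b → ∑± N (λ k → recursionWeight k * ψ a b * δ (disc k a b) (+ N)) ≡ + 2 * ∑± N (λ k → Quadratic.term k a b)
      row a b = begin
        ∑± N (λ k → recursionWeight k * ψ a b * δ (disc k a b) (+ N))
          ≡⟨ trans (∑±-cong N (term a b)) (∑±-+ N _ _) ⟩
        ∑± N (λ k → Quadratic.term k a b) + ∑± N (λ k → Quadratic.term (- k) a b)
          ≡⟨ cong (λ z → ∑± N (λ k → Quadratic.term k a b) + z) (∑±-reflect N (λ k → Quadratic.term k a b)) ⟩
        ∑± N (λ k → Quadratic.term k a b) + ∑± N (λ k → Quadratic.term k a b)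
          ≡⟨ twice (∑± N (λ k → Quadratic.term k a b)) ⟩
        + 2 * ∑± N (λ k → Quadratic.term k a b) ∎
        where
        twice : ∀ x → x + x ≡ + 2 * x
        twice = ℤ-solve-∀

  ℓ-recursion : M ≢ 0 → ∑± N (λ k → (+ 3 * (k * k) - + N) * ℓ (+ N - k * k)) ≡ + 0
  ℓ-recursion M≢0 = begin
    ∑± N (λ k → recursionWeight k * ℓ (+ N - k * k))
      ≡⟨ ∑±-lambert N 1 (+ 3) ψ recursionWeight ⟩
    ∑± N (λ k → recursionWeight k * δ (k * k) (+ N)) + + 3 * ∑⁺² N (λ a b → ∑± N (λ k → recursionWeight k * ψ a b * δ (disc k a b) (+ N)))
      ≡⟨ cong₂ (λ x y → x + + 3 * y) (squareTerms M≢0) (trans divisorTerms (cong (+ 2 *_) quadratic-fullSum)) ⟩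
    + 2 * (+ M * + 3) * (positiveSquareRoots + positiveSquareRoots) + + 3 * (+ 2 * - (+ 2 * (+ M * positiveSquareRoots)))
      ≡⟨ cancel (+ M) positiveSquareRoots ⟩
    + 0 ∎
    where
    cancel : ∀ m s → + 2 * (m * + 3) * (s + s) + + 3 * (+ 2 * - (+ 2 * (m * s))) ≡ + 0
    cancel = ℤ-solve-∀

-- (x − y)² + (y − z)² + (z − x)² for x + y + z = k
hexForm : ℤ → ℤ → ℤ → ℤ
hexForm k y z = + 2 * (k * k - + 3 * k * (y + z) + + 3 * (y * y + y * z + z * z))

threeSquares : ℤ → ℤ → ℤ → ℤ
threeSquares x y z = x * x + y * y + z * z

k²+hexForm : ∀ k y z → k * k + hexForm k y z ≡ + 3 * threeSquares (k - y - z) y z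
k²+hexForm = expand
  where
  expand : ∀ k y z → k * k + + 2 * (k * k - + 3 * k * (y + z) + + 3 * (y * y + y * z + z * z)) ≡
    + 3 * ((k - y - z) * (k - y - z) + y * y + z * z)
  expand = ℤ-solve-∀

hexForm-threeSquares : ∀ k y z → hexForm k y z ≡ threeSquares (k - y - z - y) (y - z) (z - (k - y - z))
hexForm-threeSquares = expand
  where
  expand : ∀ k y z → + 2 * (k * k - + 3 * k * (y + z) + + 3 * (y * y + y * z + z * z)) ≡
    (k - y - z - y) * (k - y - z - y) + (y - z) * (y - z) + (z - (k - y - z)) * (z - (k - y - z))
  expand = ℤ-solve-∀

hexForm-swap : ∀ k y z → hexForm k y z ≡ hexForm k z y
hexForm-swap = swap
  where
  swap : ∀ k y z → + 2 * (k * k - + 3 * k * (y + z) + + 3 * (y * y + y * z + z * z)) ≡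
    + 2 * (k * k - + 3 * k * (z + y) + + 3 * (z * z + z * y + y * y))
  swap = ℤ-solve-∀

hexForm-neg : ∀ k y z → hexForm (- k) (- y) (- z) ≡ hexForm k y z
hexForm-neg = neg
  where
  neg : ∀ k y z → + 2 * (- k * - k - + 3 * (- k) * (- y + - z) + + 3 * (- y * - y + - y * - z + - z * - z)) ≡
    + 2 * (k * k - + 3 * k * (y + z) + + 3 * (y * y + y * z + z * z))
  neg = ℤ-solve-∀

hexForm-translate : ∀ t k y z → hexForm (+ 3 * t + k) (t + y) (t + z) ≡ hexForm k y z
hexForm-translate = translate
  where
  translate : ∀ t k y z →
    + 2 * ((+ 3 * t + k) * (+ 3 * t + k) - + 3 * (+ 3 * t + k) * (t + y + (t + z))
      + + 3 * ((t + y) * (t + y) + (t + y) * (t + z) + (t + z) * (t + z))) ≡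
    + 2 * (k * k - + 3 * k * (y + z) + + 3 * (y * y + y * z + z * z))
  translate = ℤ-solve-∀

threeSquares-ℕ : ∀ x y z → threeSquares x y z ≡ + (square x ℕ.+ square y ℕ.+ square z)
threeSquares-ℕ x y z = cong₂ _+_ (cong₂ _+_ (k*k≡square x) (k*k≡square y)) (k*k≡square z)

hexForm-ℕ : ∀ k y z → ∃ λ n → hexForm k y z ≡ + n
hexForm-ℕ k y z = _ , trans (hexForm-threeSquares k y z) (threeSquares-ℕ (k - y - z - y) (y - z) (z - (k - y - z)))

hexForm≢negative : ∀ k y z n → hexForm k y z ≢ -[1+ n ]
hexForm≢negative k y z n hexForm≡x with trans (sym (proj₂ (hexForm-ℕ k y z))) hexForm≡x
... | ()

k²+hexForm-large : ∀ k y z {N} → N ℕ.< ∣ y ∣ ⊎ N ℕ.< ∣ z ∣ → k * k + hexForm k y z ≢ + N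
k²+hexForm-large k y z {N} (inj₁ N<y) k²+hexForm≡N = square+-≢ y n (inj₁ N<y) (begin
  y * y + + n                                     ≡⟨ cong (λ w → y * y + w) +n ⟩
  y * y + (x * x + z * z + (threeSquares x y z + threeSquares x y z))   ≡⟨ regroup x y z ⟩
  + 3 * threeSquares x y z                        ≡⟨ k²+hexForm k y z ⟨
  k * k + hexForm k y z                           ≡⟨ k²+hexForm≡N ⟩
  + N                                             ∎)
  where
  x = k - y - z
  s = square x ℕ.+ square y ℕ.+ square z
  n = square x ℕ.+ square z ℕ.+ (s ℕ.+ s)
  +n : + n ≡ x * x + z * z + (threeSquares x y z + threeSquares x y z)
  +n = sym (cong₂ _+_ (cong₂ _+_ (k*k≡square x) (k*k≡square z)) (cong₂ _+_ (threeSquares-ℕ x y z) (threeSquares-ℕ x y z)))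
  regroup : ∀ x y z → y * y + (x * x + z * z + (x * x + y * y + z * z + (x * x + y * y + z * z))) ≡ + 3 * (x * x + y * y + z * z)
  regroup = ℤ-solve-∀
k²+hexForm-large k y z (inj₂ N<z) k²+hexForm≡N =
  k²+hexForm-large k z y (inj₁ N<z) (trans (cong (λ w → k * k + w) (hexForm-swap k z y)) k²+hexForm≡N)

hexCount : ℕ → ℤ → ℤ → ℤ
hexCount R k m = ∑± R (λ y → ∑± R (λ z → δ (hexForm k y z) m))

hexCount-negative : ∀ R k n → hexCount R k -[1+ n ] ≡ + 0
hexCount-negative R k n = ∑±-zero R (λ y → ∑±-zero R (λ z → δ-≢ (hexForm≢negative k y z n)))

module _ {k m : ℤ} {B : ℕ} (k²+m≡B : k * k + m ≡ + B) where
  private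
    δ-hexForm-large : ∀ y z → B ℕ.< ∣ y ∣ ⊎ B ℕ.< ∣ z ∣ → δ (hexForm k y z) m ≡ + 0
    δ-hexForm-large y z large = δ-≢ (λ hexForm≡m → k²+hexForm-large k y z large (trans (cong (λ w → k * k + w) hexForm≡m) k²+m≡B))

    supported-z : ∀ y → Supported B (λ z → δ (hexForm k y z) m)
    supported-z y z B<z = δ-hexForm-large y z (inj₂ B<z)

    supported-y : ∀ R (f : ℤ → ℤ) → Supported B (λ y → ∑± R (λ z → δ (hexForm k y (f z)) m))
    supported-y R f y B<y = ∑±-zero R (λ z → δ-hexForm-large y (f z) (inj₁ B<y))

  hexCount-extend : ∀ {R} → B ℕ.≤ R → hexCount R k m ≡ hexCount B k m
  hexCount-extend {R} B≤R = trans
    (∑±-cong R (λ y → ∑±-extend (λ z → δ (hexForm k y z) m) (supported-z y) B≤R))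
    (∑±-extend (λ y → ∑± B (λ z → δ (hexForm k y z) m)) (supported-y B (λ z → z)) B≤R)

  hexCount-translate : ∀ t r n → k ≡ + 3 * t + r → ∣ t ∣ ℕ.≤ n → hexCount B k m ≡ hexCount (B ℕ.+ n) r m
  hexCount-translate t r n k≡3t+r t≤n = begin
    hexCount B k m
      ≡⟨ ∑±-cong B (λ y → ∑±-translate t (λ z → δ (hexForm k y z) m) (supported-z y) t≤n) ⟩
    ∑± B (λ y → ∑± (B ℕ.+ n) (λ z → δ (hexForm k y (t + z)) m))
      ≡⟨ ∑±-translate t (λ y → ∑± (B ℕ.+ n) (λ z → δ (hexForm k y (t + z)) m)) (supported-y (B ℕ.+ n) (λ z → t + z)) t≤n ⟩
    ∑± (B ℕ.+ n) (λ y → ∑± (B ℕ.+ n) (λ z → δ (hexForm k (t + y) (t + z)) m))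
      ≡⟨ ∑±-cong (B ℕ.+ n) (λ y → ∑±-cong (B ℕ.+ n) (λ z → cong (λ w → δ w m)
           (trans (cong (λ k → hexForm k (t + y) (t + z)) k≡3t+r) (hexForm-translate t r y z)))) ⟩
    hexCount (B ℕ.+ n) r m ∎

hexCount-neg : ∀ R k m → hexCount R (- k) m ≡ hexCount R k m
hexCount-neg R k m = begin
  hexCount R (- k) m
    ≡⟨ ∑±-reflect R (λ y → ∑± R (λ z → δ (hexForm (- k) y z) m)) ⟨
  ∑± R (λ y → ∑± R (λ z → δ (hexForm (- k) (- y) z) m))
    ≡⟨ ∑±-cong R (λ y → sym (∑±-reflect R (λ z → δ (hexForm (- k) (- y) z) m))) ⟩
  ∑± R (λ y → ∑± R (λ z → δ (hexForm (- k) (- y) (- z)) m))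
    ≡⟨ ∑±-cong R (λ y → ∑±-cong R (λ z → cong (λ w → δ w m) (hexForm-neg k y z))) ⟩
  hexCount R k m ∎

hexagonalByResidue : ℤ/3 → ℤ → ℤ
hexagonalByResidue 0F x = hexCount (suc ∣ x ∣) (+ 0) x
hexagonalByResidue 1F x = + 0
hexagonalByResidue 2F x = hexCount (suc ∣ x ∣) (+ 1) x

-- For x ≡ 0 (resp. 2) modulo 3, the number of y, z with hexForm k y z ≡ x for any k ≡ 0 (resp. ±1)
hexagonal : ℤ → ℤ
hexagonal x = hexagonalByResidue (mod₃ x) x

hexagonalByResidue-negative : ∀ a n → hexagonalByResidue a -[1+ n ] ≡ + 0
hexagonalByResidue-negative 0F n = hexCount-negative (suc (suc n)) (+ 0) n
hexagonalByResidue-negative 1F n = refl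
hexagonalByResidue-negative 2F n = hexCount-negative (suc (suc n)) (+ 1) n

balanced : ℤ/3 → ℤ
balanced 0F = + 0
balanced 1F = + 1
balanced 2F = -[1+ 0 ]

balanced-division : ∀ k → ∃ λ t → k ≡ + 3 * t + balanced (mod₃ k)
balanced-division (+ n) = natural n
  where
  increment : ∀ a t → ∃ λ t′ → + 1 + (+ 3 * t + balanced a) ≡ + 3 * t′ + balanced (suc₃ a)
  increment 0F t = t , move t
    where
    move : ∀ t → + 1 + (+ 3 * t + + 0) ≡ + 3 * t + + 1
    move = ℤ-solve-∀
  increment 1F t = t + + 1 , move t
    where
    move : ∀ t → + 1 + (+ 3 * t + + 1) ≡ + 3 * (t + + 1) + -[1+ 0 ]
    move = ℤ-solve-∀
  increment 2F t = t , move t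
    where
    move : ∀ t → + 1 + (+ 3 * t + -[1+ 0 ]) ≡ + 3 * t + + 0
    move = ℤ-solve-∀
  natural : ∀ n → ∃ λ t → + n ≡ + 3 * t + balanced (mod₃ℕ n)
  natural zero = + 0 , refl
  natural (suc n) with natural n
  ... | t , n≡3t+r with increment (mod₃ℕ n) t
  ...   | t′ , 1+3t+r≡3t′+r′ = t′ , trans (cong (λ z → + 1 + z) n≡3t+r) 1+3t+r≡3t′+r′
balanced-division -[1+ n ] with balanced-division (+ suc n)
... | t , n≡3t+r = - t , (begin
  - + suc n                                     ≡⟨ cong -_ n≡3t+r ⟩
  - (+ 3 * t + balanced (mod₃ℕ (suc n)))        ≡⟨ distribute t (balanced (mod₃ℕ (suc n))) ⟩
  + 3 * - t + - balanced (mod₃ℕ (suc n))        ≡⟨ cong (λ z → + 3 * - t + z) (balanced-neg (mod₃ℕ (suc n))) ⟩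
  + 3 * - t + balanced (-₃ mod₃ℕ (suc n))       ∎)
  where
  distribute : ∀ t b → - (+ 3 * t + b) ≡ + 3 * - t + - b
  distribute = ℤ-solve-∀
  balanced-neg : ∀ a → - balanced a ≡ balanced (-₃ a)
  balanced-neg = from-yes (Finₚ.all? λ a → - balanced a ≟ balanced (-₃ a))

mod₃-minus-square : ∀ N k → mod₃ℕ N ≡ 0F → mod₃ (+ N - k * k) ≡ -₃ (mod₃ k *₃ mod₃ k)
mod₃-minus-square N k 3∣N = trans (mod₃-minus (+ N) (k * k)) (cong₂ (λ a b → a +₃ -₃ b) 3∣N (mod₃-* k k))

cancel-minus : ∀ k n → k + (n - k) ≡ n
cancel-minus = ℤ-solve-∀

hexCount-hexagonal : ∀ N k → mod₃ℕ N ≡ 0F → hexCount N k (+ N - k * k) ≡ hexagonal (+ N - k * k)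
hexCount-hexagonal N k 3∣N = trans (byValue (+ N - k * k) (cancel-minus (k * k) (+ N)))
  (cong (λ a → hexagonalByResidue a (+ N - k * k)) (sym (mod₃-minus-square N k 3∣N)))
  where
  byResidue : ∀ R m → m ℕ.< R → ∀ a → hexCount R (balanced a) (+ m) ≡ hexagonalByResidue (-₃ (a *₃ a)) (+ m)
  byResidue R m m<R 0F = trans (hexCount-extend {+ 0} (ℤₚ.+-identityˡ (+ m)) (ℕₚ.<⇒≤ m<R))
    (sym (hexCount-extend {+ 0} (ℤₚ.+-identityˡ (+ m)) (ℕₚ.n≤1+n m)))
  byResidue R m m<R 1F = hexCount-extend {+ 1} refl m<R
  byResidue R m m<R 2F = trans (hexCount-neg R (+ 1) (+ m)) (byResidue R m m<R 1F)
  byValue : ∀ x → k * k + x ≡ + N → hexCount N k x ≡ hexagonalByResidue (-₃ (mod₃ k *₃ mod₃ k)) x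
  byValue -[1+ n ] _ = trans (hexCount-negative N k n) (sym (hexagonalByResidue-negative (-₃ (mod₃ k *₃ mod₃ k)) n))
  byValue (+ m) k²+m≡N with balanced-division k
  ... | t , k≡3t+r = trans
    (hexCount-translate k²+m≡N t (balanced (mod₃ k)) (∣ t ∣ ℕ.+ suc m) k≡3t+r (ℕₚ.m≤m+n ∣ t ∣ (suc m)))
    (byResidue (N ℕ.+ (∣ t ∣ ℕ.+ suc m)) m (ℕₚ.≤-trans (ℕₚ.m≤n+m (suc m) ∣ t ∣) (ℕₚ.m≤n+m _ N)) (mod₃ k))

module ThreeSquares (M : ℕ) where
  private
    N : ℕ
    N = M ℕ.* 3

    +N : + N ≡ + 3 * + M
    +N = trans (ℤₚ.pos-* M 3) (ℤₚ.*-comm (+ M) (+ 3))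

    δ-*3 : ∀ x → δ (+ 3 * x) (+ N) ≡ δ x (+ M)
    δ-*3 x = δ-⇔ (λ 3x≡N → ℤₚ.*-cancelˡ-≡ (+ 3) _ _ (trans 3x≡N +N)) (λ x≡M → trans (cong (+ 3 *_) x≡M) (sym +N))

  ∑±³ : (ℤ → ℤ → ℤ → ℤ) → ℤ
  ∑±³ c = ∑± N (λ y → ∑± N (λ z → ∑± N (λ x → c x y z * δ (threeSquares x y z) (+ M))))

  module _ (c′ : ℤ → ℤ) where
    private
      byTrace byFirst : ℤ → ℤ → ℤ → ℤ
      byTrace k y z = c′ k * δ (hexForm k y z) (+ N - k * k)
      byFirst y z x = c′ (x + y + z) * δ (threeSquares x y z) (+ M)

      trace : ∀ y z k → byFirst y z (- (y + z) + k) ≡ byTrace k y z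
      trace y z k = begin
        c′ (- (y + z) + k + y + z) * δ (threeSquares (- (y + z) + k) y z) (+ M)
          ≡⟨ cong₂ (λ t x → c′ t * δ (threeSquares x y z) (+ M)) (sum y z k) (first y z k) ⟩
        c′ k * δ (threeSquares (k - y - z) y z) (+ M)
          ≡⟨ cong (c′ k *_) (δ-*3 (threeSquares (k - y - z) y z)) ⟨
        c′ k * δ (+ 3 * threeSquares (k - y - z) y z) (+ N)
          ≡⟨ cong (λ w → c′ k * δ w (+ N)) (k²+hexForm k y z) ⟨
        c′ k * δ (k * k + hexForm k y z) (+ N)
          ≡⟨ cong (c′ k *_) (δ-transpose (k * k) (hexForm k y z) (+ N)) ⟨
        byTrace k y z ∎
        where
        sum : ∀ y z k → - (y + z) + k + y + z ≡ k
        sum = ℤ-solve-∀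
        first : ∀ y z k → - (y + z) + k ≡ k - y - z
        first = ℤ-solve-∀

      byFirst-supported : ∀ y z → Supported N (byFirst y z)
      byFirst-supported y z x N<x = *-δ-≢ (c′ (x + y + z)) (λ sum≡M →
        square+-≢ x (square y ℕ.+ square z) (inj₁ (ℕₚ.≤-<-trans (ℕₚ.m≤m*n M 3) N<x))
          (trans (cong (λ w → x * x + w) (sym (cong₂ _+_ (k*k≡square y) (k*k≡square z))))
              (trans (sym (ℤₚ.+-assoc (x * x) (y * y) (z * z))) sum≡M)))

      byTrace-supported : ∀ y z → Supported N (λ k → byTrace k y z)
      byTrace-supported y z k N<k = *-δ-≢ (c′ k) (λ hexForm≡N-k² → square+-≢ k (proj₁ (hexForm-ℕ k y z)) (inj₁ N<k)
        (trans (cong (λ w → k * k + w) (trans (sym (proj₂ (hexForm-ℕ k y z))) hexForm≡N-k²)) (cancel-minus (k * k) (+ N))))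

      substitute : ∀ y z → ∑± N (byFirst y z) ≡ ∑± N (λ k → byTrace k y z)
      substitute y z = begin
        ∑± N (byFirst y z)
          ≡⟨ ∑±-translate (- (y + z)) (byFirst y z) (byFirst-supported y z) ℕₚ.≤-refl ⟩
        ∑± (N ℕ.+ ∣ - (y + z) ∣) (λ k → byFirst y z (- (y + z) + k))
          ≡⟨ ∑±-cong _ (trace y z) ⟩
        ∑± (N ℕ.+ ∣ - (y + z) ∣) (λ k → byTrace k y z)
          ≡⟨ ∑±-extend (λ k → byTrace k y z) (byTrace-supported y z) (ℕₚ.m≤m+n N _) ⟩
        ∑± N (λ k → byTrace k y z) ∎

    -- 3 (x² + y² + z²) − (x + y + z)² is the hexagonal form.
    ∑±³-byTrace : ∀ c → (∀ x y z → threeSquares x y z ≡ + M → c x y z ≡ c′ (x + y + z)) →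
      ∑±³ c ≡ ∑± N (λ k → c′ k * hexCount N k (+ N - k * k))
    ∑±³-byTrace c c≡c′ = begin
      ∑±³ c
        ≡⟨ ∑±-cong N (λ y → ∑±-cong N (λ z → trans (∑±-cong N (λ x → *-δ-cong (c≡c′ x y z))) (substitute y z))) ⟩
      ∑± N (λ y → ∑± N (λ z → ∑± N (λ k → byTrace k y z)))
        ≡⟨ ∑±-cong N (λ y → ∑±-swap N N _) ⟩
      ∑± N (λ y → ∑± N (λ k → ∑± N (byTrace k y)))
        ≡⟨ ∑±-swap N N _ ⟩
      ∑± N (λ k → ∑± N (λ y → ∑± N (byTrace k y)))
        ≡⟨ ∑±-cong N (λ k → trans (∑±-cong N (λ y → ∑±-*ˡ N (c′ k) _)) (∑±-*ˡ N (c′ k) _)) ⟩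
      ∑± N (λ k → c′ k * hexCount N k (+ N - k * k)) ∎

  -- Each of the monomials xy, yz, zx is odd in one of the variables.
  ∑±³-mixed : ∑±³ (λ x y z → + 6 * (x * y + y * z + z * x)) ≡ + 0
  ∑±³-mixed = begin
    ∑±³ (λ x y z → + 6 * (x * y + y * z + z * x))
      ≡⟨ ∑±-cong N (λ y → ∑±-cong N (λ z → drop-odd y z)) ⟩
    ∑± N (λ y → ∑± N (λ z → ∑± N (λ x → + 6 * (y * z) * count x y z)))
      ≡⟨ ∑±-zero N (λ y → ∑±-odd N _ (λ z → trans (∑±-cong N (odd-z y z)) (∑±-neg N _))) ⟩
    + 0 ∎
    where
    count : ℤ → ℤ → ℤ → ℤ
    count x y z = δ (threeSquares x y z) (+ M)
    split : ∀ x y z e → + 6 * (x * y + y * z + z * x) * e ≡ x * (+ 6 * (y + z)) * e + + 6 * (y * z) * e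
    split = ℤ-solve-∀
    odd-x : ∀ y z x → x * (+ 6 * (y + z)) * count x y z ≡ - (- x * (+ 6 * (y + z)) * count (- x) y z)
    odd-x y z x = trans (neg-out x (+ 6 * (y + z)) (count x y z)) (cong (λ w → - (- x * (+ 6 * (y + z)) * δ w (+ M))) (neg-square x y z))
      where
      neg-out : ∀ x c e → x * c * e ≡ - (- x * c * e)
      neg-out = ℤ-solve-∀
      neg-square : ∀ x y z → x * x + y * y + z * z ≡ - x * - x + y * y + z * z
      neg-square = ℤ-solve-∀
    odd-z : ∀ y z x → + 6 * (y * z) * count x y z ≡ - (+ 6 * (y * - z) * count x y (- z))
    odd-z y z x = trans (neg-out y z (count x y z)) (cong (λ w → - (+ 6 * (y * - z) * δ w (+ M))) (neg-square x y z))
      where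
      neg-out : ∀ y z e → + 6 * (y * z) * e ≡ - (+ 6 * (y * - z) * e)
      neg-out = ℤ-solve-∀
      neg-square : ∀ x y z → x * x + y * y + z * z ≡ x * x + y * y + - z * - z
      neg-square = ℤ-solve-∀
    drop-odd : ∀ y z → ∑± N (λ x → + 6 * (x * y + y * z + z * x) * count x y z) ≡ ∑± N (λ x → + 6 * (y * z) * count x y z)
    drop-odd y z = begin
      ∑± N (λ x → + 6 * (x * y + y * z + z * x) * count x y z)
        ≡⟨ ∑±-cong N (λ x → split x y z (count x y z)) ⟩
      ∑± N (λ x → x * (+ 6 * (y + z)) * count x y z + + 6 * (y * z) * count x y z)
        ≡⟨ ∑±-+ N _ _ ⟩
      ∑± N (λ x → x * (+ 6 * (y + z)) * count x y z) + ∑± N (λ x → + 6 * (y * z) * count x y z)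
        ≡⟨ cong (_+ ∑± N (λ x → + 6 * (y * z) * count x y z)) (∑±-odd N _ (odd-x y z)) ⟩
      + 0 + ∑± N (λ x → + 6 * (y * z) * count x y z)
        ≡⟨ ℤₚ.+-identityˡ _ ⟩
      ∑± N (λ x → + 6 * (y * z) * count x y z) ∎

  threeSquares-hexagonal : ∑±³ (λ _ _ _ → + 1) ≡ ∑± N (λ k → hexagonal (+ N - k * k))
  threeSquares-hexagonal = trans (∑±³-byTrace (λ _ → + 1) (λ _ _ _ → + 1) (λ _ _ _ _ → refl))
    (∑±-cong N (λ k → trans (ℤₚ.*-identityˡ _) (hexCount-hexagonal N k (mod₃ℕ-*3 M))))

  hexagonal-recursion : ∑± N (λ k → (+ 3 * (k * k) - + N) * hexagonal (+ N - k * k)) ≡ + 0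
  hexagonal-recursion = begin
    ∑± N (λ k → (+ 3 * (k * k) - + N) * hexagonal (+ N - k * k))
      ≡⟨ ∑±-cong N (λ k → cong ((+ 3 * (k * k) - + N) *_) (sym (hexCount-hexagonal N k (mod₃ℕ-*3 M)))) ⟩
    ∑± N (λ k → (+ 3 * (k * k) - + N) * hexCount N k (+ N - k * k))
      ≡⟨ ∑±³-byTrace (λ k → + 3 * (k * k) - + N) (λ x y z → + 6 * (x * y + y * z + z * x)) trace ⟨
    ∑±³ (λ x y z → + 6 * (x * y + y * z + z * x))
      ≡⟨ ∑±³-mixed ⟩
    + 0 ∎
    where
    expand : ∀ x y z → + 6 * (x * y + y * z + z * x) ≡ + 3 * ((x + y + z) * (x + y + z)) - + 3 * (x * x + y * y + z * z)
    expand = ℤ-solve-∀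
    trace : ∀ x y z → threeSquares x y z ≡ + M → + 6 * (x * y + y * z + z * x) ≡ + 3 * ((x + y + z) * (x + y + z)) - + N
    trace x y z sum≡M = trans (expand x y z)
      (cong (λ w → + 3 * ((x + y + z) * (x + y + z)) - w) (trans (cong (+ 3 *_) sum≡M) (sym +N)))

2*w≢odd : ∀ w n → ℕ.parity n ≡ 1ℙ → + 2 * w ≢ + n
2*w≢odd w n odd 2w≡n with trans (sym odd) (trans (cong ℕ.parity (trans (cong ∣_∣ (sym 2w≡n)) (ℤₚ.abs-* (+ 2) w))) (ℙₚ.*-homo-* 2 ∣ w ∣))
... | ()

hexagonal-odd : ∀ n → ℕ.parity n ≡ 1ℙ → hexagonal (+ n) ≡ + 0
hexagonal-odd n odd = byResidue (mod₃ℕ n)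
  where
  hexCount-odd : ∀ R k → hexCount R k (+ n) ≡ + 0
  hexCount-odd R k = ∑±-zero R (λ y → ∑±-zero R (λ z → δ-≢ (2*w≢odd _ n odd)))
  byResidue : ∀ a → hexagonalByResidue a (+ n) ≡ + 0
  byResidue 0F = hexCount-odd (suc n) (+ 0)
  byResidue 1F = refl
  byResidue 2F = hexCount-odd (suc n) (+ 1)

ℓ-odd : ∀ n → ℕ.parity n ≡ 1ℙ → ℓ (+ n) ≡ + 0
ℓ-odd (suc n) odd = cong₂ (λ x y → x + + 3 * y) (δ-≢ (λ ())) (∑⁺²-zero (suc n) (λ i j → *-δ-≢ (ψ (+ suc i) (+ suc j))
  (λ 2ab≡n → 2*w≢odd (+ suc i * + suc j) (suc n) odd (trans (sym (ℤₚ.*-assoc (+ 2) (+ suc i) (+ suc j))) 2ab≡n))))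

mod₃-minus-square≢1 : ∀ N k → mod₃ℕ N ≡ 0F → mod₃ (+ N - k * k) ≢ 1F
mod₃-minus-square≢1 N k 3∣N ≡1 = table (mod₃ k) (trans (sym (mod₃-minus-square N k 3∣N)) ≡1)
  where
  table : ∀ a → -₃ (a *₃ a) ≢ 1F
  table = from-yes (Finₚ.all? λ a → ¬? (-₃ (a *₃ a) ≟₃ 1F))

*-≡0-cancelˡ : ∀ c x → c ≢ + 0 → c * x ≡ + 0 → x ≡ + 0
*-≡0-cancelˡ c x c≢0 cx≡0 with ℤₚ.i*j≡0⇒i≡0∨j≡0 c cx≡0
... | inj₁ c≡0 = ⊥-elim (c≢0 c≡0)
... | inj₂ x≡0 = x≡0

-- A solution of Σ_k (3k² − N) g(N − k²) = 0 for all N = 3M > 0 is determined at m ≡ 0 (mod 3) by N = m and k = 0,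
-- and at m ≡ 2 (mod 3) by N = m + 1 and k = ±1.
module Recursion (g : ℤ → ℤ) (g-negative : ∀ n → g -[1+ n ] ≡ + 0) (g-odd : ∀ n → ℕ.parity n ≡ 1ℙ → g (+ n) ≡ + 0)
  (g0≡0 : g (+ 0) ≡ + 0) (g2≡0 : g (+ 2) ≡ + 0)
  (recursion : ∀ M → M ≢ 0 → ∑± (M ℕ.* 3) (λ k → (+ 3 * (k * k) - + (M ℕ.* 3)) * g (+ (M ℕ.* 3) - k * k)) ≡ + 0) where

  private
    Vanishes : ℕ → Set
    Vanishes m = mod₃ℕ m ≢ 1F → g (+ m) ≡ + 0

    recursionTerm : ℕ → ℤ → ℤ
    recursionTerm N k = (+ 3 * (k * k) - + N) * g (+ N - k * k)

    recursionTerm-≡0 : ∀ N k m → mod₃ℕ N ≡ 0F → N ℕ.< m ℕ.+ square k → (∀ {q} → q ℕ.< m → Vanishes q) → recursionTerm N k ≡ + 0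
    recursionTerm-≡0 N k m 3∣N N<m+k² vanishes = trans (cong ((+ 3 * (k * k) - + N) *_)
      (byValue (+ N - k * k) (cancel-minus (k * k) (+ N)) (mod₃-minus-square≢1 N k 3∣N))) (ℤₚ.*-zeroʳ (+ 3 * (k * k) - + N))
      where
      byValue : ∀ x → k * k + x ≡ + N → mod₃ x ≢ 1F → g x ≡ + 0
      byValue -[1+ n ] _ _ = g-negative n
      byValue (+ q) k²+q≡N = vanishes (ℕₚ.+-cancelʳ-< (square k) q m (≡.subst (ℕ._< m ℕ.+ square k) (sym q+k²≡N) N<m+k²))
        where
        q+k²≡N : q ℕ.+ square k ≡ N
        q+k²≡N = trans (ℕₚ.+-comm q (square k)) (ℤₚ.+-injective (trans (cong (_+ + q) (sym (k*k≡square k))) k²+q≡N))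

    vanishes-≡0 : ∀ t → (∀ {q} → q ℕ.< suc t ℕ.* 3 → Vanishes q) → g (+ (suc t ℕ.* 3)) ≡ + 0
    vanishes-≡0 t vanishes = *-≡0-cancelˡ (- + N) (g (+ N)) (λ ()) (begin
      - + N * g (+ N)
        ≡⟨ cong₂ (λ c x → c * g x) (ℤₚ.+-identityˡ (- + N)) (ℤₚ.+-identityʳ (+ N)) ⟨
      recursionTerm N (+ 0)
        ≡⟨ trans (∑±-unfold N _) (trans (cong (λ z → recursionTerm N (+ 0) + z)
            (cong₂ _+_ (∑⁺-zero N (λ i _ → away (+ suc i) (s≤s z≤n))) (∑⁺-zero N (λ i _ → away -[1+ i ] (s≤s z≤n)))))
             (ℤₚ.+-identityʳ _)) ⟨
      ∑± N (recursionTerm N)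
        ≡⟨ recursion (suc t) (λ ()) ⟩
      + 0 ∎)
      where
      N = suc t ℕ.* 3
      away : ∀ k → 0 ℕ.< square k → recursionTerm N k ≡ + 0
      away k 0<k² = recursionTerm-≡0 N k N (mod₃ℕ-*3 (suc t)) (ℕₚ.m<m+n N 0<k²) vanishes

    vanishes-≡2 : ∀ t → ℕ.parity (suc (suc (suc t ℕ.* 3))) ≡ 0ℙ → (∀ {q} → q ℕ.< suc (suc (suc t ℕ.* 3)) → Vanishes q) →
      g (+ suc (suc (suc t ℕ.* 3))) ≡ + 0
    vanishes-≡2 t even vanishes = *-≡0-cancelˡ (+ 2 * (+ 3 - + N)) (g (+ m)) (λ ()) (begin
      + 2 * (+ 3 - + N) * g (+ m)
        ≡⟨ split (+ 3 - + N) (g (+ m)) ⟩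
      + 0 + ((+ 3 - + N) * g (+ m) + (+ 3 - + N) * g (+ m))
        ≡⟨ cong (_+ (recursionTerm N (+ 1) + recursionTerm N -[1+ 0 ])) centre ⟨
      recursionTerm N (+ 0) + (recursionTerm N (+ 1) + recursionTerm N -[1+ 0 ])
        ≡⟨ trans (∑±-unfold N _) (cong (λ z → recursionTerm N (+ 0) + z) (cong₂ _+_
             (headOnly (recursionTerm N) (λ i → away (+ suc (suc i)) (s≤s (s≤s z≤n))))
             (headOnly (λ k → recursionTerm N (- k)) (λ i → away -[1+ suc i ] (s≤s (s≤s z≤n)))))) ⟨
      ∑± N (recursionTerm N)
        ≡⟨ recursion (suc (suc t)) (λ ()) ⟩
      + 0 ∎)
      where
      m = suc (suc (suc t ℕ.* 3))
      N = suc m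
      odd : ℕ.parity N ≡ 1ℙ
      odd = trans (sym (ℙₚ.⁻¹-involutive (ℕ.parity N))) (cong ℙ._⁻¹ (trans (ℙₚ.suc-homo-⁻¹ m) even))
      centre : recursionTerm N (+ 0) ≡ + 0
      centre = trans (cong ((+ 0 - + N) *_) (trans (cong g (ℤₚ.+-identityʳ (+ N))) (g-odd N odd))) (ℤₚ.*-zeroʳ (+ 0 - + N))
      split : ∀ c x → + 2 * c * x ≡ + 0 + (c * x + c * x)
      split = ℤ-solve-∀
      away : ∀ k → 2 ℕ.≤ square k → recursionTerm N k ≡ + 0
      away k 2≤k² = recursionTerm-≡0 N k m (mod₃ℕ-*3 (suc (suc t)))
        (≡.subst (ℕ._≤ m ℕ.+ square k) (ℕₚ.+-comm m 2) (ℕₚ.+-monoʳ-≤ m 2≤k²)) vanishes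
      headOnly : ∀ f → (∀ i → f (+ suc (suc i)) ≡ + 0) → ∑⁺ N f ≡ f (+ 1)
      headOnly f tail≡0 = trans (∑⁺-head m f) (trans (cong (λ z → f (+ 1) + z) (∑⁺-zero m (λ i _ → tail≡0 i))) (ℤₚ.+-identityʳ (f (+ 1))))

    step : ∀ m → (∀ {q} → q ℕ.< m → Vanishes q) → Vanishes m
    step m vanishes m≢1 = byResidue (mod₃ℕ m) refl
      where
      even-≡2 : ∀ t → suc m ≡ t ℕ.* 3 → ℕ.parity m ≡ 0ℙ → g (+ m) ≡ + 0
      even-≡2 1 refl _ = g2≡0
      even-≡2 (suc (suc t)) refl even = vanishes-≡2 t even vanishes
      byParity : ∀ p → ℕ.parity m ≡ p → mod₃ℕ m ≡ 2F → g (+ m) ≡ + 0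
      byParity 1ℙ odd _ = g-odd m odd
      byParity 0ℙ even m≡2 with mod₃ℕ≡0⇒∃*3 (suc m) (cong suc₃ m≡2)
      ... | t , suc-m≡3t = even-≡2 t suc-m≡3t even
      byResidue : ∀ a → mod₃ℕ m ≡ a → g (+ m) ≡ + 0
      byResidue 0F m≡0 with mod₃ℕ≡0⇒∃*3 m m≡0
      ... | zero , refl = g0≡0
      ... | suc t , refl = vanishes-≡0 t vanishes
      byResidue 1F m≡1 = ⊥-elim (m≢1 m≡1)
      byResidue 2F m≡2 = byParity (ℕ.parity m) refl m≡2

  vanishes : ∀ m → mod₃ℕ m ≢ 1F → g (+ m) ≡ + 0
  vanishes = <-rec Vanishes step

opaque
  unfolding δ ∑⁺ ∑±

  hexagonal≡ℓ-0 : hexagonal (+ 0) ≡ ℓ (+ 0)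
  hexagonal≡ℓ-0 = refl

  hexagonal≡ℓ-2 : hexagonal (+ 2) ≡ ℓ (+ 2)
  hexagonal≡ℓ-2 = refl

hexagonal≡ℓ : ∀ x → mod₃ x ≢ 1F → hexagonal x ≡ ℓ x
hexagonal≡ℓ -[1+ n ] _ = trans (hexagonalByResidue-negative (mod₃ -[1+ n ]) n) (sym (lambert-negative 2 (+ 3) ψ n))
hexagonal≡ℓ (+ m) m≢1 = ℤₚ.i-j≡0⇒i≡j (hexagonal (+ m)) (ℓ (+ m)) (Recursion.vanishes (λ x → hexagonal x - ℓ x)
  (λ n → cong₂ _-_ (hexagonalByResidue-negative (mod₃ -[1+ n ]) n) (lambert-negative 2 (+ 3) ψ n))
  (λ n odd → cong₂ _-_ (hexagonal-odd n odd) (ℓ-odd n odd))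
  (ℤₚ.i≡j⇒i-j≡0 hexagonal≡ℓ-0) (ℤₚ.i≡j⇒i-j≡0 hexagonal≡ℓ-2) recursion m m≢1)
  where
  recursion : ∀ M → M ≢ 0 → ∑± (M ℕ.* 3) (λ k → (+ 3 * (k * k) - + (M ℕ.* 3)) *
    (hexagonal (+ (M ℕ.* 3) - k * k) - ℓ (+ (M ℕ.* 3) - k * k))) ≡ + 0
  recursion M M≢0 = begin
    ∑± N (λ k → c k * (hexagonal (+ N - k * k) - ℓ (+ N - k * k)))
      ≡⟨ ∑±-cong N (λ k → distribute (c k) (hexagonal (+ N - k * k)) (ℓ (+ N - k * k))) ⟩
    ∑± N (λ k → c k * hexagonal (+ N - k * k) + - (c k * ℓ (+ N - k * k)))
      ≡⟨ trans (∑±-+ N _ _) (cong (λ z → ∑± N (λ k → c k * hexagonal (+ N - k * k)) + z) (∑±-neg N _)) ⟩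
    ∑± N (λ k → c k * hexagonal (+ N - k * k)) - ∑± N (λ k → c k * ℓ (+ N - k * k))
      ≡⟨ cong₂ _-_ (ThreeSquares.hexagonal-recursion M) (DivisorSide.ℓ-recursion M M≢0) ⟩
    + 0 ∎
    where
    N = M ℕ.* 3
    c : ℤ → ℤ
    c k = + 3 * (k * k) - + N
    distribute : ∀ c x y → c * (x - y) ≡ c * x + - (c * y)
    distribute = ℤ-solve-∀

threeSquares-count : ∀ M → ThreeSquares.∑±³ M (λ _ _ _ → + 1) ≡ DivisorSide.squareRoots M + + 3 * LevelSums.Unweighted.fullSum M
threeSquares-count M = begin
  ThreeSquares.∑±³ M (λ _ _ _ → + 1)             ≡⟨ ThreeSquares.threeSquares-hexagonal M ⟩
  ∑± N (λ k → hexagonal (+ N - k * k))           ≡⟨ ∑±-cong N (λ k → hexagonal≡ℓ (+ N - k * k) (mod₃-minus-square≢1 N k 3∣N)) ⟩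
  ∑± N (λ k → ℓ (+ N - k * k))                   ≡⟨ ∑±-ℓ ⟩
  squareRoots + + 3 * Unweighted.fullSum         ∎
  where
  open DivisorSide M

coeff : PS → ℤ → ℤ
coeff f (+ n) = f n
coeff f -[1+ _ ] = + 0

coeff-minus-< : ∀ f {x y} → x ℤ.< y → coeff f (x - y) ≡ + 0
coeff-minus-< f {x} {y} x<y = negative (x - y) (≡.subst (x - y ℤ.<_) (ℤₚ.+-inverseʳ y) (ℤₚ.+-monoˡ-< (- y) x<y))
  where
  negative : ∀ z → z ℤ.< + 0 → coeff f z ≡ + 0
  negative -[1+ _ ] _ = refl
  negative (+ _) (ℤ.+<+ ())

∑-δ-outside : ∀ {n p} (a : ℕ → ℤ) → n ℕ.≤ p → ∑ n (λ i → δ (+ p) (+ i) * a i) ≡ + 0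
∑-δ-outside {n} a n≤p = ∑-zero< n (λ i i<n → cong (_* a i) (δ-≢ (λ p≡i → ℕₚ.<⇒≱ i<n (≡.subst (n ℕ.≤_) (ℤₚ.+-injective p≡i) n≤p))))

∑-δ : ∀ {n p} (a : ℕ → ℤ) → p ℕ.< n → ∑ n (λ i → δ (+ p) (+ i) * a i) ≡ a p
∑-δ {n} {p} a p<n = begin
  ∑ n (λ i → δ (+ p) (+ i) * a i)
    ≡⟨ ∑-extend _ (λ i p<i → cong (_* a i) (δ-≢ (λ p≡i → ℕₚ.<⇒≢ p<i (ℤₚ.+-injective p≡i)))) p<n ⟩
  ∑ p (λ i → δ (+ p) (+ i) * a i) + δ (+ p) (+ p) * a p
    ≡⟨ cong₂ (λ x d → x + d * a p) (∑-δ-outside {p} a ℕₚ.≤-refl) (δ-refl (+ p)) ⟩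
  + 0 + + 1 * a p
    ≡⟨ trans (ℤₚ.+-identityˡ _) (ℤₚ.*-identityˡ (a p)) ⟩
  a p ∎

∑-δ-coeff : ∀ f m p → ∑ (suc m) (λ i → δ (+ p) (+ i) * f (m ∸ i)) ≡ coeff f (+ m - + p)
∑-δ-coeff f m p with ℕₚ.≤-<-connex p m
... | inj₁ p≤m = trans (∑-δ (λ i → f (m ∸ i)) (s≤s p≤m)) (cong (coeff f) (sym (trans (ℤₚ.m-n≡m⊖n m p) (ℤₚ.⊖-≥ p≤m))))
... | inj₂ m<p = trans (∑-δ-outside (λ i → f (m ∸ i)) m<p) (sym (coeff-minus-< f (ℤ.+<+ m<p)))

-- Σ f(k) q^{k²}
thetaSeries : (ℤ → ℤ) → PS
thetaSeries f n = ∑± n (λ k → f k * δ (k * k) (+ n))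

thetaSeries-supported : ∀ (f : ℤ → ℤ) n → Supported n (λ k → f k * δ (k * k) (+ n))
thetaSeries-supported f n k n<k = *-δ-≢ (f k) (square-≢ k n<k)

coeff-thetaSeries : ∀ N f z → z ℤ.≤ + N → coeff (thetaSeries f) z ≡ ∑± N (λ k → f k * δ (k * k) z)
coeff-thetaSeries N f (+ n) (ℤ.+≤+ n≤N) = sym (∑±-extend (λ k → f k * δ (k * k) (+ n)) (thetaSeries-supported f n) n≤N)
coeff-thetaSeries N f -[1+ n ] _ = sym (∑±-zero N (λ k → *-δ-≢ (f k) (nonnegative k)))
  where
  nonnegative : ∀ k → k * k ≢ -[1+ n ]
  nonnegative k k²≡z with trans (sym (k*k≡square k)) k²≡z
  ... | ()

thetaSeries-⊗ : ∀ f g m → (thetaSeries f ⊗ g) m ≡ ∑± m (λ k → f k * coeff g (+ m - k * k))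
thetaSeries-⊗ f g m = begin
  (thetaSeries f ⊗ g) m
    ≡⟨ ⊗-coeff (thetaSeries f) g m ⟩
  ∑ (suc m) (λ i → thetaSeries f i * g (m ∸ i))
    ≡⟨ ∑-cong< (suc m) (λ i i≤m → expand i (ℕₚ.≤-pred i≤m)) ⟩
  ∑ (suc m) (λ i → ∑± m (λ k → f k * (δ (+ square k) (+ i) * g (m ∸ i))))
    ≡⟨ ∑±-∑ m (suc m) _ ⟨
  ∑± m (λ k → ∑ (suc m) (λ i → f k * (δ (+ square k) (+ i) * g (m ∸ i))))
    ≡⟨ ∑±-cong m (λ k → trans (∑-*ˡ (suc m) (f k) _)
         (cong (f k *_) (trans (∑-δ-coeff g m (square k)) (cong (λ z → coeff g (+ m - z)) (sym (k*k≡square k)))))) ⟩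
  ∑± m (λ k → f k * coeff g (+ m - k * k)) ∎
  where
  regroup : ∀ g f d → g * (f * d) ≡ f * (d * g)
  regroup = ℤ-solve-∀
  expand : ∀ i → i ℕ.≤ m → thetaSeries f i * g (m ∸ i) ≡ ∑± m (λ k → f k * (δ (+ square k) (+ i) * g (m ∸ i)))
  expand i i≤m = begin
    thetaSeries f i * g (m ∸ i)
      ≡⟨ ℤₚ.*-comm (thetaSeries f i) (g (m ∸ i)) ⟩
    g (m ∸ i) * thetaSeries f i
      ≡⟨ cong (g (m ∸ i) *_) (∑±-extend (λ k → f k * δ (k * k) (+ i)) (thetaSeries-supported f i) i≤m) ⟨
    g (m ∸ i) * ∑± m (λ k → f k * δ (k * k) (+ i))
      ≡⟨ ∑±-*ˡ m (g (m ∸ i)) _ ⟨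
    ∑± m (λ k → g (m ∸ i) * (f k * δ (k * k) (+ i)))
      ≡⟨ ∑±-cong m (λ k → trans (regroup (g (m ∸ i)) (f k) _) (cong (λ z → f k * (δ z (+ i) * g (m ∸ i))) (k*k≡square k))) ⟩
    ∑± m (λ k → f k * (δ (+ square k) (+ i) * g (m ∸ i))) ∎

coeff-thetaSeries-⊗ : ∀ N f g z → z ℤ.≤ + N → coeff (thetaSeries f ⊗ g) z ≡ ∑± N (λ k → f k * coeff g (z - k * k))
coeff-thetaSeries-⊗ N f g (+ m) (ℤ.+≤+ m≤N) = trans (thetaSeries-⊗ f g m)
  (sym (∑±-extend (λ k → f k * coeff g (+ m - k * k)) supported m≤N))
  where
  supported : Supported m (λ k → f k * coeff g (+ m - k * k))
  supported k m<k = trans (cong (f k *_) (coeff-minus-< g (≡.subst (+ m ℤ.<_) (sym (k*k≡square k))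
    (ℤ.+<+ (ℕₚ.<-≤-trans m<k (∣k∣≤square k)))))) (ℤₚ.*-zeroʳ (f k))
coeff-thetaSeries-⊗ N f g -[1+ n ] _ = sym (∑±-zero N (λ k → trans
  (cong (f k *_) (coeff-minus-< g (≡.subst (-[1+ n ] ℤ.<_) (sym (k*k≡square k)) ℤ.-<+))) (ℤₚ.*-zeroʳ (f k))))

sign-square : ∀ k → sign (square k) ≡ sign ∣ k ∣
sign-square k = begin
  sign (square k)                                        ≡⟨ sign-parity (square k) ⟩
  paritySign (ℕ.parity (square k))                       ≡⟨ cong paritySign (trans (ℙₚ.*-homo-* ∣ k ∣ ∣ k ∣) (ℙₚ.*-idem (ℕ.parity ∣ k ∣))) ⟩
  paritySign (ℕ.parity ∣ k ∣)                            ≡⟨ sign-parity ∣ k ∣ ⟨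
  sign ∣ k ∣                                             ∎

signᶻ twistedSign : ℤ → ℤ
signᶻ k = sign (∣ k ∣)
twistedSign k = ε k * sign (∣ k ∣)

θ twistedθ : PS
θ = thetaSeries signᶻ
twistedθ = thetaSeries twistedSign

rankWeight : ℤ → ℤ → ℤ
rankWeight n v = [ ∣ n ∣ < ∣ v ∣ ] * sign (∣ n ∣) * χ (v - n)

rankLambert : PS
rankLambert m = lambert 1 (+ 6) rankWeight (+ m)

coeff-rankLambert : ∀ z → coeff rankLambert z ≡ lambert 1 (+ 6) rankWeight z
coeff-rankLambert (+ m) = refl
coeff-rankLambert -[1+ m ] = sym (lambert-negative 1 (+ 6) rankWeight m)

module CubeIdentity (M : ℕ) where
  open PairSums M
  open DivisorSide M using (squareRoots)

  private
    sign-N : sign N ≡ sign M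
    sign-N = sign-*3 M

    sign-threeSquares : ∀ x y z → threeSquares x y z ≡ + M → signᶻ y * (signᶻ z * signᶻ x) ≡ sign M
    sign-threeSquares x y z sum≡M = begin
      signᶻ y * (signᶻ z * signᶻ x)                            ≡⟨ rotate (signᶻ x) (signᶻ y) (signᶻ z) ⟩
      signᶻ x * signᶻ y * signᶻ z                              ≡⟨ cong₂ _*_ (cong₂ _*_ (sign-square x) (sign-square y)) (sign-square z) ⟨
      sign (square x) * sign (square y) * sign (square z)      ≡⟨ cong (_* sign (square z)) (sign-+ (square x) (square y)) ⟨
      sign (square x ℕ.+ square y) * sign (square z)           ≡⟨ sign-+ (square x ℕ.+ square y) (square z) ⟨
      sign (square x ℕ.+ square y ℕ.+ square z)                ≡⟨ cong sign (ℤₚ.+-injective (trans (sym (threeSquares-ℕ x y z)) sum≡M)) ⟩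
      sign M                                                   ∎
      where
      rotate : ∀ x y z → y * (z * x) ≡ x * y * z
      rotate = ℤ-solve-∀

    threeSquares-term : ∀ y z x → signᶻ y * (signᶻ z * (signᶻ x * δ (x * x) (+ M - y * y - z * z)))
      ≡ sign M * (+ 1 * δ (threeSquares x y z) (+ M))
    threeSquares-term y z x = begin
      signᶻ y * (signᶻ z * (signᶻ x * δ (x * x) (+ M - y * y - z * z)))
        ≡⟨ regroup (signᶻ y) (signᶻ z) (signᶻ x) _ ⟩
      signᶻ y * (signᶻ z * signᶻ x) * δ (x * x) (+ M - y * y - z * z)
        ≡⟨ cong (signᶻ y * (signᶻ z * signᶻ x) *_) (trans (δ-transpose (z * z) (x * x) (+ M - y * y))
             (trans (δ-transpose (y * y) (z * z + x * x) (+ M)) (cong (λ w → δ w (+ M)) (sum x y z)))) ⟩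
      signᶻ y * (signᶻ z * signᶻ x) * δ (threeSquares x y z) (+ M)
        ≡⟨ *-δ-cong (sign-threeSquares x y z) ⟩
      sign M * δ (threeSquares x y z) (+ M)
        ≡⟨ cong (sign M *_) (ℤₚ.*-identityˡ _) ⟨
      sign M * (+ 1 * δ (threeSquares x y z) (+ M)) ∎
      where
      regroup : ∀ a b c d → a * (b * (c * d)) ≡ a * (b * c) * d
      regroup = ℤ-solve-∀
      sum : ∀ x y z → y * y + (z * z + x * x) ≡ x * x + y * y + z * z
      sum = ℤ-solve-∀

    threeSquares-row : ∀ y z → signᶻ y * (signᶻ z * ∑± N (λ x → signᶻ x * δ (x * x) (+ M - y * y - z * z))) ≡
      sign M * ∑± N (λ x → + 1 * δ (threeSquares x y z) (+ M))
    threeSquares-row y z = begin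
      signᶻ y * (signᶻ z * ∑± N (λ x → signᶻ x * δ (x * x) (+ M - y * y - z * z)))
        ≡⟨ trans (∑±-*ˡ N (signᶻ y) _) (cong (signᶻ y *_) (∑±-*ˡ N (signᶻ z) _)) ⟨
      ∑± N (λ x → signᶻ y * (signᶻ z * (signᶻ x * δ (x * x) (+ M - y * y - z * z))))
        ≡⟨ trans (∑±-cong N (threeSquares-term y z)) (∑±-*ˡ N (sign M) _) ⟩
      sign M * ∑± N (λ x → + 1 * δ (threeSquares x y z) (+ M)) ∎

  θ³-coeff : (θ ⊗ (θ ⊗ θ)) M ≡ sign M * (squareRoots + + 3 * Unweighted.fullSum)
  θ³-coeff = begin
    (θ ⊗ (θ ⊗ θ)) M
      ≡⟨ coeff-thetaSeries-⊗ N signᶻ (θ ⊗ θ) (+ M) (ℤ.+≤+ (ℕₚ.m≤m*n M 3)) ⟩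
    ∑± N (λ y → signᶻ y * coeff (θ ⊗ θ) (+ M - y * y))
      ≡⟨ ∑±-cong N (λ y → cong (signᶻ y *_) (trans (coeff-thetaSeries-⊗ N signᶻ θ (+ M - y * y) (bounded (+ M) y (ℤ.+≤+ (ℕₚ.m≤m*n M 3))))
           (∑±-cong N (λ z → cong (signᶻ z *_) (coeff-thetaSeries N signᶻ (+ M - y * y - z * z)
             (bounded (+ M - y * y) z (bounded (+ M) y (ℤ.+≤+ (ℕₚ.m≤m*n M 3))))))))) ⟩
    ∑± N (λ y → signᶻ y * ∑± N (λ z → signᶻ z * ∑± N (λ x → signᶻ x * δ (x * x) (+ M - y * y - z * z))))
      ≡⟨ ∑±-cong N (λ y → trans (sym (∑±-*ˡ N (signᶻ y) _)) (trans (∑±-cong N (threeSquares-row y)) (∑±-*ˡ N (sign M) _))) ⟩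
    ∑± N (λ y → sign M * ∑± N (λ z → ∑± N (λ x → + 1 * δ (threeSquares x y z) (+ M))))
      ≡⟨ ∑±-*ˡ N (sign M) _ ⟩
    sign M * ThreeSquares.∑±³ M (λ _ _ _ → + 1)
      ≡⟨ cong (sign M *_) (threeSquares-count M) ⟩
    sign M * (squareRoots + + 3 * Unweighted.fullSum) ∎
    where
    bounded : ∀ z k → z ℤ.≤ + N → z - k * k ℤ.≤ + N
    bounded z k = ℤₚ.≤-trans (x-k²≤x z k)

  private
    twistedSign-root : ∀ k → k * k ≡ + N → twistedSign k ≡ sign M
    twistedSign-root k k²≡N = begin
      ε k * signᶻ k            ≡⟨ cong₂ _*_ (cong ε₃ (mod₃-root k (trans (cong mod₃ k²≡N) 3∣N))) (sym (sign-square k)) ⟩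
      + 1 * sign (square k)    ≡⟨ ℤₚ.*-identityˡ _ ⟩
      sign (square k)          ≡⟨ cong sign (ℤₚ.+-injective (trans (sym (k*k≡square k)) k²≡N)) ⟩
      sign N                   ≡⟨ sign-N ⟩
      sign M                   ∎

    sign-pair : ∀ k n v → k * k + + n * + v ≡ + N → signᶻ k * sign n ≡ sign M * sign (n ℕ.* v ℕ.+ n)
    sign-pair k n v k²+nv≡N = sym (begin
      sign M * sign (n ℕ.* v ℕ.+ n)
        ≡⟨ cong₂ _*_ (trans (sym sign-N) (cong sign (sym square+nv))) (sign-+ (n ℕ.* v) n) ⟩
      sign (square k ℕ.+ n ℕ.* v) * (sign (n ℕ.* v) * sign n)
        ≡⟨ cong (_* (sign (n ℕ.* v) * sign n)) (trans (sign-+ (square k) (n ℕ.* v)) (cong (_* sign (n ℕ.* v)) (sign-square k))) ⟩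
      signᶻ k * sign (n ℕ.* v) * (sign (n ℕ.* v) * sign n)
        ≡⟨ regroup (signᶻ k) (sign (n ℕ.* v)) (sign n) ⟩
      sign (n ℕ.* v) * sign (n ℕ.* v) * (signᶻ k * sign n)
        ≡⟨ trans (cong (_* (signᶻ k * sign n)) (sign²≈1 (n ℕ.* v))) (ℤₚ.*-identityˡ _) ⟩
      signᶻ k * sign n ∎)
      where
      square+nv : square k ℕ.+ n ℕ.* v ≡ N
      square+nv = ℤₚ.+-injective (trans (cong₂ _+_ (sym (k*k≡square k)) (ℤₚ.pos-* n v)) k²+nv≡N)
      regroup : ∀ a b c → a * b * (b * c) ≡ b * b * (a * c)
      regroup = ℤ-solve-∀

    signedPair : ℤ → ℤ → ℤ
    signedPair n v = [ ∣ n ∣ < ∣ v ∣ ] * sign (∣ n ∣ ℕ.* ∣ v ∣ ℕ.+ ∣ n ∣)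

    pairTerm : ∀ i j → ∑± N (λ k → twistedSign k * rankWeight (+ suc i) (+ suc j) * δ (k * k + + 1 * + suc i * + suc j) (+ N)) ≡
      sign M * (signedPair (+ suc i) (+ suc j) * twistedCount (+ suc i) (+ suc j))
    pairTerm i j = begin
      ∑± N (λ k → twistedSign k * rankWeight n v * δ (k * k + + 1 * n * v) (+ N))
        ≡⟨ ∑±-cong N term ⟩
      ∑± N (λ k → sign M * (signedPair n v * (ε k * χ (v - n) * δ (k * k + n * v) (+ N))))
        ≡⟨ trans (∑±-*ˡ N (sign M) _) (cong (sign M *_) (∑±-*ˡ N (signedPair n v) _)) ⟩
      sign M * (signedPair n v * twistedCount n v) ∎
      where
      n = + suc i
      v = + suc j
      collect : ∀ e s l t c → e * s * (l * t * c) ≡ s * t * (l * (e * c))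
      collect = ℤ-solve-∀
      spread : ∀ m s l e c d → m * s * (l * (e * c)) * d ≡ m * (l * s * (e * c * d))
      spread = ℤ-solve-∀
      term : ∀ k → twistedSign k * rankWeight n v * δ (k * k + + 1 * n * v) (+ N) ≡
        sign M * (signedPair n v * (ε k * χ (v - n) * δ (k * k + n * v) (+ N)))
      term k = begin
        twistedSign k * rankWeight n v * δ (k * k + + 1 * n * v) (+ N)
          ≡⟨ cong₂ (λ w d → w * δ (k * k + d * v) (+ N)) (collect (ε k) (signᶻ k) [ suc i < suc j ] (sign (suc i)) (χ (v - n)))
              (ℤₚ.*-identityˡ n) ⟩
        signᶻ k * sign (suc i) * ([ suc i < suc j ] * (ε k * χ (v - n))) * δ (k * k + n * v) (+ N)
          ≡⟨ *-δ-cong (λ k²+nv≡N → cong (_* ([ suc i < suc j ] * (ε k * χ (v - n)))) (sign-pair k (suc i) (suc j) k²+nv≡N)) ⟩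
        sign M * sign (suc i ℕ.* suc j ℕ.+ suc i) * ([ suc i < suc j ] * (ε k * χ (v - n))) * δ (k * k + n * v) (+ N)
          ≡⟨ spread (sign M) (sign (suc i ℕ.* suc j ℕ.+ suc i)) [ suc i < suc j ] (ε k) (χ (v - n)) _ ⟩
        sign M * (signedPair n v * (ε k * χ (v - n) * δ (k * k + n * v) (+ N))) ∎

  twistedθ*rankLambert-coeff : (twistedθ ⊗ rankLambert) N ≡ sign M * (squareRoots + + 6 * Unweighted.slantedSum)
  twistedθ*rankLambert-coeff = begin
    (twistedθ ⊗ rankLambert) N
      ≡⟨ thetaSeries-⊗ twistedSign rankLambert N ⟩
    ∑± N (λ k → twistedSign k * coeff rankLambert (+ N - k * k))
      ≡⟨ ∑±-cong N (λ k → cong (twistedSign k *_) (coeff-rankLambert (+ N - k * k))) ⟩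
    ∑± N (λ k → twistedSign k * lambert 1 (+ 6) rankWeight (+ N - k * k))
      ≡⟨ ∑±-lambert N 0 (+ 6) rankWeight twistedSign ⟩
    ∑± N (λ k → twistedSign k * δ (k * k) (+ N))
      + + 6 * ∑⁺² N (λ a b → ∑± N (λ k → twistedSign k * rankWeight a b * δ (k * k + + 1 * a * b) (+ N)))
      ≡⟨ cong₂ (λ x y → x + + 6 * y) squareTerms pairTerms ⟩
    sign M * squareRoots + + 6 * (sign M * Unweighted.slantedSum)
      ≡⟨ factor (sign M) squareRoots Unweighted.slantedSum ⟩
    sign M * (squareRoots + + 6 * Unweighted.slantedSum) ∎
    where
    factor : ∀ s r h → s * r + + 6 * (s * h) ≡ s * (r + + 6 * h)
    factor = ℤ-solve-∀
    squareTerms : ∑± N (λ k → twistedSign k * δ (k * k) (+ N)) ≡ sign M * squareRoots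
    squareTerms = trans (∑±-cong N (λ k → *-δ-cong (twistedSign-root k))) (∑±-*ˡ N (sign M) _)
    pairTerms : ∑⁺² N (λ a b → ∑± N (λ k → twistedSign k * rankWeight a b * δ (k * k + + 1 * a * b) (+ N))) ≡ sign M * Unweighted.slantedSum
    pairTerms = begin
      ∑⁺² N (λ a b → ∑± N (λ k → twistedSign k * rankWeight a b * δ (k * k + + 1 * a * b) (+ N)))
        ≡⟨ ∑⁺²-cong< N (λ i j _ _ → pairTerm i j) ⟩
      ∑⁺² N (λ n v → sign M * (signedPair n v * twistedCount n v))
        ≡⟨ ∑⁺²-*ˡ N (sign M) _ ⟩
      sign M * ∑⁺² N (λ n v → signedPair n v * twistedCount n v)
        ≡⟨ cong (sign M *_) signedPairs≡slantedSum ⟩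
      sign M * Unweighted.slantedSum ∎

  twistedθ*rankLambert≡θ³ : (twistedθ ⊗ rankLambert) N ≡ (θ ⊗ (θ ⊗ θ)) M
  twistedθ*rankLambert≡θ³ = begin
    (twistedθ ⊗ rankLambert) N                                         ≡⟨ twistedθ*rankLambert-coeff ⟩
    sign M * (squareRoots + + 6 * Unweighted.slantedSum)
      ≡⟨ cong (λ z → sign M * (squareRoots + z)) (double Unweighted.slantedSum) ⟩
    sign M * (squareRoots + + 3 * (Unweighted.slantedSum + Unweighted.slantedSum))
      ≡⟨ cong (λ z → sign M * (squareRoots + + 3 * z)) fullSum≡2slantedSum ⟨
    sign M * (squareRoots + + 3 * Unweighted.fullSum)                  ≡⟨ θ³-coeff ⟨
    (θ ⊗ (θ ⊗ θ)) M                                                    ∎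
    where
    double : ∀ h → + 6 * h ≡ + 3 * (h + h)
    double = ℤ-solve-∀

infix 9 _[X³]
_[X³] : PS → PS
(f [X³]) 0 = f 0
(f [X³]) 1 = + 0
(f [X³]) 2 = + 0
(f [X³]) (suc (suc (suc n))) = ((f ∘ suc) [X³]) n

section : ℕ → PS → PS
section d f n = f (n ℕ.* 3 ℕ.+ d)

bySections : ∀ {P : ℕ → Set} → (∀ n → P (n ℕ.* 3 ℕ.+ 0)) → (∀ n → P (n ℕ.* 3 ℕ.+ 1)) → (∀ n → P (n ℕ.* 3 ℕ.+ 2)) → ∀ n → P n
bySections p₀ p₁ p₂ 0 = p₀ 0
bySections p₀ p₁ p₂ 1 = p₁ 0
bySections p₀ p₁ p₂ 2 = p₂ 0
bySections {P} p₀ p₁ p₂ (suc (suc (suc n))) = bySections {P ∘ (3 ℕ.+_)} (p₀ ∘ suc) (p₁ ∘ suc) (p₂ ∘ suc) n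

section-0-[X³] : ∀ f → section 0 (f [X³]) ≗ f
section-0-[X³] f zero = refl
section-0-[X³] f (suc n) = section-0-[X³] (f ∘ suc) n

section-1-[X³] : ∀ f → section 1 (f [X³]) ≗ zeroPS
section-1-[X³] f zero = refl
section-1-[X³] f (suc n) = section-1-[X³] (f ∘ suc) n

section-2-[X³] : ∀ f → section 2 (f [X³]) ≗ zeroPS
section-2-[X³] f zero = refl
section-2-[X³] f (suc n) = section-2-[X³] (f ∘ suc) n

section-0-X⊗ : ∀ f → section 0 (X ⊗ f) ≗ X ⊗ section 2 f
section-0-X⊗ f zero = refl
section-0-X⊗ f (suc n) = begin
  (X ⊗ f) (suc n ℕ.* 3 ℕ.+ 0)    ≡⟨ X⊗-suc f (2 ℕ.+ (n ℕ.* 3 ℕ.+ 0)) ⟩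
  f (2 ℕ.+ (n ℕ.* 3 ℕ.+ 0))      ≡⟨ cong f (index n) ⟩
  section 2 f n                  ≡⟨ X⊗-suc (section 2 f) n ⟨
  (X ⊗ section 2 f) (suc n)      ∎
  where
  index : ∀ n → 2 ℕ.+ (n ℕ.* 3 ℕ.+ 0) ≡ n ℕ.* 3 ℕ.+ 2
  index = ℕ-solve-∀

section-suc-X⊗ : ∀ d f → section (suc d) (X ⊗ f) ≗ section d f
section-suc-X⊗ d f n = trans (cong (X ⊗ f) (ℕₚ.+-suc (n ℕ.* 3) d)) (X⊗-suc f (n ℕ.* 3 ℕ.+ d))

section-[X³]⊗ : ∀ {d} f g → d ℕ.< 3 → section d (f [X³] ⊗ g) ≗ f ⊗ section d g
section-[X³]⊗ {d} f g d<3 n = begin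
  (f [X³] ⊗ g) (n ℕ.* 3 ℕ.+ d)
    ≡⟨ ⊗-coeff (f [X³]) g (n ℕ.* 3 ℕ.+ d) ⟩
  ∑ (suc (n ℕ.* 3 ℕ.+ d)) (λ i → (f [X³]) i * g (n ℕ.* 3 ℕ.+ d ∸ i))
    ≡⟨ convolution n f ⟩
  ∑ (suc n) (λ i → f i * section d g (n ∸ i))
    ≡⟨ ⊗-coeff f (section d g) n ⟨
  (f ⊗ section d g) n ∎
  where
  initial : ∀ d → d ℕ.< 3 → ∀ f → ∑ (suc d) (λ i → (f [X³]) i * g (d ∸ i)) ≡ f 0 * g d
  initial 0 _ f = ℤₚ.+-identityˡ _
  initial 1 _ f = trans (ℤₚ.+-identityʳ _) (ℤₚ.+-identityˡ _)
  initial 2 _ f = trans (ℤₚ.+-identityʳ _) (trans (ℤₚ.+-identityʳ _) (ℤₚ.+-identityˡ _))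
  initial (suc (suc (suc _))) (s≤s (s≤s (s≤s ()))) f
  convolution : ∀ n f → ∑ (suc (n ℕ.* 3 ℕ.+ d)) (λ i → (f [X³]) i * g (n ℕ.* 3 ℕ.+ d ∸ i)) ≡ ∑ (suc n) (λ i → f i * section d g (n ∸ i))
  convolution zero f = trans (initial d d<3 f) (sym (ℤₚ.+-identityˡ _))
  convolution (suc n) f = begin
    ∑ (4 ℕ.+ m) t
      ≡⟨ trans (∑-head (3 ℕ.+ m) t) (cong (λ z → t 0 + z) (trans (∑-head (2 ℕ.+ m) (t ∘ suc)) (trans (ℤₚ.+-identityˡ _)
           (trans (∑-head (suc m) (t ∘ suc ∘ suc)) (ℤₚ.+-identityˡ _))))) ⟩
    t 0 + ∑ (suc m) (λ i → ((f ∘ suc) [X³]) i * g (m ∸ i))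
      ≡⟨ cong (λ z → t 0 + z) (convolution n (f ∘ suc)) ⟩
    f 0 * section d g (suc n) + ∑ (suc n) (λ i → f (suc i) * section d g (n ∸ i))
      ≡⟨ ∑-head (suc n) (λ i → f i * section d g (suc n ∸ i)) ⟨
    ∑ (suc (suc n)) (λ i → f i * section d g (suc n ∸ i)) ∎
    where
    m = n ℕ.* 3 ℕ.+ d
    t : ℕ → ℤ
    t i = (f [X³]) i * g (suc n ℕ.* 3 ℕ.+ d ∸ i)

[X³]-cong< : ∀ K {f g} → (∀ i → i ℕ.< K → f i ≡ g i) → ∀ i → i ℕ.< K → (f [X³]) i ≡ (g [X³]) i
[X³]-cong< K f≡g 0 0<K = f≡g 0 0<K
[X³]-cong< K f≡g 1 _ = refl
[X³]-cong< K f≡g 2 _ = refl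
[X³]-cong< (suc (suc (suc K))) f≡g (suc (suc (suc i))) (s≤s (s≤s (s≤s i<K))) =
  [X³]-cong< K (λ j j<K → f≡g (suc j) (s≤s (ℕₚ.m≤n⇒m≤1+n (ℕₚ.m≤n⇒m≤1+n j<K)))) i i<K

[X³]-cong : ∀ {f g} → f ≗ g → f [X³] ≗ g [X³]
[X³]-cong f≗g n = [X³]-cong< (suc n) (λ i _ → f≗g i) n ℕₚ.≤-refl

[X³]-⊕ : ∀ f g → (f ⊕ g) [X³] ≗ f [X³] ⊕ g [X³]
[X³]-⊕ f g 0 = refl
[X³]-⊕ f g 1 = refl
[X³]-⊕ f g 2 = refl
[X³]-⊕ f g (suc (suc (suc n))) = [X³]-⊕ (f ∘ suc) (g ∘ suc) n

[X³]-neg : ∀ f → negPS f [X³] ≗ negPS (f [X³])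
[X³]-neg f 0 = refl
[X³]-neg f 1 = refl
[X³]-neg f 2 = refl
[X³]-neg f (suc (suc (suc n))) = [X³]-neg (f ∘ suc) n

[X³]-⊗ : ∀ f g → (f ⊗ g) [X³] ≗ f [X³] ⊗ g [X³]
[X³]-⊗ f g = bySections
  (λ n → trans (section-0-[X³] (f ⊗ g) n) (sym (trans (section-[X³]⊗ f (g [X³]) (s≤s z≤n) n)
      (⊗-cong {f} (λ _ → refl) (section-0-[X³] g) n))))
  (λ n → trans (section-1-[X³] (f ⊗ g) n) (sym (trans (section-[X³]⊗ f (g [X³]) (s≤s (s≤s z≤n)) n) (⊗-zeroʳ f (section-1-[X³] g) n))))
  (λ n → trans (section-2-[X³] (f ⊗ g) n) (sym (trans (section-[X³]⊗ f (g [X³]) (s≤s (s≤s (s≤s z≤n))) n) (⊗-zeroʳ f (section-2-[X³] g) n))))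

[X³]-zero : zeroPS [X³] ≗ zeroPS
[X³]-zero = bySections (section-0-[X³] zeroPS) (section-1-[X³] zeroPS) (section-2-[X³] zeroPS)

[X³]-one : onePS [X³] ≗ onePS
[X³]-one 0 = refl
[X³]-one 1 = refl
[X³]-one 2 = refl
[X³]-one (suc (suc (suc n))) = [X³]-zero n

[X³]-X : ∀ K → X [X³] ≗ X^ K 3
[X³]-X K n = trans (mono-3 n) (sym (X^-mono K 3 n))
  where
  mono-3 : X [X³] ≗ mono (+ 1) 3
  mono-3 0 = refl
  mono-3 1 = refl
  mono-3 2 = refl
  mono-3 (suc (suc (suc n))) = trans ([X³]-cong (λ { zero → refl ; (suc _) → refl }) n) (trans ([X³]-one n) (one n))
    where
    one : onePS ≗ mono (+ 1) 0
    one zero = refl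
    one (suc n) = refl

[X³]-isRingHomomorphism : RingHomomorphism FullPS FullPS _[X³]
[X³]-isRingHomomorphism = record
  { isSemiringHomomorphism = record
    { isNearSemiringHomomorphism = record
      { +-isMonoidHomomorphism = record
        { isMagmaHomomorphism = record
          { isRelHomomorphism = record { cong = λ f≈g → ≗⇒≈ ([X³]-cong (≈∞⇒≗ f≈g)) }
          ; homo = λ f g → ≗⇒≈ ([X³]-⊕ f g) }
        ; ε-homo = ≗⇒≈ [X³]-zero }
      ; *-homo = λ f g → ≗⇒≈ ([X³]-⊗ f g) }
    ; 1#-homo = ≗⇒≈ [X³]-one }
  ; -‿homo = λ f → ≗⇒≈ ([X³]-neg f) }

truncation-isRingHomomorphism : ∀ K → RingHomomorphism FullPS (TruncatedPS K) (λ f → f)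
truncation-isRingHomomorphism K = record
  { isSemiringHomomorphism = record
    { isNearSemiringHomomorphism = record
      { +-isMonoidHomomorphism = record
        { isMagmaHomomorphism = record
          { isRelHomomorphism = record { cong = ≈∞⇒≈< K }
          ; homo = λ _ _ → ≗⇒≈ (λ _ → refl) }
        ; ε-homo = ≗⇒≈ (λ _ → refl) }
      ; *-homo = λ _ _ → ≗⇒≈ (λ _ → refl) }
    ; 1#-homo = ≗⇒≈ (λ _ → refl) }
  ; -‿homo = λ _ → ≗⇒≈ (λ _ → refl) }

∑-coeff : ∀ K m (f : ℕ → PS) n → TruncatedCalculus.∑ K m f n ≡ ∑ m (λ i → f i n)
∑-coeff K zero f n = refl
∑-coeff K (suc m) f n = cong (_+ f m n) (∑-coeff K m f n)

-1PS≗constPS : negPS onePS ≗ constPS -[1+ 0 ]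
-1PS≗constPS zero = refl
-1PS≗constPS (suc n) = refl

sign-constPS : ∀ K s → TruncatedCalculus.sign K s ≗ constPS (sign s)
sign-constPS K zero n = refl
sign-constPS K (suc s) n = begin
  (negPS onePS ⊗ TruncatedCalculus.sign K s) n    ≡⟨ constPS-⊗ {negPS onePS} -[1+ 0 ] (TruncatedCalculus.sign K s) -1PS≗constPS n ⟩
  -[1+ 0 ] * TruncatedCalculus.sign K s n         ≡⟨ cong (-[1+ 0 ] *_) (sign-constPS K s n) ⟩
  -[1+ 0 ] * constPS (sign s) n                   ≡⟨ scale n ⟩
  constPS (sign (suc s)) n                        ∎
  where
  scale : ∀ n → -[1+ 0 ] * constPS (sign s) n ≡ constPS (sign (suc s)) n
  scale zero = refl
  scale (suc n) = refl

opaque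
  unfolding δ

  mono-δ : ∀ e n → mono (+ 1) e n ≡ δ (+ e) (+ n)
  mono-δ zero zero = refl
  mono-δ zero (suc n) = refl
  mono-δ (suc e) zero = refl
  mono-δ (suc e) (suc n) = mono-δ e n

onePS-δ : ∀ n → onePS n ≡ δ (+ 0) (+ n)
onePS-δ n = trans (one n) (mono-δ 0 n)
  where
  one : onePS ≗ mono (+ 1) 0
  one zero = refl
  one (suc n) = refl

δ-< : ∀ {e n} → n ℕ.< e → δ (+ e) (+ n) ≡ + 0
δ-< n<e = δ-≢ (λ e≡n → ℕₚ.<⇒≢ n<e (sym (ℤₚ.+-injective e≡n)))

signedPower-coeff : ∀ K s e n → (TruncatedCalculus.sign K s ⊗ X^ K e) n ≡ sign s * δ (+ e) (+ n)
signedPower-coeff K s e n = trans (constPS-⊗ {TruncatedCalculus.sign K s} (sign s) (X^ K e) (sign-constPS K s) n)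
  (cong (sign s *_) (trans (X^-mono K e n) (mono-δ e n)))

twoPS : PS
twoPS = onePS ⊕ onePS

twoPS≗constPS : twoPS ≗ constPS (+ 2)
twoPS≗constPS zero = refl
twoPS≗constPS (suc n) = refl

twoPS⊗ : ∀ f n → (twoPS ⊗ f) n ≡ + 2 * f n
twoPS⊗ f = constPS-⊗ {twoPS} (+ 2) f twoPS≗constPS

θ-truncated : ∀ k → θ ≈⟨< suc k ⟩ ThetaSeries.thetaAt (TruncatedPS (suc k)) (suc k) X
θ-truncated k = agree λ n n<K → begin
  θ n
    ≡⟨ ∑±-extend (summand n) (thetaSeries-supported signᶻ n) (ℕₚ.<⇒≤ n<K) ⟨
  ∑± (suc k) (summand n)
    ≡⟨ ∑±-unfold (suc k) (summand n) ⟩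
  + 1 * δ (+ 0) (+ n) + (∑⁺ (suc k) (summand n) + ∑⁺ (suc k) (λ m → summand n (- m)))
    ≡⟨ cong₂ _+_ (trans (ℤₚ.*-identityˡ _) (sym (onePS-δ n))) (cong (λ z → ∑⁺ (suc k) (summand n) + z) (∑⁺-cong (suc k) (symmetric n))) ⟩
  onePS n + (∑⁺ (suc k) (summand n) + ∑⁺ (suc k) (summand n))
    ≡⟨ cong (λ z → onePS n + z) (double (∑⁺ (suc k) (summand n))) ⟩
  onePS n + + 2 * ∑⁺ (suc k) (summand n)
    ≡⟨ cong (λ z → onePS n + + 2 * z) (trans (∑⁺-∑ (suc k) (summand n)) (∑-cong (suc k) (positive n))) ⟩
  onePS n + + 2 * ∑ (suc k) (λ r → thetaTerm X r n)
    ≡⟨ cong (λ z → onePS n + z) (trans (twoPS⊗ (TruncatedCalculus.∑ (suc k) (suc k) (thetaTerm X)) n)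
        (cong (+ 2 *_) (∑-coeff (suc k) (suc k) (thetaTerm X) n))) ⟨
  ThetaSeries.thetaAt (TruncatedPS (suc k)) (suc k) X n ∎
  where
  open ThetaSeries (TruncatedPS (suc k)) using (thetaTerm)
  summand : ℕ → ℤ → ℤ
  summand n x = signᶻ x * δ (x * x) (+ n)
  double : ∀ x → x + x ≡ + 2 * x
  double = ℤ-solve-∀
  symmetric : ∀ n m → summand n (- m) ≡ summand n m
  symmetric n m = cong₂ (λ s z → sign s * δ z (+ n)) (ℤₚ.∣-i∣≡∣i∣ m) (neg-square m)
    where
    neg-square : ∀ m → - m * - m ≡ m * m
    neg-square = ℤ-solve-∀
  positive : ∀ n r → summand n (+ suc r) ≡ thetaTerm X r n
  positive n r = trans (cong (λ z → sign (suc r) * δ z (+ n)) (sym (ℤₚ.pos-* (suc r) (suc r))))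
    (sym (signedPower-coeff (suc k) (suc r) (suc r ℕ.* suc r) n))

octagonalCoeff : ℕ → ℕ → ℤ
octagonalCoeff n j = sign (suc j) * δ (+ (suc j ℕ.* (3 ℕ.* suc j ℕ.+ 2))) (+ n) + sign (suc j) * δ (+ (suc j ℕ.* (3 ℕ.* j ℕ.+ 1))) (+ n)

-- Σ (−1)ʲ q^{j(3j+2)} over all integers j
octagonal : PS
octagonal n = onePS n + ∑ (suc n) (octagonalCoeff n)

octagonal-truncated : ∀ k → octagonal ≈⟨< suc k ⟩ ThetaSeries.octagonalAt (TruncatedPS (suc k)) (suc k) X
octagonal-truncated k = agree λ n n<K → cong (λ z → onePS n + z) (begin
  ∑ (suc n) (octagonalCoeff n)
    ≡⟨ ∑-extend (octagonalCoeff n) (beyond n) n<K ⟨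
  ∑ (suc k) (octagonalCoeff n)
    ≡⟨ ∑-cong (suc k) (λ j → cong₂ _+_
         (signedPower-coeff (suc k) (suc j) (suc j ℕ.* (3 ℕ.* suc j ℕ.+ 2)) n)
             (signedPower-coeff (suc k) (suc j) (suc j ℕ.* (3 ℕ.* j ℕ.+ 1)) n)) ⟨
  ∑ (suc k) (λ j → octagonalTerm X j n)
    ≡⟨ ∑-coeff (suc k) (suc k) (octagonalTerm X) n ⟨
  TruncatedCalculus.∑ (suc k) (suc k) (octagonalTerm X) n ∎)
  where
  open ThetaSeries (TruncatedPS (suc k)) using (octagonalTerm)
  beyond : ∀ n j → suc n ℕ.≤ j → octagonalCoeff n j ≡ + 0
  beyond n j n<j = cong₂ _+_ (vanishes (3 ℕ.* suc j) 1) (vanishes (3 ℕ.* j) 0)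
    where
    vanishes : ∀ m i → sign (suc j) * δ (+ (suc j ℕ.* (m ℕ.+ suc i))) (+ n) ≡ + 0
    vanishes m i = trans (cong (sign (suc j) *_) (δ-< (ℕₚ.<-≤-trans (ℕₚ.m<n⇒m<1+n n<j)
      (≡.subst (λ e → suc j ℕ.≤ suc j ℕ.* e) (sym (ℕₚ.+-suc m i)) (ℕₚ.m≤m*n (suc j) (suc (m ℕ.+ i))))))) (ℤₚ.*-zeroʳ (sign (suc j)))

powerSeriesTower : TruncationTower
powerSeriesTower = record
  { full = FullPS ; truncation = λ k → TruncatedPS (suc k)
  ; π = λ _ f → f ; π-isRingHomomorphism = λ k → truncation-isRingHomomorphism (suc k) ; π-jointlyInjective = ≈<⇒≈∞
  ; q = X ; q-nilpotent = λ k → X-nilpotent (suc k)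
  ; v = _[X³] ; v-isRingHomomorphism = [X³]-isRingHomomorphism
  ; v-cong-truncation = λ k f≈g → agree ([X³]-cong< (suc k) (at f≈g))
  ; v-q = ≗⇒≈ ([X³]-X 0)
  ; θ = θ ; octagonal = octagonal ; θ-truncated = θ-truncated ; octagonal-truncated = octagonal-truncated }

lambertCoeff : ℕ → ℕ → ℕ → ℤ
lambertCoeff m r t = sign (suc r) * δ (+ lambertExponent 0 r t) (+ m) - sign (suc r) * δ (+ lambertExponent 1 r t) (+ m)

lambertSeries-coeff : ∀ k m → m ℕ.< suc k → RankCoefficients.lambertSeries k m
  ≡ onePS m + + 6 * ∑ (suc k) (λ r → ∑ (suc k) (lambertCoeff m r))
lambertSeries-coeff k m m<K = cong (λ z → onePS m + z) (begin
  (twoPS ⊗ (onePS ⊕ onePS ⊕ onePS) ⊗ TruncatedCalculus.∑ K K lambertTerm) m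
    ≡⟨ constPS-⊗ {twoPS ⊗ (onePS ⊕ onePS ⊕ onePS)} (+ 6) (TruncatedCalculus.∑ K K lambertTerm) sixPS≗constPS m ⟩
  + 6 * TruncatedCalculus.∑ K K lambertTerm m
    ≡⟨ cong (+ 6 *_) (trans (∑-coeff K K lambertTerm m) (∑-cong K term)) ⟩
  + 6 * ∑ K (λ r → ∑ K (lambertCoeff m r)) ∎)
  where
  open RankCoefficients k using (lambertTerm; lambertTerm-expand)
  K = suc k
  sixPS≗constPS : twoPS ⊗ (onePS ⊕ onePS ⊕ onePS) ≗ constPS (+ 6)
  sixPS≗constPS n = trans (twoPS⊗ (onePS ⊕ onePS ⊕ onePS) n) (value n)
    where
    value : ∀ n → + 2 * (onePS ⊕ onePS ⊕ onePS) n ≡ constPS (+ 6) n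
    value zero = refl
    value (suc n) = refl
  signedPower : ℕ → ℕ → ℕ → PS
  signedPower c r t = TruncatedCalculus.sign K (suc r) ⊗ X^ K (lambertExponent c r t)
  term : ∀ r → lambertTerm r m ≡ ∑ K (lambertCoeff m r)
  term r = begin
    lambertTerm r m
      ≡⟨ at (lambertTerm-expand r) m m<K ⟩
    TruncatedCalculus.∑ K K (λ t → signedPower 0 r t ⊕ negPS (signedPower 1 r t)) m
      ≡⟨ ∑-coeff K K (λ t → signedPower 0 r t ⊕ negPS (signedPower 1 r t)) m ⟩
    ∑ K (λ t → signedPower 0 r t m - signedPower 1 r t m)
      ≡⟨ ∑-cong K (λ t → cong₂ _-_ (signedPower-coeff K (suc r) (lambertExponent 0 r t) m)
          (signedPower-coeff K (suc r) (lambertExponent 1 r t) m)) ⟩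
    ∑ K (lambertCoeff m r) ∎

-- χ(v − n) selects v ≡ n + 1 and v ≡ n + 2 (mod 3), the two exponents of lambertCoeff.
rankWeight-row : ∀ K m i → m ℕ.≤ K → ∑ K (λ j → rankWeight (+ suc i) (+ suc j) * δ (+ 1 * + suc i * + suc j) (+ m)) ≡ ∑ K (lambertCoeff m i)
rankWeight-row K m i m≤K = begin
  ∑ K f
    ≡⟨ ∑-extend f (λ j K≤j → beyond j (ℕₚ.≤-trans m≤K K≤j)) (ℕₚ.≤-trans (ℕₚ.m≤m*n K 3) (ℕₚ.m≤n+m (K ℕ.* 3) (suc i))) ⟨
  ∑ (suc i ℕ.+ K ℕ.* 3) f
    ≡⟨ ∑-split (suc i) (K ℕ.* 3) f ⟩
  ∑ (suc i) f + ∑ (K ℕ.* 3) (λ w → f (suc i ℕ.+ w))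
    ≡⟨ cong₂ _+_ (∑-zero< (suc i) below) (trans (∑-blocks 3 K _) (∑-cong K block)) ⟩
  + 0 + ∑ K (lambertCoeff m i)
    ≡⟨ ℤₚ.+-identityˡ _ ⟩
  ∑ K (lambertCoeff m i) ∎
  where
  f : ℕ → ℤ
  f j = rankWeight (+ suc i) (+ suc j) * δ (+ 1 * + suc i * + suc j) (+ m)
  product : ∀ j → + 1 * + suc i * + suc j ≡ + (suc i ℕ.* suc j)
  product j = trans (cong (_* + suc j) (ℤₚ.*-identityˡ (+ suc i))) (sym (ℤₚ.pos-* (suc i) (suc j)))
  beyond : ∀ j → m ℕ.≤ j → f j ≡ + 0
  beyond j m≤j = trans (cong (rankWeight (+ suc i) (+ suc j) *_) (trans (cong (λ e → δ e (+ m)) (product j))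
    (δ-< (ℕₚ.<-≤-trans (s≤s m≤j) (ℕₚ.m≤n*m (suc j) (suc i)))))) (ℤₚ.*-zeroʳ (rankWeight (+ suc i) (+ suc j)))
  below : ∀ j → j ℕ.< suc i → f j ≡ + 0
  below j j≤i = cong (λ z → z * sign (suc i) * χ (+ suc j - + suc i) * δ (+ 1 * + suc i * + suc j) (+ m)) ([<]-false j≤i)
  above : ∀ t r → f (suc i ℕ.+ (t ℕ.* 3 ℕ.+ r)) ≡ sign (suc i) * χ₃ (suc₃ (mod₃ℕ r)) * δ (+ lambertExponent r i t) (+ m)
  above t r = cong₂ _*_
    (cong₂ _*_ (trans (cong (_* sign (suc i)) ([<]-true (s≤s (ℕₚ.m≤m+n (suc i) w)))) (ℤₚ.*-identityˡ (sign (suc i))))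
      (trans (cong χ (difference (+ suc i) (+ w))) (cong (χ₃ ∘ suc₃) (mod₃ℕ-*3+ t r))))
    (cong (λ e → δ e (+ m)) (product (suc i ℕ.+ w)))
    where
    w = t ℕ.* 3 ℕ.+ r
    difference : ∀ i w → + 1 + (i + w) - i ≡ + 1 + w
    difference = ℤ-solve-∀
  block : ∀ t → ∑ 3 (λ r → f (suc i ℕ.+ (t ℕ.* 3 ℕ.+ r))) ≡ lambertCoeff m i t
  block t = trans (cong₂ _+_ (cong₂ _+_ (cong (λ z → + 0 + z) (above t 0)) (above t 1)) (above t 2))
    (collect (sign (suc i)) (δ (+ lambertExponent 0 i t) (+ m)) (δ (+ lambertExponent 1 i t) (+ m)) (δ (+ lambertExponent 2 i t) (+ m)))
    where
    collect : ∀ s a b c → + 0 + s * + 1 * a + s * -[1+ 0 ] * b + s * + 0 * c ≡ s * a - s * b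
    collect = ℤ-solve-∀

rankLambert-expand : ∀ K m → m ℕ.≤ K → rankLambert m ≡ onePS m + + 6 * ∑ K (λ r → ∑ K (lambertCoeff m r))
rankLambert-expand K m m≤K = cong₂ (λ x y → x + + 6 * y) (sym (onePS-δ m)) (begin
  divisorSum 1 m rankWeight (+ m)
    ≡⟨ divisorSum-extend 0 rankWeight (+ m) K (ℤ.+≤+ m≤K) ⟨
  divisorSum 1 K rankWeight (+ m)
    ≡⟨ trans (∑⁺-∑ K _) (∑-cong K (λ i → trans (∑⁺-∑ K _) (rankWeight-row K m i m≤K))) ⟩
  ∑ K (λ r → ∑ K (lambertCoeff m r)) ∎)

rankLambert-truncated : ∀ k → rankLambert ≈⟨< suc k ⟩ RankCoefficients.lambertSeries k
rankLambert-truncated k = agree (λ m m<K → trans (rankLambert-expand (suc k) m (ℕₚ.<⇒≤ m<K)) (sym (lambertSeries-coeff k m m<K)))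

exponentResidue : ℕ → ℤ/3 → ℤ/3
exponentResidue c a = a *₃ suc₃ (a +₃ mod₃ℕ c)

mod₃ℕ-lambertExponent : ∀ c r t → mod₃ℕ (lambertExponent c r t) ≡ exponentResidue c (mod₃ℕ (suc r))
mod₃ℕ-lambertExponent c r t = begin
  mod₃ℕ (suc r ℕ.* suc (suc r ℕ.+ (t ℕ.* 3 ℕ.+ c)))                     ≡⟨ mod₃ℕ-* (suc r) (suc (suc r ℕ.+ (t ℕ.* 3 ℕ.+ c))) ⟩
  mod₃ℕ (suc r) *₃ suc₃ (mod₃ℕ (suc r ℕ.+ (t ℕ.* 3 ℕ.+ c)))
    ≡⟨ cong (λ a → mod₃ℕ (suc r) *₃ suc₃ a) (mod₃ℕ-+ (suc r) (t ℕ.* 3 ℕ.+ c)) ⟩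
  mod₃ℕ (suc r) *₃ suc₃ (mod₃ℕ (suc r) +₃ mod₃ℕ (t ℕ.* 3 ℕ.+ c))
    ≡⟨ cong (λ a → mod₃ℕ (suc r) *₃ suc₃ (mod₃ℕ (suc r) +₃ a)) (mod₃ℕ-*3+ t c) ⟩
  exponentResidue c (mod₃ℕ (suc r))                                     ∎

lambertSum : ℕ → ℕ → ℕ → ℕ → ℤ
lambertSum K m c r = ∑ K (λ t → δ (+ lambertExponent c r t) (+ m))

lambertSum-residue : ∀ K m c r → exponentResidue c (mod₃ℕ (suc r)) ≢ mod₃ℕ m → lambertSum K m c r ≡ + 0
lambertSum-residue K m c r residue≢ = ∑-zero< K (λ t _ → δ-≢ (λ e≡m →
  residue≢ (trans (sym (mod₃ℕ-lambertExponent c r t)) (cong mod₃ e≡m))))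

∑-lambertCoeff : ∀ K m r → ∑ K (lambertCoeff m r) ≡ sign (suc r) * lambertSum K m 0 r - sign (suc r) * lambertSum K m 1 r
∑-lambertCoeff K m r = trans (∑-+ K _ _)
  (cong₂ _+_ (∑-*ˡ K (sign (suc r)) _) (trans (∑-neg K _) (cong -_ (∑-*ˡ K (sign (suc r)) _))))

onePS-*3+suc : ∀ n d → onePS (n ℕ.* 3 ℕ.+ suc d) ≡ + 0
onePS-*3+suc n d = cong onePS (ℕₚ.+-suc (n ℕ.* 3) d)

section-1-rankLambert : section 1 rankLambert ≗ zeroPS
section-1-rankLambert n = begin
  rankLambert m
    ≡⟨ rankLambert-expand m m ℕₚ.≤-refl ⟩
  onePS m + + 6 * ∑ m (λ r → ∑ m (lambertCoeff m r))
    ≡⟨ cong₂ (λ x y → x + + 6 * y) (onePS-*3+suc n 0) (∑-zero< m (λ r _ → row r)) ⟩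
  + 0 ∎
  where
  m = n ℕ.* 3 ℕ.+ 1
  vanishes : ∀ c r → (∀ a → exponentResidue c a ≢ 1F) → lambertSum m m c r ≡ + 0
  vanishes c r avoids-1 = lambertSum-residue m m c r (λ residue≡ → avoids-1 (mod₃ℕ (suc r)) (trans residue≡ (mod₃ℕ-*3+ n 1)))
  row : ∀ r → ∑ m (lambertCoeff m r) ≡ + 0
  row r = trans (∑-lambertCoeff m m r) (trans (cong₂ (λ x y → sign (suc r) * x - sign (suc r) * y)
    (vanishes 0 r (from-yes (Finₚ.all? λ a → ¬? (exponentResidue 0 a ≟₃ 1F))))
    (vanishes 1 r (from-yes (Finₚ.all? λ a → ¬? (exponentResidue 1 a ≟₃ 1F))))) (ℤₚ.+-inverseʳ (sign (suc r) * + 0)))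

signZ-sign : ∀ z → signZ z ≡ sign ∣ z ∣
signZ-sign z = alternates ∣ z ∣
  where
  period : ∀ n → does (2 ∣? suc (suc n)) ≡ does (2 ∣? n)
  period n = does-⇔ (mk⇔ (λ 2∣n+2 → ∣m+n∣m⇒∣n 2∣n+2 (∣-refl {2})) (∣m∣n⇒∣m+n (∣-refl {2}))) (2 ∣? suc (suc n)) (2 ∣? n)
  alternates : ∀ n → (if does (2 ∣? n) then + 1 else - + 1) ≡ sign n
  alternates 0 = refl
  alternates 1 = refl
  alternates (suc (suc n)) = begin
    (if does (2 ∣? suc (suc n)) then + 1 else - + 1)     ≡⟨ cong (λ b → if b then + 1 else - + 1) (period n) ⟩
    (if does (2 ∣? n) then + 1 else - + 1)               ≡⟨ alternates n ⟩
    sign n                                               ≡⟨ twice (sign n) ⟩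
    sign (suc (suc n))                                   ∎
    where
    twice : ∀ s → s ≡ -[1+ 0 ] * (-[1+ 0 ] * s)
    twice = ℤ-solve-∀

-- The coefficients of q^d in s/(1 − q^{e+1}) and in −s q^{e+1}/(1 − q^{e+1}) = s/(1 − q^{−(e+1)})
geometricCoeff inverseGeometricCoeff : ℤ → ℕ → ℤ → ℤ
geometricCoeff s e (+ d) = if does (suc e ∣? d) then s else + 0
geometricCoeff s e -[1+ _ ] = + 0
inverseGeometricCoeff s e (+ zero) = + 0
inverseGeometricCoeff s e (+ suc d) = if does (suc e ∣? suc d) then - s else + 0
inverseGeometricCoeff s e -[1+ _ ] = + 0

bilatTermCoeff-geometric : ∀ z n {e} → + 3 * z + + 1 ≡ + suc e →
  bilatTermCoeff z n ≡ geometricCoeff (signZ z) e (+ n - (+ 3 * z * z + + 3 * z))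
bilatTermCoeff-geometric z n 3z+1≡e rewrite 3z+1≡e with + n - (+ 3 * z * z + + 3 * z)
... | + _ = refl
... | -[1+ _ ] = refl

bilatTermCoeff-inverseGeometric : ∀ z n {e} → + 3 * z + + 1 ≡ -[1+ e ] →
  bilatTermCoeff z n ≡ inverseGeometricCoeff (signZ z) e (+ n - (+ 3 * z * z + + 3 * z))
bilatTermCoeff-inverseGeometric z n 3z+1≡e rewrite 3z+1≡e with + n - (+ 3 * z * z + + 3 * z)
... | + zero = refl
... | + suc _ = refl
... | -[1+ _ ] = refl

∑-multiples : ∀ K c d → d ℕ.< K → ∑ K (λ t → δ (+ (suc c ℕ.* t)) (+ d)) ≡ indicator (does (suc c ∣? d))
∑-multiples K c d d<K = byDivisibility (suc c ∣? d)
  where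
  byDivisibility : Dec (suc c ∣ d) → ∑ K (λ t → δ (+ (suc c ℕ.* t)) (+ d)) ≡ indicator (does (suc c ∣? d))
  byDivisibility (yes c∣d@(divides k refl)) = begin
    ∑ K (λ t → δ (+ (suc c ℕ.* t)) (+ (k ℕ.* suc c)))   ≡⟨ ∑-cong K (λ t → trans (cancel t) (sym (ℤₚ.*-identityʳ (δ (+ k) (+ t))))) ⟩
    ∑ K (λ t → δ (+ k) (+ t) * + 1)                     ≡⟨ ∑-δ (λ _ → + 1) (ℕₚ.≤-<-trans (ℕₚ.m≤m*n k (suc c)) d<K) ⟩
    + 1                                                 ≡⟨ cong indicator (dec-true (suc c ∣? k ℕ.* suc c) c∣d) ⟨
    indicator (does (suc c ∣? k ℕ.* suc c))             ∎
    where
    cancel : ∀ t → δ (+ (suc c ℕ.* t)) (+ (k ℕ.* suc c)) ≡ δ (+ k) (+ t)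
    cancel t = δ-⇔
      (λ ct≡kc → cong +_ (sym (ℕₚ.*-cancelˡ-≡ t k (suc c) (trans (ℤₚ.+-injective ct≡kc) (ℕₚ.*-comm k (suc c))))))
      (λ k≡t → cong +_ (trans (cong (suc c ℕ.*_) (sym (ℤₚ.+-injective k≡t))) (ℕₚ.*-comm (suc c) k)))
  byDivisibility (no c∤d) = trans
    (∑-zero< K (λ t _ → δ-≢ (λ ct≡d → c∤d (divides t (trans (sym (ℤₚ.+-injective ct≡d)) (ℕₚ.*-comm (suc c) t))))))
    (cong indicator (sym (dec-false (suc c ∣? d) c∤d)))

*-indicator : ∀ s b → s * indicator b ≡ (if b then s else + 0)
*-indicator s true = ℤₚ.*-identityʳ s
*-indicator s false = ℤₚ.*-zeroʳ s

δ-negative : ∀ e d → δ (+ e) -[1+ d ] ≡ + 0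
δ-negative e d = δ-≢ (λ ())

∑-geometric : ∀ K c s x → x ℤ.< + K → s * ∑ K (λ t → δ (+ (suc c ℕ.* t)) x) ≡ geometricCoeff s c x
∑-geometric K c s (+ d) (ℤ.+<+ d<K) = trans (cong (s *_) (∑-multiples K c d d<K)) (*-indicator s (does (suc c ∣? d)))
∑-geometric K c s -[1+ d ] _ = trans (cong (s *_) (∑-zero< K (λ t _ → δ-negative (suc c ℕ.* t) d))) (ℤₚ.*-zeroʳ s)

∑-inverseGeometric : ∀ K c s x → x ℤ.< + K → - s * ∑ K (λ t → δ (+ (suc c ℕ.* suc t)) x) ≡ inverseGeometricCoeff s c x
∑-inverseGeometric K c s (+ zero) _ = trans (cong (- s *_) (∑-zero< K (λ t _ → δ-≢ (λ ())))) (ℤₚ.*-zeroʳ (- s))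
∑-inverseGeometric K c s (+ suc d) (ℤ.+<+ d<K) = begin
  - s * ∑ K (λ t → δ (+ (suc c ℕ.* suc t)) (+ suc d))
    ≡⟨ cong (- s *_) (ℤₚ.+-identityˡ _) ⟨
  - s * (+ 0 + ∑ K (λ t → δ (+ (suc c ℕ.* suc t)) (+ suc d)))
    ≡⟨ cong (λ z → - s * (z + ∑ K (λ t → δ (+ (suc c ℕ.* suc t)) (+ suc d)))) (δ-≢ zero-multiple) ⟨
  - s * (δ (+ (suc c ℕ.* 0)) (+ suc d) + ∑ K (λ t → δ (+ (suc c ℕ.* suc t)) (+ suc d)))
    ≡⟨ cong (- s *_) (∑-head K (λ t → δ (+ (suc c ℕ.* t)) (+ suc d))) ⟨
  - s * ∑ (suc K) (λ t → δ (+ (suc c ℕ.* t)) (+ suc d))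
    ≡⟨ ∑-geometric (suc K) c (- s) (+ suc d) (ℤ.+<+ (ℕₚ.m<n⇒m<1+n d<K)) ⟩
  inverseGeometricCoeff s c (+ suc d) ∎
  where
  zero-multiple : + (suc c ℕ.* 0) ≢ + suc d
  zero-multiple 0≡suc with trans (sym (ℕₚ.*-zeroʳ (suc c))) (ℤₚ.+-injective 0≡suc)
  ... | ()
∑-inverseGeometric K c s -[1+ d ] _ = trans (cong (- s *_) (∑-zero< K (λ t _ → δ-negative (suc c ℕ.* suc t) d))) (ℤₚ.*-zeroʳ (- s))

-- The rows r = 3i and r = 3i + 1 of the double sum contribute the terms i and −(i + 1) of the bilateral series.
module BilateralTerms (n i : ℕ) where
  private
    K m A : ℕ
    K = suc n ℕ.* 3
    m = n ℕ.* 3 ℕ.+ 2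
    A = 3 ℕ.* i ℕ.* i ℕ.+ 3 ℕ.* i

    +A : + A ≡ + 3 * + i * + i + + 3 * + i
    +A = cong₂ _+_ (trans (ℤₚ.pos-* (3 ℕ.* i) i) (cong (_* + i) (ℤₚ.pos-* 3 i))) (ℤₚ.pos-* 3 i)

    n-A<K : + n - + A ℤ.< + K
    n-A<K = ℤₚ.≤-<-trans (ℤₚ.i-j≤i (+ n) (+ A)) (ℤ.+<+ (s≤s (ℕₚ.≤-trans (ℕₚ.m≤m*n n 3) (ℕₚ.m≤n+m (n ℕ.* 3) 2))))

    lambertSum-progression : ∀ c r (f : ℕ → ℕ) → (∀ t → lambertExponent c r t ≡ (A ℕ.+ f t) ℕ.* 3 ℕ.+ 2) →
      lambertSum K m c r ≡ ∑ K (λ t → δ (+ f t) (+ n - + A))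
    lambertSum-progression c r f exponent = ∑-cong K (λ t → begin
      δ (+ lambertExponent c r t) (+ m)               ≡⟨ cong (λ e → δ (+ e) (+ m)) (exponent t) ⟩
      δ (+ ((A ℕ.+ f t) ℕ.* 3 ℕ.+ 2)) (+ m)
        ≡⟨ δ-⇔ (λ e≡m → cong +_ (ℕₚ.*-cancelʳ-≡ (A ℕ.+ f t) n 3 (ℕₚ.+-cancelʳ-≡ 2 _ _ (ℤₚ.+-injective e≡m))))
                                                           (λ e≡n → cong (λ x → + (x ℕ.* 3 ℕ.+ 2)) (ℤₚ.+-injective e≡n)) ⟩
      δ (+ (A ℕ.+ f t)) (+ n)                         ≡⟨ δ-transpose (+ A) (+ f t) (+ n) ⟨
      δ (+ f t) (+ n - + A)                           ∎)

  nonnegativeTerm : sign (suc (i ℕ.* 3 ℕ.+ 0)) * lambertSum K m 0 (i ℕ.* 3 ℕ.+ 0) ≡ - bilatTermCoeff (+ i) n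
  nonnegativeTerm = begin
    sign (suc (i ℕ.* 3 ℕ.+ 0)) * lambertSum K m 0 (i ℕ.* 3 ℕ.+ 0)
      ≡⟨ cong₂ _*_ (cong sign (cong suc (ℕₚ.+-identityʳ (i ℕ.* 3))))
           (lambertSum-progression 0 (i ℕ.* 3 ℕ.+ 0) (suc (3 ℕ.* i) ℕ.*_) (exponent i)) ⟩
    -[1+ 0 ] * sign (i ℕ.* 3) * S
      ≡⟨ cong (λ s → -[1+ 0 ] * s * S) (sign-*3 i) ⟩
    -[1+ 0 ] * sign i * S
      ≡⟨ neg-out (sign i) S ⟩
    - (sign i * S)
      ≡⟨ cong (λ s → - (s * S)) (signZ-sign (+ i)) ⟨
    - (signZ (+ i) * S)
      ≡⟨ cong -_ (∑-geometric K (3 ℕ.* i) (signZ (+ i)) (+ n - + A) n-A<K) ⟩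
    - geometricCoeff (signZ (+ i)) (3 ℕ.* i) (+ n - + A)
      ≡⟨ cong -_ (trans (bilatTermCoeff-geometric (+ i) n denominator)
          (cong (λ x → geometricCoeff (signZ (+ i)) (3 ℕ.* i) (+ n - x)) (sym +A))) ⟨
    - bilatTermCoeff (+ i) n ∎
    where
    S = ∑ K (λ t → δ (+ (suc (3 ℕ.* i) ℕ.* t)) (+ n - + A))
    neg-out : ∀ s x → -[1+ 0 ] * s * x ≡ - (s * x)
    neg-out = ℤ-solve-∀
    denominator : + 3 * + i + + 1 ≡ + suc (3 ℕ.* i)
    denominator = trans (cong (_+ + 1) (sym (ℤₚ.pos-* 3 i))) (ℤₚ.+-comm (+ (3 ℕ.* i)) (+ 1))
    exponent : ∀ i t → suc (i ℕ.* 3 ℕ.+ 0) ℕ.* suc (suc (i ℕ.* 3 ℕ.+ 0) ℕ.+ (t ℕ.* 3 ℕ.+ 0)) ≡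
      (3 ℕ.* i ℕ.* i ℕ.+ 3 ℕ.* i ℕ.+ suc (3 ℕ.* i) ℕ.* t) ℕ.* 3 ℕ.+ 2
    exponent = ℕ-solve-∀

  negativeTerm : sign (suc (i ℕ.* 3 ℕ.+ 1)) * lambertSum K m 1 (i ℕ.* 3 ℕ.+ 1) ≡ bilatTermCoeff -[1+ i ] n
  negativeTerm = begin
    sign (suc (i ℕ.* 3 ℕ.+ 1)) * lambertSum K m 1 (i ℕ.* 3 ℕ.+ 1)
      ≡⟨ cong₂ _*_ (cong sign (cong suc (ℕₚ.+-comm (i ℕ.* 3) 1)))
           (lambertSum-progression 1 (i ℕ.* 3 ℕ.+ 1) (λ t → suc c ℕ.* suc t) (exponent i)) ⟩
    -[1+ 0 ] * (-[1+ 0 ] * sign (i ℕ.* 3)) * S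
      ≡⟨ cong (λ s → -[1+ 0 ] * (-[1+ 0 ] * s) * S) (sign-*3 i) ⟩
    -[1+ 0 ] * sign (suc i) * S
      ≡⟨ cong (_* S) (trans (ℤₚ.-1*i≡-i (sign (suc i))) (cong -_ (sym (signZ-sign z)))) ⟩
    - signZ z * S
      ≡⟨ ∑-inverseGeometric K c (signZ z) (+ n - + A) n-A<K ⟩
    inverseGeometricCoeff (signZ z) c (+ n - + A)
      ≡⟨ trans (bilatTermCoeff-inverseGeometric z n denominator)
          (cong (λ x → inverseGeometricCoeff (signZ z) c (+ n - x)) (sym (trans +A (reflect (+ i))))) ⟨
    bilatTermCoeff z n ∎
    where
    z = -[1+ i ]
    c = suc (3 ℕ.* i)
    S = ∑ K (λ t → δ (+ (suc c ℕ.* suc t)) (+ n - + A))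
    denominator : + 3 * z + + 1 ≡ -[1+ c ]
    denominator = trans (expand (+ i)) (cong (λ w → - (+ 2 + w)) (sym (ℤₚ.pos-* 3 i)))
      where
      expand : ∀ i → + 3 * - (+ 1 + i) + + 1 ≡ - (+ 2 + + 3 * i)
      expand = ℤ-solve-∀
    reflect : ∀ i → + 3 * i * i + + 3 * i ≡ + 3 * - (+ 1 + i) * - (+ 1 + i) + + 3 * - (+ 1 + i)
    reflect = ℤ-solve-∀
    exponent : ∀ i t → suc (i ℕ.* 3 ℕ.+ 1) ℕ.* suc (suc (i ℕ.* 3 ℕ.+ 1) ℕ.+ (t ℕ.* 3 ℕ.+ 1)) ≡
      (3 ℕ.* i ℕ.* i ℕ.+ 3 ℕ.* i ℕ.+ suc (suc (3 ℕ.* i)) ℕ.* suc t) ℕ.* 3 ℕ.+ 2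
    exponent = ℕ-solve-∀

  private
    row : ℕ → ℤ
    row r = ∑ K (lambertCoeff m r)

    lambertSum-off : ∀ c r → exponentResidue c (suc₃ (mod₃ℕ r)) ≢ 2F → lambertSum K m c (i ℕ.* 3 ℕ.+ r) ≡ + 0
    lambertSum-off c r residue≢2 = lambertSum-residue K m c (i ℕ.* 3 ℕ.+ r)
      (≡.subst₂ (λ a b → exponentResidue c (suc₃ a) ≢ b) (sym (mod₃ℕ-*3+ i r)) (sym (mod₃ℕ-*3+ n 2)) residue≢2)

    row-0 : row (i ℕ.* 3 ℕ.+ 0) ≡ - bilatTermCoeff (+ i) n
    row-0 = trans (∑-lambertCoeff K m (i ℕ.* 3 ℕ.+ 0)) (trans
      (cong₂ (λ x y → x - sign (suc (i ℕ.* 3 ℕ.+ 0)) * y) nonnegativeTerm (lambertSum-off 1 0 (λ ())))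
      (drop (- bilatTermCoeff (+ i) n) (sign (suc (i ℕ.* 3 ℕ.+ 0)))))
      where
      drop : ∀ x s → x - s * + 0 ≡ x
      drop = ℤ-solve-∀

    row-1 : row (i ℕ.* 3 ℕ.+ 1) ≡ - bilatTermCoeff -[1+ i ] n
    row-1 = trans (∑-lambertCoeff K m (i ℕ.* 3 ℕ.+ 1)) (trans
      (cong₂ (λ x y → sign (suc (i ℕ.* 3 ℕ.+ 1)) * x - y) (lambertSum-off 0 1 (λ ())) negativeTerm)
      (drop (bilatTermCoeff -[1+ i ] n) (sign (suc (i ℕ.* 3 ℕ.+ 1)))))
      where
      drop : ∀ x s → s * + 0 - x ≡ - x
      drop = ℤ-solve-∀

    row-2 : row (i ℕ.* 3 ℕ.+ 2) ≡ + 0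
    row-2 = trans (∑-lambertCoeff K m (i ℕ.* 3 ℕ.+ 2)) (trans
      (cong₂ (λ x y → sign (suc (i ℕ.* 3 ℕ.+ 2)) * x - sign (suc (i ℕ.* 3 ℕ.+ 2)) * y) (lambertSum-off 0 2 (λ ()))
          (lambertSum-off 1 2 (λ ())))
      (ℤₚ.+-inverseʳ (sign (suc (i ℕ.* 3 ℕ.+ 2)) * + 0)))

  rows-sum : ∑ 3 (λ r → ∑ K (lambertCoeff m (i ℕ.* 3 ℕ.+ r))) ≡ - (bilatTermCoeff (+ i) n + bilatTermCoeff -[1+ i ] n)
  rows-sum = trans (cong₂ _+_ (cong₂ _+_ (cong (λ z → + 0 + z) row-0) row-1) row-2)
    (sum (bilatTermCoeff (+ i) n) (bilatTermCoeff -[1+ i ] n))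
    where
    sum : ∀ x y → + 0 + - x + - y + + 0 ≡ - (x + y)
    sum = ℤ-solve-∀

section-2-rankLambert : ∀ n → section 2 rankLambert n ≡ -[1+ 5 ] * bilatSum n
section-2-rankLambert n = begin
  rankLambert m
    ≡⟨ rankLambert-expand K m (ℕₚ.≤-trans (ℕₚ.≤-reflexive (ℕₚ.+-comm (n ℕ.* 3) 2)) (ℕₚ.n≤1+n _)) ⟩
  onePS m + + 6 * ∑ K row
    ≡⟨ cong₂ (λ x y → x + + 6 * y) (onePS-*3+suc n 1) (trans (∑-blocks 3 (suc n) row) (∑-cong (suc n) (BilateralTerms.rows-sum n))) ⟩
  + 0 + + 6 * ∑ (suc n) (λ i → - (bilatTermCoeff (+ i) n + bilatTermCoeff -[1+ i ] n))
    ≡⟨ cong (λ z → + 0 + + 6 * z) (trans (∑-neg (suc n) _) (cong -_ (∑-+ (suc n) _ _))) ⟩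
  + 0 + + 6 * - (∑ (suc n) (λ i → bilatTermCoeff (+ i) n) + ∑ (suc n) (λ i → bilatTermCoeff -[1+ i ] n))
    ≡⟨ collect _ ⟩
  -[1+ 5 ] * (∑ (suc n) (λ i → bilatTermCoeff (+ i) n) + ∑ (suc n) (λ i → bilatTermCoeff -[1+ i ] n))
    ≡⟨ cong (-[1+ 5 ] *_) (cong₂ _+_ (Σ<-∑ (suc n) _) (Σ<-∑ (suc n) _)) ⟨
  -[1+ 5 ] * bilatSum n ∎
  where
  K = suc n ℕ.* 3
  m = n ℕ.* 3 ℕ.+ 2
  row : ℕ → ℤ
  row r = ∑ K (lambertCoeff m r)
  collect : ∀ x → + 0 + + 6 * - x ≡ -[1+ 5 ] * x
  collect = ℤ-solve-∀

-- Σ_{j ≤ n} f(i + j) c_{n−j} for the coefficients c of invPS f. The function behind invPS is private,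
-- so the summation is recovered by unification.
mutual
  dot : PS → ℕ → ℕ → ℤ
  dot = _

  invPS-suc : ∀ f n → invPS f (suc n) ≡ - dot f 1 n
  invPS-suc f n with 1
  ... | i = refl

dot-∑ : ∀ f i n → dot f i n ≡ ∑ (suc n) (λ j → f (i ℕ.+ j) * invPS f (n ∸ j))
dot-∑ f i zero = begin
  f i * + 1 + + 0              ≡⟨ ℤₚ.+-identityʳ _ ⟩
  f i * + 1                    ≡⟨ cong (λ j → f j * + 1) (ℕₚ.+-identityʳ i) ⟨
  f (i ℕ.+ 0) * + 1            ≡⟨ ℤₚ.+-identityˡ _ ⟨
  + 0 + f (i ℕ.+ 0) * + 1      ∎
dot-∑ f i (suc n) = begin
  f i * invPS f (suc n) + dot f (suc i) n
    ≡⟨ cong₂ _+_ (cong (λ j → f j * invPS f (suc n)) (sym (ℕₚ.+-identityʳ i))) (dot-∑ f (suc i) n) ⟩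
  f (i ℕ.+ 0) * invPS f (suc n) + ∑ (suc n) (λ j → f (suc i ℕ.+ j) * invPS f (n ∸ j))
    ≡⟨ cong (λ z → f (i ℕ.+ 0) * invPS f (suc n) + z) (∑-cong (suc n) (λ j → cong (λ m → f m * invPS f (n ∸ j)) (sym (ℕₚ.+-suc i j)))) ⟩
  f (i ℕ.+ 0) * invPS f (suc n) + ∑ (suc n) (λ j → f (i ℕ.+ suc j) * invPS f (n ∸ j))
    ≡⟨ ∑-head (suc n) (λ j → f (i ℕ.+ j) * invPS f (suc n ∸ j)) ⟨
  ∑ (suc (suc n)) (λ j → f (i ℕ.+ j) * invPS f (suc n ∸ j)) ∎

invPS-inverse : ∀ f → f 0 ≡ + 1 → f ⊗ invPS f ≈∞ onePS
invPS-inverse f f₀≡1 = ≗⇒≈ coefficient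
  where
  coefficient : f ⊗ invPS f ≗ onePS
  coefficient zero = trans (ℤₚ.+-identityˡ (f 0 * + 1)) (cong (_* + 1) f₀≡1)
  coefficient (suc n) = begin
    (f ⊗ invPS f) (suc n)
      ≡⟨ trans (⊗-coeff f (invPS f) (suc n)) (∑-head (suc n) (λ i → f i * invPS f (suc n ∸ i))) ⟩
    f 0 * invPS f (suc n) + S
      ≡⟨ cong₂ (λ x y → x * y + S) f₀≡1 (trans (invPS-suc f n) (cong -_ (dot-∑ f 1 n))) ⟩
    + 1 * - S + S
      ≡⟨ cong (_+ S) (ℤₚ.*-identityˡ (- S)) ⟩
    - S + S
      ≡⟨ ℤₚ.+-inverseˡ S ⟩
    + 0 ∎
    where S = ∑ (suc n) (λ j → f (suc j) * invPS f (n ∸ j))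

mono-scale : ∀ c e n → mono c e n ≡ c * mono (+ 1) e n
mono-scale c e n with n ≡ᵇ e
... | true = sym (ℤₚ.*-identityʳ c)
... | false = sym (ℤₚ.*-zeroʳ c)

prodUpTo-∏ : ∀ K n F → prodUpTo n F ≡ TruncatedCalculus.∏ K n F
prodUpTo-∏ K zero F = refl
prodUpTo-∏ K (suc n) F = cong (_⊗ F n) (prodUpTo-∏ K n F)

module PochhammerTruncation (c : ℤ) (c# : PS) (c#≗c : c# ≗ constPS c) (b : ℕ) where
  private
    F : ℕ → PS
    F i = onePS ⊖ mono c (suc b ℕ.+ suc b ℕ.* i)

    eulerUpTo : ℕ → ℕ → PS
    eulerUpTo K n = ThetaSeries.euler (TruncatedPS K) c# n (X^ K (suc b))

    factor : ∀ K i → F i ≈⟨< K ⟩ (onePS ⊕ negPS (c# ⊗ TruncatedCalculus._^_ K (X^ K (suc b)) (suc i)))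
    factor K i = +-congˡ {onePS} (-‿cong (CommutativeRing.trans (TruncatedPS K) (≗⇒≈ monomial)
      (*-congˡ {c#} (CommutativeRing.sym (TruncatedPS K) (^-assocʳ X (suc b) (suc i))))))
      where
      open TruncatedCalculus K using (+-congˡ; *-congˡ; -‿cong; ^-assocʳ)
      monomial : mono c (suc b ℕ.+ suc b ℕ.* i) ≗ c# ⊗ X^ K (suc b ℕ.* suc i)
      monomial n = begin
        mono c (suc b ℕ.+ suc b ℕ.* i) n              ≡⟨ cong (λ e → mono c e n) (ℕₚ.*-suc (suc b) i) ⟨
        mono c (suc b ℕ.* suc i) n                    ≡⟨ mono-scale c (suc b ℕ.* suc i) n ⟩
        c * mono (+ 1) (suc b ℕ.* suc i) n            ≡⟨ cong (c *_) (X^-mono K (suc b ℕ.* suc i) n) ⟨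
        c * X^ K (suc b ℕ.* suc i) n                  ≡⟨ constPS-⊗ {c#} c (X^ K (suc b ℕ.* suc i)) c#≗c n ⟨
        (c# ⊗ X^ K (suc b ℕ.* suc i)) n               ∎

    prodUpTo-euler : ∀ K n → prodUpTo n F ≈⟨< K ⟩ eulerUpTo K n
    prodUpTo-euler K n = ≡.subst (_≈⟨< K ⟩ eulerUpTo K n) (sym (prodUpTo-∏ K n F)) (TruncatedCalculus.∏-cong K n (factor K))

  poch-euler : ∀ k → poch c (suc b) (suc b) ≈⟨< suc k ⟩ eulerUpTo (suc k) (suc k)
  poch-euler k = agree λ n n<K → begin
    prodUpTo (suc n) F n          ≡⟨ at (prodUpTo-euler (suc n) (suc n)) n ℕₚ.≤-refl ⟩
    eulerUpTo (suc n) (suc n) n   ≡⟨ at (stable n n<K) n ℕₚ.≤-refl ⟨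
    eulerUpTo (suc n) (suc k) n   ≡⟨ at (prodUpTo-euler (suc n) (suc k)) n ℕₚ.≤-refl ⟨
    prodUpTo (suc k) F n          ≡⟨ at (prodUpTo-euler (suc k) (suc k)) n n<K ⟩
    eulerUpTo (suc k) (suc k) n   ∎
    where
    stable : ∀ n → n ℕ.< suc k → eulerUpTo (suc n) (suc k) ≈⟨< suc n ⟩ eulerUpTo (suc n) (suc n)
    stable n n<K = ThetaSeries.euler-stable (TruncatedPS (suc n)) n {X^ (suc n) (suc b)}
      (TruncatedCalculus.IsNilpotent-power (suc n) {suc n} {X} (X-nilpotent (suc n)) b) c# n<K

poch⁺-truncated : ∀ b .{{_ : ℕ.NonZero b}} k →
  poch (+ 1) b b ≈⟨< suc k ⟩ EulerRelations.minusProduct (TruncatedPS (suc k)) X k (X-nilpotent (suc k)) b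
poch⁺-truncated (suc b) = PochhammerTruncation.poch-euler (+ 1) onePS (λ _ → refl) b

poch⁻-truncated : ∀ b .{{_ : ℕ.NonZero b}} k →
  poch -[1+ 0 ] b b ≈⟨< suc k ⟩ EulerRelations.plusProduct (TruncatedPS (suc k)) X k (X-nilpotent (suc k)) b
poch⁻-truncated (suc b) = PochhammerTruncation.poch-euler -[1+ 0 ] (negPS onePS) -1PS≗constPS b

-- euler b = (q^b; q^b)_∞ and euler⁻ b = (−q^b; q^b)_∞
euler euler⁻ : ℕ → PS
euler b = poch (+ 1) b b
euler⁻ b = poch -[1+ 0 ] b b

module _ (k : ℕ) where
  open EulerRelations (TruncatedPS (suc k)) X k (X-nilpotent (suc k))

  θ⊗euler⁻₁-truncated : θ ⊗ euler⁻ 1 ≈⟨< suc k ⟩ euler 1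
  θ⊗euler⁻₁-truncated = theta-relation-1 (θ-truncated k) (poch⁻-truncated 1 k) (poch⁺-truncated 1 k)

  θ[X³]⊗euler⁻₃-truncated : θ [X³] ⊗ euler⁻ 3 ≈⟨< suc k ⟩ euler 3
  θ[X³]⊗euler⁻₃-truncated = theta-relation 3
    (TowerIdentities.AtTruncation.vθ-truncated powerSeriesTower k) (poch⁻-truncated 3 k) (poch⁺-truncated 3 k)

  octagonal⊗euler⁻₁-truncated : octagonal ⊗ euler⁻ 1 ≈⟨< suc k ⟩ euler 6 ⊗ euler⁻ 3
  octagonal⊗euler⁻₁-truncated = octagonal-relation (octagonal-truncated k) (poch⁻-truncated 1 k) (poch⁺-truncated 6 k) (poch⁻-truncated 3 k)

  euler₁⊗euler⁻₁-truncated : euler 1 ⊗ euler⁻ 1 ≈⟨< suc k ⟩ euler 2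
  euler₁⊗euler⁻₁-truncated = double-relation (poch⁺-truncated 1 k) (poch⁻-truncated 1 k) (poch⁺-truncated 2 k)

θ⊗euler⁻₁ : θ ⊗ euler⁻ 1 ≈∞ euler 1
θ⊗euler⁻₁ = ≈<⇒≈∞ θ⊗euler⁻₁-truncated

θ[X³]⊗euler⁻₃ : θ [X³] ⊗ euler⁻ 3 ≈∞ euler 3
θ[X³]⊗euler⁻₃ = ≈<⇒≈∞ θ[X³]⊗euler⁻₃-truncated

octagonal⊗euler⁻₁ : octagonal ⊗ euler⁻ 1 ≈∞ euler 6 ⊗ euler⁻ 3
octagonal⊗euler⁻₁ = ≈<⇒≈∞ octagonal⊗euler⁻₁-truncated

euler₁⊗euler⁻₁ : euler 1 ⊗ euler⁻ 1 ≈∞ euler 2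
euler₁⊗euler⁻₁ = ≈<⇒≈∞ euler₁⊗euler⁻₁-truncated

opaque
  unfolding δ ∑⁺ ∑±

  θ-constant : θ 0 ≡ + 1
  θ-constant = refl

θ-inverse : θ ⊗ invPS θ ≈∞ onePS
θ-inverse = invPS-inverse θ θ-constant

θ[X³]-inverse : θ [X³] ⊗ invPS (θ [X³]) ≈∞ onePS
θ[X³]-inverse = invPS-inverse (θ [X³]) θ-constant

rankSeries : PS
rankSeries = invPS θ ⊗ rankLambert

θ⊗rankSeries : θ ⊗ rankSeries ≈∞ rankLambert
θ⊗rankSeries = QuotientCalculus.inverse-cancelˡ FullPS {θ} {invPS θ} rankLambert θ-inverse

rankSeries-Nbar : ∀ m → rankSeries (suc m) ≡ + Nbar (+ 0) 3 (suc m) - + Nbar (+ 1) 3 (suc m)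
rankSeries-Nbar m = trans (at rankSeries≈cubicRankSeries (suc m) ℕₚ.≤-refl) (cubicRankSeries-Nbar m refl)
  where
  open RankCoefficients (suc m) using (lambertSeries; cubicRankSeries; theta*cubicRankSeries; cubicRankSeries-Nbar)
  K = suc (suc m)
  rankSeries≈cubicRankSeries : rankSeries ≈⟨< K ⟩ cubicRankSeries
  rankSeries≈cubicRankSeries = QuotientCalculus.quotient-unique (TruncatedPS K)
    {θ} {ThetaSeries.thetaAt (TruncatedPS K) K X} {rankSeries} {cubicRankSeries} {rankLambert} {lambertSeries} (invPS θ , ≈∞⇒≈< K θ-inverse)
    (θ-truncated (suc m)) (rankLambert-truncated (suc m)) (≈∞⇒≈< K θ⊗rankSeries) theta*cubicRankSeries

-- The trisection θ(q) = A(q³) − 2q B(q³), and its image under reversal of the second sign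

θ-trisection : θ ≈∞ θ [X³] [X³] ⊕ negPS (twoPS ⊗ (X ⊗ octagonal [X³]))
θ-trisection = TowerIdentities.θ-trisection powerSeriesTower

twistedθ-θ : ∀ n → twistedθ n ≡ ε₃ (mod₃ℕ n) * θ n
twistedθ-θ n = begin
  ∑± n (λ k → ε k * signᶻ k * δ (k * k) (+ n))
    ≡⟨ ∑±-cong n (λ k → trans (*-δ-cong (λ k²≡n → cong (_* signᶻ k) (ε-root k k²≡n))) (ℤₚ.*-assoc (ε₃ (mod₃ℕ n)) (signᶻ k) _)) ⟩
  ∑± n (λ k → ε₃ (mod₃ℕ n) * (signᶻ k * δ (k * k) (+ n)))
    ≡⟨ ∑±-*ˡ n (ε₃ (mod₃ℕ n)) _ ⟩
  ε₃ (mod₃ℕ n) * θ n ∎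
  where
  ε-root : ∀ k → k * k ≡ + n → ε k ≡ ε₃ (mod₃ℕ n)
  ε-root k k²≡n = trans (from-yes (Finₚ.all? λ a → ε₃ a ≟ ε₃ (a *₃ a)) (mod₃ k)) (cong ε₃ (trans (sym (mod₃-* k k)) (cong mod₃ k²≡n)))

twistedθ-trisection : twistedθ ≈∞ θ [X³] [X³] ⊕ (twoPS ⊗ (X ⊗ octagonal [X³]))
twistedθ-trisection = ≗⇒≈ (bySections
  (λ n → trans (twisted 0 n) (onlyMain (A (n ℕ.* 3 ℕ.+ 0)) (C (n ℕ.* 3 ℕ.+ 0)) (cross-0 n)))
  (λ n → trans (twisted 1 n) (onlyCross (A (n ℕ.* 3 ℕ.+ 1)) (C (n ℕ.* 3 ℕ.+ 1)) (section-1-[X³] (θ [X³]) n)))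
  (λ n → trans (twisted 2 n) (onlyCross (A (n ℕ.* 3 ℕ.+ 2)) (C (n ℕ.* 3 ℕ.+ 2)) (section-2-[X³] (θ [X³]) n))))
  where
  A C : PS
  A = θ [X³] [X³]
  C = twoPS ⊗ (X ⊗ octagonal [X³])
  twisted : ∀ r n → twistedθ (n ℕ.* 3 ℕ.+ r) ≡ ε₃ (mod₃ℕ r) * (A (n ℕ.* 3 ℕ.+ r) - C (n ℕ.* 3 ℕ.+ r))
  twisted r n = trans (twistedθ-θ (n ℕ.* 3 ℕ.+ r)) (cong₂ _*_ (cong ε₃ (mod₃ℕ-*3+ n r)) (≈∞⇒≗ θ-trisection (n ℕ.* 3 ℕ.+ r)))
  cross-0 : ∀ n → C (n ℕ.* 3 ℕ.+ 0) ≡ + 0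
  cross-0 n = trans (twoPS⊗ (X ⊗ octagonal [X³]) (n ℕ.* 3 ℕ.+ 0))
    (cong (+ 2 *_) (trans (section-0-X⊗ (octagonal [X³]) n) (⊗-zeroʳ X (section-2-[X³] octagonal) n)))
  onlyMain : ∀ a c → c ≡ + 0 → + 1 * (a - c) ≡ a + c
  onlyMain a c refl = ℤₚ.*-identityˡ (a + + 0)
  onlyCross : ∀ a c → a ≡ + 0 → -[1+ 0 ] * (a - c) ≡ a + c
  onlyCross a c refl = neg c
    where
    neg : ∀ c → -[1+ 0 ] * (+ 0 - c) ≡ + 0 + c
    neg = ℤ-solve-∀

section-cross : ∀ {d} f {g} → d ℕ.< 3 → section d (X ⊗ f) ≗ g →
  section d (twoPS ⊗ (octagonal [X³] ⊗ (X ⊗ f))) ≗ twoPS ⊗ (octagonal ⊗ g)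
section-cross {d} f {g} d<3 section≗g n = begin
  (twoPS ⊗ (octagonal [X³] ⊗ (X ⊗ f))) (n ℕ.* 3 ℕ.+ d)
    ≡⟨ twoPS⊗ (octagonal [X³] ⊗ (X ⊗ f)) (n ℕ.* 3 ℕ.+ d) ⟩
  + 2 * (octagonal [X³] ⊗ (X ⊗ f)) (n ℕ.* 3 ℕ.+ d)
    ≡⟨ cong (+ 2 *_) (trans (section-[X³]⊗ octagonal (X ⊗ f) d<3 n) (⊗-cong {octagonal} (λ _ → refl) section≗g n)) ⟩
  + 2 * (octagonal ⊗ g) n
    ≡⟨ twoPS⊗ (octagonal ⊗ g) n ⟨
  (twoPS ⊗ (octagonal ⊗ g)) n ∎

θ⊗rankSeries-trisected : rankLambert ≈∞ (θ [X³] [X³] ⊗ rankSeries) ⊕ negPS (twoPS ⊗ (octagonal [X³] ⊗ (X ⊗ rankSeries)))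
θ⊗rankSeries-trisected = CommutativeRing.trans FullPS (CommutativeRing.sym FullPS θ⊗rankSeries)
  (QuotientCalculus.*-distribʳ-minus FullPS {θ} {θ [X³] [X³]} {octagonal [X³]} {X} rankSeries θ-trisection)

section-rankLambert : ∀ {d g} → d ℕ.< 3 → section d (X ⊗ rankSeries) ≗ g →
  (θ [X³] ⊗ section d rankSeries) ⊕ negPS (twoPS ⊗ (octagonal ⊗ g)) ≈∞ section d rankLambert
section-rankLambert {d} d<3 section≗g = ≗⇒≈ (λ n → sym (trans (≈∞⇒≗ θ⊗rankSeries-trisected (n ℕ.* 3 ℕ.+ d))
  (cong₂ _-_ (section-[X³]⊗ (θ [X³]) rankSeries d<3 n) (section-cross rankSeries d<3 section≗g n))))

section-numerator : (θ [X³] ⊗ section 0 rankLambert) ⊕ (twoPS ⊗ (octagonal ⊗ (X ⊗ section 2 rankLambert))) ≈∞ θ ⊗ (θ ⊗ θ)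
section-numerator = ≗⇒≈ (λ n → sym (begin
  (θ ⊗ (θ ⊗ θ)) n
    ≡⟨ CubeIdentity.twistedθ*rankLambert≡θ³ n ⟨
  (twistedθ ⊗ rankLambert) (n ℕ.* 3)
    ≡⟨ cong (twistedθ ⊗ rankLambert) (ℕₚ.+-identityʳ (n ℕ.* 3)) ⟨
  (twistedθ ⊗ rankLambert) (n ℕ.* 3 ℕ.+ 0)
    ≡⟨ ≈∞⇒≗ (QuotientCalculus.*-distribʳ-plus FullPS {twistedθ} {θ [X³] [X³]} {octagonal [X³]} {X} rankLambert twistedθ-trisection)
        (n ℕ.* 3 ℕ.+ 0) ⟩
  ((θ [X³] [X³] ⊗ rankLambert) ⊕ (twoPS ⊗ (octagonal [X³] ⊗ (X ⊗ rankLambert)))) (n ℕ.* 3 ℕ.+ 0)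
    ≡⟨ cong₂ _+_ (section-[X³]⊗ (θ [X³]) rankLambert (s≤s z≤n) n) (section-cross rankLambert (s≤s z≤n) (section-0-X⊗ rankLambert) n) ⟩
  ((θ [X³] ⊗ section 0 rankLambert) ⊕ (twoPS ⊗ (octagonal ⊗ (X ⊗ section 2 rankLambert)))) n ∎))

θ[X³]-determinant :
  ((θ [X³] ⊗ θ [X³] ⊗ θ [X³]) ⊕ negPS (twoPS ⊗ twoPS ⊗ twoPS ⊗ (X ⊗ (octagonal ⊗ octagonal ⊗ octagonal)))) ⊗ θ [X³]
    ≈∞ θ ⊗ (θ ⊗ θ ⊗ θ)
θ[X³]-determinant = ≗⇒≈ (λ n → begin
  L n                                          ≡⟨ section-0-[X³] L n ⟨
  (L [X³]) (n ℕ.* 3 ℕ.+ 0)                     ≡⟨ ≈∞⇒≗ (TowerIdentities.v-norm powerSeriesTower) (n ℕ.* 3 ℕ.+ 0) ⟩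
  ((θ ⊗ (θ ⊗ θ ⊗ θ)) [X³]) (n ℕ.* 3 ℕ.+ 0)     ≡⟨ section-0-[X³] (θ ⊗ (θ ⊗ θ ⊗ θ)) n ⟩
  (θ ⊗ (θ ⊗ θ ⊗ θ)) n                          ∎)
  where
  L = ((θ [X³] ⊗ θ [X³] ⊗ θ [X³]) ⊕ negPS (twoPS ⊗ twoPS ⊗ twoPS ⊗ (X ⊗ (octagonal ⊗ octagonal ⊗ octagonal)))) ⊗ θ [X³]

module RankSystem = CyclicSystem.Solution FullPS {X} {θ [X³]} {octagonal} {θ}
  {section 0 rankSeries} {section 1 rankSeries} {section 2 rankSeries}
  {section 0 rankLambert} {section 2 rankLambert} (invPS θ , θ-inverse) (invPS (θ [X³]) , θ[X³]-inverse)
  (section-rankLambert (s≤s z≤n) (section-0-X⊗ rankSeries))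
  (CommutativeRing.trans FullPS (section-rankLambert (s≤s (s≤s z≤n)) (section-suc-X⊗ 0 rankSeries)) (≗⇒≈ section-1-rankLambert))
  (section-rankLambert (s≤s (s≤s (s≤s z≤n))) (section-suc-X⊗ 1 rankSeries))
  section-numerator θ[X³]-determinant
open RankSystem.EulerQuotients {euler 1} {euler⁻ 1} {euler 2} {euler 3} {euler⁻ 3} {euler 6}
  θ⊗euler⁻₁ θ[X³]⊗euler⁻₃ octagonal⊗euler⁻₁ euler₁⊗euler⁻₁
  using (F₀-product; F₁-product; F₂-quotient)

section-0-rankSeries : section 0 rankSeries ≈∞ (euler 3 ⊗ euler 3 ⊗ euler⁻ 1) ÷ (euler 1 ⊗ euler⁻ 3 ⊗ euler⁻ 3)
section-0-rankSeries = QuotientCalculus.product⇒quotient FullPS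
  {section 0 rankSeries} {euler 1 ⊗ euler⁻ 3 ⊗ euler⁻ 3} {euler 3 ⊗ euler 3 ⊗ euler⁻ 1}
  {invPS (euler 1 ⊗ euler⁻ 3 ⊗ euler⁻ 3)} (invPS-inverse (euler 1 ⊗ euler⁻ 3 ⊗ euler⁻ 3) refl) F₀-product

section-1-rankSeries : section 1 rankSeries ≈∞ (twoPS ⊗ (euler 3 ⊗ euler 6)) ÷ euler 1
section-1-rankSeries = QuotientCalculus.product⇒quotient FullPS
  {section 1 rankSeries} {euler 1} {twoPS ⊗ (euler 3 ⊗ euler 6)} {invPS (euler 1)} (invPS-inverse (euler 1) refl) F₁-product

section-2-rankSeries : section 2 rankSeries ≈∞
  ((twoPS ⊗ twoPS ⊗ (euler⁻ 3 ⊗ euler⁻ 3 ⊗ euler 6 ⊗ euler 6)) ÷ euler 2) ⊕ negPS (constPS (+ 6) ⊗ euler⁻ 3 ÷ euler 3 ⊗ bilatSum)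
section-2-rankSeries = F₂-quotient {constPS (+ 6)} {bilatSum} {invPS (euler 2)} {invPS (euler 3)} (≗⇒≈ source)
  (invPS-inverse (euler 2) refl) (invPS-inverse (euler 3) refl)
  where
  source : section 2 rankLambert ≗ negPS (constPS (+ 6) ⊗ bilatSum)
  source n = begin
    section 2 rankLambert n               ≡⟨ section-2-rankLambert n ⟩
    -[1+ 5 ] * bilatSum n                 ≡⟨ ℤₚ.neg-distribˡ-* (+ 6) (bilatSum n) ⟨
    - (+ 6 * bilatSum n)                  ≡⟨ cong -_ (constPS-⊗ {constPS (+ 6)} (+ 6) bilatSum (λ _ → refl) n) ⟨
    - (constPS (+ 6) ⊗ bilatSum) n        ∎

open import Defs using (R)

R-section : ∀ d n {m} → n ℕ.* 3 ℕ.+ d ≡ suc m → R (+ 0) (+ 1) d n ≡ section d rankSeries n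
R-section d n {m} index = begin
  N̄-difference (3 ℕ.* n ℕ.+ d)     ≡⟨ cong N̄-difference (trans (cong (ℕ._+ d) (ℕₚ.*-comm 3 n)) index) ⟩
  N̄-difference (suc m)             ≡⟨ rankSeries-Nbar m ⟨
  rankSeries (suc m)               ≡⟨ cong rankSeries index ⟨
  section d rankSeries n           ∎
  where
  N̄-difference : ℕ → ℤ
  N̄-difference i = + Nbar (+ 0) 3 i - + Nbar (+ 1) 3 i

-- The series rankSeries has constant term 1 (the empty overpartition), which R does not count.
R₀₁-0 : ∀ n → R (+ 0) (+ 1) 0 n ≡ (constPS -[1+ 0 ] ⊕ (euler 3 ⊗ euler 3 ⊗ euler⁻ 1) ÷ (euler 1 ⊗ euler⁻ 3 ⊗ euler⁻ 3)) n
R₀₁-0 zero = refl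
R₀₁-0 (suc n) = begin
  R (+ 0) (+ 1) 0 (suc n)                                                  ≡⟨ R-section 0 (suc n) refl ⟩
  section 0 rankSeries (suc n)                                             ≡⟨ ≈∞⇒≗ section-0-rankSeries (suc n) ⟩
  ((euler 3 ⊗ euler 3 ⊗ euler⁻ 1) ÷ (euler 1 ⊗ euler⁻ 3 ⊗ euler⁻ 3)) (suc n)                       ≡⟨ ℤₚ.+-identityˡ _ ⟨
  + 0 + ((euler 3 ⊗ euler 3 ⊗ euler⁻ 1) ÷ (euler 1 ⊗ euler⁻ 3 ⊗ euler⁻ 3)) (suc n)                 ∎

R₀₁-1 : ∀ n → R (+ 0) (+ 1) 1 n ≡ ((+ 2) · (euler 3 ⊗ euler 6) ÷ euler 1) n
R₀₁-1 n = begin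
  R (+ 0) (+ 1) 1 n                                  ≡⟨ R-section 1 n (ℕₚ.+-comm (n ℕ.* 3) 1) ⟩
  section 1 rankSeries n                             ≡⟨ ≈∞⇒≗ section-1-rankSeries n ⟩
  ((twoPS ⊗ (euler 3 ⊗ euler 6)) ÷ euler 1) n          ≡⟨ ⊗-cong {g = invPS (euler 1)} (twoPS⊗ (euler 3 ⊗ euler 6)) (λ _ → refl) n ⟩
  ((+ 2) · (euler 3 ⊗ euler 6) ÷ euler 1) n                      ∎

R₀₁-2 : ∀ n → R (+ 0) (+ 1) 2 n ≡ ((+ 4) · (euler⁻ 3 ⊗ euler⁻ 3 ⊗ euler 6 ⊗ euler 6) ÷ euler 2 ⊖ ((+ 6) · euler⁻ 3 ÷ euler 3) ⊗ bilatSum) n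
R₀₁-2 n = begin
  R (+ 0) (+ 1) 2 n
    ≡⟨ R-section 2 n (ℕₚ.+-comm (n ℕ.* 3) 2) ⟩
  section 2 rankSeries n
    ≡⟨ ≈∞⇒≗ section-2-rankSeries n ⟩
  ((twoPS ⊗ twoPS ⊗ (euler⁻ 3 ⊗ euler⁻ 3 ⊗ euler 6 ⊗ euler 6)) ÷ euler 2) n - (constPS (+ 6) ⊗ euler⁻ 3 ÷ euler 3 ⊗ bilatSum) n
    ≡⟨ cong₂ _-_
         (⊗-cong {g = invPS (euler 2)} (constPS-⊗ {twoPS ⊗ twoPS} (+ 4) (euler⁻ 3 ⊗ euler⁻ 3 ⊗ euler 6 ⊗ euler 6) fourPS≗constPS)
           (λ _ → refl) n)
         (⊗-cong {g = bilatSum} (⊗-cong {g = invPS (euler 3)} (constPS-⊗ {constPS (+ 6)} (+ 6) (euler⁻ 3) (λ _ → refl))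
           (λ _ → refl)) (λ _ → refl) n) ⟩
  ((+ 4) · (euler⁻ 3 ⊗ euler⁻ 3 ⊗ euler 6 ⊗ euler 6) ÷ euler 2 ⊖ ((+ 6) · euler⁻ 3 ÷ euler 3) ⊗ bilatSum) n ∎
  where
  fourPS≗constPS : twoPS ⊗ twoPS ≗ constPS (+ 4)
  fourPS≗constPS n = trans (twoPS⊗ twoPS n) (value n)
    where
    value : ∀ n → + 2 * twoPS n ≡ constPS (+ 4) n
    value zero = refl
    value (suc n) = refl

theorem1p1 :
  (∀ (n : ℕ) → R (+ 0) (+ 1) 0 n
      ≡ (constPS -[1+ 0 ]
         ⊕ (poch (+ 1) 3 3 ⊗ poch (+ 1) 3 3 ⊗ poch -[1+ 0 ] 1 1)
           ÷ (poch (+ 1) 1 1 ⊗ poch -[1+ 0 ] 3 3 ⊗ poch -[1+ 0 ] 3 3)) n)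
  × (∀ (n : ℕ) → R (+ 0) (+ 1) 1 n
      ≡ ((+ 2) · (poch (+ 1) 3 3 ⊗ poch (+ 1) 6 6) ÷ poch (+ 1) 1 1) n)
  × (∀ (n : ℕ) → R (+ 0) (+ 1) 2 n
      ≡ ((+ 4) · (poch -[1+ 0 ] 3 3 ⊗ poch -[1+ 0 ] 3 3 ⊗ poch (+ 1) 6 6 ⊗ poch (+ 1) 6 6)
           ÷ poch (+ 1) 2 2
         ⊖ ((+ 6) · poch -[1+ 0 ] 3 3 ÷ poch (+ 1) 3 3) ⊗ bilatSum) n)
theorem1p1 = R₀₁-0 , R₀₁-1 , R₀₁-2
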